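{- Let $q\in\{2,4,8\}$. Then every $4$-dimensional symplectic semifield over $\mathbb{F}_q$ is associative; that is, there exist no non-associative $4$-dimensional symplectic semifields over $\mathbb{F}_q$ for $q$ even with $q\le 8$.
   Context: A (pre)semifield $\mathbb{S}$ of dimension $n$ over $\mathbb{F}_q$ is an $n$-dimensional $\mathbb{F}_q$-vector space with an $\mathbb{F}_q$-bilinear multiplication $*$ having no zero divisors ($x*y=0$ implies $x=0$ or $y=0$); associativity and a multiplicative identity are not assumed, and $\mathbb{F}_q$ is contained in the centre. Such an $\mathbb{S}$ defines a spread of $V=\mathbb{S}\oplus\mathbb{S}$ (equivalently of $\mathrm{PG}(2n-1,q)$) consisting of the $n$-dimensional subspaces $\{(x,x*y):x\in\mathbb{S}\}$, $y\in\mathbb{S}$, together with $\{(0,y):y\in\mathbb{S}\}$. The semifield is called symplectic if there is a non-degenerate alternating $\mathbb{F}_q$-bilinear form on $V$ with respect to which every element of this spread is totally isotropic (i.e. the spread is a spread of the symplectic polar space $W(2n-1,q)$).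
   Formalization: "Semifield" is taken to have a two-sided multiplicative identity; without one the claim fails, e.g. for x*y = x·y^q on the field with q^4 elements, which is symplectic but not associative. -}

module Defs where

open import Level using (0ℓ) renaming (suc to lsuc)
open import Data.Nat using (ℕ; zero; suc) renaming (_+_ to _+ℕ_)
open import Data.Fin using (Fin)
import Data.Fin as Fin
open import Data.Product using (∃; _×_; _,_)
open import Data.Sum using (_⊎_)
open import Relation.Nullary using (¬_)
open import Relation.Binary.Definitions using (Decidable)
open import Relation.Binary.PropositionalEquality using (_≡_)
open import Algebra.Bundles using (CommutativeRing)
import Data.Vec.Functional as VF

record FiniteField (q : ℕ) : Set₁ where
  field
    commRing : CommutativeRing 0ℓ 0ℓ
  open CommutativeRing commRing public
  field
    _≟_             : Decidable _≈_
    0≉1             : ¬ (0# ≈ 1#)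
    inverse         : ∀ x → ¬ (x ≈ 0#) → ∃ λ y → x * y ≈ 1#
    enum            : Fin q → Carrier
    enum-injective  : ∀ i j → enum i ≈ enum j → i ≡ j
    enum-surjective : ∀ x → ∃ λ i → enum i ≈ x

module _ {q : ℕ} (F : FiniteField q) where
  open FiniteField F

  Σ : ∀ {n} → (Fin n → Carrier) → Carrier
  Σ {zero}  f = 0#
  Σ {suc n} f = f Fin.zero + Σ (λ i → f (Fin.suc i))

  Vec : ℕ → Set
  Vec n = Fin n → Carrier

  0v : ∀ {n} → Vec n
  0v _ = 0#

  _≈v_ : ∀ {n} → Vec n → Vec n → Set
  u ≈v v = ∀ i → u i ≈ v i

  -- An n-dimensional presemifield over F: an F-bilinear multiplication on F^n,
  -- given by its structure constants c i j k (every F-bilinear map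
  -- F^n × F^n → F^n is of this form), with no zero divisors.
  record Presemifield (n : ℕ) : Set where
    field
      c : Fin n → Fin n → Fin n → Carrier

    infixl 7 _∙_
    _∙_ : Vec n → Vec n → Vec n
    (x ∙ y) k = Σ λ i → Σ λ j → (x i * y j) * c i j k

    field
      no-zero-divisors : ∀ x y → (x ∙ y) ≈v 0v → x ≈v 0v ⊎ y ≈v 0v

  record Semifield (n : ℕ) : Set where
    field
      presemifield : Presemifield n
    open Presemifield presemifield public
    field
      e        : Vec n
      identity : ∀ x → (e ∙ x) ≈v x × (x ∙ e) ≈v x

  module _ {n : ℕ} (S : Presemifield n) where
    open Presemifield S

    form : (Fin (n +ℕ n) → Fin (n +ℕ n) → Carrier) → Vec (n +ℕ n) → Vec (n +ℕ n) → Carrier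
    form G u v = Σ λ i → Σ λ j → (u i * G i j) * v j

    -- S is symplectic: there is a non-degenerate alternating bilinear form on
    -- V = S ⊕ S for which every element of the spread
    --   { (x , x ∙ y) : x ∈ S }  (y ∈ S)   and   { (0 , y) : y ∈ S }
    -- is totally isotropic.
    IsSymplectic : Set
    IsSymplectic = ∃ λ (G : Fin (n +ℕ n) → Fin (n +ℕ n) → Carrier) →
        (∀ u → form G u u ≈ 0#)
      × (∀ u → (∀ v → form G u v ≈ 0#) → u ≈v 0v)
      × (∀ y x x′ → form G (x VF.++ (x ∙ y)) (x′ VF.++ (x′ ∙ y)) ≈ 0#)
      × (∀ y y′ → form G (0v {n} VF.++ y) (0v {n} VF.++ y′) ≈ 0#)

  IsAssociative : ∀ {n} → Presemifield n → Set
  IsAssociative S = ∀ x y z → ((x ∙ y) ∙ z) ≈v (x ∙ (y ∙ z))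
    where open Presemifield S

{-# OPTIONS --safe #-}
module Submission where

-- Transposing the structure tensor of a symplectic semifield S yields a commutative presemifield A on
-- K⁴, and S is associative as soon as the maps μ with μ a ∙ b = a ∙ μ b act transitively on A.
-- Call a line ⟨p,q⟩ of A special if p ∙ p, p ∙ q and q ∙ q are linearly dependent. In characteristic 2
-- squaring is additive, and Artin–Schreier theory (v ↦ v ∙ v + p ∙ v) shows that every nonzero p lies on
-- exactly one special line, so that distinct special lines are disjoint. In a basis adapted to one
-- special line and its action on the quotient, A depends on few parameters; a finite search over them shows
-- that if A has no zero divisors and every other point has its special line, then A is isotopic
-- to a field.

-- Let `b` pair the two summands of V under the form. Isotropy of the spread makes `b x (x′ ∙ y)`
-- symmetric in x and x′, and reading this trilinear form as a product of x and x′ gives the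
-- commutative presemifield. A map with μ a ∙ b = a ∙ μ b there is self-adjoint for `b`, commutes
-- with the right multiplications of S, and so is a left multiplication. Transitivity of these maps
-- is invariant under isotopy, so A may be given a unit and a convenient basis. The relation on a
-- special line is normalised to q ∙ q = p ∙ q + ε p ∙ p, with ε not of the form r² + r: p and q
-- multiply like 1 and a root of y² + y + ε. The obstacle is the size of the search. Besides the
-- constants of the action, the unknowns are the line components χ, ψ of two products and all four
-- coordinates ω of e₃ ∙ e₄. Squares and products with ⟨e₁,e₂⟩ do not involve ω, and they alone
-- restrict which vectors can span the special line through a given point. Only then is ω
-- considered: every point must retain a line closed under the product modulo squares, and any ω
-- that survives gives an associative product or one with zero divisors.

module Commutative where
  import Algebra.Solver.Ring
  open import Algebra.Bundles using (CommutativeRing; RawRing)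
  open import Algebra.Solver.Ring.AlmostCommutativeRing using (fromCommutativeRing; _-Raw-AlmostCommutative⟶_)
  open import Algebra.Structures using (IsCommutativeRing)
  open import Data.Bool.Base using (Bool; true; false; not; _∧_; _∨_; _xor_; if_then_else_; T)
  open import Data.Empty using (⊥; ⊥-elim)
  open import Data.Fin.Base using (Fin; zero; suc; punchOut; remQuot)
  import Data.Fin.Base as Fin
  import Data.Fin.Properties as Fin
  open import Data.Fin.Properties using (any?; punchOut-injective; injective⇒≤; remQuot-combine; combine-remQuot)
  open import Data.List.Base as List using (List; []; _∷_)
  open import Data.List.Membership.Propositional using (_∈_)
  open import Data.List.Membership.Propositional.Properties using (∈-map⁻; ∈-cartesianProduct⁺; ∈-cartesianProduct⁻)
  open import Data.List.Relation.Unary.Any using (here; there)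
  open import Data.Maybe.Base using (Maybe; just; nothing; is-just)
  open import Data.Nat.Base as ℕ using (ℕ; zero; suc)
  import Data.Nat.Properties as ℕ
  open import Data.Product using (∃; ∃₂; _×_; _,_; proj₁; proj₂)
  import Data.Sum
  open import Data.Sum using (_⊎_; inj₁; inj₂; [_,_])
  open import Data.Vec.Base using (Vec; []; _∷_; lookup; map; zipWith; replicate)
  open import Function.Base using (_∘_; id)
  open import Level using (0ℓ)
  open import Relation.Binary.PropositionalEquality hiding ([_])
  open import Relation.Nullary using (¬_; yes; no; Dec)
  open import Relation.Nullary.Decidable using (isYes; map′)

  -- Counting on finite sets

  record Finite (A : Set) : Set where
    field
      size    : ℕ
      to      : A → Fin size
      from    : Fin size → A
      to-from : ∀ i → to (from i) ≡ i
      from-to : ∀ a → from (to a) ≡ a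

    to-injective : ∀ {a b} → to a ≡ to b → a ≡ b
    to-injective {a} {b} e = trans (sym (from-to a)) (trans (cong from e) (from-to b))

    from-injective : ∀ {i j} → from i ≡ from j → i ≡ j
    from-injective {i} {j} e = trans (sym (to-from i)) (trans (cong to e) (to-from j))

    _≟_ : (a b : A) → Dec (a ≡ b)
    a ≟ b = map′ to-injective (cong to) (to a Fin.≟ to b)

    search : {P : A → Set} → (∀ a → Dec (P a)) → Dec (∃ P)
    search {P} P? = map′ (λ (i , p) → from i , p)
                         (λ (a , p) → to a , subst P (sym (from-to a)) p)
                         (any? (P? ∘ from))

  _×-finite_ : ∀ {A B} → Finite A → Finite B → Finite (A × B)
  FA ×-finite FB = record
    { size    = A.size ℕ.* B.size
    ; to      = λ (a , b) → Fin.combine (A.to a) (B.to b)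
    ; from    = λ i → A.from (proj₁ (remQuot B.size i)) , B.from (proj₂ (remQuot {A.size} B.size i))
    ; to-from = λ i → trans (cong₂ Fin.combine (A.to-from _) (B.to-from _)) (combine-remQuot {A.size} B.size i)
    ; from-to = λ (a , b) → cong₂ _,_
        (trans (cong (A.from ∘ proj₁) (remQuot-combine (A.to a) (B.to b))) (A.from-to a))
        (trans (cong (B.from ∘ proj₂) (remQuot-combine {A.size} (A.to a) (B.to b))) (B.from-to b))
    }
    where
    module A = Finite FA
    module B = Finite FB

  Fin-surjective : ∀ {n} (f : Fin n → Fin n) → (∀ {i j} → f i ≡ f j → i ≡ j) → ∀ y → ∃ λ x → f x ≡ y
  Fin-surjective {suc n} f inj y with any? (λ x → f x Fin.≟ y)
  ... | yes p = p
  ... | no ¬p = ⊥-elim (ℕ.1+n≰n (injective⇒≤ {f = λ x → punchOut (y≢ x)}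
                  (λ {a} {b} e → inj (punchOut-injective (y≢ a) (y≢ b) e))))
    where
    y≢ : ∀ x → y ≢ f x
    y≢ x e = ¬p (x , sym e)

  module _ {A : Set} (FA : Finite A) where
    open Finite FA

    opaque
      injective⇒surjective : (f : A → A) → (∀ {a b} → f a ≡ f b → a ≡ b) → ∀ y → ∃ λ x → f x ≡ y
      injective⇒surjective f inj y with Fin-surjective (to ∘ f ∘ from) (from-injective ∘ inj ∘ to-injective) (to y)
      ... | i , e = from i , to-injective e

      misses⇒collides : (f : A → A) (y : A) → (∀ x → f x ≢ y) → ∃₂ λ a b → a ≢ b × f a ≡ f b
      misses⇒collides f y miss with search (λ a → search (λ b → dec a b))
        where
        dec : ∀ a b → Dec (a ≢ b × f a ≡ f b)
        dec a b with a ≟ b | f a ≟ f b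
        ... | yes p | _     = no λ (q , _) → q p
        ... | no p  | yes q = yes (p , q)
        ... | no p  | no q  = no λ (_ , r) → q r
      ... | yes (a , b , p) = a , b , p
      ... | no ¬p = ⊥-elim (miss _ (proj₂ (injective⇒surjective f inj y)))
        where
        inj : ∀ {a b} → f a ≡ f b → a ≡ b
        inj {a} {b} e with a ≟ b
        ... | yes p = p
        ... | no p  = ⊥-elim (¬p (a , b , p , e))

      -- A section of a surjective `f` is injective, hence bijective by finiteness, and then `f` is
      -- its inverse and cannot identify two points.
      collides⇒misses : (f : A → A) {a b : A} → a ≢ b → f a ≡ f b → ∃ λ y → ∀ x → f x ≢ y
      collides⇒misses f {a} {b} a≢b e with search (λ y → ¬? (search (λ x → f x ≟ y)))
        where open import Relation.Nullary.Decidable using (¬?)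
      ... | yes (y , p) = y , λ x q → p (x , q)
      ... | no ¬p = ⊥-elim (a≢b (trans (sym (s∘f a)) (trans (cong s e) (s∘f b))))
        where
        pre : ∀ y → ∃ λ x → f x ≡ y
        pre y with search (λ x → f x ≟ y)
        ... | yes q = q
        ... | no q  = ⊥-elim (¬p (y , q))
        s : A → A
        s y = proj₁ (pre y)
        s-inj : ∀ {y z} → s y ≡ s z → y ≡ z
        s-inj {y} {z} q = trans (sym (proj₂ (pre y))) (trans (cong f q) (proj₂ (pre z)))
        s∘f : ∀ x → s (f x) ≡ x
        s∘f x with injective⇒surjective s s-inj x
        ... | y , q = trans (cong (s ∘ f) (sym q)) (trans (cong s (proj₂ (pre y))) q)

  -- Finite fields of characteristic 2 and the space K⁴

  record Field₂ : Set₁ where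
    infixl 6 _+_
    infixl 7 _*_
    field
      K                 : Set
      _+_ _*_           : K → K → K
      0# 1#             : K
      -- Negation is `id`, so the inverse law of the additive group reads x + x = 0: characteristic
      -- 2 is built in.
      isCommutativeRing : IsCommutativeRing _≡_ _+_ _*_ id 0# 1#
      finite            : Finite K
      1≢0               : 1# ≢ 0#
      inv               : K → K
      inverse           : ∀ x → x ≢ 0# → x * inv x ≡ 1#
      sqrt              : K → K
      sqrt-square       : ∀ x → sqrt x * sqrt x ≡ x
      -- A representative of the nontrivial coset of the Artin-Schreier image {r² + r}; `halve` says
      -- that there is no third coset.
      ε                 : K
      ε-missed          : ∀ r → r * r + r ≢ ε
      halve             : ∀ r → ∃ λ s → s * s + s ≡ r ⊎ s * s + s ≡ r + ε
      elements          : List K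
      complete          : ∀ x → x ∈ elements
      is0               : K → Bool
      is0-sound         : ∀ {x} → is0 x ≡ true → x ≡ 0#
      is0-zero          : is0 0# ≡ true

  module Field₂-Properties (𝔽 : Field₂) where
    open Field₂ 𝔽 public
    open IsCommutativeRing isCommutativeRing public
      using (+-assoc; +-comm; +-identityˡ; +-identityʳ; *-assoc; *-comm; *-identityˡ; *-identityʳ;
             distribˡ; distribʳ; zeroˡ; zeroʳ)
      renaming (-‿inverseʳ to +-self)
    open Finite finite public using (_≟_)

    commutativeRing : CommutativeRing 0ℓ 0ℓ
    commutativeRing = record { isCommutativeRing = isCommutativeRing }

    private
      Coeff : RawRing 0ℓ 0ℓ
      Coeff = record { _≈_ = _≡_ ; _+_ = _xor_ ; _*_ = _∧_ ; -_ = id ; 0# = false ; 1# = true }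

      ⟦_⟧₂ : Bool → K
      ⟦ false ⟧₂ = 0#
      ⟦ true  ⟧₂ = 1#

      morphism : Coeff -Raw-AlmostCommutative⟶ fromCommutativeRing commutativeRing
      morphism = record
        { ⟦_⟧    = ⟦_⟧₂
        ; +-homo = λ { false b → sym (+-identityˡ _) ; true false → sym (+-identityʳ _) ; true true → sym (+-self 1#) }
        ; *-homo = λ { false b → sym (zeroˡ _) ; true b → sym (*-identityˡ _) }
        ; -‿homo = λ _ → refl
        ; 0-homo = refl
        ; 1-homo = refl
        }

      coeff≟ : ∀ x y → Maybe (⟦ x ⟧₂ ≡ ⟦ y ⟧₂)
      coeff≟ false false = just refl
      coeff≟ true  true  = just refl
      coeff≟ _     _     = nothing

    open Algebra.Solver.Ring Coeff (fromCommutativeRing commutativeRing) morphism coeff≟ public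
      using (Polynomial; con; var; _:+_; _:*_; _:=_; solve; ⟦_⟧; normalise; _≟N_; 0N; 0N-homo; ⟦_⟧N-cong; correct)

    +⇒≡ : ∀ {x y} → x + y ≡ 0# → x ≡ y
    +⇒≡ {x} {y} e = begin
      x           ≡⟨ sym (+-identityʳ x) ⟩
      x + 0#      ≡⟨ cong (x +_) (sym (+-self y)) ⟩
      x + (y + y) ≡⟨ sym (+-assoc x y y) ⟩
      x + y + y   ≡⟨ cong (_+ y) e ⟩
      0# + y      ≡⟨ +-identityˡ y ⟩
      y           ∎
      where open ≡-Reasoning

    ≡⇒+ : ∀ {x y} → x ≡ y → x + y ≡ 0#
    ≡⇒+ {x} refl = +-self x

    *-zero : ∀ {x y} → x * y ≡ 0# → x ≡ 0# ⊎ y ≡ 0#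
    *-zero {x} {y} e with x ≟ 0#
    ... | yes p = inj₁ p
    ... | no p  = inj₂ (begin
      y               ≡⟨ sym (*-identityˡ y) ⟩
      1# * y          ≡⟨ cong (_* y) (sym (inverse x p)) ⟩
      x * inv x * y   ≡⟨ cong (_* y) (*-comm x _) ⟩
      inv x * x * y   ≡⟨ *-assoc _ _ _ ⟩
      inv x * (x * y) ≡⟨ cong (inv x *_) e ⟩
      inv x * 0#      ≡⟨ zeroʳ _ ⟩
      0#              ∎)
      where open ≡-Reasoning

    *-cancel : ∀ {x y} → x ≢ 0# → x * y ≡ 0# → y ≡ 0#
    *-cancel n e with *-zero e
    ... | inj₁ z = ⊥-elim (n z)
    ... | inj₂ z = z

    infixr 7 _·_
    infixl 6 _⊕_

    V : Set
    V = K × K × K × K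

    V-finite : Finite V
    V-finite = finite ×-finite (finite ×-finite (finite ×-finite finite))

    open Finite V-finite public using () renaming (_≟_ to _≟ᵛ_)

    opaque
      _⊕_ : V → V → V
      (a , b , c , d) ⊕ (a′ , b′ , c′ , d′) = a + a′ , b + b′ , c + c′ , d + d′

      _·_ : K → V → V
      r · (a , b , c , d) = r * a , r * b , r * c , r * d

      0v : V
      0v = 0# , 0# , 0# , 0#

      ext : ∀ {a b c d a′ b′ c′ d′ : K} → a ≡ a′ → b ≡ b′ → c ≡ c′ → d ≡ d′ → (a , b , c , d) ≡ (a′ , b′ , c′ , d′)
      ext refl refl refl refl = refl

      ⊕-assoc : ∀ u v w → u ⊕ v ⊕ w ≡ u ⊕ (v ⊕ w)
      ⊕-assoc u v w = ext (+-assoc _ _ _) (+-assoc _ _ _) (+-assoc _ _ _) (+-assoc _ _ _)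

      ⊕-comm : ∀ u v → u ⊕ v ≡ v ⊕ u
      ⊕-comm u v = ext (+-comm _ _) (+-comm _ _) (+-comm _ _) (+-comm _ _)

      ⊕-identityˡ : ∀ u → 0v ⊕ u ≡ u
      ⊕-identityˡ u = ext (+-identityˡ _) (+-identityˡ _) (+-identityˡ _) (+-identityˡ _)

      ⊕-identityʳ : ∀ u → u ⊕ 0v ≡ u
      ⊕-identityʳ u = ext (+-identityʳ _) (+-identityʳ _) (+-identityʳ _) (+-identityʳ _)

      ⊕-self : ∀ u → u ⊕ u ≡ 0v
      ⊕-self u = ext (+-self _) (+-self _) (+-self _) (+-self _)

      ·-⊕ : ∀ r u v → r · (u ⊕ v) ≡ r · u ⊕ r · v
      ·-⊕ r u v = ext (distribˡ _ _ _) (distribˡ _ _ _) (distribˡ _ _ _) (distribˡ _ _ _)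

      +-· : ∀ r s u → (r + s) · u ≡ r · u ⊕ s · u
      +-· r s u = ext (distribʳ _ _ _) (distribʳ _ _ _) (distribʳ _ _ _) (distribʳ _ _ _)

      *-· : ∀ r s u → (r * s) · u ≡ r · s · u
      *-· r s u = ext (*-assoc _ _ _) (*-assoc _ _ _) (*-assoc _ _ _) (*-assoc _ _ _)

      1-· : ∀ u → 1# · u ≡ u
      1-· u = ext (*-identityˡ _) (*-identityˡ _) (*-identityˡ _) (*-identityˡ _)

      0-· : ∀ u → 0# · u ≡ 0v
      0-· u = ext (zeroˡ _) (zeroˡ _) (zeroˡ _) (zeroˡ _)

      ·-0 : ∀ r → r · 0v ≡ 0v
      ·-0 r = ext (zeroʳ _) (zeroʳ _) (zeroʳ _) (zeroʳ _)

      e₁ e₂ e₃ e₄ : V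
      e₁ = 1# , 0# , 0# , 0#
      e₂ = 0# , 1# , 0# , 0#
      e₃ = 0# , 0# , 1# , 0#
      e₄ = 0# , 0# , 0# , 1#

      coordinates : ∀ a b c d → (a , b , c , d) ≡ a · e₁ ⊕ b · e₂ ⊕ c · e₃ ⊕ d · e₄
      coordinates a b c d = ext
        (solve 4 (λ a b c d → a := a :* con true :+ b :* con false :+ c :* con false :+ d :* con false) refl a b c d)
        (solve 4 (λ a b c d → b := a :* con false :+ b :* con true :+ c :* con false :+ d :* con false) refl a b c d)
        (solve 4 (λ a b c d → c := a :* con false :+ b :* con false :+ c :* con true :+ d :* con false) refl a b c d)
        (solve 4 (λ a b c d → d := a :* con false :+ b :* con false :+ c :* con false :+ d :* con true) refl a b c d)

      0v-≡ : 0v ≡ (0# , 0# , 0# , 0#)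
      0v-≡ = refl

    ⊕-medial : ∀ u v w x → (u ⊕ v) ⊕ (w ⊕ x) ≡ (u ⊕ w) ⊕ (v ⊕ x)
    ⊕-medial u v w x = trans (⊕-assoc u v _) (trans (cong (u ⊕_) (trans (sym (⊕-assoc v w x))
      (trans (cong (_⊕ x) (⊕-comm v w)) (⊕-assoc w v x)))) (sym (⊕-assoc u w _)))

    ⊕⇒≡ : ∀ {u v} → u ⊕ v ≡ 0v → u ≡ v
    ⊕⇒≡ {u} {v} e = trans (sym (⊕-identityʳ u)) (trans (cong (u ⊕_) (sym (⊕-self v)))
      (trans (sym (⊕-assoc u v v)) (trans (cong (_⊕ v) e) (⊕-identityˡ v))))

    ≡⇒⊕ : ∀ {u v} → u ≡ v → u ⊕ v ≡ 0v
    ≡⇒⊕ {u} refl = ⊕-self u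

    absorb : ∀ {u w} c → w ≡ 0v → u ⊕ c · w ≡ u
    absorb {u} c refl = trans (cong (u ⊕_) (·-0 c)) (⊕-identityʳ u)

    ⊕-absorb : ∀ {u w} → w ≡ 0v → u ⊕ w ≡ u
    ⊕-absorb refl = ⊕-identityʳ _

    ·-zero : ∀ {r u} → r · u ≡ 0v → r ≡ 0# ⊎ u ≡ 0v
    ·-zero {r} {u} e with r ≟ 0#
    ... | yes p = inj₁ p
    ... | no p  = inj₂ (trans (sym (1-· u)) (trans (cong (_· u) (trans (sym (inverse r p)) (*-comm r _)))
                    (trans (*-· _ r u) (trans (cong (inv r ·_) e) (·-0 _)))))

  -- Commutative presemifields on K⁴ and a reflective solver for their identities

  record Presemifield₂ (𝔽 : Field₂) : Set where
    open Field₂-Properties 𝔽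
    infixl 7 _∙_
    field
      _∙_          : V → V → V
      ∙-comm       : ∀ u v → u ∙ v ≡ v ∙ u
      ∙-⊕          : ∀ u v w → u ∙ (v ⊕ w) ≡ u ∙ v ⊕ u ∙ w
      ∙-·          : ∀ r u v → u ∙ (r · v) ≡ r · (u ∙ v)
      zero-product : ∀ {u v} → u ∙ v ≡ 0v → u ≡ 0v ⊎ v ≡ 0v

  module Presemifield₂-Properties {𝔽 : Field₂} (A : Presemifield₂ 𝔽) where
    open Field₂-Properties 𝔽 public
    open Presemifield₂ A public

    ⊕-∙ : ∀ u v w → (u ⊕ v) ∙ w ≡ u ∙ w ⊕ v ∙ w
    ⊕-∙ u v w = trans (∙-comm _ w) (trans (∙-⊕ w u v) (cong₂ _⊕_ (∙-comm w u) (∙-comm w v)))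

    ·-∙ : ∀ r u v → (r · u) ∙ v ≡ r · (u ∙ v)
    ·-∙ r u v = trans (∙-comm _ v) (trans (∙-· r v u) (cong (r ·_) (∙-comm v u)))

    ∙-0 : ∀ u → u ∙ 0v ≡ 0v
    ∙-0 u = trans (cong (u ∙_) (sym (0-· 0v))) (trans (∙-· 0# u 0v) (0-· _))

    0-∙ : ∀ u → 0v ∙ u ≡ 0v
    0-∙ u = trans (∙-comm _ u) (∙-0 u)

    ∙-cancel : ∀ {u v w} → u ≢ 0v → u ∙ v ≡ u ∙ w → v ≡ w
    ∙-cancel {u} {v} {w} u≢0 e with zero-product {u} {v ⊕ w} (trans (∙-⊕ u v w) (≡⇒⊕ e))
    ... | inj₁ z = ⊥-elim (u≢0 z)
    ... | inj₂ z = ⊕⇒≡ z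

    ∙-surjective : ∀ {u} → u ≢ 0v → ∀ w → ∃ λ v → u ∙ v ≡ w
    ∙-surjective {u} u≢0 = injective⇒surjective V-finite (u ∙_) (∙-cancel u≢0)

    -- Reflective proofs of identities that hold for every symmetric bilinear ∙ in characteristic 2.
    infixl 6 _⊞_
    infixr 7 _⊡_

    data Expr (m n : ℕ) : Set where
      at  : Fin n → Expr m n
      _⊞_ : Expr m n → Expr m n → Expr m n
      _⊡_ : Polynomial m → Expr m n → Expr m n

    data Expr² (m n : ℕ) : Set where
      _⊠_ : Expr m n → Expr m n → Expr² m n
      _⊞_ : Expr² m n → Expr² m n → Expr² m n
      _⊡_ : Polynomial m → Expr² m n → Expr² m n

    infixl 8 _⊠_

    module _ {m : ℕ} (ρ : Vec K m) where
      eval : ∀ {n} → Vec V n → Expr m n → V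
      eval as (at i)  = lookup as i
      eval as (e ⊞ f) = eval as e ⊕ eval as f
      eval as (p ⊡ e) = ⟦ p ⟧ ρ · eval as e

      eval² : ∀ {n} → Vec V n → Expr² m n → V
      eval² as (e ⊠ f) = eval as e ∙ eval as f
      eval² as (e ⊞ f) = eval² as e ⊕ eval² as f
      eval² as (p ⊡ e) = ⟦ p ⟧ ρ · eval² as e

      combine : ∀ {n} → Vec (Polynomial m) n → Vec V n → V
      combine []       []       = 0v
      combine (p ∷ ps) (a ∷ as) = ⟦ p ⟧ ρ · a ⊕ combine ps as

      combine² : ∀ {k n} → Vec (Vec (Polynomial m) n) k → Vec V k → Vec V n → V
      combine² []       []       bs = 0v
      combine² (r ∷ rs) (a ∷ as) bs = a ∙ combine r bs ⊕ combine² rs as bs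

      zeros : ∀ {n} → Vec (Polynomial m) n
      zeros = replicate _ (con false)

      combine-zeros : ∀ {n} (as : Vec V n) → combine zeros as ≡ 0v
      combine-zeros []       = refl
      combine-zeros (a ∷ as) = trans (cong₂ _⊕_ (0-· a) (combine-zeros as)) (⊕-identityˡ _)

      unit : ∀ {n} → Fin n → Vec (Polynomial m) n
      unit zero    = con true ∷ zeros
      unit (suc i) = con false ∷ unit i

      combine-unit : ∀ {n} (i : Fin n) (as : Vec V n) → combine (unit i) as ≡ lookup as i
      combine-unit zero    (a ∷ as) = trans (cong₂ _⊕_ (1-· a) (combine-zeros as)) (⊕-identityʳ _)
      combine-unit (suc i) (a ∷ as) = trans (cong₂ _⊕_ (0-· a) (combine-unit i as)) (⊕-identityˡ _)

      combine-⊕ : ∀ {n} (ps qs : Vec (Polynomial m) n) as → combine (zipWith _:+_ ps qs) as ≡ combine ps as ⊕ combine qs as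
      combine-⊕ []       []       []       = sym (⊕-self 0v)
      combine-⊕ (p ∷ ps) (q ∷ qs) (a ∷ as) = trans (cong₂ _⊕_ (+-· _ _ a) (combine-⊕ ps qs as)) (⊕-medial _ _ _ _)

      combine-· : ∀ {n} p (ps : Vec (Polynomial m) n) as → combine (map (p :*_) ps) as ≡ ⟦ p ⟧ ρ · combine ps as
      combine-· p []       []       = sym (·-0 _)
      combine-· p (q ∷ ps) (a ∷ as) = trans (cong₂ _⊕_ (*-· _ _ a) (combine-· p ps as)) (sym (·-⊕ _ _ _))

      nf : ∀ {n} → Expr m n → Vec (Polynomial m) n
      nf (at i)  = unit i
      nf (e ⊞ f) = zipWith _:+_ (nf e) (nf f)
      nf (p ⊡ e) = map (p :*_) (nf e)

      nf-correct : ∀ {n} (e : Expr m n) as → combine (nf e) as ≡ eval as e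
      nf-correct (at i)  as = combine-unit i as
      nf-correct (e ⊞ f) as = trans (combine-⊕ (nf e) (nf f) as) (cong₂ _⊕_ (nf-correct e as) (nf-correct f as))
      nf-correct (p ⊡ e) as = trans (combine-· p (nf e) as) (cong (⟦ p ⟧ ρ ·_) (nf-correct e as))

      nf² : ∀ {n} → Expr² m n → Vec (Vec (Polynomial m) n) n
      nf² (e ⊠ f) = map (λ p → map (p :*_) (nf f)) (nf e)
      nf² (e ⊞ f) = zipWith (zipWith _:+_) (nf² e) (nf² f)
      nf² (p ⊡ e) = map (map (p :*_)) (nf² e)

      combine²-⊠ : ∀ {k n} (ps : Vec (Polynomial m) k) (qs : Vec (Polynomial m) n) as bs →
                   combine² (map (λ p → map (p :*_) qs) ps) as bs ≡ combine ps as ∙ combine qs bs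
      combine²-⊠ []       qs []       bs = sym (0-∙ _)
      combine²-⊠ (p ∷ ps) qs (a ∷ as) bs = trans (cong₂ _⊕_
        (trans (cong (a ∙_) (combine-· p qs bs)) (trans (∙-· _ a _) (sym (·-∙ _ a _))))
        (combine²-⊠ ps qs as bs)) (sym (⊕-∙ _ _ _))

      combine²-⊕ : ∀ {k n} (ps qs : Vec (Vec (Polynomial m) n) k) as bs →
                   combine² (zipWith (zipWith _:+_) ps qs) as bs ≡ combine² ps as bs ⊕ combine² qs as bs
      combine²-⊕ []       []       []       bs = sym (⊕-self 0v)
      combine²-⊕ (p ∷ ps) (q ∷ qs) (a ∷ as) bs = trans (cong₂ _⊕_
        (trans (cong (a ∙_) (combine-⊕ p q bs)) (∙-⊕ a _ _)) (combine²-⊕ ps qs as bs)) (⊕-medial _ _ _ _)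

      combine²-· : ∀ {k n} p (ps : Vec (Vec (Polynomial m) n) k) as bs →
                   combine² (map (map (p :*_)) ps) as bs ≡ ⟦ p ⟧ ρ · combine² ps as bs
      combine²-· p []       []       bs = sym (·-0 _)
      combine²-· p (q ∷ ps) (a ∷ as) bs = trans (cong₂ _⊕_
        (trans (cong (a ∙_) (combine-· p q bs)) (∙-· _ a _)) (combine²-· p ps as bs)) (sym (·-⊕ _ _ _))

      nf²-correct : ∀ {n} (e : Expr² m n) as → combine² (nf² e) as as ≡ eval² as e
      nf²-correct (e ⊠ f) as = trans (combine²-⊠ (nf e) (nf f) as as) (cong₂ _∙_ (nf-correct e as) (nf-correct f as))
      nf²-correct (e ⊞ f) as = trans (combine²-⊕ (nf² e) (nf² f) as as) (cong₂ _⊕_ (nf²-correct e as) (nf²-correct f as))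
      nf²-correct (p ⊡ e) as = trans (combine²-· p (nf² e) as as) (cong (⟦ p ⟧ ρ ·_) (nf²-correct e as))

      Zero : Polynomial m → Set
      Zero p = ⟦ p ⟧ ρ ≡ 0#

      zero? : ∀ p → Maybe (Zero p)
      zero? p with normalise p ≟N 0N
      ... | just e  = just (trans (sym (correct p ρ)) (trans (⟦ e ⟧N-cong ρ) (0N-homo ρ)))
      ... | nothing = nothing

      allZero? : ∀ {n} (ps : Vec (Polynomial m) n) → Maybe (∀ as → combine ps as ≡ 0v)
      allZero? []       = just λ { [] → refl }
      allZero? (p ∷ ps) with zero? p | allZero? ps
      ... | just e | just es = just λ { (a ∷ as) → trans (cong₂ _⊕_ (trans (cong (_· a) e) (0-· a)) (es as)) (⊕-self 0v) }
      ... | _      | _       = nothing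

      hd : ∀ {n} → Vec (Polynomial m) (suc n) → Polynomial m
      hd (p ∷ _) = p
      tl : ∀ {n} → Vec (Polynomial m) (suc n) → Vec (Polynomial m) n
      tl (_ ∷ ps) = ps

      combine²-column : ∀ {k n} (rs : Vec (Vec (Polynomial m) (suc n)) k) as b bs →
        combine² rs as (b ∷ bs) ≡ b ∙ combine (map hd rs) as ⊕ combine² (map tl rs) as bs
      combine²-column []             []       b bs = sym (trans (⊕-identityʳ _) (∙-0 b))
      combine²-column ((p ∷ r) ∷ rs) (a ∷ as) b bs = trans (cong₂ _⊕_
        (trans (∙-⊕ a _ _) (cong₂ _⊕_ (trans (∙-· _ a b) (trans (cong (⟦ p ⟧ ρ ·_) (∙-comm a b)) (sym (∙-· _ b a)))) refl))
        (combine²-column rs as b bs))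
        (trans (⊕-medial _ _ _ _) (cong₂ _⊕_ (sym (∙-⊕ b _ _)) refl))

      -- The normal form keeps the coefficients of aᵢ ∙ aⱼ and aⱼ ∙ aᵢ apart. Since the product is
      -- commutative and the characteristic is 2, the sum vanishes when the diagonal is zero and the
      -- matrix equals its transpose; the first row is compared with the first column, then the rest
      -- is treated recursively.
      alternating? : ∀ {n} (rs : Vec (Vec (Polynomial m) n) n) → Maybe (∀ as → combine² rs as as ≡ 0v)
      alternating? []             = just λ { [] → refl }
      alternating? ((p ∷ r) ∷ rs) with zero? p | allZero? (zipWith _:+_ r (map hd rs)) | alternating? (map tl rs)
      ... | just e | just es | just fs = just λ { (a ∷ as) → trans (cong₂ _⊕_
            (trans (cong (λ t → a ∙ (t · a ⊕ combine r as)) e) (cong (a ∙_) (trans (cong (_⊕ combine r as) (0-· a)) (⊕-identityˡ _))))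
            (trans (combine²-column rs as a as) (trans (cong₂ _⊕_ refl (fs as)) (⊕-identityʳ _))))
            (trans (sym (∙-⊕ a _ _)) (trans (cong (a ∙_) (trans (sym (combine-⊕ r (map hd rs) as)) (es as))) (∙-0 a))) }
      ... | _      | _       | _       = nothing

    opaque
      linear : ∀ {m n} (e f : Expr m n) ρ as → {T (is-just (allZero? ρ (nf ρ (e ⊞ f))))} → eval ρ as e ≡ eval ρ as f
      linear e f ρ as {t} with allZero? ρ (nf ρ (e ⊞ f))
      ... | just z = ⊕⇒≡ (trans (sym (nf-correct ρ (e ⊞ f) as)) (z as))

      bilinear : ∀ {m n} (e f : Expr² m n) ρ as → {T (is-just (alternating? ρ (nf² ρ (e ⊞ f))))} → eval² ρ as e ≡ eval² ρ as f
      bilinear e f ρ as {t} with alternating? ρ (nf² ρ (e ⊞ f))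
      ... | just z = ⊕⇒≡ (trans (sym (nf²-correct ρ (e ⊞ f) as)) (z as))

    pattern x₀ = zero
    pattern x₁ = suc zero
    pattern x₂ = suc (suc zero)
    pattern x₃ = suc (suc (suc zero))
    pattern x₄ = suc (suc (suc (suc zero)))
    pattern x₅ = suc (suc (suc (suc (suc zero))))
    pattern x₆ = suc (suc (suc (suc (suc (suc zero)))))
    pattern x₇ = suc (suc (suc (suc (suc (suc (suc zero))))))

    square-⊕ : ∀ u v → (u ⊕ v) ∙ (u ⊕ v) ≡ u ∙ u ⊕ v ∙ v
    square-⊕ u v = bilinear {0} ((at x₀ ⊞ at x₁) ⊠ (at x₀ ⊞ at x₁)) (at x₀ ⊠ at x₀ ⊞ at x₁ ⊠ at x₁) [] (u ∷ v ∷ [])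

    square-· : ∀ r u → (r · u) ∙ (r · u) ≡ (r * r) · (u ∙ u)
    square-· r u = bilinear ((var x₀ ⊡ at x₀) ⊠ (var x₀ ⊡ at x₀)) ((var x₀ :* var x₀) ⊡ (at x₀ ⊠ at x₀)) (r ∷ []) (u ∷ [])

  -- Boolean searches over lists and their soundness

  module _ {A : Set} where
    anyᵇ allᵇ : (A → Bool) → List A → Bool
    anyᵇ p []       = false
    anyᵇ p (x ∷ xs) = if p x then true else anyᵇ p xs
    allᵇ p []       = true
    allᵇ p (x ∷ xs) = if p x then allᵇ p xs else false

    filterᵇ : (A → Bool) → List A → List A
    filterᵇ p []       = []
    filterᵇ p (x ∷ xs) = if p x then x ∷ filterᵇ p xs else filterᵇ p xs

    nullᵇ : List A → Bool
    nullᵇ []      = true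
    nullᵇ (_ ∷ _) = false

    anyᵇ-sound : ∀ p xs → anyᵇ p xs ≡ true → ∃ λ x → x ∈ xs × p x ≡ true
    anyᵇ-sound p (x ∷ xs) e with p x in eq
    ... | true  = x , here refl , eq
    ... | false with anyᵇ-sound p xs e
    ...   | y , y∈ , q = y , there y∈ , q

    allᵇ-sound : ∀ p xs → allᵇ p xs ≡ true → ∀ {x} → x ∈ xs → p x ≡ true
    allᵇ-sound p (x ∷ xs) e x∈ with p x in eq
    allᵇ-sound p (x ∷ xs) e (here refl) | true = eq
    allᵇ-sound p (x ∷ xs) e (there x∈)  | true = allᵇ-sound p xs e x∈

    filterᵇ-∈ : ∀ p xs {x} → x ∈ xs → p x ≡ true → x ∈ filterᵇ p xs
    filterᵇ-∈ p (y ∷ xs) (here refl) q rewrite q = here refl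
    filterᵇ-∈ p (y ∷ xs) (there x∈) q with p y
    ... | true  = there (filterᵇ-∈ p xs x∈ q)
    ... | false = filterᵇ-∈ p xs x∈ q

    filterᵇ-⊆ : ∀ p xs {x} → x ∈ filterᵇ p xs → x ∈ xs × p x ≡ true
    filterᵇ-⊆ p (y ∷ xs) x∈ with p y in eq
    filterᵇ-⊆ p (y ∷ xs) (here refl) | true = here refl , eq
    filterᵇ-⊆ p (y ∷ xs) (there x∈)  | true with filterᵇ-⊆ p xs x∈
    ... | z , q = there z , q
    filterᵇ-⊆ p (y ∷ xs) x∈ | false with filterᵇ-⊆ p xs x∈
    ... | z , q = there z , q

    nullᵇ-empty : ∀ {xs : List A} {x} → x ∈ xs → nullᵇ xs ≡ true → ⊥
    nullᵇ-empty (here _)  ()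
    nullᵇ-empty (there _) ()

  ∨-sound : ∀ a {b} → a ∨ b ≡ true → a ≡ true ⊎ b ≡ true
  ∨-sound true  e = inj₁ refl
  ∨-sound false e = inj₂ e

  ∧-sound : ∀ a {b} → a ∧ b ≡ true → a ≡ true × b ≡ true
  ∧-sound true e = refl , e

  not-sound : ∀ {a} → not a ≡ true → a ≢ true
  not-sound {true} ()
  not-sound {false} _ ()

  not-complete : ∀ {a} → a ≢ true → not a ≡ true
  not-complete {true}  n = ⊥-elim (n refl)
  not-complete {false} n = refl

  module Search {L Q : Set} (Ls : List L) (Qs : List Q) (bad : L → L → Bool) (closes : Q → L → L → Bool) (accepts : Q → Bool) where
    good : L → List L
    good a = filterᵇ (λ b → not (bad a b)) Ls

    goods : List (L × List L)
    goods = List.map (λ a → a , good a) Ls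

    refutes : Q → L × List L → Bool
    refutes ω (a , bs) = allᵇ (λ b → not (closes ω a b)) bs

    -- If some point has no possible partner, the parameters are contradictory whatever ω is.
    -- Otherwise ω is refuted by a point none of whose partners closes for it. The lists of partners
    -- do not depend on ω, so they are passed in and shared by all ω.
    finish : List (L × List L) → Bool
    finish gs = anyᵇ (λ g → nullᵇ (proj₂ g)) gs ∨ allᵇ (λ ω → anyᵇ (refutes ω) gs ∨ accepts ω) Qs

    settled : Bool
    settled = finish goods

    module _ {ω : Q} (ω∈ : ω ∈ Qs) (partner : ∀ a → ∃ λ b → b ∈ Ls × bad a b ≢ true × closes ω a b ≡ true) where
      private
        partner∈ : ∀ a → ∃ λ b → b ∈ good a × closes ω a b ≡ true
        partner∈ a with partner a
        ... | b , b∈ , nb , c = b , filterᵇ-∈ _ Ls b∈ (not-complete nb) , c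

      settled-accepts : settled ≡ true → accepts ω ≡ true
      settled-accepts e with ∨-sound (anyᵇ (λ g → nullᵇ (proj₂ g)) goods) e
      ... | inj₁ e′ with anyᵇ-sound _ goods e′
      ...   | g , g∈ , n with ∈-map⁻ (λ a → a , good a) g∈
      ...     | a , _ , refl = ⊥-elim (nullᵇ-empty (proj₁ (proj₂ (partner∈ a))) n)
      settled-accepts e | inj₂ e′ with ∨-sound (anyᵇ (refutes ω) goods) (allᵇ-sound _ Qs e′ ω∈)
      ... | inj₂ a = a
      ... | inj₁ r with anyᵇ-sound (refutes ω) goods r
      ...   | g , g∈ , n with ∈-map⁻ (λ a → a , good a) g∈
      ...     | a , _ , refl with partner∈ a
      ...       | b , b∈ , c = ⊥-elim (not-sound (allᵇ-sound _ (good a) n b∈) c)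

  module ZeroProducts {Q : Set} (Qs : List Q) (isZero : Q → Bool) (mul : Q → Q → Q) where
    search : Bool
    search = anyᵇ (λ u → not (isZero u) ∧ anyᵇ (λ v → not (isZero v) ∧ isZero (mul u v)) Qs) Qs

    search-sound : search ≡ true → ∃₂ λ u v → isZero u ≢ true × isZero v ≢ true × isZero (mul u v) ≡ true
    search-sound e with anyᵇ-sound _ Qs e
    ... | u , _ , e′ with ∧-sound (not (isZero u)) e′
    ...   | nu , e″ with anyᵇ-sound _ Qs e″
    ...     | v , _ , e‴ with ∧-sound (not (isZero v)) e‴
    ...       | nv , z = u , v , not-sound nu , not-sound nv , z

  module Sweep {L : Set} (Ls : List L) (p q : L → L → Bool) where
    sweep : Bool
    sweep = allᵇ (λ χ → allᵇ (λ ψ → p χ ψ ∨ q χ ψ) Ls) Ls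

    sweep-sound : sweep ≡ true → ∀ {χ ψ} → χ ∈ Ls → ψ ∈ Ls → p χ ψ ≡ true ⊎ q χ ψ ≡ true
    sweep-sound e {χ} {ψ} χ∈ ψ∈ = ∨-sound (p χ ψ) (allᵇ-sound _ Ls (allᵇ-sound _ Ls e χ∈) ψ∈)

  -- The finite search over structure constants

  module Checker (𝔽 : Field₂) (l m τ β : Field₂.K 𝔽) where
    open Field₂ 𝔽

    L Q : Set
    L = K × K
    Q = K × K × K × K

    -- `directions` contains one representative of each point of the projective line over K.
    Ls directions : List L
    Ls = List.cartesianProduct elements elements
    directions = (1# , 0#) ∷ List.map (_, 1#) elements

    Qs : List Q
    Qs = List.cartesianProduct elements (List.cartesianProduct elements Ls)

    infixl 6 _+ᴸ_ _+ᵠ_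
    infixr 7 _*ᴸ_ _*ᵠ_
    _+ᴸ_ : L → L → L
    (a , b) +ᴸ (c , d) = a + c , b + d
    _*ᴸ_ : K → L → L
    r *ᴸ (a , b) = r * a , r * b
    _+ᵠ_ : Q → Q → Q
    (a , b , c , d) +ᵠ (a′ , b′ , c′ , d′) = a + a′ , b + b′ , c + c′ , d + d′
    _*ᵠ_ : K → Q → Q
    r *ᵠ (a , b , c , d) = r * a , r * b , r * c , r * d

    isL0 : L → Bool
    isL0 (a , b) = is0 a ∧ is0 b
    isQ0 : Q → Bool
    isQ0 (a , b , c , d) = is0 a ∧ is0 b ∧ is0 c ∧ is0 d

    -- The product of K[x]/(x² + lx + m), which is the product on ⟨e₁,e₂⟩ with e₂ in the place of x.
    _∙ᴸ_ : L → L → L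
    (a , b) ∙ᴸ (c , d) = a * c + m * (b * d) , a * d + b * c + l * (b * d)

    module _ (χ ψ : L) where
      mulᴸ : L → Q → Q
      mulᴸ (a , b) (c , d , e , f) =
        a * c + b * (m * d + proj₁ χ * f) , a * d + b * (c + l * d + proj₂ χ * f) , a * e + b * (β * f) , a * f + b * (e + f)

      sqᵠ : Q → Q
      sqᵠ (a , b , c , d) = a * a + m * (b * b) + proj₁ ψ * (d * d) , l * (b * b) + τ * (c * c) + proj₂ ψ * (d * d) , c * c + ε * (d * d) , d * d

      -- `ω` is a candidate for e₃ ∙ e₄. It enters only with the coefficient c d′ + d c′, which
      -- vanishes on squares and on products with ⟨e₁,e₂⟩.
      mulᵠ : Q → Q → Q → Q
      mulᵠ ω u@(a , b , c , d) v@(a′ , b′ , c′ , d′) =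
        mulᴸ (a , b) v +ᵠ mulᴸ (a′ , b′) (0# , 0# , c , d)
          +ᵠ (proj₁ ψ * (d * d′) , τ * (c * c′) + proj₂ ψ * (d * d′) , c * c′ + ε * (d * d′) , d * d′) +ᵠ (c * d′ + d * c′) *ᵠ ω

    -- With n = a e₁ + b e₂ and u = c e₃ + d e₄, the two equations are the e₃- and e₄-coordinates of
    -- n ∙ u + u ∙ u: the point n of the line fixes the direction u modulo the line.
    fixes : L × L → Bool
    fixes ((a , b) , (c , d)) = not (isL0 (c , d)) ∧ is0 (a * c + b * (β * d) + (c * c + ε * (d * d))) ∧ is0 (a * d + b * (c + d) + d * d)

    -- For each fixed direction, the values t² + nt with t on the line. They depend on neither χ nor
    -- ψ, so one table serves the whole sweep.
    fixedTable : List ((L × L) × List L)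
    fixedTable = List.map (λ (x , u) → (x , u) , List.map (λ t → t ∙ᴸ t +ᴸ x ∙ᴸ t) Ls) (filterᵇ fixes (List.cartesianProduct directions Ls))

    -- The ⟨e₁,e₂⟩-component of u ∙ u + n ∙ u for a direction u fixed by n.
    rest : L → L → L × L → L
    rest χ ψ ((a , b) , (c , d)) = (0# , τ * (c * c)) +ᴸ (d * d) *ᴸ ψ +ᴸ (b * d) *ᴸ χ

    -- A match gives a vector w = t + u off the line with w ∙ w = n ∙ w, hence the zero product w ∙
    -- (w + n).
    divides : L → L → List ((L × L) × List L) → Bool
    divides χ ψ = anyᵇ (λ (xu , is) → anyᵇ (λ i → isL0 (i +ᴸ rest χ ψ xu)) is)

    wedge : L → L → K
    wedge (a , b) (c , d) = a * d + b * c

    -- The point a p + b q fixes the direction u when a n₁ + b n₂ = 0. Proportional pairs (n₁ , n₂)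
    -- at two different directions therefore mean that one point fixes both, which a special line
    -- does not allow.
    crosses : L × K × K → L × K × K → Bool
    crosses (u , n₁ , n₂) (u′ , n₁′ , n₂′) = is0 (n₁ * n₂′ + n₂ * n₁′) ∧ not (is0 (wedge u u′))

    anyPair : List (L × K × K) → Bool
    anyPair []       = false
    anyPair (x ∷ xs) = if anyᵇ (crosses x) xs then true else anyPair xs

    entry : L → L → L → L → L → L × K × K
    entry f₁ fₓ g₁ gₓ u@(s , t) = u , wedge (u ∙ᴸ u) (s *ᴸ f₁ +ᴸ t *ᴸ fₓ) , wedge (u ∙ᴸ u) (s *ᴸ g₁ +ᴸ t *ᴸ gₓ)

    violates : L → L → L → L → Bool
    violates f₁ fₓ g₁ gₓ = anyPair (List.map (entry f₁ fₓ g₁ gₓ) directions)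

    module _ (χ ψ : L) where
      -- The ⟨e₁,e₂⟩-components of the squares of a + e₃ and b + e₄, whose other components are e₃
      -- and ε e₃ + e₄. Modulo these squares, e₃ becomes `PPᴸ a` and e₄ becomes `QQᴸ b` + ε `PPᴸ a`;
      -- this substitution produces the formulas of `badLine′` and `closes`.
      PPᴸ QQᴸ : L → L
      PPᴸ a = a ∙ᴸ a +ᴸ (0# , τ)
      QQᴸ b = b ∙ᴸ b +ᴸ ψ

      -- Can ⟨a + e₃, b + e₄⟩ not be a special line, judging from its products with ⟨e₁,e₂⟩ alone?
      badLine′ : L → L → L → L → Bool
      badLine′ a b v z = violates (a +ᴸ v) ((0# , 1#) ∙ᴸ a +ᴸ (z +ᴸ ε *ᴸ v)) (b +ᴸ (z +ᴸ ε *ᴸ v)) ((0# , 1#) ∙ᴸ b +ᴸ χ +ᴸ (z +ᴸ (β + ε) *ᴸ v))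

      badLine : L → L → Bool
      badLine a b = badLine′ a b (PPᴸ a) (QQᴸ b)

      closes : Q → L → L → Bool
      closes ω a b = reduced (mulᵠ χ ψ ω (proj₁ a , proj₂ a , 1# , 0#) (proj₁ b , proj₂ b , 0# , 1#))
        where
        reduced : Q → Bool
        reduced (w₁ , w₂ , w₃ , w₄) = isL0 ((w₁ , w₂) +ᴸ (w₄ *ᴸ QQᴸ b +ᴸ (w₃ + ε * w₄) *ᴸ PPᴸ a))

      units : List Q
      units = (1# , 0# , 0# , 0#) ∷ (0# , 1# , 0# , 0#) ∷ (0# , 0# , 1# , 0#) ∷ (0# , 0# , 0# , 1#) ∷ []

      associates : Q → Bool
      associates ω = allᵇ (λ u → allᵇ (λ v → allᵇ (λ w → isQ0 (mulᵠ χ ψ ω (mulᵠ χ ψ ω u v) w +ᵠ mulᵠ χ ψ ω u (mulᵠ χ ψ ω v w))) units) units) units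

      annihilates : Q → Bool
      annihilates ω = ZeroProducts.search Qs isQ0 (mulᵠ χ ψ ω)

      settled : Bool
      settled = Search.settled Ls Qs badLine closes (λ ω → associates ω ∨ annihilates ω)

    checkWith : List ((L × L) × List L) → Bool
    checkWith table = Sweep.sweep Ls (λ χ ψ → divides χ ψ table) settled

    check : Bool
    check = checkWith fixedTable

  -- The fields with 2, 4 and 8 elements

  module Exhaustive {K : Set} (F : Finite K) (elements : List K) (complete : ∀ x → x ∈ elements) where
    infix 4 _==_
    _==_ : K → K → Bool
    x == y = isYes (Finite._≟_ F x y)

    ==-sound : ∀ {x y} → (x == y) ≡ true → x ≡ y
    ==-sound {x} {y} e with Finite._≟_ F x y
    ... | yes p = p

    ∀₁ : ∀ {f g : K → K} → allᵇ (λ x → f x == g x) elements ≡ true → ∀ x → f x ≡ g x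
    ∀₁ e x = ==-sound (allᵇ-sound _ elements e (complete x))

    ∀₂ : ∀ {f g : K → K → K} → allᵇ (λ x → allᵇ (λ y → f x y == g x y) elements) elements ≡ true → ∀ x y → f x y ≡ g x y
    ∀₂ {f} {g} e x = ∀₁ {f x} {g x} (allᵇ-sound _ elements e (complete x))

    ∀₃ : ∀ {f g : K → K → K → K} → allᵇ (λ x → allᵇ (λ y → allᵇ (λ z → f x y z == g x y z) elements) elements) elements ≡ true →
         ∀ x y z → f x y z ≡ g x y z
    ∀₃ {f} {g} e x = ∀₂ {f x} {g x} (allᵇ-sound _ elements e (complete x))

    module _ {_+_ _*_ : K → K → K} {0# 1# : K} where
      private
        all₁ : (K → Bool) → Set
        all₁ p = allᵇ p elements ≡ true

      commutative-ring :
        all₁ (λ x → allᵇ (λ y → allᵇ (λ z → ((x + y) + z) == (x + (y + z))) elements) elements) →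
        all₁ (λ x → allᵇ (λ y → (x + y) == (y + x)) elements) →
        all₁ (λ x → (0# + x) == x) →
        all₁ (λ x → (x + x) == 0#) →
        all₁ (λ x → allᵇ (λ y → allᵇ (λ z → ((x * y) * z) == (x * (y * z))) elements) elements) →
        all₁ (λ x → allᵇ (λ y → (x * y) == (y * x)) elements) →
        all₁ (λ x → (1# * x) == x) →
        all₁ (λ x → allᵇ (λ y → allᵇ (λ z → (x * (y + z)) == ((x * y) + (x * z))) elements) elements) →
        IsCommutativeRing _≡_ _+_ _*_ (λ x → x) 0# 1#
      commutative-ring +-a +-c +-i +-s *-a *-c *-i d = record
        { isRing = record
          { +-isAbelianGroup = record
            { isGroup = record
              { isMonoid = record
                { isSemigroup = record
                  { isMagma = record { isEquivalence = isEquivalence ; ∙-cong = cong₂ _+_ }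
                  ; assoc = ∀₃ +-a }
                ; identity = ∀₁ +-i , λ x → trans (comm x 0#) (∀₁ +-i x) }
              ; inverse = ∀₁ +-s , ∀₁ +-s
              ; ⁻¹-cong = λ e → e }
            ; comm = comm }
          ; *-cong = cong₂ _*_
          ; *-assoc = ∀₃ *-a
          ; *-identity = ∀₁ *-i , λ x → trans (*-comm x 1#) (∀₁ *-i x)
          ; distrib = ∀₃ d , λ x y z → trans (*-comm (y + z) x) (trans (∀₃ d x y z) (cong₂ _+_ (*-comm x y) (*-comm x z))) }
        ; *-comm = *-comm }
        where
        comm : ∀ x y → (x + y) ≡ (y + x)
        comm = ∀₂ +-c
        *-comm : ∀ x y → (x * y) ≡ (y * x)
        *-comm = ∀₂ *-c

  -- GF(4) = {0, 1, ω, ω²}; the element γₙ of GF(8) = F₂[t]/(t³ + t + 1) is the polynomial whose coefficients are the binary digits of n.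
  data F₂ : Set where
    𝟎₂ 𝟏₂ : F₂

  module GF2 where
    infixl 6 _+_
    infixl 7 _*_
    _+_ _*_ : F₂ → F₂ → F₂
    𝟎₂ + y = y
    𝟏₂ + 𝟎₂ = 𝟏₂; 𝟏₂ + 𝟏₂ = 𝟎₂
    𝟎₂ * y = 𝟎₂
    𝟏₂ * y = y

    inv sqrt : F₂ → F₂
    inv 𝟎₂ = 𝟎₂; inv 𝟏₂ = 𝟏₂
    sqrt 𝟎₂ = 𝟎₂; sqrt 𝟏₂ = 𝟏₂

    finite : Finite F₂
    finite = record { size = 2 ; to = to ; from = from ; to-from = to-from ; from-to = from-to }
      where
      to : F₂ → Fin 2
      to 𝟎₂ = zero; to 𝟏₂ = suc zero
      from : Fin 2 → F₂
      from zero = 𝟎₂; from (suc zero) = 𝟏₂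
      to-from : ∀ i → to (from i) ≡ i
      to-from zero = refl; to-from (suc zero) = refl
      from-to : ∀ a → from (to a) ≡ a
      from-to 𝟎₂ = refl; from-to 𝟏₂ = refl

    elements : List F₂
    elements = 𝟎₂ ∷ 𝟏₂ ∷ []

    complete : ∀ x → x ∈ elements
    complete 𝟎₂ = here refl
    complete 𝟏₂ = there (here refl)

    open Exhaustive finite elements complete

    field₂ : Field₂
    field₂ = record
      { K = F₂ ; _+_ = _+_ ; _*_ = _*_ ; 0# = 𝟎₂ ; 1# = 𝟏₂
      ; isCommutativeRing = isCommutativeRing
      ; finite = finite ; 1≢0 = λ ()
      ; inv = inv ; inverse = λ { 𝟎₂ n → ⊥-elim (n refl) ; 𝟏₂ _ → refl }
      ; sqrt = sqrt ; sqrt-square = ∀₁ refl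
      ; ε = 𝟏₂ ; ε-missed = λ { 𝟎₂ () ; 𝟏₂ () }
      ; halve = λ { 𝟎₂ → 𝟎₂ , inj₁ refl ; 𝟏₂ → 𝟎₂ , inj₂ refl }
      ; elements = elements ; complete = complete
      ; is0 = λ { 𝟎₂ → true ; _ → false } ; is0-sound = λ { {𝟎₂} _ → refl ; {𝟏₂} () } ; is0-zero = refl
      }
      where
      isCommutativeRing : IsCommutativeRing _≡_ _+_ _*_ (λ x → x) 𝟎₂ 𝟏₂
      isCommutativeRing = commutative-ring refl refl refl refl refl refl refl refl

  data F₄ : Set where
    𝟎₄ 𝟏₄ ω₄ ω₄² : F₄

  module GF4 where
    infixl 6 _+_
    infixl 7 _*_
    _+_ _*_ : F₄ → F₄ → F₄
    𝟎₄ + y = y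
    𝟏₄ + 𝟎₄ = 𝟏₄; 𝟏₄ + 𝟏₄ = 𝟎₄; 𝟏₄ + ω₄ = ω₄²; 𝟏₄ + ω₄² = ω₄
    ω₄ + 𝟎₄ = ω₄; ω₄ + 𝟏₄ = ω₄²; ω₄ + ω₄ = 𝟎₄; ω₄ + ω₄² = 𝟏₄
    ω₄² + 𝟎₄ = ω₄²; ω₄² + 𝟏₄ = ω₄; ω₄² + ω₄ = 𝟏₄; ω₄² + ω₄² = 𝟎₄
    𝟎₄ * y = 𝟎₄
    𝟏₄ * y = y
    ω₄ * 𝟎₄ = 𝟎₄; ω₄ * 𝟏₄ = ω₄; ω₄ * ω₄ = ω₄²; ω₄ * ω₄² = 𝟏₄
    ω₄² * 𝟎₄ = 𝟎₄; ω₄² * 𝟏₄ = ω₄²; ω₄² * ω₄ = 𝟏₄; ω₄² * ω₄² = ω₄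

    inv sqrt : F₄ → F₄
    inv 𝟎₄ = 𝟎₄; inv 𝟏₄ = 𝟏₄; inv ω₄ = ω₄²; inv ω₄² = ω₄
    sqrt 𝟎₄ = 𝟎₄; sqrt 𝟏₄ = 𝟏₄; sqrt ω₄ = ω₄²; sqrt ω₄² = ω₄

    finite : Finite F₄
    finite = record { size = 4 ; to = to ; from = from ; to-from = to-from ; from-to = from-to }
      where
      to : F₄ → Fin 4
      to 𝟎₄ = zero; to 𝟏₄ = suc zero; to ω₄ = suc (suc zero); to ω₄² = suc (suc (suc zero))
      from : Fin 4 → F₄
      from zero = 𝟎₄; from (suc zero) = 𝟏₄; from (suc (suc zero)) = ω₄; from (suc (suc (suc zero))) = ω₄²
      to-from : ∀ i → to (from i) ≡ i
      to-from zero = refl; to-from (suc zero) = refl; to-from (suc (suc zero)) = refl; to-from (suc (suc (suc zero))) = refl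
      from-to : ∀ a → from (to a) ≡ a
      from-to 𝟎₄ = refl; from-to 𝟏₄ = refl; from-to ω₄ = refl; from-to ω₄² = refl

    elements : List F₄
    elements = 𝟎₄ ∷ 𝟏₄ ∷ ω₄ ∷ ω₄² ∷ []

    complete : ∀ x → x ∈ elements
    complete 𝟎₄ = here refl
    complete 𝟏₄ = there (here refl)
    complete ω₄ = there (there (here refl))
    complete ω₄² = there (there (there (here refl)))

    open Exhaustive finite elements complete

    field₂ : Field₂
    field₂ = record
      { K = F₄ ; _+_ = _+_ ; _*_ = _*_ ; 0# = 𝟎₄ ; 1# = 𝟏₄
      ; isCommutativeRing = isCommutativeRing
      ; finite = finite ; 1≢0 = λ ()
      ; inv = inv ; inverse = λ { 𝟎₄ n → ⊥-elim (n refl) ; 𝟏₄ _ → refl ; ω₄ _ → refl ; ω₄² _ → refl }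
      ; sqrt = sqrt ; sqrt-square = ∀₁ refl
      ; ε = ω₄ ; ε-missed = λ { 𝟎₄ () ; 𝟏₄ () ; ω₄ () ; ω₄² () }
      ; halve = λ { 𝟎₄ → 𝟎₄ , inj₁ refl ; 𝟏₄ → ω₄ , inj₁ refl ; ω₄ → 𝟎₄ , inj₂ refl ; ω₄² → ω₄ , inj₂ refl }
      ; elements = elements ; complete = complete
      ; is0 = λ { 𝟎₄ → true ; _ → false } ; is0-sound = λ { {𝟎₄} _ → refl ; {𝟏₄} () ; {ω₄} () ; {ω₄²} () } ; is0-zero = refl
      }
      where
      isCommutativeRing : IsCommutativeRing _≡_ _+_ _*_ (λ x → x) 𝟎₄ 𝟏₄
      isCommutativeRing = commutative-ring refl refl refl refl refl refl refl refl

  data F₈ : Set where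
    𝟎₈ 𝟏₈ γ₂ γ₃ γ₄ γ₅ γ₆ γ₇ : F₈

  module GF8 where
    infixl 6 _+_
    infixl 7 _*_
    _+_ _*_ : F₈ → F₈ → F₈
    𝟎₈ + y = y
    𝟏₈ + 𝟎₈ = 𝟏₈; 𝟏₈ + 𝟏₈ = 𝟎₈; 𝟏₈ + γ₂ = γ₃; 𝟏₈ + γ₃ = γ₂; 𝟏₈ + γ₄ = γ₅; 𝟏₈ + γ₅ = γ₄; 𝟏₈ + γ₆ = γ₇; 𝟏₈ + γ₇ = γ₆
    γ₂ + 𝟎₈ = γ₂; γ₂ + 𝟏₈ = γ₃; γ₂ + γ₂ = 𝟎₈; γ₂ + γ₃ = 𝟏₈; γ₂ + γ₄ = γ₆; γ₂ + γ₅ = γ₇; γ₂ + γ₆ = γ₄; γ₂ + γ₇ = γ₅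
    γ₃ + 𝟎₈ = γ₃; γ₃ + 𝟏₈ = γ₂; γ₃ + γ₂ = 𝟏₈; γ₃ + γ₃ = 𝟎₈; γ₃ + γ₄ = γ₇; γ₃ + γ₅ = γ₆; γ₃ + γ₆ = γ₅; γ₃ + γ₇ = γ₄
    γ₄ + 𝟎₈ = γ₄; γ₄ + 𝟏₈ = γ₅; γ₄ + γ₂ = γ₆; γ₄ + γ₃ = γ₇; γ₄ + γ₄ = 𝟎₈; γ₄ + γ₅ = 𝟏₈; γ₄ + γ₆ = γ₂; γ₄ + γ₇ = γ₃
    γ₅ + 𝟎₈ = γ₅; γ₅ + 𝟏₈ = γ₄; γ₅ + γ₂ = γ₇; γ₅ + γ₃ = γ₆; γ₅ + γ₄ = 𝟏₈; γ₅ + γ₅ = 𝟎₈; γ₅ + γ₆ = γ₃; γ₅ + γ₇ = γ₂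
    γ₆ + 𝟎₈ = γ₆; γ₆ + 𝟏₈ = γ₇; γ₆ + γ₂ = γ₄; γ₆ + γ₃ = γ₅; γ₆ + γ₄ = γ₂; γ₆ + γ₅ = γ₃; γ₆ + γ₆ = 𝟎₈; γ₆ + γ₇ = 𝟏₈
    γ₇ + 𝟎₈ = γ₇; γ₇ + 𝟏₈ = γ₆; γ₇ + γ₂ = γ₅; γ₇ + γ₃ = γ₄; γ₇ + γ₄ = γ₃; γ₇ + γ₅ = γ₂; γ₇ + γ₆ = 𝟏₈; γ₇ + γ₇ = 𝟎₈
    𝟎₈ * y = 𝟎₈
    𝟏₈ * y = y
    γ₂ * 𝟎₈ = 𝟎₈; γ₂ * 𝟏₈ = γ₂; γ₂ * γ₂ = γ₄; γ₂ * γ₃ = γ₆; γ₂ * γ₄ = γ₃; γ₂ * γ₅ = 𝟏₈; γ₂ * γ₆ = γ₇; γ₂ * γ₇ = γ₅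
    γ₃ * 𝟎₈ = 𝟎₈; γ₃ * 𝟏₈ = γ₃; γ₃ * γ₂ = γ₆; γ₃ * γ₃ = γ₅; γ₃ * γ₄ = γ₇; γ₃ * γ₅ = γ₄; γ₃ * γ₆ = 𝟏₈; γ₃ * γ₇ = γ₂
    γ₄ * 𝟎₈ = 𝟎₈; γ₄ * 𝟏₈ = γ₄; γ₄ * γ₂ = γ₃; γ₄ * γ₃ = γ₇; γ₄ * γ₄ = γ₆; γ₄ * γ₅ = γ₂; γ₄ * γ₆ = γ₅; γ₄ * γ₇ = 𝟏₈
    γ₅ * 𝟎₈ = 𝟎₈; γ₅ * 𝟏₈ = γ₅; γ₅ * γ₂ = 𝟏₈; γ₅ * γ₃ = γ₄; γ₅ * γ₄ = γ₂; γ₅ * γ₅ = γ₇; γ₅ * γ₆ = γ₃; γ₅ * γ₇ = γ₆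
    γ₆ * 𝟎₈ = 𝟎₈; γ₆ * 𝟏₈ = γ₆; γ₆ * γ₂ = γ₇; γ₆ * γ₃ = 𝟏₈; γ₆ * γ₄ = γ₅; γ₆ * γ₅ = γ₃; γ₆ * γ₆ = γ₂; γ₆ * γ₇ = γ₄
    γ₇ * 𝟎₈ = 𝟎₈; γ₇ * 𝟏₈ = γ₇; γ₇ * γ₂ = γ₅; γ₇ * γ₃ = γ₂; γ₇ * γ₄ = 𝟏₈; γ₇ * γ₅ = γ₆; γ₇ * γ₆ = γ₄; γ₇ * γ₇ = γ₃

    inv sqrt : F₈ → F₈
    inv 𝟎₈ = 𝟎₈; inv 𝟏₈ = 𝟏₈; inv γ₂ = γ₅; inv γ₃ = γ₆; inv γ₄ = γ₇; inv γ₅ = γ₂; inv γ₆ = γ₃; inv γ₇ = γ₄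
    sqrt 𝟎₈ = 𝟎₈; sqrt 𝟏₈ = 𝟏₈; sqrt γ₂ = γ₆; sqrt γ₃ = γ₇; sqrt γ₄ = γ₂; sqrt γ₅ = γ₃; sqrt γ₆ = γ₄; sqrt γ₇ = γ₅

    finite : Finite F₈
    finite = record { size = 8 ; to = to ; from = from ; to-from = to-from ; from-to = from-to }
      where
      to : F₈ → Fin 8
      to 𝟎₈ = zero; to 𝟏₈ = suc zero; to γ₂ = suc (suc zero); to γ₃ = suc (suc (suc zero)); to γ₄ = suc (suc (suc (suc zero))); to γ₅ = suc (suc (suc (suc (suc zero)))); to γ₆ = suc (suc (suc (suc (suc (suc zero))))); to γ₇ = suc (suc (suc (suc (suc (suc (suc zero))))))
      from : Fin 8 → F₈
      from zero = 𝟎₈; from (suc zero) = 𝟏₈; from (suc (suc zero)) = γ₂; from (suc (suc (suc zero))) = γ₃; from (suc (suc (suc (suc zero)))) = γ₄; from (suc (suc (suc (suc (suc zero))))) = γ₅; from (suc (suc (suc (suc (suc (suc zero)))))) = γ₆; from (suc (suc (suc (suc (suc (suc (suc zero))))))) = γ₇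
      to-from : ∀ i → to (from i) ≡ i
      to-from zero = refl; to-from (suc zero) = refl; to-from (suc (suc zero)) = refl; to-from (suc (suc (suc zero))) = refl; to-from (suc (suc (suc (suc zero)))) = refl; to-from (suc (suc (suc (suc (suc zero))))) = refl; to-from (suc (suc (suc (suc (suc (suc zero)))))) = refl; to-from (suc (suc (suc (suc (suc (suc (suc zero))))))) = refl
      from-to : ∀ a → from (to a) ≡ a
      from-to 𝟎₈ = refl; from-to 𝟏₈ = refl; from-to γ₂ = refl; from-to γ₃ = refl; from-to γ₄ = refl; from-to γ₅ = refl; from-to γ₆ = refl; from-to γ₇ = refl

    elements : List F₈
    elements = 𝟎₈ ∷ 𝟏₈ ∷ γ₂ ∷ γ₃ ∷ γ₄ ∷ γ₅ ∷ γ₆ ∷ γ₇ ∷ []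

    complete : ∀ x → x ∈ elements
    complete 𝟎₈ = here refl
    complete 𝟏₈ = there (here refl)
    complete γ₂ = there (there (here refl))
    complete γ₃ = there (there (there (here refl)))
    complete γ₄ = there (there (there (there (here refl))))
    complete γ₅ = there (there (there (there (there (here refl)))))
    complete γ₆ = there (there (there (there (there (there (here refl))))))
    complete γ₇ = there (there (there (there (there (there (there (here refl)))))))

    open Exhaustive finite elements complete

    field₂ : Field₂
    field₂ = record
      { K = F₈ ; _+_ = _+_ ; _*_ = _*_ ; 0# = 𝟎₈ ; 1# = 𝟏₈
      ; isCommutativeRing = isCommutativeRing
      ; finite = finite ; 1≢0 = λ ()
      ; inv = inv ; inverse = λ { 𝟎₈ n → ⊥-elim (n refl) ; 𝟏₈ _ → refl ; γ₂ _ → refl ; γ₃ _ → refl ; γ₄ _ → refl ; γ₅ _ → refl ; γ₆ _ → refl ; γ₇ _ → refl }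
      ; sqrt = sqrt ; sqrt-square = ∀₁ refl
      ; ε = 𝟏₈ ; ε-missed = λ { 𝟎₈ () ; 𝟏₈ () ; γ₂ () ; γ₃ () ; γ₄ () ; γ₅ () ; γ₆ () ; γ₇ () }
      ; halve = λ { 𝟎₈ → 𝟎₈ , inj₁ refl ; 𝟏₈ → 𝟎₈ , inj₂ refl ; γ₂ → γ₄ , inj₁ refl ; γ₃ → γ₄ , inj₂ refl ; γ₄ → γ₆ , inj₁ refl ; γ₅ → γ₆ , inj₂ refl ; γ₆ → γ₂ , inj₁ refl ; γ₇ → γ₂ , inj₂ refl }
      ; elements = elements ; complete = complete
      ; is0 = λ { 𝟎₈ → true ; _ → false } ; is0-sound = λ { {𝟎₈} _ → refl ; {𝟏₈} () ; {γ₂} () ; {γ₃} () ; {γ₄} () ; {γ₅} () ; {γ₆} () ; {γ₇} () } ; is0-zero = refl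
      }
      where
      isCommutativeRing : IsCommutativeRing _≡_ _+_ _*_ (λ x → x) 𝟎₈ 𝟏₈
      isCommutativeRing = commutative-ring refl refl refl refl refl refl refl refl

  -- A record, so that the conversion checker compares l, m and β instead of unfolding the check.
  record Checked (𝔽 : Field₂) (l m β : Field₂.K 𝔽) : Set where
    constructor checked
    open Field₂ 𝔽
    field holds : Checker.check 𝔽 l m (ε * inv l) β ≡ true

  -- The listed elements are those outside {r² + r}, that is, all m for which y² + y + m is
  -- irreducible over GF(8).
  checked₈ : ∀ {m} → m ∈ 𝟏₈ ∷ γ₃ ∷ γ₅ ∷ γ₇ ∷ [] → Checked GF8.field₂ 𝟏₈ m 𝟏₈
  checked₈ (here refl)                         = checked refl
  checked₈ (there (here refl))                 = checked refl
  checked₈ (there (there (here refl)))         = checked refl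
  checked₈ (there (there (there (here refl)))) = checked refl

  -- Special lines and Artin-Schreier theory on them

  module Lines {𝔽 : Field₂} (A : Presemifield₂ 𝔽) where
    open Presemifield₂-Properties A public

    infix 4 _∈⟨_,_⟩ _∈²⟨_,_⟩

    _∈⟨_,_⟩ : V → V → V → Set
    v ∈⟨ p , q ⟩ = ∃₂ λ a b → v ≡ a · p ⊕ b · q

    -- Squaring is additive and K is perfect, so the squares form a subspace; on a special line it
    -- is spanned by p ∙ p and p ∙ q. All later congruences are taken modulo it.
    _∈²⟨_,_⟩ : V → V → V → Set
    w ∈²⟨ p , q ⟩ = ∃ λ n → n ∈⟨ p , q ⟩ × w ≡ n ∙ n

    ∈-⊕ : ∀ {p q u v} → u ∈⟨ p , q ⟩ → v ∈⟨ p , q ⟩ → u ⊕ v ∈⟨ p , q ⟩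
    ∈-⊕ {p} {q} (a , b , refl) (a′ , b′ , refl) = a + a′ , b + b′ ,
      linear ((var x₀ ⊡ at x₀ ⊞ var x₁ ⊡ at x₁) ⊞ (var x₂ ⊡ at x₀ ⊞ var x₃ ⊡ at x₁))
             ((var x₀ :+ var x₂) ⊡ at x₀ ⊞ (var x₁ :+ var x₃) ⊡ at x₁) (a ∷ b ∷ a′ ∷ b′ ∷ []) (p ∷ q ∷ [])

    ∈-· : ∀ {p q u} r → u ∈⟨ p , q ⟩ → r · u ∈⟨ p , q ⟩
    ∈-· {p} {q} r (a , b , refl) = r * a , r * b ,
      linear (var x₂ ⊡ (var x₀ ⊡ at x₀ ⊞ var x₁ ⊡ at x₁))
             ((var x₂ :* var x₀) ⊡ at x₀ ⊞ (var x₂ :* var x₁) ⊡ at x₁) (a ∷ b ∷ r ∷ []) (p ∷ q ∷ [])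

    ∈²-⊕ : ∀ {p q u v} → u ∈²⟨ p , q ⟩ → v ∈²⟨ p , q ⟩ → u ⊕ v ∈²⟨ p , q ⟩
    ∈²-⊕ (n , n∈ , refl) (m , m∈ , refl) = n ⊕ m , ∈-⊕ n∈ m∈ , sym (square-⊕ n m)

    ∈²-· : ∀ {p q u} r → u ∈²⟨ p , q ⟩ → r · u ∈²⟨ p , q ⟩
    ∈²-· r (n , n∈ , refl) = sqrt r · n , ∈-· (sqrt r) n∈ , sym (trans (square-· (sqrt r) n) (cong (_· _) (sqrt-square r)))

    0∈ : ∀ {p q} → 0v ∈⟨ p , q ⟩
    0∈ = 0# , 0# , sym (trans (cong₂ _⊕_ (0-· _) (0-· _)) (⊕-self 0v))

    0∈² : ∀ {p q} → 0v ∈²⟨ p , q ⟩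
    0∈² = 0v , 0∈ , sym (∙-0 0v)

    norm : K → K → K
    norm a b = a * a + a * b + ε * (b * b)

    -- The norm form of K[y]/(y² + y + ε): a zero with b nonzero would make r = a/b a solution of r²
    -- + r = ε.
    norm-zero : ∀ {a b} → norm a b ≡ 0# → a ≡ 0# × b ≡ 0#
    norm-zero {a} {b} e with b ≟ 0#
    ... | yes refl = [ id , id ] (*-zero (trans (solve 2 (λ a e → a :* a := a :* a :+ a :* con false :+ e :* (con false :* con false)) refl a ε) e)) , refl
    ... | no b≢0 = ⊥-elim (ε-missed (a * inv b) (+⇒≡ (begin
      t * t + t + ε                                  ≡⟨ solve 3 (λ a c e → (a :* c) :* (a :* c) :+ a :* c :+ e
                                                          := (a :* a :* (c :* c) :+ a :* c :* con true :+ e :* (con true :* con true))) refl a c ε ⟩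
      a * a * (c * c) + a * c * 1# + ε * (1# * 1#)   ≡⟨ cong (λ o → a * a * (c * c) + a * c * o + ε * (o * o)) (sym (inverse b b≢0)) ⟩
      a * a * (c * c) + a * c * (b * c) + ε * (b * c * (b * c)) ≡⟨ solve 4 (λ a b c e → a :* a :* (c :* c) :+ a :* c :* (b :* c) :+ e :* (b :* c :* (b :* c))
                                                          := (a :* a :+ a :* b :+ e :* (b :* b)) :* (c :* c)) refl a b c ε ⟩
      norm a b * (c * c)                             ≡⟨ cong (_* (c * c)) e ⟩
      0# * (c * c)                                   ≡⟨ zeroˡ _ ⟩
      0# ∎)))
      where
      open ≡-Reasoning
      c t : K
      c = inv b
      t = a * c

    Free : V → V → V → V → Set
    Free p q u u′ = ∀ r r′ → r · u ⊕ r′ · u′ ∈⟨ p , q ⟩ → r ≡ 0# × r′ ≡ 0#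

    Independent : V → V → Set
    Independent u v = ∀ {a b} → a · u ⊕ b · v ≡ 0v → a ≡ 0# × b ≡ 0#

    independent⁺ : ∀ {p q} → p ≢ 0v → (∀ r → q ≢ r · p) → Independent p q
    independent⁺ {p} {q} p≢0 q≢ {a} {b} e with b ≟ 0#
    ... | yes refl = [ id , (λ z → ⊥-elim (p≢0 z)) ] (·-zero (trans (linear (var x₀ ⊡ at x₀) (var x₀ ⊡ at x₀ ⊞ con false ⊡ at x₁) (a ∷ []) (p ∷ q ∷ [])) e)) , refl
    ... | no b≢0 = ⊥-elim (q≢ (inv b * a) (begin
      q                                         ≡⟨ sym (1-· q) ⟩
      1# · q                                    ≡⟨ cong (_· q) (sym (trans (*-comm (inv b) b) (inverse b b≢0))) ⟩
      (inv b * b) · q                           ≡⟨ linear ((var x₁ :* var x₂) ⊡ at x₁) ((var x₁ :* var x₀) ⊡ at x₀ ⊞ var x₁ ⊡ (var x₀ ⊡ at x₀ ⊞ var x₂ ⊡ at x₁)) (a ∷ inv b ∷ b ∷ []) (p ∷ q ∷ []) ⟩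
      (inv b * a) · p ⊕ inv b · (a · p ⊕ b · q) ≡⟨ absorb (inv b) e ⟩
      (inv b * a) · p                           ∎))
      where open ≡-Reasoning

    record Special (p q : V) : Set where
      field
        square : q ∙ q ≡ p ∙ q ⊕ ε · (p ∙ p)
        p≢0    : p ≢ 0v
        q≢     : ∀ r → q ≢ r · p

      private
        square′ : q ∙ q ⊕ (p ∙ q ⊕ ε · (p ∙ p)) ≡ 0v
        square′ = ≡⇒⊕ square

      independent : Independent p q
      independent = independent⁺ p≢0 q≢

      -- p and q multiply like 1 and y in F[y]/(y² + y + ε), so ⟨p,q⟩ may be rebased at any nonzero a + by.
      rebase : ∀ {a b} → a · p ⊕ b · q ≢ 0v → Special (a · p ⊕ b · q) ((ε * b) · p ⊕ (a + b) · q)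
      rebase {a} {b} nz = record
        { square = begin
            q′ ∙ q′ ≡⟨ bilinear (Q′ ⊠ Q′)
                 ((P′ ⊠ Q′ ⊞ var x₂ ⊡ (P′ ⊠ P′)) ⊞ c ⊡ (at x₁ ⊠ at x₁ ⊞ (at x₀ ⊠ at x₁ ⊞ var x₂ ⊡ (at x₀ ⊠ at x₀)))) (a ∷ b ∷ ε ∷ []) (p ∷ q ∷ []) ⟩
            (p′ ∙ q′ ⊕ ε · (p′ ∙ p′)) ⊕ _ ≡⟨ absorb _ square′ ⟩
            p′ ∙ q′ ⊕ ε · (p′ ∙ p′) ∎
        ; p≢0 = nz
        ; q≢ = λ r e → step r (independent (trans (linear
               ((var x₃ :* var x₁ :+ var x₂ :* var x₀) ⊡ at x₀ ⊞ (var x₀ :+ var x₁ :+ var x₂ :* var x₁) ⊡ at x₁)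
               (((var x₃ :* var x₁) ⊡ at x₀ ⊞ (var x₀ :+ var x₁) ⊡ at x₁) ⊞ var x₂ ⊡ (var x₀ ⊡ at x₀ ⊞ var x₁ ⊡ at x₁))
               (a ∷ b ∷ r ∷ ε ∷ []) (p ∷ q ∷ [])) (≡⇒⊕ e)))
        }
        where
        open ≡-Reasoning
        p′ q′ : V
        p′ = a · p ⊕ b · q
        q′ = (ε * b) · p ⊕ (a + b) · q
        P′ Q′ : Expr 3 2
        P′ = var x₀ ⊡ at x₀ ⊞ var x₁ ⊡ at x₁
        Q′ = (var x₂ :* var x₁) ⊡ at x₀ ⊞ (var x₀ :+ var x₁) ⊡ at x₁
        c : Polynomial 3
        c = var x₀ :* var x₀ :+ var x₀ :* var x₁ :+ var x₂ :* (var x₁ :* var x₁)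
        step : ∀ r → ε * b + r * a ≡ 0# × a + b + r * b ≡ 0# → ⊥
        step r (e₁ , e₂) with norm-zero {a} {b} (begin
          a * a + a * b + ε * (b * b) ≡⟨ solve 4 (λ a b r e → a :* a :+ a :* b :+ e :* (b :* b) := (e :* b :+ r :* a) :* b :+ (a :+ b :+ r :* b) :* a) refl a b r ε ⟩
          (ε * b + r * a) * b + (a + b + r * b) * a ≡⟨ cong₂ (λ s t → s * b + t * a) e₁ e₂ ⟩
          0# * b + 0# * a ≡⟨ cong₂ _+_ (zeroˡ b) (zeroˡ a) ⟩
          0# + 0# ≡⟨ +-self 0# ⟩
          0# ∎)
        ... | refl , refl = nz (trans (cong₂ _⊕_ (0-· p) (0-· q)) (⊕-self 0v))

      rebase-∈ : ∀ {a b v} → a · p ⊕ b · q ≢ 0v → v ∈⟨ p , q ⟩ → v ∈⟨ a · p ⊕ b · q , (ε * b) · p ⊕ (a + b) · q ⟩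
      rebase-∈ {a} {b} nz (c , d , refl) = i * (c * (a + b) + ε * d * b) , i * (c * b + d * a) , (begin
        c · p ⊕ d · q ≡⟨ sym (1-· _) ⟩
        1# · (c · p ⊕ d · q) ≡⟨ cong (_· (c · p ⊕ d · q)) (sym (trans (*-comm i _) (inverse (norm a b) (λ z → nz (trans (cong₂ (λ s t → s · p ⊕ t · q) (proj₁ (norm-zero z)) (proj₂ (norm-zero z))) (trans (cong₂ _⊕_ (0-· p) (0-· q)) (⊕-self 0v))))))) ⟩
        (i * norm a b) · (c · p ⊕ d · q) ≡⟨ linear
          ((I :* (A′ :* A′ :+ A′ :* B′ :+ E :* (B′ :* B′))) ⊡ (C ⊡ at x₀ ⊞ D ⊡ at x₁))
          ((I :* (C :* (A′ :+ B′) :+ E :* D :* B′)) ⊡ (A′ ⊡ at x₀ ⊞ B′ ⊡ at x₁) ⊞ (I :* (C :* B′ :+ D :* A′)) ⊡ ((E :* B′) ⊡ at x₀ ⊞ (A′ :+ B′) ⊡ at x₁))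
          (a ∷ b ∷ c ∷ d ∷ i ∷ ε ∷ []) (p ∷ q ∷ []) ⟩
        _ ∎)
        where
        open ≡-Reasoning
        i : K
        i = inv (norm a b)
        A′ B′ C D I E : Polynomial 6
        A′ = var x₀
        B′ = var x₁
        C = var x₂
        D = var x₃
        I = var x₄
        E = var x₅

      rebase-∈⁻ : ∀ {a b v} → v ∈⟨ a · p ⊕ b · q , (ε * b) · p ⊕ (a + b) · q ⟩ → v ∈⟨ p , q ⟩
      rebase-∈⁻ {a} {b} (c , d , refl) = ∈-⊕ (∈-· c (a , b , refl)) (∈-· d (ε * b , a + b , refl))

      rebase-∈² : ∀ {a b w} → a · p ⊕ b · q ≢ 0v → w ∈²⟨ p , q ⟩ → w ∈²⟨ a · p ⊕ b · q , (ε * b) · p ⊕ (a + b) · q ⟩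
      rebase-∈² nz (n , n∈ , e) = n , rebase-∈ nz n∈ , e

      pp∈² : p ∙ p ∈²⟨ p , q ⟩
      pp∈² = p , (1# , 0# , linear (at x₀) (con true ⊡ at x₀ ⊞ con false ⊡ at x₁) [] (p ∷ q ∷ [])) , refl

      qq∈² : q ∙ q ∈²⟨ p , q ⟩
      qq∈² = q , (0# , 1# , linear (at x₁) (con false ⊡ at x₀ ⊞ con true ⊡ at x₁) [] (p ∷ q ∷ [])) , refl

      pq∈² : p ∙ q ∈²⟨ p , q ⟩
      pq∈² = subst (_∈²⟨ p , q ⟩) (sym (begin
        p ∙ q ≡⟨ bilinear (at x₀ ⊠ at x₁) ((at x₁ ⊠ at x₁ ⊞ var x₀ ⊡ (at x₀ ⊠ at x₀)) ⊞ con true ⊡ (at x₁ ⊠ at x₁ ⊞ (at x₀ ⊠ at x₁ ⊞ var x₀ ⊡ (at x₀ ⊠ at x₀)))) (ε ∷ []) (p ∷ q ∷ []) ⟩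
        (q ∙ q ⊕ ε · (p ∙ p)) ⊕ 1# · _ ≡⟨ absorb 1# square′ ⟩
        q ∙ q ⊕ ε · (p ∙ p) ∎)) (∈²-⊕ qq∈² (∈²-· ε pp∈²))
        where open ≡-Reasoning

      square-∈ : ∀ {n} → n ∈⟨ p , q ⟩ → ∃₂ λ c d → n ∙ n ≡ (c * c + ε * (d * d)) · (p ∙ p) ⊕ (d * d) · (p ∙ q) × n ≡ c · p ⊕ d · q
      square-∈ (c , d , refl) = c , d , trans (bilinear ((C ⊡ at x₀ ⊞ D ⊡ at x₁) ⊠ (C ⊡ at x₀ ⊞ D ⊡ at x₁))
         (((C :* C :+ var x₂ :* (D :* D)) ⊡ (at x₀ ⊠ at x₀) ⊞ (D :* D) ⊡ (at x₀ ⊠ at x₁)) ⊞ (D :* D) ⊡ (at x₁ ⊠ at x₁ ⊞ (at x₀ ⊠ at x₁ ⊞ var x₂ ⊡ (at x₀ ⊠ at x₀))))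
         (c ∷ d ∷ ε ∷ []) (p ∷ q ∷ [])) (absorb (d * d) square′) , refl
        where
        C D : Polynomial 3
        C = var x₀
        D = var x₁

      -- On a special line every square n ∙ n has the form p ∙ m with m on the line, and p can be
      -- cancelled.
      regular : ∀ {u} → p ∙ u ∈²⟨ p , q ⟩ → u ∈⟨ p , q ⟩
      regular {u} (n , n∈ , e) with square-∈ n∈
      ... | c , d , e′ , _ with zero-product {p} {u ⊕ m} (trans (bilinear (at x₀ ⊠ (at x₂ ⊞ (C ⊡ at x₀ ⊞ D ⊡ at x₁))) (at x₀ ⊠ at x₂ ⊞ (C ⊡ (at x₀ ⊠ at x₀) ⊞ D ⊡ (at x₀ ⊠ at x₁)))
              ((c * c + ε * (d * d)) ∷ d * d ∷ []) (p ∷ q ∷ u ∷ [])) (≡⇒⊕ (trans e e′)))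
        where
        m : V
        m = (c * c + ε * (d * d)) · p ⊕ (d * d) · q
        C D : Polynomial 2
        C = var x₀
        D = var x₁
      ...   | inj₁ z = ⊥-elim (p≢0 z)
      ...   | inj₂ z = _ , _ , ⊕⇒≡ z

      -- Squaring is additive with trivial kernel.
      square-injective : ∀ {u} → u ∙ u ∈²⟨ p , q ⟩ → u ∈⟨ p , q ⟩
      square-injective {u} (n , n∈ , e) = subst (_∈⟨ p , q ⟩) (sym (⊕⇒≡ ([ id , id ] (zero-product (trans (square-⊕ u n) (≡⇒⊕ e)))))) n∈

      root-solves : ∀ r s {c d} → s * s + s ≡ d * d → r * r + r + ε * (s * s) ≡ c * c + ε * (d * d) →
              (r · p ⊕ s · q) ∙ (r · p ⊕ s · q) ⊕ p ∙ (r · p ⊕ s · q) ≡ (c · p ⊕ d · q) ∙ (c · p ⊕ d · q)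
      root-solves r s {c} {d} es er = ⊕⇒≡ (begin
        ((r · p ⊕ s · q) ∙ (r · p ⊕ s · q) ⊕ p ∙ (r · p ⊕ s · q)) ⊕ (c · p ⊕ d · q) ∙ (c · p ⊕ d · q)
          ≡⟨ bilinear ((RS ⊠ RS ⊞ at x₀ ⊠ RS) ⊞ CD ⊠ CD)
               ((((R :* R :+ R :+ E :* (S :* S)) :+ (C :* C :+ E :* (D :* D))) ⊡ (at x₀ ⊠ at x₀)
                 ⊞ (S :* S :+ S :+ D :* D) ⊡ (at x₀ ⊠ at x₁))
                 ⊞ (S :* S :+ D :* D) ⊡ (at x₁ ⊠ at x₁ ⊞ (at x₀ ⊠ at x₁ ⊞ E ⊡ (at x₀ ⊠ at x₀))))
               (r ∷ s ∷ c ∷ d ∷ ε ∷ []) (p ∷ q ∷ []) ⟩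
        ((r * r + r + ε * (s * s) + (c * c + ε * (d * d))) · (p ∙ p) ⊕ (s * s + s + d * d) · (p ∙ q)) ⊕ (s * s + d * d) · _
          ≡⟨ absorb _ square′ ⟩
        (r * r + r + ε * (s * s) + (c * c + ε * (d * d))) · (p ∙ p) ⊕ (s * s + s + d * d) · (p ∙ q)
          ≡⟨ cong₂ (λ x y → x · (p ∙ p) ⊕ y · (p ∙ q)) (≡⇒+ er) (≡⇒+ es) ⟩
        0# · (p ∙ p) ⊕ 0# · (p ∙ q) ≡⟨ cong₂ _⊕_ (0-· _) (0-· _) ⟩
        0v ⊕ 0v ≡⟨ ⊕-self 0v ⟩
        0v ∎)
        where
        open ≡-Reasoning
        R S C D E : Polynomial 5
        R = var x₀
        S = var x₁
        C = var x₂
        D = var x₃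
        E = var x₄
        RS CD : Expr 5 2
        RS = R ⊡ at x₀ ⊞ S ⊡ at x₁
        CD = C ⊡ at x₀ ⊞ D ⊡ at x₁

      -- v ↦ v² + pv maps ⟨p,q⟩ onto a subgroup of index 2 of its squares.
      root : ∀ {c d s} → s * s + s ≡ d * d →
             ∃ λ t → t ∈⟨ p , q ⟩ × t ∙ t ⊕ p ∙ t ≡ (c · p ⊕ d · q) ∙ (c · p ⊕ d · q)
      root {c} {d} {s} es with halve (c * c + ε * (d * d) + ε * (s * s))
      ... | r , inj₁ er = r · p ⊕ s · q , (r , s , refl) , root-solves r s es
              (trans (cong (_+ ε * (s * s)) er) (solve 2 (λ a b → a :+ b :+ b := a) refl _ _))
      -- Replacing s by s + 1 keeps s² + s but changes ε s² by ε, which absorbs the ε left over by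
      -- `halve`.
      ... | r , inj₂ er = r · p ⊕ (s + 1#) · q , (r , s + 1# , refl) , root-solves r (s + 1#)
              (trans (solve 1 (λ s → (s :+ con true) :* (s :+ con true) :+ (s :+ con true) := s :* s :+ s) refl s) es)
              (trans (cong (_+ ε * ((s + 1#) * (s + 1#))) er)
                     (solve 3 (λ x e s → x :+ e :* (s :* s) :+ e :+ e :* ((s :+ con true) :* (s :+ con true)) := x) refl _ ε s))

      -- If t is the solution on the line given by `root`, then (l + t) ∙ (l + t + p) = 0, so l is t
      -- or t + p.
      root-∈ : ∀ l {c d s} → p ∙ l ⊕ l ∙ l ≡ (c · p ⊕ d · q) ∙ (c · p ⊕ d · q) → s * s + s ≡ d * d → l ∈⟨ p , q ⟩
      root-∈ l {c} {d} e es with root {c} {d} es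
      ... | t , t∈ , et with zero-product {l ⊕ t} {l ⊕ t ⊕ p} (begin
          (l ⊕ t) ∙ (l ⊕ t ⊕ p) ≡⟨ bilinear ((at x₀ ⊞ at x₁) ⊠ (at x₀ ⊞ at x₁ ⊞ at x₂)) ((at x₂ ⊠ at x₀ ⊞ at x₀ ⊠ at x₀) ⊞ (at x₁ ⊠ at x₁ ⊞ at x₂ ⊠ at x₁)) [] (l ∷ t ∷ p ∷ []) ⟩
          (p ∙ l ⊕ l ∙ l) ⊕ (t ∙ t ⊕ p ∙ t) ≡⟨ ≡⇒⊕ (trans e (sym et)) ⟩
          0v ∎)
        where open ≡-Reasoning
      ... | inj₁ z = subst (_∈⟨ p , q ⟩) (sym (⊕⇒≡ z)) t∈
      ... | inj₂ z = subst (_∈⟨ p , q ⟩) (sym (⊕⇒≡ (trans (sym (⊕-assoc l t p)) z)))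
                       (∈-⊕ t∈ (1# , 0# , linear (at x₀) (con true ⊡ at x₀ ⊞ con false ⊡ at x₁) [] (p ∷ q ∷ [])))

      -- Among l, l′ and l + l′ one translate by ⟨p,q⟩ is a root of v² + pv, which has only the roots 0 and p.
      dependent : ∀ {l l′} → p ∙ l ⊕ l ∙ l ∈²⟨ p , q ⟩ → p ∙ l′ ⊕ l′ ∙ l′ ∈²⟨ p , q ⟩ →
                  l ∈⟨ p , q ⟩ ⊎ l′ ∈⟨ p , q ⟩ ⊎ l ⊕ l′ ∈⟨ p , q ⟩
      dependent {l} {l′} (n , (c , d , refl) , e) (n′ , (c′ , d′ , refl) , e′) with halve (d * d) | halve (d′ * d′)
      ... | s , inj₁ es | _ = inj₁ (root-∈ l e es)
      ... | s , inj₂ es | s′ , inj₁ es′ = inj₂ (inj₁ (root-∈ l′ e′ es′))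
      ... | s , inj₂ es | s′ , inj₂ es′ = inj₂ (inj₂ (root-∈ (l ⊕ l′) {c + c′} {d + d′} {s + s′}
        (begin
          p ∙ (l ⊕ l′) ⊕ (l ⊕ l′) ∙ (l ⊕ l′) ≡⟨ bilinear (at x₀ ⊠ (at x₁ ⊞ at x₂) ⊞ (at x₁ ⊞ at x₂) ⊠ (at x₁ ⊞ at x₂)) ((at x₀ ⊠ at x₁ ⊞ at x₁ ⊠ at x₁) ⊞ (at x₀ ⊠ at x₂ ⊞ at x₂ ⊠ at x₂)) [] (p ∷ l ∷ l′ ∷ []) ⟩
          (p ∙ l ⊕ l ∙ l) ⊕ (p ∙ l′ ⊕ l′ ∙ l′) ≡⟨ cong₂ _⊕_ e e′ ⟩
          _ ≡⟨ bilinear ((var x₀ ⊡ at x₀ ⊞ var x₁ ⊡ at x₁) ⊠ (var x₀ ⊡ at x₀ ⊞ var x₁ ⊡ at x₁) ⊞ (var x₂ ⊡ at x₀ ⊞ var x₃ ⊡ at x₁) ⊠ (var x₂ ⊡ at x₀ ⊞ var x₃ ⊡ at x₁))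
                 (((var x₀ :+ var x₂) ⊡ at x₀ ⊞ (var x₁ :+ var x₃) ⊡ at x₁) ⊠ ((var x₀ :+ var x₂) ⊡ at x₀ ⊞ (var x₁ :+ var x₃) ⊡ at x₁)) (c ∷ d ∷ c′ ∷ d′ ∷ []) (p ∷ q ∷ []) ⟩
          _ ∎)
        (begin
          (s + s′) * (s + s′) + (s + s′) ≡⟨ solve 2 (λ s t → (s :+ t) :* (s :+ t) :+ (s :+ t) := (s :* s :+ s) :+ (t :* t :+ t)) refl s s′ ⟩
          (s * s + s) + (s′ * s′ + s′) ≡⟨ cong₂ _+_ es es′ ⟩
          (d * d + ε) + (d′ * d′ + ε) ≡⟨ solve 3 (λ d t e → (d :* d :+ e) :+ (t :* t :+ e) := (d :+ t) :* (d :+ t)) refl d d′ ε ⟩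
          (d + d′) * (d + d′) ∎)))
        where open ≡-Reasoning

      free-∉ : ∀ {u u′} → Free p q u u′ → ¬ (u ∈⟨ p , q ⟩) × ¬ (u′ ∈⟨ p , q ⟩)
      free-∉ {u} {u′} fr =
        (λ u∈ → 1≢0 (proj₁ (fr 1# 0# (subst (_∈⟨ p , q ⟩) (linear (at x₀) (con true ⊡ at x₀ ⊞ con false ⊡ at x₁) [] (u ∷ u′ ∷ [])) u∈)))) ,
        (λ u∈ → 1≢0 (proj₂ (fr 0# 1# (subst (_∈⟨ p , q ⟩) (linear (at x₁) (con false ⊡ at x₀ ⊞ con true ⊡ at x₁) [] (u ∷ u′ ∷ [])) u∈))))

      scaled : ∀ u c → p ∙ u ⊕ c · (u ∙ u) ∈²⟨ p , q ⟩ → p ∙ (c · u) ⊕ (c · u) ∙ (c · u) ∈²⟨ p , q ⟩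
      scaled u c h = subst (_∈²⟨ p , q ⟩) (bilinear (var x₀ ⊡ (at x₀ ⊠ at x₁ ⊞ var x₀ ⊡ (at x₁ ⊠ at x₁))) (at x₀ ⊠ (var x₀ ⊡ at x₁) ⊞ (var x₀ ⊡ at x₁) ⊠ (var x₀ ⊡ at x₁)) (c ∷ []) (p ∷ u ∷ [])) (∈²-· c h)
      nonzero : ∀ {u c} → ¬ (u ∈⟨ p , q ⟩) → p ∙ u ⊕ c · (u ∙ u) ∈²⟨ p , q ⟩ → c ≢ 0#
      nonzero u∉ h refl = u∉ (regular (subst (_∈²⟨ p , q ⟩) (trans (cong (_ ⊕_) (0-· _)) (⊕-identityʳ _)) h))

      -- The factor c is nonzero by `regular`, and passing from u to c u turns the hypothesis into
      -- the Artin-Schreier form required by `dependent`. Whichever of its three outcomes occurs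
      -- contradicts freeness of u, u′ modulo the line.
      no-collision₀ : ∀ {u u′ c c′} → Free p q u u′ → p ∙ u ⊕ c · (u ∙ u) ∈²⟨ p , q ⟩ → p ∙ u′ ⊕ c′ · (u′ ∙ u′) ∈²⟨ p , q ⟩ → ⊥
      no-collision₀ {u} {u′} {c} {c′} fr h h′ with dependent (scaled u c h) (scaled u′ c′ h′)
      ... | inj₁ z = nonzero (free-∉ fr .proj₁) h (proj₁ (fr c 0# (subst (_∈⟨ p , q ⟩) (linear (var x₀ ⊡ at x₀) (var x₀ ⊡ at x₀ ⊞ con false ⊡ at x₁) (c ∷ []) (u ∷ u′ ∷ [])) z)))
      ... | inj₂ (inj₁ z) = nonzero (free-∉ fr .proj₂) h′ (proj₂ (fr 0# c′ (subst (_∈⟨ p , q ⟩) (linear (var x₀ ⊡ at x₁) (con false ⊡ at x₀ ⊞ var x₀ ⊡ at x₁) (c′ ∷ []) (u ∷ u′ ∷ [])) z)))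
      ... | inj₂ (inj₂ z) = nonzero (free-∉ fr .proj₁) h (proj₁ (fr c c′ z))

    -- A point of ⟨p,q⟩ fixes at most one direction modulo ⟨p,q⟩.
    no-collision : ∀ {p q} → Special p q → ∀ {x u u′ c c′} → x ∈⟨ p , q ⟩ → x ≢ 0v → Free p q u u′ →
      x ∙ u ⊕ c · (u ∙ u) ∈²⟨ p , q ⟩ → x ∙ u′ ⊕ c′ · (u′ ∙ u′) ∈²⟨ p , q ⟩ → ⊥
    no-collision {p} {q} M {u = u} {u′} (a , b , refl) x≢0 fr h h′ =
      Special.no-collision₀ (M.rebase x≢0) (λ r r′ z → fr r r′ (M.rebase-∈⁻ z)) (M.rebase-∈² x≢0 h) (M.rebase-∈² x≢0 h′)
      where module M = Special M

    regular-∈ : ∀ {p q x u} → Special p q → x ∈⟨ p , q ⟩ → x ≢ 0v → x ∙ u ∈²⟨ p , q ⟩ → u ∈⟨ p , q ⟩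
    regular-∈ M (a , b , refl) x≢0 h = M.rebase-∈⁻ (Special.regular (M.rebase x≢0) (M.rebase-∈² x≢0 h))
      where module M = Special M

    dependent-∈ : ∀ {p q x l l′} → Special p q → x ∈⟨ p , q ⟩ → x ≢ 0v →
      x ∙ l ⊕ l ∙ l ∈²⟨ p , q ⟩ → x ∙ l′ ⊕ l′ ∙ l′ ∈²⟨ p , q ⟩ → l ∈⟨ p , q ⟩ ⊎ l′ ∈⟨ p , q ⟩ ⊎ l ⊕ l′ ∈⟨ p , q ⟩
    dependent-∈ M (a , b , refl) x≢0 h h′ = Data.Sum.map M.rebase-∈⁻ (Data.Sum.map M.rebase-∈⁻ M.rebase-∈⁻)
      (Special.dependent (M.rebase x≢0) (M.rebase-∈² x≢0 h) (M.rebase-∈² x≢0 h′))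
      where module M = Special M

    rebase-at : ∀ {p q w} → Special p q → w ∈⟨ p , q ⟩ → w ≢ 0v →
      ∃ λ q′ → Special w q′ × (∀ {u} → u ∈⟨ p , q ⟩ → u ∈⟨ w , q′ ⟩) × (∀ {u} → u ∈⟨ w , q′ ⟩ → u ∈⟨ p , q ⟩)
    rebase-at S (a , b , refl) w≢0 = _ , Special.rebase S w≢0 , Special.rebase-∈ S w≢0 , Special.rebase-∈⁻ S

  -- Directions modulo a special line, and bases of V

  module Crossings {𝔽 : Field₂} (A : Presemifield₂ 𝔽) where
    open Lines A public

    inv-cancel : ∀ {x} → x ≢ 0# → ∀ y → inv x * (x * y) ≡ y
    inv-cancel {x} n y = trans (sym (*-assoc _ x y)) (trans (cong (_* y) (trans (*-comm _ x) (inverse x n))) (*-identityˡ y))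

    parallel : ∀ {s₁ s₂ h₁ h₂} → s₁ ≢ 0# ⊎ s₂ ≢ 0# → s₁ * h₂ + s₂ * h₁ ≡ 0# → ∃ λ c → c * s₁ ≡ h₁ × c * s₂ ≡ h₂
    parallel {s₁} {s₂} {h₁} {h₂} (inj₁ n) e = inv s₁ * h₁ ,
      trans (solve 3 (λ i h s → i :* h :* s := i :* (s :* h)) refl (inv s₁) h₁ s₁) (inv-cancel n h₁) ,
      trans (solve 3 (λ i h s → i :* h :* s := i :* (s :* h)) refl (inv s₁) h₁ s₂) (trans (cong (inv s₁ *_) (sym (+⇒≡ e))) (inv-cancel n h₂))
    parallel {s₁} {s₂} {h₁} {h₂} (inj₂ n) e = inv s₂ * h₂ ,
      trans (solve 3 (λ i h s → i :* h :* s := i :* (s :* h)) refl (inv s₂) h₂ s₁) (trans (cong (inv s₂ *_) (+⇒≡ e)) (inv-cancel n h₁)) ,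
      trans (solve 3 (λ i h s → i :* h :* s := i :* (s :* h)) refl (inv s₂) h₂ s₂) (inv-cancel n h₂)

    common-kernel : ∀ n₁ n₂ m₁ m₂ → n₁ * m₂ ≡ n₂ * m₁ →
      ∃₂ λ a b → ¬ (a ≡ 0# × b ≡ 0#) × a * n₁ + b * n₂ ≡ 0# × a * m₁ + b * m₂ ≡ 0#
    common-kernel n₁ n₂ m₁ m₂ e with n₁ ≟ 0# | n₂ ≟ 0# | m₁ ≟ 0# | m₂ ≟ 0#
    ... | no p | _ | _ | _ = n₂ , n₁ , (λ (_ , z) → p z) , trans (cong (_+ n₁ * n₂) (*-comm n₂ n₁)) (+-self _) , ≡⇒+ (sym e)
    ... | _ | no p | _ | _ = n₂ , n₁ , (λ (z , _) → p z) , trans (cong (_+ n₁ * n₂) (*-comm n₂ n₁)) (+-self _) , ≡⇒+ (sym e)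
    ... | _ | _ | no p | _ = m₂ , m₁ , (λ (_ , z) → p z) , ≡⇒+ (trans (*-comm m₂ n₁) (trans e (*-comm n₂ m₁))) , trans (cong (_+ m₁ * m₂) (*-comm m₂ m₁)) (+-self _)
    ... | _ | _ | _ | no p = m₂ , m₁ , (λ (z , _) → p z) , ≡⇒+ (trans (*-comm m₂ n₁) (trans e (*-comm n₂ m₁))) , trans (cong (_+ m₁ * m₂) (*-comm m₂ m₁)) (+-self _)
    ... | yes refl | yes refl | yes refl | yes refl = 1# , 0# , (λ (z , _) → 1≢0 z) , vanish , vanish
      where
      vanish : 1# * 0# + 0# * 0# ≡ 0#
      vanish = trans (cong₂ _+_ (zeroʳ _) (zeroʳ _)) (+-self 0#)

    -- The products of u with p₁, p₂ and u, in coordinates k₁, k₂ modulo the squares of ⟨p,q⟩.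
    record Images (p q p₁ p₂ k₁ k₂ u : V) : Set where
      field
        {s₁ s₂ f₁ f₂ g₁ g₂} : K
        s : u ∙ u  ⊕ (s₁ · k₁ ⊕ s₂ · k₂) ∈²⟨ p , q ⟩
        f : p₁ ∙ u ⊕ (f₁ · k₁ ⊕ f₂ · k₂) ∈²⟨ p , q ⟩
        g : p₂ ∙ u ⊕ (g₁ · k₁ ⊕ g₂ · k₂) ∈²⟨ p , q ⟩
      N₁ N₂ : K
      N₁ = s₁ * f₂ + s₂ * f₁
      N₂ = s₁ * g₂ + s₂ * g₁

      -- `N₁` and `N₂` are the determinants of p₁ ∙ u and p₂ ∙ u against u ∙ u modulo the squares. A
      -- vanishing combination makes (a p₁ + b p₂) ∙ u parallel to u ∙ u, which is itself nonzero
      -- there by `square-injective`.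
      fixes : Special p q → ¬ (u ∈⟨ p , q ⟩) → ∀ {a b} → a * N₁ + b * N₂ ≡ 0# →
              ∃ λ c → (a · p₁ ⊕ b · p₂) ∙ u ⊕ c · (u ∙ u) ∈²⟨ p , q ⟩
      fixes M u∉ {a} {b} e = combined (parallel s≢0 (trans
          (solve 8 (λ a b s₁ s₂ f₁ f₂ g₁ g₂ → s₁ :* (a :* f₂ :+ b :* g₂) :+ s₂ :* (a :* f₁ :+ b :* g₁)
                     := a :* (s₁ :* f₂ :+ s₂ :* f₁) :+ b :* (s₁ :* g₂ :+ s₂ :* g₁)) refl a b s₁ s₂ f₁ f₂ g₁ g₂) e))
        where
        s≢0 : s₁ ≢ 0# ⊎ s₂ ≢ 0#
        s≢0 with s₁ ≟ 0# | s₂ ≟ 0#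
        ... | no n   | _      = inj₁ n
        ... | yes _  | no n   = inj₂ n
        ... | yes z₁ | yes z₂ = ⊥-elim (u∉ (Special.square-injective M (subst (_∈²⟨ p , q ⟩)
                (trans (cong (u ∙ u ⊕_) (trans (cong₂ _⊕_ (trans (cong (_· k₁) z₁) (0-· _)) (trans (cong (_· k₂) z₂) (0-· _))) (⊕-self 0v))) (⊕-identityʳ _)) s)))
        combined : (∃ λ c → c * s₁ ≡ a * f₁ + b * g₁ × c * s₂ ≡ a * f₂ + b * g₂) →
                   ∃ λ c → (a · p₁ ⊕ b · p₂) ∙ u ⊕ c · (u ∙ u) ∈²⟨ p , q ⟩
        combined (c , e₁ , e₂) = c , subst (_∈²⟨ p , q ⟩) (begin
          a · (p₁ ∙ u ⊕ (f₁ · k₁ ⊕ f₂ · k₂)) ⊕ b · (p₂ ∙ u ⊕ (g₁ · k₁ ⊕ g₂ · k₂)) ⊕ c · (u ∙ u ⊕ (s₁ · k₁ ⊕ s₂ · k₂))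
            ≡⟨ linear {7} ((var x₀ ⊡ (at x₀ ⊞ (var x₃ ⊡ at x₃ ⊞ var x₄ ⊡ at x₄)) ⊞ var x₁ ⊡ (at x₁ ⊞ (var x₅ ⊡ at x₃ ⊞ var x₆ ⊡ at x₄))) ⊞ var x₂ ⊡ at x₂)
                      (((var x₀ ⊡ at x₀ ⊞ var x₁ ⊡ at x₁) ⊞ ((var x₀ :* var x₃ :+ var x₁ :* var x₅) ⊡ at x₃ ⊞ (var x₀ :* var x₄ :+ var x₁ :* var x₆) ⊡ at x₄)) ⊞ var x₂ ⊡ at x₂)
                      (a ∷ b ∷ c ∷ f₁ ∷ f₂ ∷ g₁ ∷ g₂ ∷ []) (p₁ ∙ u ∷ p₂ ∙ u ∷ _ ∷ k₁ ∷ k₂ ∷ []) ⟩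
          ((a · (p₁ ∙ u) ⊕ b · (p₂ ∙ u)) ⊕ ((a * f₁ + b * g₁) · k₁ ⊕ (a * f₂ + b * g₂) · k₂)) ⊕ c · (u ∙ u ⊕ (s₁ · k₁ ⊕ s₂ · k₂))
            ≡⟨ cong₂ (λ x y → ((a · (p₁ ∙ u) ⊕ b · (p₂ ∙ u)) ⊕ (x · k₁ ⊕ y · k₂)) ⊕ c · (u ∙ u ⊕ (s₁ · k₁ ⊕ s₂ · k₂))) (sym e₁) (sym e₂) ⟩
          ((a · (p₁ ∙ u) ⊕ b · (p₂ ∙ u)) ⊕ ((c * s₁) · k₁ ⊕ (c * s₂) · k₂)) ⊕ c · (u ∙ u ⊕ (s₁ · k₁ ⊕ s₂ · k₂))
            ≡⟨ linear {5} (((var x₀ ⊡ at x₀ ⊞ var x₁ ⊡ at x₁) ⊞ ((var x₂ :* var x₃) ⊡ at x₃ ⊞ (var x₂ :* var x₄) ⊡ at x₄)) ⊞ var x₂ ⊡ (at x₂ ⊞ (var x₃ ⊡ at x₃ ⊞ var x₄ ⊡ at x₄)))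
                      ((var x₀ ⊡ at x₀ ⊞ var x₁ ⊡ at x₁) ⊞ var x₂ ⊡ at x₂)
                      (a ∷ b ∷ c ∷ s₁ ∷ s₂ ∷ []) (p₁ ∙ u ∷ p₂ ∙ u ∷ u ∙ u ∷ k₁ ∷ k₂ ∷ []) ⟩
          (a · (p₁ ∙ u) ⊕ b · (p₂ ∙ u)) ⊕ c · (u ∙ u)
            ≡⟨ cong (_⊕ c · (u ∙ u)) (sym (bilinear ((var x₀ ⊡ at x₀ ⊞ var x₁ ⊡ at x₁) ⊠ at x₂) (var x₀ ⊡ (at x₀ ⊠ at x₂) ⊞ var x₁ ⊡ (at x₁ ⊠ at x₂)) (a ∷ b ∷ []) (p₁ ∷ p₂ ∷ u ∷ []))) ⟩
          (a · p₁ ⊕ b · p₂) ∙ u ⊕ c · (u ∙ u) ∎)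
          (∈²-⊕ (∈²-⊕ (∈²-· a f) (∈²-· b g)) (∈²-· c s))
          where open ≡-Reasoning

    -- Proportional pairs of determinants have a common nonzero kernel vector (a , b), and then the
    -- single point a p₁ + b p₂ fixes both u and u′.
    no-crossing : ∀ {p q p₁ p₂ k₁ k₂ u u′} → Special p q → p₁ ∈⟨ p , q ⟩ → p₂ ∈⟨ p , q ⟩ → Independent p₁ p₂ → Free p q u u′ →
      (I : Images p q p₁ p₂ k₁ k₂ u) (I′ : Images p q p₁ p₂ k₁ k₂ u′) →
      Images.N₁ I * Images.N₂ I′ ≢ Images.N₂ I * Images.N₁ I′
    no-crossing M p₁∈ p₂∈ ind fr I I′ e with common-kernel (Images.N₁ I) (Images.N₂ I) (Images.N₁ I′) (Images.N₂ I′) e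
    ... | a , b , nz , e₁ , e₂ = no-collision M (∈-⊕ (∈-· a p₁∈) (∈-· b p₂∈)) (λ z → nz (ind z)) fr
            (proj₂ (Images.fixes I M (proj₁ (Special.free-∉ M fr)) e₁)) (proj₂ (Images.fixes I′ M (proj₂ (Special.free-∉ M fr)) e₂))

    Basis : V → V → V → V → Set
    Basis b₁ b₂ b₃ b₄ = ∀ {a b c d} → a · b₁ ⊕ b · b₂ ⊕ c · b₃ ⊕ d · b₄ ≡ 0v → (a ≡ 0# × b ≡ 0#) × (c ≡ 0# × d ≡ 0#)

    opaque
      unfolding _⊕_
      span : V → V → V → V → V → V
      span b₁ b₂ b₃ b₄ (a , b , c , d) = a · b₁ ⊕ b · b₂ ⊕ c · b₃ ⊕ d · b₄

      span-≡ : ∀ {b₁ b₂ b₃ b₄} a b c d → span b₁ b₂ b₃ b₄ (a , b , c , d) ≡ a · b₁ ⊕ b · b₂ ⊕ c · b₃ ⊕ d · b₄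
      span-≡ a b c d = refl

      span-⊕ : ∀ {b₁ b₂ b₃ b₄} u v → span b₁ b₂ b₃ b₄ (u ⊕ v) ≡ span b₁ b₂ b₃ b₄ u ⊕ span b₁ b₂ b₃ b₄ v
      span-⊕ {b₁} {b₂} {b₃} {b₄} (a , b , c , d) (a′ , b′ , c′ , d′) = linear
        ((var x₀ :+ var x₄) ⊡ at x₀ ⊞ (var x₁ :+ var x₅) ⊡ at x₁ ⊞ (var x₂ :+ var x₆) ⊡ at x₂ ⊞ (var x₃ :+ var x₇) ⊡ at x₃)
        ((var x₀ ⊡ at x₀ ⊞ var x₁ ⊡ at x₁ ⊞ var x₂ ⊡ at x₂ ⊞ var x₃ ⊡ at x₃) ⊞ (var x₄ ⊡ at x₀ ⊞ var x₅ ⊡ at x₁ ⊞ var x₆ ⊡ at x₂ ⊞ var x₇ ⊡ at x₃))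
        (a ∷ b ∷ c ∷ d ∷ a′ ∷ b′ ∷ c′ ∷ d′ ∷ []) (b₁ ∷ b₂ ∷ b₃ ∷ b₄ ∷ [])

      span-· : ∀ {b₁ b₂ b₃ b₄} r v → span b₁ b₂ b₃ b₄ (r · v) ≡ r · span b₁ b₂ b₃ b₄ v
      span-· {b₁} {b₂} {b₃} {b₄} r (a , b , c , d) = linear
        ((var x₄ :* var x₀) ⊡ at x₀ ⊞ (var x₄ :* var x₁) ⊡ at x₁ ⊞ (var x₄ :* var x₂) ⊡ at x₂ ⊞ (var x₄ :* var x₃) ⊡ at x₃)
        (var x₄ ⊡ (var x₀ ⊡ at x₀ ⊞ var x₁ ⊡ at x₁ ⊞ var x₂ ⊡ at x₂ ⊞ var x₃ ⊡ at x₃))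
        (a ∷ b ∷ c ∷ d ∷ r ∷ []) (b₁ ∷ b₂ ∷ b₃ ∷ b₄ ∷ [])

      span-zero : ∀ {b₁ b₂ b₃ b₄} → Basis b₁ b₂ b₃ b₄ → ∀ {u} → span b₁ b₂ b₃ b₄ u ≡ 0v → u ≡ 0v
      span-zero B {a , b , c , d} e with B {a} {b} {c} {d} e
      ... | (refl , refl) , refl , refl = refl

    opaque
      unfolding _⊕_ e₁ span
      span-e₁ : ∀ {b₁ b₂ b₃ b₄} → span b₁ b₂ b₃ b₄ e₁ ≡ b₁
      span-e₁ {b₁} {b₂} {b₃} {b₄} = linear (con true ⊡ at x₀ ⊞ con false ⊡ at x₁ ⊞ con false ⊡ at x₂ ⊞ con false ⊡ at x₃) (at x₀) [] (b₁ ∷ b₂ ∷ b₃ ∷ b₄ ∷ [])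
      span-e₂ : ∀ {b₁ b₂ b₃ b₄} → span b₁ b₂ b₃ b₄ e₂ ≡ b₂
      span-e₂ {b₁} {b₂} {b₃} {b₄} = linear (con false ⊡ at x₀ ⊞ con true ⊡ at x₁ ⊞ con false ⊡ at x₂ ⊞ con false ⊡ at x₃) (at x₁) [] (b₁ ∷ b₂ ∷ b₃ ∷ b₄ ∷ [])
      span-e₃ : ∀ {b₁ b₂ b₃ b₄} → span b₁ b₂ b₃ b₄ e₃ ≡ b₃
      span-e₃ {b₁} {b₂} {b₃} {b₄} = linear (con false ⊡ at x₀ ⊞ con false ⊡ at x₁ ⊞ con true ⊡ at x₂ ⊞ con false ⊡ at x₃) (at x₂) [] (b₁ ∷ b₂ ∷ b₃ ∷ b₄ ∷ [])
      span-e₄ : ∀ {b₁ b₂ b₃ b₄} → span b₁ b₂ b₃ b₄ e₄ ≡ b₄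
      span-e₄ {b₁} {b₂} {b₃} {b₄} = linear (con false ⊡ at x₀ ⊞ con false ⊡ at x₁ ⊞ con false ⊡ at x₂ ⊞ con true ⊡ at x₃) (at x₃) [] (b₁ ∷ b₂ ∷ b₃ ∷ b₄ ∷ [])

    module _ {b₁ b₂ b₃ b₄} (B : Basis b₁ b₂ b₃ b₄) where
      span-injective : ∀ {u v} → span b₁ b₂ b₃ b₄ u ≡ span b₁ b₂ b₃ b₄ v → u ≡ v
      span-injective e = ⊕⇒≡ (span-zero B (trans (span-⊕ _ _) (≡⇒⊕ e)))

      span-surjective : ∀ w → ∃ λ u → span b₁ b₂ b₃ b₄ u ≡ w
      span-surjective = injective⇒surjective V-finite (span b₁ b₂ b₃ b₄) span-injective

    opaque
      unfolding span
      -- The linear map sending the standard basis to x, y, z, 0 is not injective, so by counting it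
      -- misses a vector.
      outside : ∀ x y z → ∃ λ v → ∀ a b c → v ≢ a · x ⊕ b · y ⊕ c · z
      outside x y z with collides⇒misses V-finite (span x y z 0v) {0# , 0# , 0# , 1#} {0# , 0# , 0# , 0#}
                           (λ e → 1≢0 (cong (λ (_ , _ , _ , d) → d) e))
                           (cong (0# · x ⊕ 0# · y ⊕ 0# · z ⊕_) (trans (·-0 1#) (sym (·-0 0#))))
      ... | v , miss = v , λ a b c e → miss (a , b , c , 0#) (sym (trans e (sym (trans (cong (a · x ⊕ b · y ⊕ c · z ⊕_) (·-0 0#)) (⊕-identityʳ _)))))

    complete-basis : ∀ {p q r} → Independent p q → ¬ (r ∈⟨ p , q ⟩) → ∃ λ s → Basis p q r s
    complete-basis {p} {q} {r} ind r∉ with outside p q r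
    ... | s , s∉ = s , basis
      where
      divide : ∀ {e x} → e ≢ 0# → e · x ≡ 0v → x ≡ 0v
      divide n z = [ (λ w → ⊥-elim (n w)) , id ] (·-zero z)
      basis : Basis p q r s
      basis {a} {b} {c} {d} e with d ≟ 0#
      ... | no d≢0 = ⊥-elim (s∉ (inv d * a) (inv d * b) (inv d * c) (⊕⇒≡ (divide d≢0 (begin
        d · (s ⊕ ((inv d * a) · p ⊕ (inv d * b) · q ⊕ (inv d * c) · r))
          ≡⟨ linear (var x₃ ⊡ (at x₃ ⊞ ((var x₄ :* var x₀) ⊡ at x₀ ⊞ (var x₄ :* var x₁) ⊡ at x₁ ⊞ (var x₄ :* var x₂) ⊡ at x₂)))
                    (var x₃ ⊡ at x₃ ⊞ (var x₃ :* var x₄) ⊡ (var x₀ ⊡ at x₀ ⊞ var x₁ ⊡ at x₁ ⊞ var x₂ ⊡ at x₂)) (a ∷ b ∷ c ∷ d ∷ inv d ∷ []) (p ∷ q ∷ r ∷ s ∷ []) ⟩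
        d · s ⊕ (d * inv d) · (a · p ⊕ b · q ⊕ c · r) ≡⟨ cong (d · s ⊕_) (trans (cong (_· (a · p ⊕ b · q ⊕ c · r)) (inverse d d≢0)) (1-· _)) ⟩
        d · s ⊕ (a · p ⊕ b · q ⊕ c · r) ≡⟨ ⊕-comm _ _ ⟩
        a · p ⊕ b · q ⊕ c · r ⊕ d · s ≡⟨ e ⟩
        0v ∎))))
        where open ≡-Reasoning
      ... | yes refl with c ≟ 0#
      ...   | no c≢0 = ⊥-elim (r∉ (inv c * a , inv c * b , ⊕⇒≡ (divide c≢0 (begin
        c · (r ⊕ ((inv c * a) · p ⊕ (inv c * b) · q))
          ≡⟨ linear (var x₂ ⊡ (at x₂ ⊞ ((var x₃ :* var x₀) ⊡ at x₀ ⊞ (var x₃ :* var x₁) ⊡ at x₁)))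
                    (var x₂ ⊡ at x₂ ⊞ (var x₂ :* var x₃) ⊡ (var x₀ ⊡ at x₀ ⊞ var x₁ ⊡ at x₁)) (a ∷ b ∷ c ∷ inv c ∷ []) (p ∷ q ∷ r ∷ []) ⟩
        c · r ⊕ (c * inv c) · (a · p ⊕ b · q) ≡⟨ cong (c · r ⊕_) (trans (cong (_· (a · p ⊕ b · q)) (inverse c c≢0)) (1-· _)) ⟩
        c · r ⊕ (a · p ⊕ b · q) ≡⟨ linear (var x₂ ⊡ at x₂ ⊞ (var x₀ ⊡ at x₀ ⊞ var x₁ ⊡ at x₁)) (var x₀ ⊡ at x₀ ⊞ var x₁ ⊡ at x₁ ⊞ var x₂ ⊡ at x₂ ⊞ con false ⊡ at x₃) (a ∷ b ∷ c ∷ []) (p ∷ q ∷ r ∷ s ∷ []) ⟩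
        a · p ⊕ b · q ⊕ c · r ⊕ 0# · s ≡⟨ e ⟩
        0v ∎))))
        where open ≡-Reasoning
      ...   | yes refl = ind (trans (linear (var x₀ ⊡ at x₀ ⊞ var x₁ ⊡ at x₁) (var x₀ ⊡ at x₀ ⊞ var x₁ ⊡ at x₁ ⊞ con false ⊡ at x₂ ⊞ con false ⊡ at x₃) (a ∷ b ∷ []) (p ∷ q ∷ r ∷ s ∷ [])) e) , refl , refl

    outside₂ : ∀ p q → ∃ λ r → ¬ (r ∈⟨ p , q ⟩)
    outside₂ p q with outside p q q
    ... | r , r∉ = r , λ (a , b , e) → r∉ a b 0# (trans e (linear (var x₀ ⊡ at x₀ ⊞ var x₁ ⊡ at x₁) (var x₀ ⊡ at x₀ ⊞ var x₁ ⊡ at x₁ ⊞ con false ⊡ at x₁) (a ∷ b ∷ []) (p ∷ q ∷ [])))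

  -- P maps A′ onto A, with x ∙ P (u ∙′ v) = P u ∙ P v.
  record Isotopic {𝔽 : Field₂} (A A′ : Presemifield₂ 𝔽) : Set where
    open Field₂-Properties 𝔽
    open Presemifield₂ A using (_∙_)
    open Presemifield₂ A′ using () renaming (_∙_ to _∙′_)
    field
      x            : V
      x≢0          : x ≢ 0v
      P            : V → V
      P-⊕          : ∀ u v → P (u ⊕ v) ≡ P u ⊕ P v
      P-·          : ∀ r v → P (r · v) ≡ r · P v
      P-injective  : ∀ {u v} → P u ≡ P v → u ≡ v
      P-surjective : ∀ w → ∃ λ u → P u ≡ w
      P-∙          : ∀ u v → x ∙ P (u ∙′ v) ≡ P u ∙ P v

  -- Isotopes in which a chosen vector becomes the unit

  module _ {𝔽 : Field₂} (A : Presemifield₂ 𝔽) where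
    open Crossings A

    module _ {b₁ b₂ b₃ b₄ : V} (B : Basis b₁ b₂ b₃ b₄) where
      private
        P : V → V
        P = span b₁ b₂ b₃ b₄

        b₁≢0 : b₁ ≢ 0v
        b₁≢0 e = 1≢0 (proj₁ (proj₁ (B {1#} {0#} {0#} {0#} (trans (linear (con true ⊡ at x₀ ⊞ con false ⊡ at x₁ ⊞ con false ⊡ at x₂ ⊞ con false ⊡ at x₃) (at x₀) [] (b₁ ∷ b₂ ∷ b₃ ∷ b₄ ∷ [])) e))))

        quotient : ∀ u v → ∃ λ w → b₁ ∙ P w ≡ P u ∙ P v
        quotient u v with ∙-surjective b₁≢0 (P u ∙ P v)
        ... | t , e with span-surjective B t
        ...   | w , refl = w , e

        infixl 7 _∙′_
        _∙′_ : V → V → V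
        u ∙′ v = proj₁ (quotient u v)

        P-∙ : ∀ u v → b₁ ∙ P (u ∙′ v) ≡ P u ∙ P v
        P-∙ u v = proj₂ (quotient u v)

        cancel : ∀ {u v} → b₁ ∙ P u ≡ b₁ ∙ P v → u ≡ v
        cancel e = span-injective B (∙-cancel b₁≢0 e)

      -- Each axiom is checked after applying the injective map w ↦ b₁ ∙ P w, where it reduces to
      -- the same axiom of A.
      isotope : Presemifield₂ 𝔽
      isotope = record
        { _∙_ = _∙′_
        ; ∙-comm = λ u v → cancel (trans (P-∙ u v) (trans (∙-comm _ _) (sym (P-∙ v u))))
        ; ∙-⊕ = λ u v w → cancel (begin
            b₁ ∙ P (u ∙′ (v ⊕ w)) ≡⟨ P-∙ u _ ⟩
            P u ∙ P (v ⊕ w) ≡⟨ cong (P u ∙_) (span-⊕ v w) ⟩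
            P u ∙ (P v ⊕ P w) ≡⟨ ∙-⊕ _ _ _ ⟩
            P u ∙ P v ⊕ P u ∙ P w ≡⟨ cong₂ _⊕_ (sym (P-∙ u v)) (sym (P-∙ u w)) ⟩
            b₁ ∙ P (u ∙′ v) ⊕ b₁ ∙ P (u ∙′ w) ≡⟨ sym (∙-⊕ _ _ _) ⟩
            b₁ ∙ (P (u ∙′ v) ⊕ P (u ∙′ w)) ≡⟨ cong (b₁ ∙_) (sym (span-⊕ _ _)) ⟩
            b₁ ∙ P (u ∙′ v ⊕ u ∙′ w) ∎)
        ; ∙-· = λ r u v → cancel (begin
            b₁ ∙ P (u ∙′ (r · v)) ≡⟨ P-∙ u _ ⟩
            P u ∙ P (r · v) ≡⟨ cong (P u ∙_) (span-· r v) ⟩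
            P u ∙ (r · P v) ≡⟨ ∙-· r _ _ ⟩
            r · (P u ∙ P v) ≡⟨ cong (r ·_) (sym (P-∙ u v)) ⟩
            r · (b₁ ∙ P (u ∙′ v)) ≡⟨ sym (∙-· r _ _) ⟩
            b₁ ∙ (r · P (u ∙′ v)) ≡⟨ cong (b₁ ∙_) (sym (span-· r _)) ⟩
            b₁ ∙ P (r · (u ∙′ v)) ∎)
        ; zero-product = λ {u} {v} e → Data.Sum.map (span-zero B) (span-zero B) (zero-product (begin
            P u ∙ P v ≡⟨ sym (P-∙ u v) ⟩
            b₁ ∙ P (u ∙′ v) ≡⟨ cong (λ w → b₁ ∙ P w) e ⟩
            b₁ ∙ P 0v ≡⟨ cong (b₁ ∙_) (trans (cong P (sym (0-· 0v))) (trans (span-· 0# 0v) (0-· _))) ⟩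
            b₁ ∙ 0v ≡⟨ ∙-0 b₁ ⟩
            0v ∎))
        }
        where open ≡-Reasoning

      isotopic : Isotopic A isotope
      isotopic = record
        { x = b₁ ; x≢0 = b₁≢0 ; P = P ; P-⊕ = span-⊕ ; P-· = span-·
        ; P-injective = span-injective B ; P-surjective = span-surjective B ; P-∙ = P-∙ }

      isotope-unit : ∀ v → e₁ ∙′ v ≡ v
      isotope-unit v = cancel (trans (P-∙ e₁ v) (cong (_∙ P v) span-e₁))

  -- Existence of a special line through every point

  module Functionals (𝔽 : Field₂) where
    open Field₂-Properties 𝔽

    opaque
      unfolding _⊕_ e₁
      φ : V → V → K
      φ (a , b , c , d) (a′ , b′ , c′ , d′) = a * a′ + b * b′ + c * c′ + d * d′

      φ-⊕ : ∀ w u v → φ w (u ⊕ v) ≡ φ w u + φ w v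
      φ-⊕ (a , b , c , d) (a′ , b′ , c′ , d′) (a″ , b″ , c″ , d″) = solve 12 (λ a b c d a′ b′ c′ d′ a″ b″ c″ d″ →
        a :* (a′ :+ a″) :+ b :* (b′ :+ b″) :+ c :* (c′ :+ c″) :+ d :* (d′ :+ d″) :=
        (a :* a′ :+ b :* b′ :+ c :* c′ :+ d :* d′) :+ (a :* a″ :+ b :* b″ :+ c :* c″ :+ d :* d″)) refl
        a b c d a′ b′ c′ d′ a″ b″ c″ d″

      φ-· : ∀ w r v → φ w (r · v) ≡ r * φ w v
      φ-· (a , b , c , d) r (a′ , b′ , c′ , d′) = solve 9 (λ a b c d a′ b′ c′ d′ r →
        a :* (r :* a′) :+ b :* (r :* b′) :+ c :* (r :* c′) :+ d :* (r :* d′) := r :* (a :* a′ :+ b :* b′ :+ c :* c′ :+ d :* d′)) refl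
        a b c d a′ b′ c′ d′ r

      φ-comm : ∀ v w → φ v w ≡ φ w v
      φ-comm (a , b , c , d) (a′ , b′ , c′ , d′) = cong₂ _+_ (cong₂ _+_ (cong₂ _+_ (*-comm _ _) (*-comm _ _)) (*-comm _ _)) (*-comm _ _)

      decompose : ∀ v → v ≡ φ e₁ v · e₁ ⊕ φ e₂ v · e₂ ⊕ φ e₃ v · e₃ ⊕ φ e₄ v · e₄
      decompose (a , b , c , d) = trans (coordinates a b c d) (cong₂ _⊕_ (cong₂ _⊕_ (cong₂ _⊕_ (cong (_· e₁) p₁) (cong (_· e₂) p₂)) (cong (_· e₃) p₃)) (cong (_· e₄) p₄))
        where
        p₁ : a ≡ φ e₁ (a , b , c , d)
        p₁ = solve 4 (λ a b c d → a := con true :* a :+ con false :* b :+ con false :* c :+ con false :* d) refl a b c d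
        p₂ : b ≡ φ e₂ (a , b , c , d)
        p₂ = solve 4 (λ a b c d → b := con false :* a :+ con true :* b :+ con false :* c :+ con false :* d) refl a b c d
        p₃ : c ≡ φ e₃ (a , b , c , d)
        p₃ = solve 4 (λ a b c d → c := con false :* a :+ con false :* b :+ con true :* c :+ con false :* d) refl a b c d
        p₄ : d ≡ φ e₄ (a , b , c , d)
        p₄ = solve 4 (λ a b c d → d := con false :* a :+ con false :* b :+ con false :* c :+ con true :* d) refl a b c d

      φ-tuple : ∀ {a b c d} → (φ e₁ (a , b , c , d) ≡ a × φ e₂ (a , b , c , d) ≡ b) × (φ e₃ (a , b , c , d) ≡ c × φ e₄ (a , b , c , d) ≡ d)
      φ-tuple {a} {b} {c} {d} =
        (solve 4 (λ a b c d → con true :* a :+ con false :* b :+ con false :* c :+ con false :* d := a) refl a b c d ,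
         solve 4 (λ a b c d → con false :* a :+ con true :* b :+ con false :* c :+ con false :* d := b) refl a b c d) ,
        (solve 4 (λ a b c d → con false :* a :+ con false :* b :+ con true :* c :+ con false :* d := c) refl a b c d ,
         solve 4 (λ a b c d → con false :* a :+ con false :* b :+ con false :* c :+ con true :* d := d) refl a b c d)

    φ-⊕ˡ : ∀ u v w → φ (u ⊕ v) w ≡ φ u w + φ v w
    φ-⊕ˡ u v w = trans (φ-comm _ w) (trans (φ-⊕ w u v) (cong₂ _+_ (φ-comm w u) (φ-comm w v)))

    φ-0 : ∀ w → φ w 0v ≡ 0#
    φ-0 w = trans (cong (φ w) (sym (0-· 0v))) (trans (φ-· w 0# 0v) (zeroˡ _))

    φ-4 : ∀ w a b c d x y z t → φ w (a · x ⊕ b · y ⊕ c · z ⊕ d · t) ≡ a * φ w x + b * φ w y + c * φ w z + d * φ w t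
    φ-4 w a b c d x y z t = trans (φ-⊕ w _ _) (cong₂ _+_ (trans (φ-⊕ w _ _) (cong₂ _+_ (trans (φ-⊕ w _ _)
      (cong₂ _+_ (φ-· w a x) (φ-· w b y))) (φ-· w c z))) (φ-· w d t))

    φ-nondegenerate : ∀ {w} → w ≢ 0v → ∃ λ t → φ w t ≡ 1#
    φ-nondegenerate {w} n with φ w e₁ ≟ 0# | φ w e₂ ≟ 0# | φ w e₃ ≟ 0# | φ w e₄ ≟ 0#
    ... | no p | _ | _ | _ = inv (φ w e₁) · e₁ , trans (φ-· w _ _) (trans (*-comm _ _) (inverse _ p))
    ... | _ | no p | _ | _ = inv (φ w e₂) · e₂ , trans (φ-· w _ _) (trans (*-comm _ _) (inverse _ p))
    ... | _ | _ | no p | _ = inv (φ w e₃) · e₃ , trans (φ-· w _ _) (trans (*-comm _ _) (inverse _ p))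
    ... | _ | _ | _ | no p = inv (φ w e₄) · e₄ , trans (φ-· w _ _) (trans (*-comm _ _) (inverse _ p))
    ... | yes p | yes q | yes r | yes s = ⊥-elim (n (trans (decompose w)
          (trans (cong₂ _⊕_ (cong₂ _⊕_ (cong₂ _⊕_ (kill e₁ p) (kill e₂ q)) (kill e₃ r)) (kill e₄ s))
                 (trans (⊕-identityʳ _) (trans (⊕-identityʳ _) (⊕-identityʳ _))))))
      where
      kill : ∀ e → φ w e ≡ 0# → φ e w · e ≡ 0v
      kill e z = trans (cong (_· e) (trans (φ-comm e w) z)) (0-· e)

  module Unital {𝔽 : Field₂} (A : Presemifield₂ 𝔽) (identity : ∀ v → Presemifield₂._∙_ A (Field₂-Properties.e₁ 𝔽) v ≡ v) where
    open Crossings A public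
    open Functionals 𝔽 public

    private
      basis : Vec V 4
      basis = e₁ ∷ e₂ ∷ e₃ ∷ e₄ ∷ []

    opaque
      unfolding φ
      φ-e₁ : φ e₁ e₁ ≡ 1#
      φ-e₁ = proj₁ (proj₁ (φ-tuple {1#} {0#} {0#} {0#}))

    e₁≢0 : e₁ ≢ 0v
    e₁≢0 e = 1≢0 (trans (sym φ-e₁) (trans (cong (φ e₁) e) (φ-0 e₁)))

    -- `Φ` is additive and measures on the basis vectors how far φ w is from commuting with
    -- squaring. Since e₁ is a unit, its first coordinate is r + r² with r = φ w e₁ and is never ε.
    -- So `Φ` is not surjective, two functionals collide, and their sum commutes with squaring.
    square-functional : ∃ λ w → w ≢ 0v × (∀ v → φ w (v ∙ v) ≡ φ w v * φ w v)
    square-functional = w , (λ z → a≢b (⊕⇒≡ z)) , semilinear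
      where
      Φ : V → V
      Φ w = φ w (e₁ ∙ e₁) + φ w e₁ * φ w e₁ , φ w (e₂ ∙ e₂) + φ w e₂ * φ w e₂ , φ w (e₃ ∙ e₃) + φ w e₃ * φ w e₃ , φ w (e₄ ∙ e₄) + φ w e₄ * φ w e₄
      missed : ∀ w → Φ w ≢ (ε , 0# , 0# , 0#)
      missed w e = ε-missed (φ w e₁) (trans (+-comm _ _) (trans (cong (λ t → φ w t + φ w e₁ * φ w e₁) (sym (identity e₁))) (cong proj₁ e)))
      collision : ∃₂ λ a b → a ≢ b × Φ a ≡ Φ b
      collision = misses⇒collides V-finite Φ _ missed
      a b w : V
      a = proj₁ collision
      b = proj₁ (proj₂ collision)
      w = a ⊕ b
      a≢b : a ≢ b
      a≢b = proj₁ (proj₂ (proj₂ collision))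
      Φ≡ : Φ a ≡ Φ b
      Φ≡ = proj₂ (proj₂ (proj₂ collision))
      vanishes : ∀ t s → φ a t + φ a s * φ a s ≡ φ b t + φ b s * φ b s → φ w t ≡ φ w s * φ w s
      vanishes t s e = +⇒≡ (begin
        φ w t + φ w s * φ w s ≡⟨ cong₂ (λ x y → x + y * y) (φ-⊕ˡ a b t) (φ-⊕ˡ a b s) ⟩
        φ a t + φ b t + (φ a s + φ b s) * (φ a s + φ b s) ≡⟨ solve 4 (λ x y z t → x :+ y :+ (z :+ t) :* (z :+ t) := (x :+ z :* z) :+ (y :+ t :* t)) refl (φ a t) (φ b t) (φ a s) (φ b s) ⟩
        (φ a t + φ a s * φ a s) + (φ b t + φ b s * φ b s) ≡⟨ ≡⇒+ e ⟩
        0# ∎)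
        where open ≡-Reasoning
      semilinear : ∀ v → φ w (v ∙ v) ≡ φ w v * φ w v
      semilinear v = begin
        φ w (v ∙ v) ≡⟨ cong (λ u → φ w (u ∙ u)) (decompose v) ⟩
        φ w (_ ∙ _) ≡⟨ cong (φ w) (bilinear (X ⊠ X) ((var x₀ :* var x₀) ⊡ (at x₀ ⊠ at x₀) ⊞ (var x₁ :* var x₁) ⊡ (at x₁ ⊠ at x₁) ⊞ (var x₂ :* var x₂) ⊡ (at x₂ ⊠ at x₂) ⊞ (var x₃ :* var x₃) ⊡ (at x₃ ⊠ at x₃))
                         (p ∷ q ∷ r ∷ s ∷ []) basis) ⟩
        φ w (_ ⊕ _) ≡⟨ φ-4 w (p * p) (q * q) (r * r) (s * s) _ _ _ _ ⟩
        p * p * φ w (e₁ ∙ e₁) + q * q * φ w (e₂ ∙ e₂) + r * r * φ w (e₃ ∙ e₃) + s * s * φ w (e₄ ∙ e₄)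
          ≡⟨ cong₂ _+_ (cong₂ _+_ (cong₂ _+_ (cong (p * p *_) (vanishes (e₁ ∙ e₁) e₁ (cong proj₁ Φ≡))) (cong (q * q *_) (vanishes (e₂ ∙ e₂) e₂ (cong (proj₁ ∘ proj₂) Φ≡))))
               (cong (r * r *_) (vanishes (e₃ ∙ e₃) e₃ (cong (proj₁ ∘ proj₂ ∘ proj₂) Φ≡)))) (cong (s * s *_) (vanishes (e₄ ∙ e₄) e₄ (cong (proj₂ ∘ proj₂ ∘ proj₂) Φ≡))) ⟩
        p * p * (φ w e₁ * φ w e₁) + q * q * (φ w e₂ * φ w e₂) + r * r * (φ w e₃ * φ w e₃) + s * s * (φ w e₄ * φ w e₄)
          ≡⟨ solve 8 (λ p q r s a b c d → p :* p :* (a :* a) :+ q :* q :* (b :* b) :+ r :* r :* (c :* c) :+ s :* s :* (d :* d)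
                 := (p :* a :+ q :* b :+ r :* c :+ s :* d) :* (p :* a :+ q :* b :+ r :* c :+ s :* d)) refl p q r s (φ w e₁) (φ w e₂) (φ w e₃) (φ w e₄) ⟩
        (p * φ w e₁ + q * φ w e₂ + r * φ w e₃ + s * φ w e₄) * (p * φ w e₁ + q * φ w e₂ + r * φ w e₃ + s * φ w e₄)
          ≡⟨ cong (λ t → t * t) (sym (trans (cong (φ w) (decompose v)) (φ-4 w p q r s e₁ e₂ e₃ e₄))) ⟩
        φ w v * φ w v ∎
        where
        open ≡-Reasoning
        p q r s : K
        p = φ e₁ v
        q = φ e₂ v
        r = φ e₃ v
        s = φ e₄ v
        X : Expr 4 4
        X = var x₀ ⊡ at x₀ ⊞ var x₁ ⊡ at x₁ ⊞ var x₂ ⊡ at x₂ ⊞ var x₃ ⊡ at x₃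

    -- If φ w e₁ were nonzero, φ w (u ∙ v) would restrict to an alternating form on the 3-dimensional kernel of φ w, hence be degenerate.
    module _ {w : V} (w≢0 : w ≢ 0v) (semilinear : ∀ v → φ w (v ∙ v) ≡ φ w v * φ w v) where
      private
        β : V → V → K
        β u v = φ w (u ∙ v)

        β-4 : ∀ a b c d v → β (a · e₁ ⊕ b · e₂ ⊕ c · e₃ ⊕ d · e₄) v ≡ a * β e₁ v + b * β e₂ v + c * β e₃ v + d * β e₄ v
        β-4 a b c d v = trans (cong (φ w) (bilinear ((var x₀ ⊡ at x₀ ⊞ var x₁ ⊡ at x₁ ⊞ var x₂ ⊡ at x₂ ⊞ var x₃ ⊡ at x₃) ⊠ at x₄)
          (var x₀ ⊡ (at x₀ ⊠ at x₄) ⊞ var x₁ ⊡ (at x₁ ⊠ at x₄) ⊞ var x₂ ⊡ (at x₂ ⊠ at x₄) ⊞ var x₃ ⊡ (at x₃ ⊠ at x₄)) (a ∷ b ∷ c ∷ d ∷ []) (e₁ ∷ e₂ ∷ e₃ ∷ e₄ ∷ v ∷ [])))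
          (φ-4 w a b c d _ _ _ _)

        β-comm : ∀ u v → β u v ≡ β v u
        β-comm u v = cong (φ w) (∙-comm u v)

        β-e₁ : ∀ v → β e₁ v ≡ φ w v
        β-e₁ v = cong (φ w) (identity v)

        w₁ w₂ w₃ w₄ : K
        w₁ = φ w e₁
        w₂ = φ w e₂
        w₃ = φ w e₃
        w₄ = φ w e₄

        nondegenerate : ∀ {r} → r ≢ 0v → ¬ (β r e₁ ≡ 0# × β r e₂ ≡ 0# × β r e₃ ≡ 0# × β r e₄ ≡ 0#)
        nondegenerate {r} r≢0 (z₁ , z₂ , z₃ , z₄) with φ-nondegenerate w≢0
        ... | t , e with ∙-surjective r≢0 t
        ...   | u , refl = 1≢0 (begin
          1# ≡⟨ sym e ⟩
          β r u ≡⟨ β-comm r u ⟩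
          β u r ≡⟨ cong (λ v → β v r) (decompose u) ⟩
          β (φ e₁ u · e₁ ⊕ φ e₂ u · e₂ ⊕ φ e₃ u · e₃ ⊕ φ e₄ u · e₄) r ≡⟨ β-4 _ _ _ _ r ⟩
          φ e₁ u * β e₁ r + φ e₂ u * β e₂ r + φ e₃ u * β e₃ r + φ e₄ u * β e₄ r
            ≡⟨ cong₂ _+_ (cong₂ _+_ (cong₂ _+_ (kill _ e₁ z₁) (kill _ e₂ z₂)) (kill _ e₃ z₃)) (kill _ e₄ z₄) ⟩
          0# + 0# + 0# + 0# ≡⟨ trans (+-identityʳ _) (trans (+-identityʳ _) (+-self 0#)) ⟩
          0# ∎)
          where
          open ≡-Reasoning
          kill : ∀ x v → β r v ≡ 0# → x * β v r ≡ 0#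
          kill x v z = trans (cong (x *_) (trans (β-comm v r) z)) (zeroʳ x)

        combination-≢0 : ∀ {a b c d} → b ≢ 0# ⊎ c ≢ 0# ⊎ d ≢ 0# → a · e₁ ⊕ b · e₂ ⊕ c · e₃ ⊕ d · e₄ ≢ 0v
        combination-≢0 {a} {b} {c} {d} n e = absurd n
          where
          e′ : (a , b , c , d) ≡ (0# , 0# , 0# , 0#)
          e′ = trans (coordinates a b c d) (trans e 0v-≡)
          absurd : b ≢ 0# ⊎ c ≢ 0# ⊎ d ≢ 0# → ⊥
          absurd (inj₁ n) = n (cong (proj₁ ∘ proj₂) e′)
          absurd (inj₂ (inj₁ n)) = n (cong (proj₁ ∘ proj₂ ∘ proj₂) e′)
          absurd (inj₂ (inj₂ n)) = n (cong (proj₂ ∘ proj₂ ∘ proj₂) e′)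

      isotropic : w₁ ≡ 0#
      isotropic with w₁ ≟ 0#
      ... | yes z = z
      ... | no w₁≢0 = ⊥-elim (degenerate (a₃₄ ≟ 0#) (a₂₄ ≟ 0#) (a₂₃ ≟ 0#))
        where
        open ≡-Reasoning
        β₂₃ β₂₄ β₃₄ a₂₃ a₂₄ a₃₄ : K
        β₂₃ = β e₂ e₃
        β₂₄ = β e₂ e₄
        β₃₄ = β e₃ e₄
        a₂₃ = β₂₃ + w₂ * w₃
        a₂₄ = β₂₄ + w₂ * w₄
        a₃₄ = β₃₄ + w₃ * w₄
        w₁≡1 : w₁ ≡ 1#
        w₁≡1 = sym (+⇒≡ (*-cancel w₁≢0 (begin
          w₁ * (1# + w₁)  ≡⟨ solve 1 (λ a → a :* (con true :+ a) := a :+ a :* a) refl w₁ ⟩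
          w₁ + w₁ * w₁    ≡⟨ cong (_+ w₁ * w₁) (trans (cong (φ w) (sym (identity e₁))) (semilinear e₁)) ⟩
          w₁ * w₁ + w₁ * w₁ ≡⟨ +-self _ ⟩
          0# ∎)))
        row : ∀ a b c d v → a * φ w v + b * β e₂ v + c * β e₃ v + d * β e₄ v ≡ β (a · e₁ ⊕ b · e₂ ⊕ c · e₃ ⊕ d · e₄) v
        row a b c d v = sym (trans (β-4 a b c d v) (cong (λ t → a * t + b * β e₂ v + c * β e₃ v + d * β e₄ v) (β-e₁ v)))
        βe₁ : ∀ v → β v e₁ ≡ φ w v
        βe₁ v = trans (β-comm v e₁) (β-e₁ v)
        -- Once w₁ = 1, the vectors eᵢ + wᵢ e₁ with i = 2, 3, 4 form a basis of the kernel of φ w,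
        -- and the aᵢⱼ are the entries of the form there. A 3 × 3 alternating matrix has the radical
        -- vector (a₃₄ , a₂₄ , a₂₃); `r₁` collects its e₁-coordinate. It is also orthogonal to e₁,
        -- so it lies in the radical on all of V.
        r₁ : K
        r₁ = a₃₄ * w₂ + a₂₄ * w₃ + a₂₃ * w₄
        radical : a₃₄ ≢ 0# ⊎ a₂₄ ≢ 0# ⊎ a₂₃ ≢ 0# → ⊥
        radical n = nondegenerate (combination-≢0 {r₁} n)
          ( trans (sym (row _ _ _ _ e₁)) (trans (cong₂ _+_ (cong₂ _+_ (cong₂ _+_ (cong (r₁ *_) w₁≡1) (cong (a₃₄ *_) (βe₁ e₂))) (cong (a₂₄ *_) (βe₁ e₃))) (cong (a₂₃ *_) (βe₁ e₄)))
              (solve 6 (λ a b c x y z → (a :* x :+ b :* y :+ c :* z) :* con true :+ a :* x :+ b :* y :+ c :* z := con false) refl a₃₄ a₂₄ a₂₃ w₂ w₃ w₄))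
          , trans (sym (row _ _ _ _ e₂)) (trans (cong₂ _+_ (cong₂ _+_ (cong (r₁ * w₂ +_) (cong (a₃₄ *_) (semilinear e₂))) (cong (a₂₄ *_) (β-comm e₃ e₂))) (cong (a₂₃ *_) (β-comm e₄ e₂)))
              (solve 6 (λ x y z p q r → ((r :+ y :* z) :* x :+ (q :+ x :* z) :* y :+ (p :+ x :* y) :* z) :* x :+ (r :+ y :* z) :* (x :* x) :+ (q :+ x :* z) :* p :+ (p :+ x :* y) :* q := con false) refl w₂ w₃ w₄ β₂₃ β₂₄ β₃₄))
          , trans (sym (row _ _ _ _ e₃)) (trans (cong₂ _+_ (cong (r₁ * w₃ + a₃₄ * β₂₃ +_) (cong (a₂₄ *_) (semilinear e₃))) (cong (a₂₃ *_) (β-comm e₄ e₃)))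
              (solve 6 (λ x y z p q r → ((r :+ y :* z) :* x :+ (q :+ x :* z) :* y :+ (p :+ x :* y) :* z) :* y :+ (r :+ y :* z) :* p :+ (q :+ x :* z) :* (y :* y) :+ (p :+ x :* y) :* r := con false) refl w₂ w₃ w₄ β₂₃ β₂₄ β₃₄))
          , trans (sym (row _ _ _ _ e₄)) (trans (cong (r₁ * w₄ + a₃₄ * β₂₄ + a₂₄ * β₃₄ +_) (cong (a₂₃ *_) (semilinear e₄)))
              (solve 6 (λ x y z p q r → ((r :+ y :* z) :* x :+ (q :+ x :* z) :* y :+ (p :+ x :* y) :* z) :* z :+ (r :+ y :* z) :* q :+ (q :+ x :* z) :* r :+ (p :+ x :* y) :* (z :* z) := con false) refl w₂ w₃ w₄ β₂₃ β₂₄ β₃₄)))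
        degenerate : Dec (a₃₄ ≡ 0#) → Dec (a₂₄ ≡ 0#) → Dec (a₂₃ ≡ 0#) → ⊥
        degenerate (no n) _ _ = radical (inj₁ n)
        degenerate _ (no n) _ = radical (inj₂ (inj₁ n))
        degenerate _ _ (no n) = radical (inj₂ (inj₂ n))
        -- The form vanishes on the whole kernel, so e₂ + w₂ e₁ serves as a radical vector.
        degenerate (yes z₃₄) (yes z₂₄) (yes z₂₃) = nondegenerate (combination-≢0 {w₂} {1#} {0#} {0#} (inj₁ 1≢0))
          ( trans (sym (row _ _ _ _ e₁)) (trans (cong₂ _+_ (cong₂ _+_ (cong₂ _+_ (cong (w₂ *_) w₁≡1) (cong (1# *_) (βe₁ e₂))) refl) refl)
              (solve 3 (λ x p q → x :* con true :+ con true :* x :+ con false :* p :+ con false :* q := con false) refl w₂ _ _))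
          , trans (sym (row _ _ _ _ e₂)) (trans (cong₂ _+_ (cong₂ _+_ (cong (w₂ * w₂ +_) (cong (1# *_) (semilinear e₂))) refl) refl)
              (solve 3 (λ x p q → x :* x :+ con true :* (x :* x) :+ con false :* p :+ con false :* q := con false) refl w₂ _ _))
          , trans (sym (row _ _ _ _ e₃)) (trans (solve 5 (λ x y b p q → x :* y :+ con true :* b :+ con false :* p :+ con false :* q := b :+ x :* y) refl w₂ w₃ β₂₃ _ _) z₂₃)
          , trans (sym (row _ _ _ _ e₄)) (trans (solve 5 (λ x y b p q → x :* y :+ con true :* b :+ con false :* p :+ con false :* q := b :+ x :* y) refl w₂ w₄ β₂₄ _ _) z₂₄))

      private
        -- Because φ w e₁ = 0, applying φ w turns Θ into r ↦ r² + r, which misses ε; hence Θ is not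
        -- onto and has a kernel. The last summand keeps e₁ out of that kernel: Θ (r e₁) = r e₁,
        -- whereas v ↦ v² + v alone would kill e₁.
        Θ : V → V
        Θ v = v ∙ v ⊕ v ⊕ (φ e₁ v * φ e₁ v) · e₁

        φ-Θ : ∀ v → φ w (Θ v) ≡ φ w v * φ w v + φ w v
        φ-Θ v = begin
          φ w (v ∙ v ⊕ v ⊕ (φ e₁ v * φ e₁ v) · e₁) ≡⟨ φ-⊕ w _ _ ⟩
          φ w (v ∙ v ⊕ v) + φ w ((φ e₁ v * φ e₁ v) · e₁) ≡⟨ cong₂ _+_ (φ-⊕ w _ _) (trans (φ-· w _ e₁) (trans (cong (_ *_) isotropic) (zeroʳ _))) ⟩
          φ w (v ∙ v) + φ w v + 0# ≡⟨ +-identityʳ _ ⟩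
          φ w (v ∙ v) + φ w v ≡⟨ cong (_+ φ w v) (semilinear v) ⟩
          φ w v * φ w v + φ w v ∎
          where open ≡-Reasoning

        Θ-missed : ∃ λ t → ∀ v → Θ v ≢ t
        Θ-missed = ε · t , λ v z → ε-missed (φ w v) (trans (sym (φ-Θ v)) (trans (cong (φ w) z) (trans (φ-· w ε t)
          (trans (cong (ε *_) (proj₂ (φ-nondegenerate w≢0))) (trans (*-comm ε 1#) (*-identityˡ ε))))))
          where
          t : V
          t = proj₁ (φ-nondegenerate w≢0)

        Θ-⊕ : ∀ a b → Θ (a ⊕ b) ≡ Θ a ⊕ Θ b
        Θ-⊕ a b = trans (cong₂ (λ u t → u ⊕ (a ⊕ b) ⊕ (t * t) · e₁) (square-⊕ a b) (φ-⊕ e₁ a b))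
          (linear ((at x₀ ⊞ at x₁) ⊞ (at x₂ ⊞ at x₃) ⊞ ((var x₀ :+ var x₁) :* (var x₀ :+ var x₁)) ⊡ at x₄)
                  ((at x₀ ⊞ at x₂ ⊞ (var x₀ :* var x₀) ⊡ at x₄) ⊞ (at x₁ ⊞ at x₃ ⊞ (var x₁ :* var x₁) ⊡ at x₄)) (φ e₁ a ∷ φ e₁ b ∷ []) (a ∙ a ∷ b ∙ b ∷ a ∷ b ∷ e₁ ∷ []))

        kernel : ∃ λ d → d ≢ 0v × Θ d ≡ 0v
        kernel with misses⇒collides V-finite Θ (proj₁ Θ-missed) (proj₂ Θ-missed)
        ... | a , b , a≢b , e = a ⊕ b , (λ z → a≢b (⊕⇒≡ z)) , trans (Θ-⊕ a b) (≡⇒⊕ e)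

        module _ {d : V} (d≢0 : d ≢ 0v) (Θd : Θ d ≡ 0v) where
          x : K
          x = φ e₁ d

          d∙d : d ∙ d ≡ d ⊕ (x * x) · e₁
          d∙d = ⊕⇒≡ (trans (sym (⊕-assoc _ _ _)) Θd)

          translate : ∀ s → (d ⊕ s · e₁) ∙ (d ⊕ s · e₁) ≡ (d ⊕ s · e₁) ⊕ (s * s + s + x * x) · e₁
          translate s = begin
            (d ⊕ s · e₁) ∙ (d ⊕ s · e₁) ≡⟨ trans (square-⊕ _ _) (cong₂ _⊕_ d∙d (trans (square-· s e₁) (cong ((s * s) ·_) (identity e₁)))) ⟩
            d ⊕ (x * x) · e₁ ⊕ (s * s) · e₁ ≡⟨ linear (at x₀ ⊞ (var x₀ :* var x₀) ⊡ at x₁ ⊞ (var x₁ :* var x₁) ⊡ at x₁) ((at x₀ ⊞ var x₁ ⊡ at x₁) ⊞ (var x₁ :* var x₁ :+ var x₁ :+ var x₀ :* var x₀) ⊡ at x₁) (x ∷ s ∷ []) (d ∷ e₁ ∷ []) ⟩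
            (d ⊕ s · e₁) ⊕ (s * s + s + x * x) · e₁ ∎
            where open ≡-Reasoning

          d∉ : ∀ r → d ≢ r · e₁
          d∉ r e = [ (λ z → d≢0 (trans e (trans (cong (_· e₁) z) (0-· e₁)))) , (λ z → e₁≢0 z) ] (·-zero {r} {e₁} (begin
            r · e₁ ≡⟨ linear {1} {1} (var x₀ ⊡ at x₀) (((var x₀ :* var x₀) ⊡ at x₀) ⊞ (var x₀ ⊡ at x₀ ⊞ (var x₀ :* var x₀) ⊡ at x₀)) (r ∷ []) (e₁ ∷ []) ⟩
            (r * r) · e₁ ⊕ (r · e₁ ⊕ (r * r) · e₁) ≡⟨ cong₂ (λ u t → u ⊕ (r · e₁ ⊕ (t * t) · e₁)) (sym (trans (square-· r e₁) (cong ((r * r) ·_) (identity e₁)))) (sym xr) ⟩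
            (r · e₁) ∙ (r · e₁) ⊕ (r · e₁ ⊕ (x * x) · e₁) ≡⟨ cong (λ u → u ∙ u ⊕ (u ⊕ (x * x) · e₁)) (sym e) ⟩
            d ∙ d ⊕ (d ⊕ (x * x) · e₁) ≡⟨ ≡⇒⊕ d∙d ⟩
            0v ∎))
            where
            open ≡-Reasoning
            xr : x ≡ r
            xr = trans (cong (φ e₁) e) (trans (φ-· e₁ r e₁) (trans (cong (r *_) φ-e₁) (trans (*-comm r 1#) (*-identityˡ r))))

          translate-∉ : ∀ s r → d ⊕ s · e₁ ≢ r · e₁
          translate-∉ s r e = d∉ (r + s) (begin
            d ≡⟨ linear (at x₀) ((at x₀ ⊞ var x₀ ⊡ at x₁) ⊞ var x₀ ⊡ at x₁) (s ∷ []) (d ∷ e₁ ∷ []) ⟩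
            (d ⊕ s · e₁) ⊕ s · e₁ ≡⟨ cong (_⊕ s · e₁) e ⟩
            r · e₁ ⊕ s · e₁ ≡⟨ sym (+-· r s e₁) ⟩
            (r + s) · e₁ ∎)
            where open ≡-Reasoning

          -- Moving d by s e₁ replaces the constant x² by s² + s + x², which `halve` brings to 0 or
          -- ε. The value 0 gives the zero product y ∙ (y + e₁); the value ε is the relation of a
          -- special line.
          special-translate : (∃ λ s → s * s + s ≡ x * x ⊎ s * s + s ≡ x * x + ε) → ∃ λ y → Special e₁ y
          special-translate (s , inj₁ e) = ⊥-elim ([ (λ z → translate-∉ s 0# (trans z (sym (0-· e₁)))) , (λ z → translate-∉ s 1# (trans (⊕⇒≡ z) (sym (1-· e₁)))) ]
            (zero-product {d ⊕ s · e₁} {(d ⊕ s · e₁) ⊕ e₁} (begin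
              y ∙ (y ⊕ e₁) ≡⟨ ∙-⊕ y y e₁ ⟩
              y ∙ y ⊕ y ∙ e₁ ≡⟨ cong₂ _⊕_ (translate s) (trans (∙-comm y e₁) (identity y)) ⟩
              y ⊕ (s * s + s + x * x) · e₁ ⊕ y ≡⟨ cong (λ t → y ⊕ t · e₁ ⊕ y) (≡⇒+ e) ⟩
              y ⊕ 0# · e₁ ⊕ y ≡⟨ linear (at x₀ ⊞ con false ⊡ at x₁ ⊞ at x₀) (con false ⊡ at x₁) [] (y ∷ e₁ ∷ []) ⟩
              0# · e₁ ≡⟨ 0-· e₁ ⟩
              0v ∎)))
            where
            open ≡-Reasoning
            y : V
            y = d ⊕ s · e₁
          special-translate (s , inj₂ e) = d ⊕ s · e₁ , record
            { square = trans (translate s) (cong₂ _⊕_ (sym (identity _)) (cong₂ _·_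
                (trans (cong (_+ x * x) e) (solve 2 (λ a e → a :+ e :+ a := e) refl (x * x) ε)) (sym (identity e₁))))
            ; p≢0 = e₁≢0
            ; q≢ = translate-∉ s
            }

      special-kernel : ∃ λ y → Special e₁ y
      special-kernel = special-translate (proj₁ (proj₂ kernel)) (proj₂ (proj₂ kernel)) (halve _)

    special₁ : ∃ λ y → Special e₁ y
    special₁ = special-kernel (proj₁ (proj₂ square-functional)) (proj₂ (proj₂ square-functional))

  module _ {𝔽 : Field₂} (A : Presemifield₂ 𝔽) where
    open Crossings A

    opaque
      -- The defining relation is preserved by isotopy, so it suffices to treat the isotope with x
      -- as its unit.
      exists-special : ∀ {x} → x ≢ 0v → ∃ λ y → Special x y
      exists-special {x} x≢0 with outside x x x
      ... | q , q∉ = transport (complete-basis ind (proj₂ (outside₂ x q)))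
        where
        open ≡-Reasoning
        ind : Independent x q
        ind = independent⁺ x≢0 λ r e → q∉ r 0# 0# (trans e (linear (var x₀ ⊡ at x₀) (var x₀ ⊡ at x₀ ⊞ con false ⊡ at x₀ ⊞ con false ⊡ at x₀) (r ∷ []) (x ∷ [])))
        transport : (∃ λ s → Basis x q (proj₁ (outside₂ x q)) s) → ∃ λ y → Special x y
        transport (s , B) = go (Unital.special₁ (isotope A B) (isotope-unit A B))
          where
          open Isotopic (isotopic A B) using (P; P-⊕; P-·; P-injective; P-∙)
          open Presemifield₂ (isotope A B) using () renaming (_∙_ to _∙′_)
          module A′ = Crossings (isotope A B)
          P-e₁ : P e₁ ≡ x
          P-e₁ = span-e₁
          go : (∃ λ y → A′.Special e₁ y) → ∃ λ y → Special x y
          go (y , S) = P y , record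
            { square = begin
                P y ∙ P y ≡⟨ sym (P-∙ y y) ⟩
                x ∙ P (y ∙′ y) ≡⟨ cong (λ u → x ∙ P u) (A′.Special.square S) ⟩
                x ∙ P (e₁ ∙′ y ⊕ ε · (e₁ ∙′ e₁)) ≡⟨ cong₂ (λ u v → x ∙ P (u ⊕ ε · v)) (isotope-unit A B y) (isotope-unit A B e₁) ⟩
                x ∙ P (y ⊕ ε · e₁) ≡⟨ cong (x ∙_) (trans (P-⊕ _ _) (cong (P y ⊕_) (trans (P-· ε e₁) (cong (ε ·_) P-e₁)))) ⟩
                x ∙ (P y ⊕ ε · x) ≡⟨ trans (∙-⊕ x _ _) (cong (x ∙ P y ⊕_) (∙-· ε x x)) ⟩
                x ∙ P y ⊕ ε · (x ∙ x) ∎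
            ; p≢0 = x≢0
            ; q≢ = λ r e → A′.Special.q≢ S r (P-injective (trans e (trans (cong (r ·_) (sym P-e₁)) (sym (P-· r e₁)))))
            }

  -- The action of a special line on the quotient

  module Frames {𝔽 : Field₂} (A : Presemifield₂ 𝔽) where
    open Crossings A public

    module _ {p q : V} (S : Special p q) where
      private module S = Special S

      -- Multiplication by p is bijective and carries ⟨p,q⟩ onto its squares, so it carries a basis
      -- modulo the line to a basis modulo the squares.
      mod-coordinates : ∀ {v c} → Free p q v c → ∀ w → ∃₂ λ s t → w ⊕ (s · (p ∙ v) ⊕ t · (p ∙ c)) ∈²⟨ p , q ⟩
      mod-coordinates {v} {c} fr w = go (∙-surjective S.p≢0 w)
        where
        B : Basis p q v c
        B {a} {b} {c′} {d} e = S.independent (trans (linear (var x₀ ⊡ at x₀ ⊞ var x₁ ⊡ at x₁) (var x₀ ⊡ at x₀ ⊞ var x₁ ⊡ at x₁ ⊞ con false ⊡ at x₂ ⊞ con false ⊡ at x₃) (a ∷ b ∷ []) (p ∷ q ∷ v ∷ c ∷ []))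
                             (trans (cong₂ (λ s t → a · p ⊕ b · q ⊕ s · v ⊕ t · c) (sym (proj₁ z)) (sym (proj₂ z))) e)) , z
          where
          z : c′ ≡ 0# × d ≡ 0#
          z = fr c′ d (a , b , ⊕⇒≡ (trans (linear ((var x₂ ⊡ at x₂ ⊞ var x₃ ⊡ at x₃) ⊞ (var x₀ ⊡ at x₀ ⊞ var x₁ ⊡ at x₁)) (var x₀ ⊡ at x₀ ⊞ var x₁ ⊡ at x₁ ⊞ var x₂ ⊡ at x₂ ⊞ var x₃ ⊡ at x₃) (a ∷ b ∷ c′ ∷ d ∷ []) (p ∷ q ∷ v ∷ c ∷ [])) e))
        go : (∃ λ u → p ∙ u ≡ w) → _
        go (u , refl) with span-surjective B u
        ... | (a , b , s , t) , refl = s , t , subst (_∈²⟨ p , q ⟩) (sym (trans (cong (λ u → p ∙ u ⊕ (s · (p ∙ v) ⊕ t · (p ∙ c))) (span-≡ a b s t))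
              (bilinear (at x₀ ⊠ (var x₀ ⊡ at x₀ ⊞ var x₁ ⊡ at x₁ ⊞ var x₂ ⊡ at x₂ ⊞ var x₃ ⊡ at x₃) ⊞ (var x₂ ⊡ (at x₀ ⊠ at x₂) ⊞ var x₃ ⊡ (at x₀ ⊠ at x₃)))
                        (var x₀ ⊡ (at x₀ ⊠ at x₀) ⊞ var x₁ ⊡ (at x₀ ⊠ at x₁)) (a ∷ b ∷ s ∷ t ∷ []) (p ∷ q ∷ v ∷ c ∷ []))))
              (∈²-⊕ (∈²-· a S.pp∈²) (∈²-· b S.pq∈²))

      -- Every direction modulo ⟨p,q⟩ is fixed by exactly one point of ⟨p,q⟩; by counting, p fixes one.
      fixed-direction : ∀ {c₁ c₂} → Free p q c₁ c₂ → ∃ λ v → ¬ (v ∈⟨ p , q ⟩) × v ∙ v ⊕ p ∙ v ∈²⟨ p , q ⟩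
      fixed-direction {c₁} {c₂} fr = conclude (injective⇒surjective K² X X-injective (1# , 0#))
        where
        K² : Finite (K × K)
        K² = finite ×-finite finite
        U L : K × K → V
        U (a , b) = a · c₁ ⊕ b · c₂
        L (a , b) = a · p ⊕ b · q
        0² : K × K
        0² = 0# , 0#
        _+²_ : K × K → K × K → K × K
        (a , b) +² (a′ , b′) = a + a′ , b + b′
        combine-+² : ∀ x y u u′ → (proj₁ u · x ⊕ proj₂ u · y) ⊕ (proj₁ u′ · x ⊕ proj₂ u′ · y) ≡ proj₁ (u +² u′) · x ⊕ proj₂ (u +² u′) · y
        combine-+² x y (a , b) (a′ , b′) = linear ((var x₀ ⊡ at x₀ ⊞ var x₁ ⊡ at x₁) ⊞ (var x₂ ⊡ at x₀ ⊞ var x₃ ⊡ at x₁)) ((var x₀ :+ var x₂) ⊡ at x₀ ⊞ (var x₁ :+ var x₃) ⊡ at x₁) (a ∷ b ∷ a′ ∷ b′ ∷ []) (x ∷ y ∷ [])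
        +²⇒≡ : ∀ {u u′} → u +² u′ ≡ 0² → u ≡ u′
        +²⇒≡ e = cong₂ _,_ (+⇒≡ (cong proj₁ e)) (+⇒≡ (cong proj₂ e))
        zero² : ∀ x y → 0# · x ⊕ 0# · y ≡ 0v
        zero² x y = trans (cong₂ _⊕_ (0-· x) (0-· y)) (⊕-self 0v)
        U-∈ : ∀ {u} → U u ∈⟨ p , q ⟩ → u ≡ 0²
        U-∈ {a , b} h = cong₂ _,_ (proj₁ (fr a b h)) (proj₂ (fr a b h))
        L-zero : ∀ {l} → L l ≡ 0v → l ≡ 0²
        L-zero e = cong₂ _,_ (proj₁ (S.independent e)) (proj₂ (S.independent e))
        co : V → K × K
        co w = proj₁ (mod-coordinates fr w) , proj₁ (proj₂ (mod-coordinates fr w))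
        co-≡ : ∀ {w w′} → co w ≡ co w′ → w ⊕ w′ ∈²⟨ p , q ⟩
        co-≡ {w} {w′} e = subst (_∈²⟨ p , q ⟩) (begin
          (w ⊕ k (co w)) ⊕ (w′ ⊕ k (co w′)) ≡⟨ cong (λ t → (w ⊕ k t) ⊕ (w′ ⊕ k (co w′))) e ⟩
          (w ⊕ k (co w′)) ⊕ (w′ ⊕ k (co w′)) ≡⟨ linear ((at x₀ ⊞ at x₂) ⊞ (at x₁ ⊞ at x₂)) (at x₀ ⊞ at x₁) [] (w ∷ w′ ∷ k (co w′) ∷ []) ⟩
          w ⊕ w′ ∎) (∈²-⊕ (proj₂ (proj₂ (mod-coordinates fr w))) (proj₂ (proj₂ (mod-coordinates fr w′))))
          where
          open ≡-Reasoning
          k : K × K → V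
          k (s , t) = s · (p ∙ c₁) ⊕ t · (p ∙ c₂)
        -- By `regular-∈`, multiplication by u is injective from the line to V modulo the squares.
        -- Both are two-dimensional, so the class of u ∙ u is reached.
        fixing : ∀ u → u ≢ 0² → ∃ λ l → L l ∙ U u ⊕ U u ∙ U u ∈²⟨ p , q ⟩
        fixing u u≢0 = l , co-≡ (proj₂ surj)
          where
          inj : ∀ {l l′} → co (L l ∙ U u) ≡ co (L l′ ∙ U u) → l ≡ l′
          inj {l} {l′} e with L (l +² l′) ≟ᵛ 0v
          ... | yes z = +²⇒≡ (L-zero z)
          ... | no n = ⊥-elim (u≢0 (U-∈ (regular-∈ S (_ , _ , refl) n (subst (_∈²⟨ p , q ⟩) (trans (sym (⊕-∙ _ _ _)) (cong (_∙ U u) (combine-+² p q l l′))) (co-≡ e)))))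
          surj : ∃ λ l → co (L l ∙ U u) ≡ co (U u ∙ U u)
          surj = injective⇒surjective K² (λ l → co (L l ∙ U u)) inj (co (U u ∙ U u))
          l : K × K
          l = proj₁ surj
        -- The direction 0 is sent to the point 0, so that X is a self-map of K² and injectivity
        -- implies surjectivity.
        X′ : ∀ u → Dec (u ≡ 0²) → K × K
        X′ u (yes _) = 0²
        X′ u (no n)  = proj₁ (fixing u n)
        X : K × K → K × K
        X u = X′ u (Finite._≟_ K² u 0²)
        X-fixes′ : ∀ u d → L (X′ u d) ∙ U u ⊕ U u ∙ U u ∈²⟨ p , q ⟩
        X-fixes′ _ (yes refl) = subst (_∈²⟨ p , q ⟩) (sym (trans (cong₂ (λ x y → x ∙ y ⊕ y ∙ y) (zero² p q) (zero² c₁ c₂)) (trans (cong₂ _⊕_ (∙-0 0v) (∙-0 0v)) (⊕-self 0v)))) 0∈²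
        X-fixes′ u (no n)     = proj₂ (fixing u n)
        X-fixes : ∀ u → L (X u) ∙ U u ⊕ U u ∙ U u ∈²⟨ p , q ⟩
        X-fixes u = X-fixes′ u (Finite._≟_ K² u 0²)
        X-zero : ∀ {u} → u ≡ 0² → X u ≡ 0²
        X-zero {u} e with Finite._≟_ K² u 0²
        ... | yes _ = refl
        ... | no n  = ⊥-elim (n e)
        fixed-by-zero : ∀ u → L (X u) ≡ 0v → u ≡ 0²
        fixed-by-zero u z = U-∈ (S.square-injective (subst (_∈²⟨ p , q ⟩) (trans (cong (λ l → l ∙ U u ⊕ U u ∙ U u) z) (trans (cong (_⊕ U u ∙ U u) (0-∙ _)) (⊕-identityˡ _))) (X-fixes u)))
        -- By `dependent-∈`, if one nonzero point fixes u and u′ then u, u′ or u + u′ vanishes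
        -- modulo the line; in the first two cases the point would be 0.
        X-injective : ∀ {u u′} → X u ≡ X u′ → u ≡ u′
        X-injective {u} {u′} e with L (X u) ≟ᵛ 0v
        ... | yes z = trans (fixed-by-zero u z) (sym (fixed-by-zero u′ (trans (cong L (sym e)) z)))
        ... | no n with dependent-∈ {l = U u} {U u′} S (_ , _ , refl) n (X-fixes u) (subst (λ l → L l ∙ U u′ ⊕ U u′ ∙ U u′ ∈²⟨ p , q ⟩) (sym e) (X-fixes u′))
        ...   | inj₁ h        = ⊥-elim (n (trans (cong L (X-zero (U-∈ h))) (zero² p q)))
        ...   | inj₂ (inj₁ h) = ⊥-elim (n (trans (cong L (trans e (X-zero (U-∈ h)))) (zero² p q)))
        ...   | inj₂ (inj₂ h) = +²⇒≡ (U-∈ (subst (_∈⟨ p , q ⟩) (combine-+² c₁ c₂ u u′) h))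
        conclude : (∃ λ u → X u ≡ (1# , 0#)) → _
        conclude (u , e) = U u , (λ h → 1≢0 (cong proj₁ (trans (sym e) (X-zero (U-∈ h))))) ,
          subst (_∈²⟨ p , q ⟩) (begin
            L (X u) ∙ U u ⊕ U u ∙ U u ≡⟨ cong (λ l → L l ∙ U u ⊕ U u ∙ U u) e ⟩
            (1# · p ⊕ 0# · q) ∙ U u ⊕ U u ∙ U u ≡⟨ bilinear ((con true ⊡ at x₀ ⊞ con false ⊡ at x₁) ⊠ at x₂ ⊞ at x₂ ⊠ at x₂) (at x₂ ⊠ at x₂ ⊞ at x₀ ⊠ at x₂) [] (p ∷ q ∷ U u ∷ []) ⟩
            U u ∙ U u ⊕ p ∙ U u ∎) (X-fixes u)
          where open ≡-Reasoning

      free : ∀ {v c} → Basis p q v c → Free p q v c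
      free {v} {c} B r r′ (a , b , e) = proj₂ (B {a} {b} {r} {r′} (trans (linear (var x₀ ⊡ at x₀ ⊞ var x₁ ⊡ at x₁ ⊞ var x₂ ⊡ at x₂ ⊞ var x₃ ⊡ at x₃) ((var x₂ ⊡ at x₂ ⊞ var x₃ ⊡ at x₃) ⊞ (var x₀ ⊡ at x₀ ⊞ var x₁ ⊡ at x₁)) (a ∷ b ∷ r ∷ r′ ∷ []) (p ∷ q ∷ v ∷ c ∷ [])) (≡⇒⊕ e)))

      -- Artin–Schreier normalisation of a second direction: c² ≡ pc + εpv modulo the squares of ⟨p,q⟩.
      second-direction : ∀ {v} → ¬ (v ∈⟨ p , q ⟩) → v ∙ v ⊕ p ∙ v ∈²⟨ p , q ⟩ →
        ∃ λ c → Free p q v c × c ∙ c ⊕ (p ∙ c ⊕ ε · (p ∙ v)) ∈²⟨ p , q ⟩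
      second-direction {v} v∉ vv = go (proj₁ completion) (free (proj₂ completion))
        where
        open ≡-Reasoning
        completion : ∃ λ c → Basis p q v c
        completion = complete-basis S.independent v∉
        go : ∀ c → Free p q v c → ∃ λ c → Free p q v c × c ∙ c ⊕ (p ∙ c ⊕ ε · (p ∙ v)) ∈²⟨ p , q ⟩
        go c fr = normalise-μ (mod-coordinates fr (c ∙ c))
          where
          normalise-μ : (∃₂ λ μ l → c ∙ c ⊕ (μ · (p ∙ v) ⊕ l · (p ∙ c)) ∈²⟨ p , q ⟩) → _
          normalise-μ (μ , l , cc) = shift (halve (i * i * μ))
            where
            -- For l = 0, c ∙ c is congruent to μ (p ∙ v), hence to the square of sqrt μ · v, which
            -- puts sqrt μ · v + c on the line.
            l≢0 : l ≢ 0#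
            l≢0 refl = 1≢0 (proj₂ (fr (sqrt μ) 1# (S.square-injective (subst (_∈²⟨ p , q ⟩) (begin
              (c ∙ c ⊕ (μ · (p ∙ v) ⊕ 0# · (p ∙ c))) ⊕ μ · (v ∙ v ⊕ p ∙ v)
                ≡⟨ bilinear ((at x₂ ⊠ at x₂ ⊞ (var x₀ ⊡ (at x₀ ⊠ at x₁) ⊞ con false ⊡ (at x₀ ⊠ at x₂))) ⊞ var x₀ ⊡ (at x₁ ⊠ at x₁ ⊞ at x₀ ⊠ at x₁)) (var x₀ ⊡ (at x₁ ⊠ at x₁) ⊞ at x₂ ⊠ at x₂) (μ ∷ []) (p ∷ v ∷ c ∷ []) ⟩
              μ · (v ∙ v) ⊕ c ∙ c ≡⟨ cong (λ m → m · (v ∙ v) ⊕ c ∙ c) (sym (sqrt-square μ)) ⟩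
              (sqrt μ * sqrt μ) · (v ∙ v) ⊕ c ∙ c ≡⟨ bilinear ((var x₀ :* var x₀) ⊡ (at x₀ ⊠ at x₀) ⊞ at x₁ ⊠ at x₁) ((var x₀ ⊡ at x₀ ⊞ con true ⊡ at x₁) ⊠ (var x₀ ⊡ at x₀ ⊞ con true ⊡ at x₁)) (sqrt μ ∷ []) (v ∷ c ∷ []) ⟩
              (sqrt μ · v ⊕ 1# · c) ∙ (sqrt μ · v ⊕ 1# · c) ∎) (∈²-⊕ cc (∈²-· μ vv))))))
            i : K
            i = inv l
            il : i * l ≡ 1#
            il = trans (*-comm i l) (inverse l l≢0)
            module _ (s : K) where
              c′ : V
              c′ = i · c ⊕ s · v
              c′c′ : c′ ∙ c′ ⊕ (p ∙ c′ ⊕ (i * i * μ + (s * s + s)) · (p ∙ v)) ∈²⟨ p , q ⟩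
              c′c′ = subst (_∈²⟨ p , q ⟩) (begin
                (i * i) · (c ∙ c ⊕ (μ · (p ∙ v) ⊕ l · (p ∙ c))) ⊕ (s * s) · (v ∙ v ⊕ p ∙ v)
                  ≡⟨ bilinear (I :* I ⊡ (at x₂ ⊠ at x₂ ⊞ (M ⊡ (at x₀ ⊠ at x₁) ⊞ L ⊡ (at x₀ ⊠ at x₂))) ⊞ (s′ :* s′) ⊡ (at x₁ ⊠ at x₁ ⊞ at x₀ ⊠ at x₁))
                        ((C ⊠ C ⊞ (at x₀ ⊠ C ⊞ (I :* I :* M :+ (s′ :* s′ :+ s′)) ⊡ (at x₀ ⊠ at x₁))) ⊞ (I :* (I :* L) :+ I) ⊡ (at x₀ ⊠ at x₂))
                        (i ∷ μ ∷ l ∷ s ∷ []) (p ∷ v ∷ c ∷ []) ⟩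
                (c′ ∙ c′ ⊕ (p ∙ c′ ⊕ (i * i * μ + (s * s + s)) · (p ∙ v))) ⊕ (i * (i * l) + i) · (p ∙ c)
                  ≡⟨ cong (λ t → (c′ ∙ c′ ⊕ (p ∙ c′ ⊕ (i * i * μ + (s * s + s)) · (p ∙ v))) ⊕ t · (p ∙ c)) (≡⇒+ (trans (cong (i *_) il) (trans (*-comm i 1#) (*-identityˡ i)))) ⟩
                (c′ ∙ c′ ⊕ (p ∙ c′ ⊕ (i * i * μ + (s * s + s)) · (p ∙ v))) ⊕ 0# · (p ∙ c) ≡⟨ trans (cong₂ _⊕_ refl (0-· _)) (⊕-identityʳ _) ⟩
                c′ ∙ c′ ⊕ (p ∙ c′ ⊕ (i * i * μ + (s * s + s)) · (p ∙ v)) ∎) (∈²-⊕ (∈²-· (i * i) cc) (∈²-· (s * s) vv))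
                where
                I M L s′ : Polynomial 4
                I = var x₀
                M = var x₁
                L = var x₂
                s′ = var x₃
                C : Expr 4 3
                C = I ⊡ at x₂ ⊞ s′ ⊡ at x₁
              free′ : Free p q v c′
              free′ r r′ h with fr (r + r′ * s) (r′ * i) (subst (_∈⟨ p , q ⟩) (linear (var x₀ ⊡ at x₀ ⊞ var x₁ ⊡ (var x₂ ⊡ at x₁ ⊞ var x₃ ⊡ at x₀)) ((var x₀ :+ var x₁ :* var x₃) ⊡ at x₀ ⊞ (var x₁ :* var x₂) ⊡ at x₁) (r ∷ r′ ∷ i ∷ s ∷ []) (v ∷ c ∷ [])) h)
              ... | e₁ , e₂ = trans (solve 3 (λ r t s → r := (r :+ t :* s) :+ t :* s) refl r r′ s) (trans (cong₂ _+_ e₁ (trans (cong (_* s) r′0) (zeroˡ s))) (+-self 0#)) , r′0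
                where
                r′0 : r′ ≡ 0#
                r′0 = begin
                  r′           ≡⟨ sym (trans (*-comm r′ 1#) (*-identityˡ r′)) ⟩
                  r′ * 1#      ≡⟨ cong (r′ *_) (sym il) ⟩
                  r′ * (i * l) ≡⟨ sym (*-assoc r′ i l) ⟩
                  r′ * i * l   ≡⟨ cong (_* l) e₂ ⟩
                  0# * l       ≡⟨ zeroˡ l ⟩
                  0#           ∎
            shift : (∃ λ s → s * s + s ≡ i * i * μ ⊎ s * s + s ≡ i * i * μ + ε) → _
            -- The coefficient of p ∙ v vanishes, so c′ would be a second direction fixed by p.
            shift (s , inj₁ e) = ⊥-elim (no-collision S {p} {v} {c′ s} {1#} {1#} (1# , 0# , linear (at x₀) (con true ⊡ at x₀ ⊞ con false ⊡ at x₁) [] (p ∷ q ∷ [])) S.p≢0 (free′ s)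
              (subst (_∈²⟨ p , q ⟩) (bilinear (at x₁ ⊠ at x₁ ⊞ at x₀ ⊠ at x₁) (at x₀ ⊠ at x₁ ⊞ con true ⊡ (at x₁ ⊠ at x₁)) [] (p ∷ v ∷ [])) vv)
              (subst (_∈²⟨ p , q ⟩) (trans (cong (λ t → c′ s ∙ c′ s ⊕ (p ∙ c′ s ⊕ t · (p ∙ v))) (≡⇒+ (sym e)))
                 (bilinear (at x₁ ⊠ at x₁ ⊞ (at x₀ ⊠ at x₁ ⊞ con false ⊡ (at x₀ ⊠ at x₂))) (at x₀ ⊠ at x₁ ⊞ con true ⊡ (at x₁ ⊠ at x₁)) [] (p ∷ c′ s ∷ v ∷ []))) (c′c′ s)))
            shift (s , inj₂ e) = c′ s , free′ s , subst (_∈²⟨ p , q ⟩) (cong (λ t → c′ s ∙ c′ s ⊕ (p ∙ c′ s ⊕ t · (p ∙ v)))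
                (trans (cong (i * i * μ +_) e) (solve 2 (λ a e → a :+ (a :+ e) := e) refl _ ε))) (c′c′ s)

  module Frames′ {𝔽 : Field₂} (A : Presemifield₂ 𝔽) where
    open Frames A public

    -- A special line ⟨p,q⟩ = ⟨p,x⟩ together with its action on the directions v, c modulo the line.
    record Frame (p x v c : V) (l m α β : K) : Set where
      field
        {q} : V
        special : Special p q
        x∈  : x ∈⟨ p , q ⟩
        ind : Independent p x
        fr  : Free p q v c
        xx  : x ∙ x ≡ l · (p ∙ x) ⊕ m · (p ∙ p)
        vv  : v ∙ v ⊕ p ∙ v ∈²⟨ p , q ⟩
        xv  : x ∙ v ⊕ (α · (p ∙ v) ⊕ p ∙ c) ∈²⟨ p , q ⟩
        xc  : x ∙ c ⊕ (β · (p ∙ v) ⊕ p ∙ c) ∈²⟨ p , q ⟩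
        cc  : c ∙ c ⊕ (p ∙ c ⊕ ε · (p ∙ v)) ∈²⟨ p , q ⟩

      p∈ : p ∈⟨ p , q ⟩
      p∈ = 1# , 0# , linear (at x₀) (con true ⊡ at x₀ ⊞ con false ⊡ at x₁) [] (p ∷ q ∷ [])

      images : ∀ s t → Images p q p x (p ∙ v) (p ∙ c) (s · v ⊕ t · c)
      images s t = record
        { s₁ = s * s + ε * (t * t) ; s₂ = t * t ; f₁ = s ; f₂ = t ; g₁ = α * s + β * t ; g₂ = s + t
        ; s = subst (_∈²⟨ p , q ⟩) (bilinear {4} {4}
                ((var x₀ :* var x₀) ⊡ (at x₂ ⊠ at x₂ ⊞ at x₀ ⊠ at x₂) ⊞ (var x₁ :* var x₁) ⊡ (at x₃ ⊠ at x₃ ⊞ (at x₀ ⊠ at x₃ ⊞ var x₂ ⊡ (at x₀ ⊠ at x₂))))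
                (U ⊠ U ⊞ ((var x₀ :* var x₀ :+ var x₂ :* (var x₁ :* var x₁)) ⊡ (at x₀ ⊠ at x₂) ⊞ (var x₁ :* var x₁) ⊡ (at x₀ ⊠ at x₃)))
                (s ∷ t ∷ ε ∷ 0# ∷ []) (p ∷ x ∷ v ∷ c ∷ [])) (∈²-⊕ (∈²-· (s * s) vv) (∈²-· (t * t) cc))
        ; f = subst (_∈²⟨ p , q ⟩) (bilinear {4} {4} (con false ⊡ (at x₀ ⊠ at x₀)) (at x₀ ⊠ U ⊞ (var x₀ ⊡ (at x₀ ⊠ at x₂) ⊞ var x₁ ⊡ (at x₀ ⊠ at x₃)))
                (s ∷ t ∷ ε ∷ 0# ∷ []) (p ∷ x ∷ v ∷ c ∷ [])) (∈²-· 0# (Special.pp∈² special))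
        ; g = subst (_∈²⟨ p , q ⟩) (bilinear {4} {4}
                (var x₀ ⊡ (at x₁ ⊠ at x₂ ⊞ (var x₂ ⊡ (at x₀ ⊠ at x₂) ⊞ at x₀ ⊠ at x₃)) ⊞ var x₁ ⊡ (at x₁ ⊠ at x₃ ⊞ (var x₃ ⊡ (at x₀ ⊠ at x₂) ⊞ at x₀ ⊠ at x₃)))
                (at x₁ ⊠ U ⊞ ((var x₂ :* var x₀ :+ var x₃ :* var x₁) ⊡ (at x₀ ⊠ at x₂) ⊞ (var x₀ :+ var x₁) ⊡ (at x₀ ⊠ at x₃)))
                (s ∷ t ∷ α ∷ β ∷ []) (p ∷ x ∷ v ∷ c ∷ [])) (∈²-⊕ (∈²-· s xv) (∈²-· t xc))
        }
        where
        U : Expr 4 4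
        U = var x₀ ⊡ at x₂ ⊞ var x₁ ⊡ at x₃

      -- The two polynomials are the determinants `N₁` and `N₂` of `images` for the points p and x.
      -- They involve α and β only, so this constrains the action on the quotient before l and m are
      -- considered.
      no-crossings : ∀ {s t s′ t′} → s * t′ + t * s′ ≢ 0# →
        let N₁ s t = (s * s + ε * (t * t)) * t + t * t * s
            N₂ s t = (s * s + ε * (t * t)) * (s + t) + t * t * (α * s + β * t)
        in N₁ s t * N₂ s′ t′ ≢ N₂ s t * N₁ s′ t′
      no-crossings {s} {t} {s′} {t′} d e = no-crossing special p∈ x∈ ind free′ (images s t) (images s′ t′) e
        where
        free′ : Free p q (s · v ⊕ t · c) (s′ · v ⊕ t′ · c)
        free′ r r′ h with fr (r * s + r′ * s′) (r * t + r′ * t′) (subst (_∈⟨ p , q ⟩) (linear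
            (var x₀ ⊡ (var x₂ ⊡ at x₀ ⊞ var x₃ ⊡ at x₁) ⊞ var x₁ ⊡ (var x₄ ⊡ at x₀ ⊞ var x₅ ⊡ at x₁))
            ((var x₀ :* var x₂ :+ var x₁ :* var x₄) ⊡ at x₀ ⊞ (var x₀ :* var x₃ :+ var x₁ :* var x₅) ⊡ at x₁)
            (r ∷ r′ ∷ s ∷ t ∷ s′ ∷ t′ ∷ []) (v ∷ c ∷ [])) h)
        ... | z₁ , z₂ =
          *-cancel d (trans (solve 6 (λ r r′ s t s′ t′ → (s :* t′ :+ t :* s′) :* r := (r :* s :+ r′ :* s′) :* t′ :+ (r :* t :+ r′ :* t′) :* s′) refl r r′ s t s′ t′)
                        (trans (cong₂ (λ x y → x * t′ + y * s′) z₁ z₂) (trans (cong₂ _+_ (zeroˡ _) (zeroˡ _)) (+-self 0#)))) ,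
          *-cancel d (trans (solve 6 (λ r r′ s t s′ t′ → (s :* t′ :+ t :* s′) :* r′ := (r :* s :+ r′ :* s′) :* t :+ (r :* t :+ r′ :* t′) :* s) refl r r′ s t s′ t′)
                        (trans (cong₂ (λ x y → x * t + y * s) z₁ z₂) (trans (cong₂ _+_ (zeroˡ _) (zeroˡ _)) (+-self 0#))))

      -- The expression is the determinant of p ∙ u and x ∙ u modulo the squares for u = s v + t c.
      -- Were it zero, a nonzero point of the line would send u into the squares, and `regular-∈`
      -- would put u on the line.
      no-kernel : ∀ {s t} → ¬ (s ≡ 0# × t ≡ 0#) → s * (s + t) + t * (α * s + β * t) ≢ 0#
      no-kernel {s} {t} nz e = kernel (common-kernel s (α * s + β * t) t (s + t) (+⇒≡ (trans (cong (s * (s + t) +_) (*-comm (α * s + β * t) t)) e)))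
        where
        module I = Images (images s t)
        u : V
        u = s · v ⊕ t · c
        kernel : (∃₂ λ a b → ¬ (a ≡ 0# × b ≡ 0#) × a * s + b * (α * s + β * t) ≡ 0# × a * t + b * (s + t) ≡ 0#) → ⊥
        kernel (a , b , ab , z₁ , z₂) = nz (fr s t (regular-∈ special (∈-⊕ (∈-· a p∈) (∈-· b x∈)) (λ z → ab (ind z)) (subst (_∈²⟨ p , q ⟩) (begin
          a · (p ∙ u ⊕ (s · (p ∙ v) ⊕ t · (p ∙ c))) ⊕ b · (x ∙ u ⊕ ((α * s + β * t) · (p ∙ v) ⊕ (s + t) · (p ∙ c)))
            ≡⟨ linear {6} {4} (var x₀ ⊡ (at x₀ ⊞ (var x₂ ⊡ at x₂ ⊞ var x₃ ⊡ at x₃)) ⊞ var x₁ ⊡ (at x₁ ⊞ (var x₄ ⊡ at x₂ ⊞ var x₅ ⊡ at x₃)))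
                 ((var x₀ ⊡ at x₀ ⊞ var x₁ ⊡ at x₁) ⊞ ((var x₀ :* var x₂ :+ var x₁ :* var x₄) ⊡ at x₂ ⊞ (var x₀ :* var x₃ :+ var x₁ :* var x₅) ⊡ at x₃))
                 (a ∷ b ∷ s ∷ t ∷ α * s + β * t ∷ s + t ∷ []) (p ∙ u ∷ x ∙ u ∷ p ∙ v ∷ p ∙ c ∷ []) ⟩
          (a · (p ∙ u) ⊕ b · (x ∙ u)) ⊕ ((a * s + b * (α * s + β * t)) · (p ∙ v) ⊕ (a * t + b * (s + t)) · (p ∙ c))
            ≡⟨ ⊕-absorb (trans (cong₂ (λ y z → y · (p ∙ v) ⊕ z · (p ∙ c)) z₁ z₂) (trans (cong₂ _⊕_ (0-· _) (0-· _)) (⊕-self 0v))) ⟩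
          a · (p ∙ u) ⊕ b · (x ∙ u) ≡⟨ sym (trans (⊕-∙ _ _ u) (cong₂ _⊕_ (·-∙ a p u) (·-∙ b x u))) ⟩
          (a · p ⊕ b · x) ∙ u ∎) (∈²-⊕ (∈²-· a I.f) (∈²-· b I.g)))))
          where open ≡-Reasoning

      -- A root r factors the relation for x ∙ x into (x + r p) ∙ (x + (r + l) p) = 0.
      irreducible : ∀ r → r * r + l * r + m ≢ 0#
      irreducible r e = [ (λ z → contradiction-with r z) , (λ z → contradiction-with (r + l) z) ] (zero-product {x ⊕ r · p} {x ⊕ (r + l) · p} (begin
        (x ⊕ r · p) ∙ (x ⊕ (r + l) · p)
          ≡⟨ bilinear ((at x₁ ⊞ var x₀ ⊡ at x₀) ⊠ (at x₁ ⊞ (var x₀ :+ var x₁) ⊡ at x₀))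
                      (((var x₀ :* var x₀ :+ var x₁ :* var x₀ :+ var x₂) ⊡ (at x₀ ⊠ at x₀)) ⊞ (at x₁ ⊠ at x₁ ⊞ (var x₁ ⊡ (at x₀ ⊠ at x₁) ⊞ var x₂ ⊡ (at x₀ ⊠ at x₀)))) (r ∷ l ∷ m ∷ []) (p ∷ x ∷ []) ⟩
        (r * r + l * r + m) · (p ∙ p) ⊕ (x ∙ x ⊕ (l · (p ∙ x) ⊕ m · (p ∙ p))) ≡⟨ cong₂ _⊕_ (trans (cong (_· (p ∙ p)) e) (0-· _)) (≡⇒⊕ xx) ⟩
        0v ⊕ 0v ≡⟨ ⊕-self 0v ⟩
        0v ∎))
        where
        open ≡-Reasoning
        contradiction-with : ∀ r → x ⊕ r · p ≡ 0v → ⊥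
        contradiction-with r z = 1≢0 (proj₂ (ind (trans (linear (var x₀ ⊡ at x₀ ⊞ con true ⊡ at x₁) (at x₁ ⊞ var x₀ ⊡ at x₀) (r ∷ []) (p ∷ x ∷ [])) z)))

    exists-frame : ∀ {p} → p ≢ 0v → ∃ λ x → ∃₂ λ v c → ∃₂ λ l m → ∃₂ λ α β → Frame p x v c l m α β
    exists-frame {p} p≢0 = from-special (exists-special A p≢0)
      where
      from-special : (∃ λ q → Special p q) → _
      from-special (q , S) = from-direction (fixed-direction S (free S (proj₂ (complete-basis S.independent (proj₂ (outside₂ p q))))))
        where
        module S = Special S
        from-direction : (∃ λ v → ¬ (v ∈⟨ p , q ⟩) × v ∙ v ⊕ p ∙ v ∈²⟨ p , q ⟩) → _
        from-direction (v , v∉ , vv) = from-second (second-direction S v∉ vv)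
          where
          from-second : (∃ λ c → Free p q v c × c ∙ c ⊕ (p ∙ c ⊕ ε · (p ∙ v)) ∈²⟨ p , q ⟩) → _
          from-second (c , fr , cc) = from-matrix (mod-coordinates S fr (q ∙ v)) (mod-coordinates S fr (q ∙ c))
            where
            from-matrix : (∃₂ λ s t → q ∙ v ⊕ (s · (p ∙ v) ⊕ t · (p ∙ c)) ∈²⟨ p , q ⟩) →
                          (∃₂ λ s t → q ∙ c ⊕ (s · (p ∙ v) ⊕ t · (p ∙ c)) ∈²⟨ p , q ⟩) → _
            from-matrix (n₁₁ , n , qv) (n₁₂ , n₂₂ , qc) =
              x , v , c , i , i * i * (d * d + d + ε) , i * (n₁₁ + d) , i * n₁₂ , record
              { special = S
              ; x∈ = i * d , i , refl
              ; ind = λ {a} {b} e → ind (S.independent (trans (linear {4} {2} ((var x₀ :+ var x₁ :* (var x₂ :* var x₃)) ⊡ at x₀ ⊞ (var x₁ :* var x₂) ⊡ at x₁) (var x₀ ⊡ at x₀ ⊞ var x₁ ⊡ ((var x₂ :* var x₃) ⊡ at x₀ ⊞ var x₂ ⊡ at x₁)) (a ∷ b ∷ i ∷ d ∷ []) (p ∷ q ∷ [])) e))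
              ; fr = fr
              ; xx = ⊕⇒≡ (trans (bilinear (X ⊠ X ⊞ (I ⊡ (at x₀ ⊠ X) ⊞ (I :* I :* (D :* D :+ D :+ E)) ⊡ (at x₀ ⊠ at x₀)))
                        ((I :* I) ⊡ (at x₁ ⊠ at x₁ ⊞ (at x₀ ⊠ at x₁ ⊞ E ⊡ (at x₀ ⊠ at x₀)))) (i ∷ d ∷ ε ∷ n ∷ []) (p ∷ q ∷ []))
                      (trans (cong ((i * i) ·_) (≡⇒⊕ S.square)) (·-0 _)))
              ; vv = vv
              ; xv = subst (_∈²⟨ p , q ⟩) (trans (bilinear {4} {4} (var x₀ ⊡ (at x₁ ⊠ at x₂ ⊞ (var x₁ ⊡ (at x₀ ⊠ at x₂) ⊞ var x₂ ⊡ (at x₀ ⊠ at x₃))))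
                        ((((var x₀ :* var x₃) ⊡ at x₀ ⊞ var x₀ ⊡ at x₁) ⊠ at x₂ ⊞ ((var x₀ :* (var x₁ :+ var x₃)) ⊡ (at x₀ ⊠ at x₂) ⊞ at x₀ ⊠ at x₃)) ⊞ (con true :+ var x₀ :* var x₂) ⊡ (at x₀ ⊠ at x₃))
                        (i ∷ n₁₁ ∷ n ∷ d ∷ []) (p ∷ q ∷ v ∷ c ∷ [])) (⊕-absorb (trans (cong (_· (p ∙ c)) (trans (cong (1# +_) in1) (+-self 1#))) (0-· _))))
                      (∈²-· i qv)
              ; xc = subst (_∈²⟨ p , q ⟩) (trans (bilinear {4} {4} (var x₀ ⊡ (at x₁ ⊠ at x₃ ⊞ (var x₁ ⊡ (at x₀ ⊠ at x₂) ⊞ var x₂ ⊡ (at x₀ ⊠ at x₃))))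
                        ((((var x₀ :* (var x₂ :+ var x₃)) ⊡ at x₀ ⊞ var x₀ ⊡ at x₁) ⊠ at x₃ ⊞ ((var x₀ :* var x₁) ⊡ (at x₀ ⊠ at x₂) ⊞ at x₀ ⊠ at x₃)) ⊞ (con true :+ var x₀ :* var x₃) ⊡ (at x₀ ⊠ at x₃))
                        (i ∷ n₁₂ ∷ n₂₂ ∷ n ∷ []) (p ∷ q ∷ v ∷ c ∷ [])) (⊕-absorb (trans (cong (_· (p ∙ c)) (trans (cong (1# +_) in1) (+-self 1#))) (0-· _))))
                      (∈²-· i qc)
              ; cc = cc
              }
              where
              -- For n = 0 the nonzero point n₁₁ p + q would send v into the squares.
              n≢0 : n ≢ 0#
              n≢0 refl = v∉ (regular-∈ S (n₁₁ , 1# , refl) (λ z → 1≢0 (proj₂ (S.independent z)))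
                (subst (_∈²⟨ p , q ⟩) (bilinear (at x₁ ⊠ at x₂ ⊞ (var x₀ ⊡ (at x₀ ⊠ at x₂) ⊞ con false ⊡ (at x₀ ⊠ at x₃))) ((var x₀ ⊡ at x₀ ⊞ con true ⊡ at x₁) ⊠ at x₂) (n₁₁ ∷ []) (p ∷ q ∷ v ∷ c ∷ [])) qv))
              i d : K
              i = inv n
              d = n₂₂ + n
              in1 : i * n ≡ 1#
              in1 = trans (*-comm i n) (inverse n n≢0)
              -- The factor i makes the coefficient of p ∙ c in x ∙ v equal to 1; the summand d p
              -- then does the same for x ∙ c.
              x : V
              x = (i * d) · p ⊕ i · q
              I D E : Polynomial 4
              I = var x₀
              D = var x₁
              E = var x₂
              X : Expr 4 2
              X = (I :* D) ⊡ at x₀ ⊞ I ⊡ at x₁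
              ind : ∀ {a b} → a + b * (i * d) ≡ 0# × b * i ≡ 0# → a ≡ 0# × b ≡ 0#
              ind {a} {b} (e , e′) = trans (solve 2 (λ a t → a := (a :+ t) :+ t) refl a _) (trans (cong₂ _+_ e (trans (cong (_* (i * d)) b0) (zeroˡ _))) (+-self 0#)) , b0
                where
                b0 : b ≡ 0#
                b0 = begin
                  b           ≡⟨ sym (trans (*-comm b 1#) (*-identityˡ b)) ⟩
                  b * 1#      ≡⟨ cong (b *_) (sym in1) ⟩
                  b * (i * n) ≡⟨ sym (*-assoc b i n) ⟩
                  b * i * n   ≡⟨ cong (_* n) e′ ⟩
                  0# * n      ≡⟨ zeroˡ n ⟩
                  0#          ∎
                  where open ≡-Reasoning

  -- Normal forms: changing the base point and lifting congruences to equations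

  module NormalForms {𝔽 : Field₂} (A : Presemifield₂ 𝔽) where
    open Frames′ A public

    -- Changing the base point of the line to ap + bx, compatibly with the field of multiplications on the quotient.
    rebase-frame : ∀ {p x v c l m} (a b m′ : K) → norm a b ≢ 0# →
      (a + b) * (a + b) * l ≡ a * (a + b) + b * (ε * b) + b * (a + b) * l + m′ * (b * b * l) →
      ε * b * (ε * b) + (a + b) * (a + b) * m ≡ a * (ε * b) + b * (a + b) * m + m′ * (a * a + b * b * m) →
      Frame p x v c l m 0# ε →
      Frame (a · p ⊕ b · x) ((ε * b) · p ⊕ (a + b) · x) (a · v ⊕ b · c) ((ε * b) · v ⊕ (a + b) · c) 1# m′ 0# ε
    rebase-frame {p} {x} {v} {c} {l} {m} a b m′ n≢0 E₁ E₂ F = move (rebase-at F.special (in-pq a b) p′≢0)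
      where
      module F = Frame F
      module S = Special F.special
      open ≡-Reasoning
      a′ b′ e′ : Polynomial 3
      a′ = var x₀
      b′ = var x₁
      e′ = var x₂
      P X W C : Expr 3 4
      P = a′ ⊡ at x₀ ⊞ b′ ⊡ at x₁
      X = (e′ :* b′) ⊡ at x₀ ⊞ (a′ :+ b′) ⊡ at x₁
      W = a′ ⊡ at x₂ ⊞ b′ ⊡ at x₃
      C = (e′ :* b′) ⊡ at x₂ ⊞ (a′ :+ b′) ⊡ at x₃
      Tvv Txv Txc Tcc : Expr² 3 4
      Tvv = at x₂ ⊠ at x₂ ⊞ at x₀ ⊠ at x₂
      Txv = at x₁ ⊠ at x₂ ⊞ (con false ⊡ (at x₀ ⊠ at x₂) ⊞ at x₀ ⊠ at x₃)
      Txc = at x₁ ⊠ at x₃ ⊞ (e′ ⊡ (at x₀ ⊠ at x₂) ⊞ at x₀ ⊠ at x₃)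
      Tcc = at x₃ ⊠ at x₃ ⊞ (at x₀ ⊠ at x₃ ⊞ e′ ⊡ (at x₀ ⊠ at x₂))
      ρ : Vec K 3
      ρ = a ∷ b ∷ ε ∷ []
      as : Vec V 4
      as = p ∷ x ∷ v ∷ c ∷ []
      p′ x′ : V
      p′ = a · p ⊕ b · x
      x′ = (ε * b) · p ⊕ (a + b) · x
      solve₂ : ∀ {r r′} → r * a + r′ * (ε * b) ≡ 0# × r * b + r′ * (a + b) ≡ 0# → r ≡ 0# × r′ ≡ 0#
      solve₂ {r} {r′} (e , e″) =
        *-cancel n≢0 (begin
          norm a b * r ≡⟨ solve 5 (λ a b r s e → (a :* a :+ a :* b :+ e :* (b :* b)) :* r := (r :* a :+ s :* (e :* b)) :* (a :+ b) :+ (r :* b :+ s :* (a :+ b)) :* (e :* b)) refl a b r r′ ε ⟩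
          (r * a + r′ * (ε * b)) * (a + b) + (r * b + r′ * (a + b)) * (ε * b) ≡⟨ cong₂ (λ s t → s * (a + b) + t * (ε * b)) e e″ ⟩
          0# * (a + b) + 0# * (ε * b) ≡⟨ trans (cong₂ _+_ (zeroˡ _) (zeroˡ _)) (+-self 0#) ⟩
          0# ∎) ,
        *-cancel n≢0 (begin
          norm a b * r′ ≡⟨ solve 5 (λ a b r s e → (a :* a :+ a :* b :+ e :* (b :* b)) :* s := (r :* a :+ s :* (e :* b)) :* b :+ (r :* b :+ s :* (a :+ b)) :* a) refl a b r r′ ε ⟩
          (r * a + r′ * (ε * b)) * b + (r * b + r′ * (a + b)) * a ≡⟨ cong₂ (λ s t → s * b + t * a) e e″ ⟩
          0# * b + 0# * a ≡⟨ trans (cong₂ _+_ (zeroˡ _) (zeroˡ _)) (+-self 0#) ⟩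
          0# ∎)
      regroup : ∀ r r′ u w → r · (a · u ⊕ b · w) ⊕ r′ · ((ε * b) · u ⊕ (a + b) · w) ≡ (r * a + r′ * (ε * b)) · u ⊕ (r * b + r′ * (a + b)) · w
      regroup r r′ u w = linear (var x₃ ⊡ (var x₀ ⊡ at x₀ ⊞ var x₁ ⊡ at x₁) ⊞ var x₄ ⊡ ((var x₂ :* var x₁) ⊡ at x₀ ⊞ (var x₀ :+ var x₁) ⊡ at x₁))
        ((var x₃ :* var x₀ :+ var x₄ :* (var x₂ :* var x₁)) ⊡ at x₀ ⊞ (var x₃ :* var x₁ :+ var x₄ :* (var x₀ :+ var x₁)) ⊡ at x₁) (a ∷ b ∷ ε ∷ r ∷ r′ ∷ []) (u ∷ w ∷ [])
      ind′ : Independent p′ x′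
      ind′ {r} {r′} z = solve₂ (F.ind (trans (sym (regroup r r′ p x)) z))
      -- After x ∙ x is eliminated, the coefficients of p ∙ x and p ∙ p in this relation are the two
      -- sides compared by `E₁` and `E₂`.
      xx′ : x′ ∙ x′ ≡ 1# · (p′ ∙ x′) ⊕ m′ · (p′ ∙ p′)
      xx′ = ⊕⇒≡ (begin
        x′ ∙ x′ ⊕ (1# · (p′ ∙ x′) ⊕ m′ · (p′ ∙ p′))
          ≡⟨ bilinear {6} {2} (X′ ⊠ X′ ⊞ (con true ⊡ (P′ ⊠ X′) ⊞ M ⊡ (P′ ⊠ P′)))
               ((((D :* D :* L) :+ (A′ :* D :+ B′ :* (E :* B′) :+ B′ :* D :* L :+ M :* (B′ :* B′ :* L))) ⊡ (at x₀ ⊠ at x₁)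
                 ⊞ ((E :* B′ :* (E :* B′) :+ D :* D :* N) :+ (A′ :* (E :* B′) :+ B′ :* D :* N :+ M :* (A′ :* A′ :+ B′ :* B′ :* N))) ⊡ (at x₀ ⊠ at x₀))
                 ⊞ (D :* D :+ B′ :* D :+ M :* (B′ :* B′)) ⊡ (at x₁ ⊠ at x₁ ⊞ (L ⊡ (at x₀ ⊠ at x₁) ⊞ N ⊡ (at x₀ ⊠ at x₀))))
               (a ∷ b ∷ ε ∷ l ∷ m ∷ m′ ∷ []) (p ∷ x ∷ []) ⟩
        _ ≡⟨ absorb _ (≡⇒⊕ F.xx) ⟩
        _ ≡⟨ cong₂ (λ s t → s · (p ∙ x) ⊕ t · (p ∙ p)) (≡⇒+ E₁) (≡⇒+ E₂) ⟩
        0# · (p ∙ x) ⊕ 0# · (p ∙ p) ≡⟨ trans (cong₂ _⊕_ (0-· _) (0-· _)) (⊕-self 0v) ⟩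
        0v ∎)
        where
        A′ B′ E L N M D : Polynomial 6
        A′ = var x₀
        B′ = var x₁
        E = var x₂
        L = var x₃
        N = var x₄
        M = var x₅
        D = A′ :+ B′
        P′ X′ : Expr 6 2
        P′ = A′ ⊡ at x₀ ⊞ B′ ⊡ at x₁
        X′ = (E :* B′) ⊡ at x₀ ⊞ D ⊡ at x₁
      p′≢0 : p′ ≢ 0v
      p′≢0 z = n≢0 (trans (cong₂ norm (proj₁ (F.ind z)) (proj₂ (F.ind z))) (solve 1 (λ e → con false :* con false :+ con false :* con false :+ e :* (con false :* con false) := con false) refl ε))
      in-pq : ∀ s t → s · p ⊕ t · x ∈⟨ p , F.q ⟩
      in-pq s t = ∈-⊕ (∈-· s F.p∈) (∈-· t F.x∈)
      move : (∃ λ q′ → Special p′ q′ × (∀ {u} → u ∈⟨ p , F.q ⟩ → u ∈⟨ p′ , q′ ⟩) × (∀ {u} → u ∈⟨ p′ , q′ ⟩ → u ∈⟨ p , F.q ⟩)) → Frame p′ x′ _ _ 1# m′ 0# ε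
      move (q′ , S′ , to , from) = record
        { special = S′
        ; x∈ = to (in-pq (ε * b) (a + b))
        ; ind = ind′
        ; fr = λ r r′ h → solve₂ (F.fr _ _ (subst (_∈⟨ p , F.q ⟩) (regroup r r′ v c) (from h)))
        ; xx = xx′
        ; vv = to² (subst (_∈²⟨ p , F.q ⟩) (bilinear ((a′ :* a′) ⊡ Tvv ⊞ (b′ :* b′) ⊡ Tcc ⊞ (a′ :* b′) ⊡ Txv ⊞ (b′ :* b′) ⊡ Txc) (W ⊠ W ⊞ P ⊠ W) ρ as)
                 (∈²-⊕ (∈²-⊕ (∈²-⊕ (∈²-· _ F.vv) (∈²-· _ F.cc)) (∈²-· _ F.xv)) (∈²-· _ F.xc)))
        ; xv = to² (subst (_∈²⟨ p , F.q ⟩) (bilinear ((a′ :* (a′ :+ b′) :+ b′ :* (e′ :* b′)) ⊡ Txv) (X ⊠ W ⊞ (con false ⊡ (P ⊠ W) ⊞ P ⊠ C)) ρ as) (∈²-· _ F.xv))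
        ; xc = to² (subst (_∈²⟨ p , F.q ⟩) (bilinear (((a′ :+ b′) :* (e′ :* b′) :+ e′ :* (a′ :* b′) :+ b′ :* (e′ :* b′)) ⊡ Txv ⊞ ((a′ :+ b′) :* (a′ :+ b′) :+ e′ :* (b′ :* b′) :+ b′ :* (a′ :+ b′)) ⊡ Txc)
                 (X ⊠ C ⊞ (e′ ⊡ (P ⊠ W) ⊞ P ⊠ C)) ρ as) (∈²-⊕ (∈²-· _ F.xv) (∈²-· _ F.xc)))
        ; cc = to² (subst (_∈²⟨ p , F.q ⟩) (bilinear ((e′ :* b′ :* (e′ :* b′)) ⊡ Tvv ⊞ ((a′ :+ b′) :* (a′ :+ b′)) ⊡ Tcc ⊞ (b′ :* (e′ :* b′) :+ e′ :* (a′ :* b′)) ⊡ Txv ⊞ (b′ :* (a′ :+ b′) :+ e′ :* (b′ :* b′)) ⊡ Txc)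
                 (C ⊠ C ⊞ (P ⊠ C ⊞ e′ ⊡ (P ⊠ W))) ρ as) (∈²-⊕ (∈²-⊕ (∈²-⊕ (∈²-· _ F.vv) (∈²-· _ F.cc)) (∈²-· _ F.xv)) (∈²-· _ F.xc)))
        }
        where
        to² : ∀ {w} → w ∈²⟨ p , F.q ⟩ → w ∈²⟨ p′ , q′ ⟩
        to² (n , n∈ , e) = n , to n∈ , e

    -- The congruences of a frame, made into equations by correcting v and c with vectors of the
    -- line. The constants χ and ψ are the line components left over; v ∙ z is not prescribed.
    record NormalBasis (p x v z : V) (l m τ β χ₁ χ₂ ψ₁ ψ₂ : K) : Set where
      field
        {q}   : V
        special : Special p q
        x∈    : x ∈⟨ p , q ⟩
        ∈-px  : ∀ {u} → u ∈⟨ p , q ⟩ → ∃₂ λ s t → u ≡ s · p ⊕ t · x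
        basis : Basis p x v z
        xx    : x ∙ x ≡ m · (p ∙ p) ⊕ l · (p ∙ x)
        xv    : x ∙ v ≡ p ∙ z
        xz    : x ∙ z ≡ χ₁ · (p ∙ p) ⊕ χ₂ · (p ∙ x) ⊕ β · (p ∙ v) ⊕ p ∙ z
        vv    : v ∙ v ≡ τ · (p ∙ x) ⊕ p ∙ v
        zz    : z ∙ z ≡ ψ₁ · (p ∙ p) ⊕ ψ₂ · (p ∙ x) ⊕ ε · (p ∙ v) ⊕ p ∙ z

    module _ {p x v c : V} {l m β : K} (F : Frame p x v c l m 0# β) where
      private
        module F = Frame F
        module S = Special F.special
        open ≡-Reasoning
        q : V
        q = F.q

        -- K is perfect, so r² + m always has a root.
        l≢0 : l ≢ 0#
        l≢0 refl = F.irreducible (sqrt m) (trans (cong (λ t → t + 0# * sqrt m + m) (sqrt-square m)) (solve 2 (λ m r → m :+ con false :* r :+ m := con false) refl m (sqrt m)))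

        λ⁻¹ : K
        λ⁻¹ = inv l

        lλ⁻¹ : l * λ⁻¹ ≡ 1#
        lλ⁻¹ = inverse l l≢0

        px-∈ : ∀ {u} → u ∈⟨ p , q ⟩ → ∃₂ λ s t → u ≡ s · p ⊕ t · x
        px-∈ (s , t , refl) = go F.x∈
          where
          go : x ∈⟨ p , q ⟩ → _
          go (x₁′ , x₂′ , e) = s + t * inv x₂′ * x₁′ , t * inv x₂′ , (begin
            s · p ⊕ t · q ≡⟨ cong (λ o → s · p ⊕ o · q) (trans (trans (sym (trans (*-comm t 1#) (*-identityˡ t))) (cong (t *_) (sym (trans (*-comm _ x₂′) (inverse x₂′ x₂≢0))))) (sym (*-assoc t _ _))) ⟩
            s · p ⊕ (t * inv x₂′ * x₂′) · q ≡⟨ linear {5} {2} (var x₀ ⊡ at x₀ ⊞ (var x₁ :* var x₂ :* var x₄) ⊡ at x₁)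
                 ((var x₀ :+ var x₁ :* var x₂ :* var x₃) ⊡ at x₀ ⊞ (var x₁ :* var x₂) ⊡ (var x₃ ⊡ at x₀ ⊞ var x₄ ⊡ at x₁)) (s ∷ t ∷ inv x₂′ ∷ x₁′ ∷ x₂′ ∷ []) (p ∷ q ∷ []) ⟩
            (s + t * inv x₂′ * x₁′) · p ⊕ (t * inv x₂′) · (x₁′ · p ⊕ x₂′ · q) ≡⟨ cong (λ o → (s + t * inv x₂′ * x₁′) · p ⊕ (t * inv x₂′) · o) (sym e) ⟩
            (s + t * inv x₂′ * x₁′) · p ⊕ (t * inv x₂′) · x ∎)
            where
            x₂≢0 : x₂′ ≢ 0#
            x₂≢0 refl = 1≢0 (proj₂ (F.ind {x₁′} {1#} (trans (cong (λ o → x₁′ · p ⊕ 1# · o) e) (trans (linear {1} {2} (var x₀ ⊡ at x₀ ⊞ con true ⊡ (var x₀ ⊡ at x₀ ⊞ con false ⊡ at x₁)) (con false ⊡ at x₀) (x₁′ ∷ []) (p ∷ q ∷ [])) (0-· p)))))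

        square-px : ∀ s t → (s · p ⊕ t · x) ∙ (s · p ⊕ t · x) ≡ (s * s + m * (t * t)) · (p ∙ p) ⊕ (l * (t * t)) · (p ∙ x)
        square-px s t = trans (bilinear {4} {2} ((var x₀ ⊡ at x₀ ⊞ var x₁ ⊡ at x₁) ⊠ (var x₀ ⊡ at x₀ ⊞ var x₁ ⊡ at x₁))
          (((var x₀ :* var x₀ :+ var x₃ :* (var x₁ :* var x₁)) ⊡ (at x₀ ⊠ at x₀) ⊞ (var x₂ :* (var x₁ :* var x₁)) ⊡ (at x₀ ⊠ at x₁))
            ⊞ (var x₁ :* var x₁) ⊡ (at x₁ ⊠ at x₁ ⊞ (var x₂ ⊡ (at x₀ ⊠ at x₁) ⊞ var x₃ ⊡ (at x₀ ⊠ at x₀)))) (s ∷ t ∷ l ∷ m ∷ []) (p ∷ x ∷ []))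
          (absorb _ (≡⇒⊕ F.xx))

        px-∈² : ∀ {w} → w ∈²⟨ p , q ⟩ → ∃₂ λ s t → w ≡ s · (p ∙ p) ⊕ t · (p ∙ x)
        px-∈² (n , n∈ , refl) with px-∈ n∈
        ... | s , t , refl = _ , _ , square-px s t

        pp∈² : p ∙ p ∈²⟨ p , q ⟩
        pp∈² = S.pp∈²

        px∈² : p ∙ x ∈²⟨ p , q ⟩
        px∈² = go F.x∈
          where
          go : x ∈⟨ p , q ⟩ → _
          go (s , t , e) = subst (λ o → p ∙ o ∈²⟨ p , q ⟩) (sym e) (subst (_∈²⟨ p , q ⟩) (bilinear {2} {2} (var x₀ ⊡ (at x₀ ⊠ at x₀) ⊞ var x₁ ⊡ (at x₀ ⊠ at x₁)) (at x₀ ⊠ (var x₀ ⊡ at x₀ ⊞ var x₁ ⊡ at x₁)) (s ∷ t ∷ []) (p ∷ q ∷ [])) (∈²-⊕ (∈²-· s S.pp∈²) (∈²-· t S.pq∈²)))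

        xx∈² : x ∙ x ∈²⟨ p , q ⟩
        xx∈² = x , F.x∈ , refl

        -- v ↦ v² + pv on the line misses (ε/l)·px; every square of the line is congruent to 0 or to that element.
        translate : ∀ τ₁ τ₂ → ∃₂ λ a b → a * a + a + m * (b * b) ≡ τ₁ × (l * (b * b) + b ≡ τ₂ ⊎ l * (b * b) + b ≡ τ₂ + ε * λ⁻¹)
        translate τ₁ τ₂ = go (halve (l * τ₂))
          where
          module _ (s : K) where
            b₀ : K
            b₀ = λ⁻¹ * s
            lb₀ : l * (b₀ * b₀) + b₀ ≡ λ⁻¹ * (s * s + s)
            lb₀ = trans (solve 3 (λ l i s → l :* (i :* s :* (i :* s)) :+ i :* s := l :* i :* (i :* (s :* s)) :+ i :* s) refl l λ⁻¹ s)
              (trans (cong (λ o → o * (λ⁻¹ * (s * s)) + λ⁻¹ * s) lλ⁻¹) (solve 2 (λ i s → con true :* (i :* (s :* s)) :+ i :* s := i :* (s :* s :+ s)) refl λ⁻¹ s))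
            shifted : l * ((b₀ + λ⁻¹) * (b₀ + λ⁻¹)) + (b₀ + λ⁻¹) ≡ l * (b₀ * b₀) + b₀
            shifted = trans (solve 3 (λ l b i → l :* ((b :+ i) :* (b :+ i)) :+ (b :+ i) := l :* (b :* b) :+ b :+ (l :* i :* i :+ i)) refl l b₀ λ⁻¹)
              (trans (cong (λ o → l * (b₀ * b₀) + b₀ + (o * λ⁻¹ + λ⁻¹)) lλ⁻¹) (solve 2 (λ t i → t :+ (con true :* i :+ i) := t) refl _ λ⁻¹))
            -- If t² + t were m/l², then l t would be a root of r² + l r + m.
            norm-shift : ∃ λ t → t * t + t ≡ m * (λ⁻¹ * λ⁻¹) + ε
            norm-shift with halve (m * (λ⁻¹ * λ⁻¹))
            ... | t , inj₂ e = t , e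
            ... | t , inj₁ e = ⊥-elim (F.irreducible (l * t) (begin
              l * t * (l * t) + l * (l * t) + m ≡⟨ solve 3 (λ l t m → l :* t :* (l :* t) :+ l :* (l :* t) :+ m := l :* l :* (t :* t :+ t) :+ m) refl l t m ⟩
              l * l * (t * t + t) + m ≡⟨ cong (λ o → l * l * o + m) e ⟩
              l * l * (m * (λ⁻¹ * λ⁻¹)) + m ≡⟨ solve 3 (λ l i m → l :* l :* (m :* (i :* i)) :+ m := l :* i :* (l :* i) :* m :+ m) refl l λ⁻¹ m ⟩
              l * λ⁻¹ * (l * λ⁻¹) * m + m ≡⟨ cong (λ o → o * o * m + m) lλ⁻¹ ⟩
              1# * 1# * m + m ≡⟨ solve 1 (λ m → con true :* con true :* m :+ m := con false) refl m ⟩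
              0# ∎))
            -- When `halve` leaves an ε in the equation for a, adding 1/l to b does not change l b²
            -- + b but changes m b² by m/l²; adding t to a then cancels both m/l² and ε.
            first : ∃₂ λ a b → a * a + a + m * (b * b) ≡ τ₁ × l * (b * b) + b ≡ λ⁻¹ * (s * s + s)
            first with halve (τ₁ + m * (b₀ * b₀))
            ... | a , inj₁ e = a , b₀ , trans (cong (_+ m * (b₀ * b₀)) e) (solve 2 (λ t u → t :+ u :+ u := t) refl τ₁ _) , lb₀
            ... | a , inj₂ e with norm-shift
            ...   | t , e′ = a + t , b₀ + λ⁻¹ , (begin
              (a + t) * (a + t) + (a + t) + m * ((b₀ + λ⁻¹) * (b₀ + λ⁻¹)) ≡⟨ solve 5 (λ a t m b i → (a :+ t) :* (a :+ t) :+ (a :+ t) :+ m :* ((b :+ i) :* (b :+ i)) := (a :* a :+ a) :+ (t :* t :+ t) :+ m :* (b :* b) :+ m :* (i :* i)) refl a t m b₀ λ⁻¹ ⟩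
              (a * a + a) + (t * t + t) + m * (b₀ * b₀) + m * (λ⁻¹ * λ⁻¹) ≡⟨ cong₂ (λ o o′ → o + o′ + m * (b₀ * b₀) + m * (λ⁻¹ * λ⁻¹)) e e′ ⟩
              (τ₁ + m * (b₀ * b₀) + ε) + (m * (λ⁻¹ * λ⁻¹) + ε) + m * (b₀ * b₀) + m * (λ⁻¹ * λ⁻¹) ≡⟨ solve 4 (λ t u e w → (t :+ u :+ e) :+ (w :+ e) :+ u :+ w := t) refl τ₁ _ ε _ ⟩
              τ₁ ∎) , trans shifted lb₀
          go : (∃ λ s → s * s + s ≡ l * τ₂ ⊎ s * s + s ≡ l * τ₂ + ε) → _
          go (s , inj₁ e) with first s
          ... | a , b , e₁ , e₂ = a , b , e₁ , inj₁ (trans e₂ (trans (cong (λ⁻¹ *_) e) (inv-cancel l≢0 τ₂)))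
          go (s , inj₂ e) with first s
          ... | a , b , e₁ , e₂ = a , b , e₁ , inj₂ (trans e₂ (trans (cong (λ⁻¹ *_) e) (trans (distribˡ _ _ _) (cong₂ _+_ (inv-cancel l≢0 τ₂) (*-comm λ⁻¹ ε)))))

        -- Here τ = ε/l originates: `translate` reduces v ∙ v + p ∙ v to 0 or to (ε/l) p ∙ x. The
        -- value 0 would give v′ ∙ (v′ + p) = 0 and put v on the line.
        shifted-v : ∃ λ n → n ∈⟨ p , q ⟩ × (v ⊕ n) ∙ (v ⊕ n) ≡ (ε * λ⁻¹) · (p ∙ x) ⊕ p ∙ (v ⊕ n)
        shifted-v with px-∈² F.vv
        ... | τ₁ , τ₂ , e with translate τ₁ τ₂
        ...   | a , b , e₁ , e₂ = n , ∈-⊕ (∈-· a F.p∈) (∈-· b F.x∈) , cases e₂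
          where
          n v′ : V
          n = a · p ⊕ b · x
          v′ = v ⊕ n
          value : v′ ∙ v′ ⊕ p ∙ v′ ≡ (τ₂ + (l * (b * b) + b)) · (p ∙ x)
          value = begin
            v′ ∙ v′ ⊕ p ∙ v′ ≡⟨ bilinear {2} {3} ((at x₂ ⊞ N) ⊠ (at x₂ ⊞ N) ⊞ at x₀ ⊠ (at x₂ ⊞ N)) (((at x₂ ⊠ at x₂ ⊞ at x₀ ⊠ at x₂) ⊞ N ⊠ N) ⊞ (var x₀ ⊡ (at x₀ ⊠ at x₀) ⊞ var x₁ ⊡ (at x₀ ⊠ at x₁))) (a ∷ b ∷ []) (p ∷ x ∷ v ∷ []) ⟩
            ((v ∙ v ⊕ p ∙ v) ⊕ n ∙ n) ⊕ (a · (p ∙ p) ⊕ b · (p ∙ x)) ≡⟨ cong₂ (λ s t → (s ⊕ t) ⊕ (a · (p ∙ p) ⊕ b · (p ∙ x))) e (square-px a b) ⟩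
            ((τ₁ · (p ∙ p) ⊕ τ₂ · (p ∙ x)) ⊕ ((a * a + m * (b * b)) · (p ∙ p) ⊕ (l * (b * b)) · (p ∙ x))) ⊕ (a · (p ∙ p) ⊕ b · (p ∙ x))
              ≡⟨ linear {6} {2} (((var x₂ ⊡ at x₀ ⊞ var x₃ ⊡ at x₁) ⊞ ((var x₀ :* var x₀ :+ var x₅ :* (var x₁ :* var x₁)) ⊡ at x₀ ⊞ (var x₄ :* (var x₁ :* var x₁)) ⊡ at x₁)) ⊞ (var x₀ ⊡ at x₀ ⊞ var x₁ ⊡ at x₁))
                   ((var x₂ :+ (var x₀ :* var x₀ :+ var x₀ :+ var x₅ :* (var x₁ :* var x₁))) ⊡ at x₀ ⊞ (var x₃ :+ (var x₄ :* (var x₁ :* var x₁) :+ var x₁)) ⊡ at x₁) (a ∷ b ∷ τ₁ ∷ τ₂ ∷ l ∷ m ∷ []) (p ∙ p ∷ p ∙ x ∷ []) ⟩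
            (τ₁ + (a * a + a + m * (b * b))) · (p ∙ p) ⊕ (τ₂ + (l * (b * b) + b)) · (p ∙ x) ≡⟨ cong (λ o → o · (p ∙ p) ⊕ (τ₂ + (l * (b * b) + b)) · (p ∙ x)) (≡⇒+ (sym e₁)) ⟩
            0# · (p ∙ p) ⊕ (τ₂ + (l * (b * b) + b)) · (p ∙ x) ≡⟨ trans (cong₂ _⊕_ (0-· _) refl) (⊕-identityˡ _) ⟩
            (τ₂ + (l * (b * b) + b)) · (p ∙ x) ∎
            where
            N : Expr 2 3
            N = var x₀ ⊡ at x₀ ⊞ var x₁ ⊡ at x₁
          v∉ : ¬ (v ∈⟨ p , q ⟩)
          v∉ = proj₁ (S.free-∉ F.fr)
          n∈ : n ∈⟨ p , q ⟩
          n∈ = ∈-⊕ (∈-· a F.p∈) (∈-· b F.x∈)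
          absurd : l * (b * b) + b ≡ τ₂ → ⊥
          absurd e₂ = [ (λ z → v∉ (subst (_∈⟨ p , q ⟩) (sym (⊕⇒≡ z)) n∈)) , (λ z → v∉ (subst (_∈⟨ p , q ⟩) (sym (⊕⇒≡ (trans (sym (⊕-assoc v n p)) z))) (∈-⊕ n∈ F.p∈))) ]
            (zero-product {v′} {v′ ⊕ p} (trans (trans (∙-⊕ v′ v′ p) (cong (v′ ∙ v′ ⊕_) (∙-comm v′ p))) (trans value (trans (cong (_· (p ∙ x)) (≡⇒+ (sym e₂))) (0-· _)))))
          done : l * (b * b) + b ≡ τ₂ + ε * λ⁻¹ → v′ ∙ v′ ≡ (ε * λ⁻¹) · (p ∙ x) ⊕ p ∙ v′
          done e₂ = ⊕⇒≡ (begin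
            v′ ∙ v′ ⊕ ((ε * λ⁻¹) · (p ∙ x) ⊕ p ∙ v′) ≡⟨ linear {1} {3} (at x₀ ⊞ (var x₀ ⊡ at x₂ ⊞ at x₁)) ((at x₀ ⊞ at x₁) ⊞ var x₀ ⊡ at x₂) (ε * λ⁻¹ ∷ []) (v′ ∙ v′ ∷ p ∙ v′ ∷ p ∙ x ∷ []) ⟩
            (v′ ∙ v′ ⊕ p ∙ v′) ⊕ (ε * λ⁻¹) · (p ∙ x) ≡⟨ cong₂ _⊕_ (trans value (cong (_· (p ∙ x)) (trans (cong (τ₂ +_) e₂) (solve 2 (λ t u → t :+ (t :+ u) := u) refl τ₂ _)))) refl ⟩
            (ε * λ⁻¹) · (p ∙ x) ⊕ (ε * λ⁻¹) · (p ∙ x) ≡⟨ ⊕-self _ ⟩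
            0v ∎)
          cases : l * (b * b) + b ≡ τ₂ ⊎ l * (b * b) + b ≡ τ₂ + ε * λ⁻¹ → v′ ∙ v′ ≡ (ε * λ⁻¹) · (p ∙ x) ⊕ p ∙ v′
          cases (inj₁ z) = ⊥-elim (absurd z)
          cases (inj₂ z) = done z

      -- z is defined by p ∙ z = x ∙ v′. By `regular` it differs from c by a vector of the line, so
      -- the congruences for x ∙ c and c ∙ c carry over to z and only their line components remain
      -- to be named.
      normal-basis : ∃₂ λ v′ z → ∃₂ λ χ₁ χ₂ → ∃₂ λ ψ₁ ψ₂ → NormalBasis p x v′ z l m (ε * inv l) β χ₁ χ₂ ψ₁ ψ₂
      normal-basis = with-v shifted-v
        where
        with-v : (∃ λ n → n ∈⟨ p , q ⟩ × (v ⊕ n) ∙ (v ⊕ n) ≡ (ε * λ⁻¹) · (p ∙ x) ⊕ p ∙ (v ⊕ n)) → _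
        with-v (n , n∈ , vv′) = with-z (∙-surjective S.p≢0 (x ∙ v′))
          where
          v′ : V
          v′ = v ⊕ n
          products : ∀ {k} → k ∈⟨ p , q ⟩ → (x ∙ k ∈²⟨ p , q ⟩) × (p ∙ k ∈²⟨ p , q ⟩)
          products k∈ with px-∈ k∈
          ... | s , t , refl =
            subst (_∈²⟨ p , q ⟩) (bilinear {2} {2} (var x₀ ⊡ (at x₀ ⊠ at x₁) ⊞ var x₁ ⊡ (at x₁ ⊠ at x₁)) (at x₁ ⊠ (var x₀ ⊡ at x₀ ⊞ var x₁ ⊡ at x₁)) (s ∷ t ∷ []) (p ∷ x ∷ [])) (∈²-⊕ (∈²-· s px∈²) (∈²-· t xx∈²)) ,
            subst (_∈²⟨ p , q ⟩) (bilinear {2} {2} (var x₀ ⊡ (at x₀ ⊠ at x₀) ⊞ var x₁ ⊡ (at x₀ ⊠ at x₁)) (at x₀ ⊠ (var x₀ ⊡ at x₀ ⊞ var x₁ ⊡ at x₁)) (s ∷ t ∷ []) (p ∷ x ∷ [])) (∈²-⊕ (∈²-· s pp∈²) (∈²-· t px∈²))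
          with-z : (∃ λ z → p ∙ z ≡ x ∙ v′) → _
          with-z (z , pz) = assemble (px-∈² xz) (px-∈² zz)
            where
            k : V
            k = z ⊕ c
            k∈ : k ∈⟨ p , q ⟩
            k∈ = S.regular (subst (_∈²⟨ p , q ⟩) (begin
              (x ∙ v ⊕ (0# · (p ∙ v) ⊕ p ∙ c)) ⊕ x ∙ n ≡⟨ bilinear {0} {5} ((at x₁ ⊠ at x₂ ⊞ (con false ⊡ (at x₀ ⊠ at x₂) ⊞ at x₀ ⊠ at x₃)) ⊞ at x₁ ⊠ at x₄) (at x₁ ⊠ (at x₂ ⊞ at x₄) ⊞ at x₀ ⊠ at x₃) [] (p ∷ x ∷ v ∷ c ∷ n ∷ []) ⟩
              x ∙ v′ ⊕ p ∙ c ≡⟨ cong (_⊕ p ∙ c) (sym pz) ⟩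
              p ∙ z ⊕ p ∙ c ≡⟨ sym (∙-⊕ p z c) ⟩
              p ∙ k ∎) (∈²-⊕ F.xv (proj₁ (products n∈))))
            xz : x ∙ z ⊕ (β · (p ∙ v′) ⊕ p ∙ z) ∈²⟨ p , q ⟩
            xz = subst (_∈²⟨ p , q ⟩) (bilinear {1} {6}
              (((at x₁ ⊠ at x₃ ⊞ (var x₀ ⊡ (at x₀ ⊠ at x₂) ⊞ at x₀ ⊠ at x₃)) ⊞ at x₁ ⊠ (at x₅ ⊞ at x₃)) ⊞ var x₀ ⊡ (at x₀ ⊠ at x₄) ⊞ at x₀ ⊠ (at x₅ ⊞ at x₃))
              (at x₁ ⊠ at x₅ ⊞ (var x₀ ⊡ (at x₀ ⊠ (at x₂ ⊞ at x₄)) ⊞ at x₀ ⊠ at x₅)) (β ∷ []) (p ∷ x ∷ v ∷ c ∷ n ∷ z ∷ []))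
              (∈²-⊕ (∈²-⊕ (∈²-⊕ F.xc (proj₁ (products k∈))) (∈²-· β (proj₂ (products n∈)))) (proj₂ (products k∈)))
            zz : z ∙ z ⊕ (p ∙ z ⊕ ε · (p ∙ v′)) ∈²⟨ p , q ⟩
            zz = subst (_∈²⟨ p , q ⟩) (bilinear {1} {6}
              (((at x₃ ⊠ at x₃ ⊞ (at x₀ ⊠ at x₃ ⊞ var x₀ ⊡ (at x₀ ⊠ at x₂))) ⊞ (at x₅ ⊞ at x₃) ⊠ (at x₅ ⊞ at x₃)) ⊞ var x₀ ⊡ (at x₀ ⊠ at x₄) ⊞ at x₀ ⊠ (at x₅ ⊞ at x₃))
              (at x₅ ⊠ at x₅ ⊞ (at x₀ ⊠ at x₅ ⊞ var x₀ ⊡ (at x₀ ⊠ (at x₂ ⊞ at x₄)))) (ε ∷ []) (p ∷ x ∷ v ∷ c ∷ n ∷ z ∷ []))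
              (∈²-⊕ (∈²-⊕ (∈²-⊕ F.cc (k , k∈ , refl)) (∈²-· ε (proj₂ (products n∈)))) (proj₂ (products k∈)))
            B : Basis p x v′ z
            B {r} {s} {t} {o} e = F.ind (trans (trans (linear (var x₀ ⊡ at x₀ ⊞ var x₁ ⊡ at x₁) (var x₀ ⊡ at x₀ ⊞ var x₁ ⊡ at x₁ ⊞ con false ⊡ at x₂ ⊞ con false ⊡ at x₃) (r ∷ s ∷ []) (p ∷ x ∷ v′ ∷ z ∷ []))
                (cong₂ (λ y y′ → r · p ⊕ s · x ⊕ y · v′ ⊕ y′ · z) (sym (proj₁ f)) (sym (proj₂ f)))) e) , f
              where
              f : t ≡ 0# × o ≡ 0#
              f = F.fr t o (subst (_∈⟨ p , q ⟩) (begin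
                (t · n ⊕ o · k) ⊕ (r · p ⊕ s · x) ≡⟨ sym (⊕-absorb e) ⟩
                ((t · n ⊕ o · k) ⊕ (r · p ⊕ s · x)) ⊕ (r · p ⊕ s · x ⊕ t · v′ ⊕ o · z)
                  ≡⟨ linear {4} {6} (((var x₂ ⊡ at x₄ ⊞ var x₃ ⊡ (at x₅ ⊞ at x₃)) ⊞ (var x₀ ⊡ at x₀ ⊞ var x₁ ⊡ at x₁)) ⊞ (var x₀ ⊡ at x₀ ⊞ var x₁ ⊡ at x₁ ⊞ var x₂ ⊡ (at x₂ ⊞ at x₄) ⊞ var x₃ ⊡ at x₅))
                       (var x₂ ⊡ at x₂ ⊞ var x₃ ⊡ at x₃) (r ∷ s ∷ t ∷ o ∷ []) (p ∷ x ∷ v ∷ c ∷ n ∷ z ∷ []) ⟩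
                t · v ⊕ o · c ∎) (∈-⊕ (∈-⊕ (∈-· t n∈) (∈-· o k∈)) (∈-⊕ (∈-· r F.p∈) (∈-· s F.x∈))))
            assemble : (∃₂ λ s t → x ∙ z ⊕ (β · (p ∙ v′) ⊕ p ∙ z) ≡ s · (p ∙ p) ⊕ t · (p ∙ x)) →
                       (∃₂ λ s t → z ∙ z ⊕ (p ∙ z ⊕ ε · (p ∙ v′)) ≡ s · (p ∙ p) ⊕ t · (p ∙ x)) → _
            assemble (χ₁ , χ₂ , e) (ψ₁ , ψ₂ , e′) = v′ , z , χ₁ , χ₂ , ψ₁ , ψ₂ , record
              { special = F.special
              ; x∈ = F.x∈
              ; ∈-px = px-∈
              ; basis = B
              ; xx = trans F.xx (⊕-comm _ _)
              ; xv = sym pz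
              ; xz = ⊕⇒≡ (trans (linear {3} {5} (at x₀ ⊞ (var x₀ ⊡ at x₃ ⊞ var x₁ ⊡ at x₄ ⊞ var x₂ ⊡ at x₁ ⊞ at x₂)) ((at x₀ ⊞ (var x₂ ⊡ at x₁ ⊞ at x₂)) ⊞ (var x₀ ⊡ at x₃ ⊞ var x₁ ⊡ at x₄))
                       (χ₁ ∷ χ₂ ∷ β ∷ []) (x ∙ z ∷ p ∙ v′ ∷ p ∙ z ∷ p ∙ p ∷ p ∙ x ∷ [])) (≡⇒⊕ e))
              ; vv = vv′
              ; zz = ⊕⇒≡ (trans (linear {3} {5} (at x₀ ⊞ (var x₀ ⊡ at x₃ ⊞ var x₁ ⊡ at x₄ ⊞ var x₂ ⊡ at x₁ ⊞ at x₂)) ((at x₀ ⊞ (at x₂ ⊞ var x₂ ⊡ at x₁)) ⊞ (var x₀ ⊡ at x₃ ⊞ var x₁ ⊡ at x₄))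
                       (ψ₁ ∷ ψ₂ ∷ ε ∷ []) (z ∙ z ∷ p ∙ v′ ∷ p ∙ z ∷ p ∙ p ∷ p ∙ x ∷ [])) (≡⇒⊕ e′))
              }

  -- Multiplication tables, and disjointness of special lines

  module Tables {𝔽 : Field₂} (A : Presemifield₂ 𝔽) where
    open NormalForms A public
    open Functionals 𝔽 public

    record Table (l m τ β χ₁ χ₂ ψ₁ ψ₂ : K) : Set where
      field
        {y}      : V
        identity : ∀ v → e₁ ∙ v ≡ v
        special  : Special e₁ y
        e₂∈      : e₂ ∈⟨ e₁ , y ⟩
        ∈-e₁e₂   : ∀ {u} → u ∈⟨ e₁ , y ⟩ → ∃₂ λ s t → u ≡ s · e₁ ⊕ t · e₂
        e₂e₂     : e₂ ∙ e₂ ≡ m · e₁ ⊕ l · e₂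
        e₂e₃     : e₂ ∙ e₃ ≡ e₄
        e₂e₄     : e₂ ∙ e₄ ≡ χ₁ · e₁ ⊕ χ₂ · e₂ ⊕ β · e₃ ⊕ e₄
        e₃e₃     : e₃ ∙ e₃ ≡ τ · e₂ ⊕ e₃
        e₄e₄     : e₄ ∙ e₄ ≡ ψ₁ · e₁ ⊕ ψ₂ · e₂ ⊕ ε · e₃ ⊕ e₄

    opaque
      unfolding e₁
      vec : K → K → K → K → V
      vec a b c d = a , b , c , d

      vec-≡ : ∀ a b c d → vec a b c d ≡ a · e₁ ⊕ b · e₂ ⊕ c · e₃ ⊕ d · e₄
      vec-≡ a b c d = coordinates a b c d

      vec-injective : ∀ {a b c d a′ b′ c′ d′} → vec a b c d ≡ vec a′ b′ c′ d′ → (a ≡ a′ × b ≡ b′) × (c ≡ c′ × d ≡ d′)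
      vec-injective refl = (refl , refl) , refl , refl

      vec-surjective : ∀ v → ∃₂ λ a b → ∃₂ λ c d → v ≡ vec a b c d
      vec-surjective (a , b , c , d) = a , b , c , d , refl

      vec-⊕ : ∀ a b c d a′ b′ c′ d′ → vec a b c d ⊕ vec a′ b′ c′ d′ ≡ vec (a + a′) (b + b′) (c + c′) (d + d′)
      vec-⊕ a b c d a′ b′ c′ d′ = trans (cong₂ _⊕_ (vec-≡ a b c d) (vec-≡ a′ b′ c′ d′)) (trans
        (linear ((var x₀ ⊡ at x₀ ⊞ var x₁ ⊡ at x₁ ⊞ var x₂ ⊡ at x₂ ⊞ var x₃ ⊡ at x₃) ⊞ (var x₄ ⊡ at x₀ ⊞ var x₅ ⊡ at x₁ ⊞ var x₆ ⊡ at x₂ ⊞ var x₇ ⊡ at x₃))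
                ((var x₀ :+ var x₄) ⊡ at x₀ ⊞ (var x₁ :+ var x₅) ⊡ at x₁ ⊞ (var x₂ :+ var x₆) ⊡ at x₂ ⊞ (var x₃ :+ var x₇) ⊡ at x₃)
                (a ∷ b ∷ c ∷ d ∷ a′ ∷ b′ ∷ c′ ∷ d′ ∷ []) (e₁ ∷ e₂ ∷ e₃ ∷ e₄ ∷ []))
        (sym (vec-≡ _ _ _ _)))

      vec-0 : vec 0# 0# 0# 0# ≡ 0v
      vec-0 = trans (vec-≡ _ _ _ _) (trans (linear {0} (con false ⊡ at x₀ ⊞ con false ⊡ at x₁ ⊞ con false ⊡ at x₂ ⊞ con false ⊡ at x₃) (con false ⊡ at x₀) [] (e₁ ∷ e₂ ∷ e₃ ∷ e₄ ∷ [])) (0-· e₁))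

    -- Adding the two quadratic relations gives (a + b) ∙ (a + b + n) = 0.
    special-unique : ∀ {n a b} → Special n a → Special n b → a ∈⟨ n , b ⟩
    special-unique {n} {a} {b} S S′ = cases (zero-product {a ⊕ b} {a ⊕ b ⊕ n} (begin
        (a ⊕ b) ∙ (a ⊕ b ⊕ n) ≡⟨ bilinear {1} {3} ((at x₁ ⊞ at x₂) ⊠ (at x₁ ⊞ at x₂ ⊞ at x₀)) ((at x₁ ⊠ at x₁ ⊞ (at x₀ ⊠ at x₁ ⊞ var x₀ ⊡ (at x₀ ⊠ at x₀))) ⊞ (at x₂ ⊠ at x₂ ⊞ (at x₀ ⊠ at x₂ ⊞ var x₀ ⊡ (at x₀ ⊠ at x₀)))) (ε ∷ []) (n ∷ a ∷ b ∷ []) ⟩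
        _ ≡⟨ cong₂ _⊕_ (≡⇒⊕ (Special.square S)) (≡⇒⊕ (Special.square S′)) ⟩
        0v ⊕ 0v ≡⟨ ⊕-self 0v ⟩
        0v ∎))
      where
      open ≡-Reasoning
      cases : a ⊕ b ≡ 0v ⊎ a ⊕ b ⊕ n ≡ 0v → a ∈⟨ n , b ⟩
      cases (inj₁ z) = 0# , 1# , trans (⊕⇒≡ z) (linear {0} {2} (at x₁) (con false ⊡ at x₀ ⊞ con true ⊡ at x₁) [] (n ∷ b ∷ []))
      cases (inj₂ z) = 1# , 1# , trans (⊕⇒≡ (trans (sym (⊕-assoc a b n)) z)) (linear {0} {2} (at x₁ ⊞ at x₀) (con true ⊡ at x₀ ⊞ con true ⊡ at x₁) [] (n ∷ b ∷ []))

    -- Special lines are pairwise disjoint.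
    special-disjoint : ∀ {p q p′ q′ n} → Special p q → Special p′ q′ → n ∈⟨ p , q ⟩ → n ∈⟨ p′ , q′ ⟩ → ¬ (p ∈⟨ p′ , q′ ⟩) → n ≡ 0v
    special-disjoint {p} {q} {p′} {q′} {n} S S′ n∈ n∈′ p∉ with n ≟ᵛ 0v
    ... | yes z = z
    ... | no n≢0 = ⊥-elim (compare (rebase-at S n∈ n≢0) (rebase-at S′ n∈′ n≢0))
      where
      compare : (∃ λ a → Special n a × (∀ {u} → u ∈⟨ p , q ⟩ → u ∈⟨ n , a ⟩) × (∀ {u} → u ∈⟨ n , a ⟩ → u ∈⟨ p , q ⟩)) →
                (∃ λ b → Special n b × (∀ {u} → u ∈⟨ p′ , q′ ⟩ → u ∈⟨ n , b ⟩) × (∀ {u} → u ∈⟨ n , b ⟩ → u ∈⟨ p′ , q′ ⟩)) → ⊥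
      compare (a , Sa , to , _) (b , Sb , _ , from) = inside (to (1# , 0# , linear {0} {2} (at x₀) (con true ⊡ at x₀ ⊞ con false ⊡ at x₁) [] (p ∷ q ∷ [])))
        where
        inside : p ∈⟨ n , a ⟩ → ⊥
        inside (s , t , e) = p∉ (subst (_∈⟨ p′ , q′ ⟩) (sym e) (∈-⊕ (∈-· s n∈′) (∈-· t (from (special-unique Sa Sb)))))

  module _ {𝔽 : Field₂} (A : Presemifield₂ 𝔽) where
    open Tables A

    table : ∀ {p x v z l m τ β χ₁ χ₂ ψ₁ ψ₂} (N : NormalBasis p x v z l m τ β χ₁ χ₂ ψ₁ ψ₂) →
            Tables.Table (isotope A (NormalBasis.basis N)) l m τ β χ₁ χ₂ ψ₁ ψ₂
    table {p} {x} {v} {z} {l} {m} {τ} {β} {χ₁} {χ₂} {ψ₁} {ψ₂} N = with-y (P-surjective N.q)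
      where
      module N = NormalBasis N
      module S = Special N.special
      open Isotopic (isotopic A N.basis) using (P; P-⊕; P-·; P-injective; P-surjective; P-∙)
      open Presemifield₂ (isotope A N.basis) using () renaming (_∙_ to _∙′_)
      module T = Tables (isotope A N.basis)
      open ≡-Reasoning
      product : ∀ u w t → P u ∙ P w ≡ p ∙ P t → u ∙′ w ≡ t
      product u w t e = P-injective (∙-cancel S.p≢0 (trans (P-∙ u w) e))
      P₁ : P e₁ ≡ p
      P₁ = span-e₁
      P₂ : P e₂ ≡ x
      P₂ = span-e₂
      P₃ : P e₃ ≡ v
      P₃ = span-e₃
      P₄ : P e₄ ≡ z
      P₄ = span-e₄
      P-s : ∀ {u w} s → P u ≡ w → P (s · u) ≡ s · w
      P-s s refl = P-· s _
      P-+ : ∀ {u w u′ w′} → P u ≡ w → P u′ ≡ w′ → P (u ⊕ u′) ≡ w ⊕ w′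
      P-+ refl refl = P-⊕ _ _
      with-y : (∃ λ y → P y ≡ N.q) → T.Table l m τ β χ₁ χ₂ ψ₁ ψ₂
      with-y (y , Py) = record
        { y = y
        ; identity = isotope-unit A N.basis
        ; special = record
          { square = product y y (e₁ ∙′ y ⊕ ε · (e₁ ∙′ e₁)) (begin
              P y ∙ P y ≡⟨ cong₂ _∙_ Py Py ⟩
              N.q ∙ N.q ≡⟨ S.square ⟩
              p ∙ N.q ⊕ ε · (p ∙ p) ≡⟨ sym (trans (∙-⊕ p _ _) (cong (p ∙ N.q ⊕_) (∙-· ε p p))) ⟩
              p ∙ (N.q ⊕ ε · p) ≡⟨ cong (p ∙_) (sym (P-+ Py (P-s ε P₁))) ⟩
              p ∙ P (y ⊕ ε · e₁) ≡⟨ cong₂ (λ a b → p ∙ P (a ⊕ ε · b)) (sym (isotope-unit A N.basis y)) (sym (isotope-unit A N.basis e₁)) ⟩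
              p ∙ P (e₁ ∙′ y ⊕ ε · (e₁ ∙′ e₁)) ∎)
          ; p≢0 = λ e → S.p≢0 (trans (sym P₁) (trans (cong P (trans e (sym (0-· e₁)))) (trans (P-s 0# P₁) (0-· p))))
          ; q≢ = λ r e → S.q≢ r (trans (sym Py) (trans (cong P e) (P-s r P₁)))
          }
        ; e₂∈ = member N.x∈
        ; ∈-e₁e₂ = λ (s , t , e) → pull (N.∈-px (s , t , trans (cong P e) (P-+ (P-s s P₁) (P-s t Py))))
        ; e₂e₂ = product e₂ e₂ _ (begin
            P e₂ ∙ P e₂ ≡⟨ cong₂ _∙_ P₂ P₂ ⟩
            x ∙ x ≡⟨ N.xx ⟩
            m · (p ∙ p) ⊕ l · (p ∙ x) ≡⟨ bilinear {2} {2} (var x₀ ⊡ (at x₀ ⊠ at x₀) ⊞ var x₁ ⊡ (at x₀ ⊠ at x₁)) (at x₀ ⊠ (var x₀ ⊡ at x₀ ⊞ var x₁ ⊡ at x₁)) (m ∷ l ∷ []) (p ∷ x ∷ []) ⟩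
            p ∙ (m · p ⊕ l · x) ≡⟨ cong (p ∙_) (sym (P-+ (P-s m P₁) (P-s l P₂))) ⟩
            p ∙ P (m · e₁ ⊕ l · e₂) ∎)
        ; e₂e₃ = product e₂ e₃ _ (trans (cong₂ _∙_ P₂ P₃) (trans N.xv (cong (p ∙_) (sym P₄))))
        ; e₂e₄ = product e₂ e₄ _ (begin
            P e₂ ∙ P e₄ ≡⟨ cong₂ _∙_ P₂ P₄ ⟩
            x ∙ z ≡⟨ N.xz ⟩
            _ ≡⟨ combination χ₁ χ₂ β ⟩
            p ∙ (χ₁ · p ⊕ χ₂ · x ⊕ β · v ⊕ z) ≡⟨ cong (p ∙_) (sym (P-+ (P-+ (P-+ (P-s χ₁ P₁) (P-s χ₂ P₂)) (P-s β P₃)) P₄)) ⟩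
            p ∙ P (χ₁ · e₁ ⊕ χ₂ · e₂ ⊕ β · e₃ ⊕ e₄) ∎)
        ; e₃e₃ = product e₃ e₃ _ (begin
            P e₃ ∙ P e₃ ≡⟨ cong₂ _∙_ P₃ P₃ ⟩
            v ∙ v ≡⟨ N.vv ⟩
            τ · (p ∙ x) ⊕ p ∙ v ≡⟨ bilinear {1} {3} (var x₀ ⊡ (at x₀ ⊠ at x₁) ⊞ at x₀ ⊠ at x₂) (at x₀ ⊠ (var x₀ ⊡ at x₁ ⊞ at x₂)) (τ ∷ []) (p ∷ x ∷ v ∷ []) ⟩
            p ∙ (τ · x ⊕ v) ≡⟨ cong (p ∙_) (sym (P-+ (P-s τ P₂) P₃)) ⟩
            p ∙ P (τ · e₂ ⊕ e₃) ∎)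
        ; e₄e₄ = product e₄ e₄ _ (begin
            P e₄ ∙ P e₄ ≡⟨ cong₂ _∙_ P₄ P₄ ⟩
            z ∙ z ≡⟨ N.zz ⟩
            _ ≡⟨ combination ψ₁ ψ₂ ε ⟩
            p ∙ (ψ₁ · p ⊕ ψ₂ · x ⊕ ε · v ⊕ z) ≡⟨ cong (p ∙_) (sym (P-+ (P-+ (P-+ (P-s ψ₁ P₁) (P-s ψ₂ P₂)) (P-s ε P₃)) P₄)) ⟩
            p ∙ P (ψ₁ · e₁ ⊕ ψ₂ · e₂ ⊕ ε · e₃ ⊕ e₄) ∎)
        }
        where
        combination : ∀ a b c → a · (p ∙ p) ⊕ b · (p ∙ x) ⊕ c · (p ∙ v) ⊕ p ∙ z ≡ p ∙ (a · p ⊕ b · x ⊕ c · v ⊕ z)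
        combination a b c = bilinear {3} {4} (var x₀ ⊡ (at x₀ ⊠ at x₀) ⊞ var x₁ ⊡ (at x₀ ⊠ at x₁) ⊞ var x₂ ⊡ (at x₀ ⊠ at x₂) ⊞ at x₀ ⊠ at x₃) (at x₀ ⊠ (var x₀ ⊡ at x₀ ⊞ var x₁ ⊡ at x₁ ⊞ var x₂ ⊡ at x₂ ⊞ at x₃)) (a ∷ b ∷ c ∷ []) (p ∷ x ∷ v ∷ z ∷ [])
        member : x ∈⟨ p , N.q ⟩ → e₂ T.∈⟨ e₁ , y ⟩
        member (s , t , e) = s , t , P-injective (trans P₂ (trans e (sym (P-+ (P-s s P₁) (P-s t Py)))))
        pull : ∀ {u} → (∃₂ λ s t → P u ≡ s · p ⊕ t · x) → ∃₂ λ s t → u ≡ s · e₁ ⊕ t · e₂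
        pull (s , t , e) = s , t , P-injective (trans e (sym (P-+ (P-s s P₁) (P-s t P₂))))

  -- The middle nucleus acts transitively.
  Nuclear : {𝔽 : Field₂} → Presemifield₂ 𝔽 → Set
  Nuclear {𝔽} A = ∀ e v → e ≢ 0v → ∃ λ (μ : V → V) → μ e ≡ v × (∀ a b → μ a ∙ b ≡ a ∙ μ b)
    where
    open Field₂-Properties 𝔽
    open Presemifield₂ A

  module _ {𝔽 : Field₂} {A A′ : Presemifield₂ 𝔽} (I : Isotopic A A′) where
    open Field₂-Properties 𝔽
    open Presemifield₂ A using (_∙_)
    open Presemifield₂ A′ using () renaming (_∙_ to _∙′_)
    open Isotopic I

    -- The maps are conjugated by P; the required equality is the image of the given one under w ↦ x
    -- ∙ P w.
    nuclear-isotopic : Nuclear A′ → Nuclear A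
    nuclear-isotopic N e v e≢0 with P-surjective e | P-surjective v
    ... | e′ , refl | v′ , refl with N e′ v′ (λ z → e≢0 (trans (cong P (trans z (sym (0-· 0v)))) (trans (P-· 0# 0v) (0-· _))))
    ...   | μ , refl , commutes = μ′ , cong (P ∘ μ) (P⁻¹-P e′) , λ a b → begin
        μ′ a ∙ b ≡⟨ cong (μ′ a ∙_) (sym (P-P⁻¹ b)) ⟩
        P (μ (P⁻¹ a)) ∙ P (P⁻¹ b) ≡⟨ sym (P-∙ _ _) ⟩
        x ∙ P (μ (P⁻¹ a) ∙′ P⁻¹ b) ≡⟨ cong (λ t → x ∙ P t) (commutes _ _) ⟩
        x ∙ P (P⁻¹ a ∙′ μ (P⁻¹ b)) ≡⟨ P-∙ _ _ ⟩
        P (P⁻¹ a) ∙ μ′ b ≡⟨ cong (_∙ μ′ b) (P-P⁻¹ a) ⟩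
        a ∙ μ′ b ∎
      where
      open ≡-Reasoning
      P⁻¹ : V → V
      P⁻¹ w = proj₁ (P-surjective w)
      P-P⁻¹ : ∀ w → P (P⁻¹ w) ≡ w
      P-P⁻¹ w = proj₂ (P-surjective w)
      P⁻¹-P : ∀ w → P⁻¹ (P w) ≡ w
      P⁻¹-P w = P-injective (P-P⁻¹ (P w))
      μ′ : V → V
      μ′ w = P (μ (P⁻¹ w))

  -- Soundness of the search

  module Soundness {𝔽 : Field₂} (A : Presemifield₂ 𝔽) (l m τ β χ₁ χ₂ ψ₁ ψ₂ : Field₂.K 𝔽)
                   (T : Tables.Table A l m τ β χ₁ χ₂ ψ₁ ψ₂) where
    open Tables A hiding (_∈⟨_,_⟩) public
    open Tables A using (_∈⟨_,_⟩)
    open Checker 𝔽 l m τ β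
    private
      module T = Table T
      χ ψ : L
      χ = χ₁ , χ₂
      ψ = ψ₁ , ψ₂
      es : Vec V 4
      es = e₁ ∷ e₂ ∷ e₃ ∷ e₄ ∷ []
      open ≡-Reasoning

    ⟪_⟫ : Q → V
    ⟪ a , b , c , d ⟫ = vec a b c d

    ⟪⟫-⊕ : ∀ u v → ⟪ u ⟫ ⊕ ⟪ v ⟫ ≡ ⟪ u +ᵠ v ⟫
    ⟪⟫-⊕ (a , b , c , d) (a′ , b′ , c′ , d′) = vec-⊕ a b c d a′ b′ c′ d′

    ⟪⟫-· : ∀ r u → r · ⟪ u ⟫ ≡ ⟪ r *ᵠ u ⟫
    ⟪⟫-· r (a , b , c , d) = trans (cong (r ·_) (vec-≡ a b c d)) (trans
      (linear {5} {4} (var x₄ ⊡ (var x₀ ⊡ at x₀ ⊞ var x₁ ⊡ at x₁ ⊞ var x₂ ⊡ at x₂ ⊞ var x₃ ⊡ at x₃))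
        ((var x₄ :* var x₀) ⊡ at x₀ ⊞ (var x₄ :* var x₁) ⊡ at x₁ ⊞ (var x₄ :* var x₂) ⊡ at x₂ ⊞ (var x₄ :* var x₃) ⊡ at x₃)
        (a ∷ b ∷ c ∷ d ∷ r ∷ []) es) (sym (vec-≡ _ _ _ _)))

    ⟪⟫-surjective : ∀ v → ∃ λ u → v ≡ ⟪ u ⟫
    ⟪⟫-surjective v with vec-surjective v
    ... | a , b , c , d , e = (a , b , c , d) , e

    mulᴸ-sound : ∀ a b v → (a · e₁ ⊕ b · e₂) ∙ ⟪ v ⟫ ≡ ⟪ mulᴸ χ ψ (a , b) v ⟫
    mulᴸ-sound a b (c , d , e , f) = begin
      (a · e₁ ⊕ b · e₂) ∙ vec c d e f ≡⟨ cong ((a · e₁ ⊕ b · e₂) ∙_) (vec-≡ c d e f) ⟩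
      (a · e₁ ⊕ b · e₂) ∙ (c · e₁ ⊕ d · e₂ ⊕ e · e₃ ⊕ f · e₄)
        ≡⟨ bilinear {6} {4} ((var x₀ ⊡ at x₀ ⊞ var x₁ ⊡ at x₁) ⊠ W) (var x₀ ⊡ (at x₀ ⊠ W) ⊞ var x₁ ⊡ (var x₂ ⊡ (at x₀ ⊠ at x₁) ⊞ var x₃ ⊡ (at x₁ ⊠ at x₁) ⊞ var x₄ ⊡ (at x₁ ⊠ at x₂) ⊞ var x₅ ⊡ (at x₁ ⊠ at x₃))) (a ∷ b ∷ c ∷ d ∷ e ∷ f ∷ []) es ⟩
      a · (e₁ ∙ w) ⊕ b · (c · (e₁ ∙ e₂) ⊕ d · (e₂ ∙ e₂) ⊕ e · (e₂ ∙ e₃) ⊕ f · (e₂ ∙ e₄))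
        ≡⟨ cong₂ (λ s t → a · s ⊕ b · t) (T.identity w) (cong₂ _⊕_ (cong₂ _⊕_ (cong₂ _⊕_ (cong (c ·_) (T.identity e₂)) (cong (d ·_) T.e₂e₂)) (cong (e ·_) T.e₂e₃)) (cong (f ·_) T.e₂e₄)) ⟩
      a · w ⊕ b · (c · e₂ ⊕ d · (m · e₁ ⊕ l · e₂) ⊕ e · e₄ ⊕ f · (χ₁ · e₁ ⊕ χ₂ · e₂ ⊕ β · e₃ ⊕ e₄))
        ≡⟨ linear {11} {4} (var x₀ ⊡ (var x₂ ⊡ at x₀ ⊞ var x₃ ⊡ at x₁ ⊞ var x₄ ⊡ at x₂ ⊞ var x₅ ⊡ at x₃)
             ⊞ var x₁ ⊡ (var x₂ ⊡ at x₁ ⊞ var x₃ ⊡ (M ⊡ at x₀ ⊞ var x₇ ⊡ at x₁) ⊞ var x₄ ⊡ at x₃ ⊞ var x₅ ⊡ (X₁ ⊡ at x₀ ⊞ X₂ ⊡ at x₁ ⊞ B ⊡ at x₂ ⊞ at x₃)))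
           ((var x₀ :* var x₂ :+ var x₁ :* (M :* var x₃ :+ X₁ :* var x₅)) ⊡ at x₀
             ⊞ (var x₀ :* var x₃ :+ var x₁ :* (var x₂ :+ var x₇ :* var x₃ :+ X₂ :* var x₅)) ⊡ at x₁
             ⊞ (var x₀ :* var x₄ :+ var x₁ :* (B :* var x₅)) ⊡ at x₂
             ⊞ (var x₀ :* var x₅ :+ var x₁ :* (var x₄ :+ var x₅)) ⊡ at x₃)
           (a ∷ b ∷ c ∷ d ∷ e ∷ f ∷ m ∷ l ∷ χ₁ ∷ χ₂ ∷ β ∷ []) es ⟩
      _ ≡⟨ sym (vec-≡ _ _ _ _) ⟩
      ⟪ mulᴸ χ ψ (a , b) (c , d , e , f) ⟫ ∎
      where
      w : V
      w = c · e₁ ⊕ d · e₂ ⊕ e · e₃ ⊕ f · e₄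
      W : Expr 6 4
      W = var x₂ ⊡ at x₀ ⊞ var x₃ ⊡ at x₁ ⊞ var x₄ ⊡ at x₂ ⊞ var x₅ ⊡ at x₃
      open import Data.Fin.Base using (suc)
      M X₁ X₂ B : Polynomial 11
      M = var x₆
      X₁ = var (suc x₇)
      X₂ = var (suc (suc x₇))
      B = var (suc (suc (suc x₇)))

    vec-L : ∀ a b → vec a b 0# 0# ≡ a · e₁ ⊕ b · e₂
    vec-L a b = trans (vec-≡ a b 0# 0#) (linear {2} {4} (var x₀ ⊡ at x₀ ⊞ var x₁ ⊡ at x₁ ⊞ con false ⊡ at x₂ ⊞ con false ⊡ at x₃) (var x₀ ⊡ at x₀ ⊞ var x₁ ⊡ at x₁) (a ∷ b ∷ []) es)

    sqᵠ-sound : ∀ u → ⟪ u ⟫ ∙ ⟪ u ⟫ ≡ ⟪ sqᵠ χ ψ u ⟫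
    sqᵠ-sound (a , b , c , d) = begin
      vec a b c d ∙ vec a b c d ≡⟨ cong (λ t → t ∙ t) (vec-≡ a b c d) ⟩
      _ ≡⟨ bilinear {4} {4} (W ⊠ W) ((var x₀ :* var x₀) ⊡ (at x₀ ⊠ at x₀) ⊞ (var x₁ :* var x₁) ⊡ (at x₁ ⊠ at x₁) ⊞ (var x₂ :* var x₂) ⊡ (at x₂ ⊠ at x₂) ⊞ (var x₃ :* var x₃) ⊡ (at x₃ ⊠ at x₃)) (a ∷ b ∷ c ∷ d ∷ []) es ⟩
      (a * a) · (e₁ ∙ e₁) ⊕ (b * b) · (e₂ ∙ e₂) ⊕ (c * c) · (e₃ ∙ e₃) ⊕ (d * d) · (e₄ ∙ e₄)
        ≡⟨ cong₂ _⊕_ (cong₂ _⊕_ (cong₂ _⊕_ (cong ((a * a) ·_) (T.identity e₁)) (cong ((b * b) ·_) T.e₂e₂)) (cong ((c * c) ·_) T.e₃e₃)) (cong ((d * d) ·_) T.e₄e₄) ⟩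
      (a * a) · e₁ ⊕ (b * b) · (m · e₁ ⊕ l · e₂) ⊕ (c * c) · (τ · e₂ ⊕ e₃) ⊕ (d * d) · (ψ₁ · e₁ ⊕ ψ₂ · e₂ ⊕ ε · e₃ ⊕ e₄)
        ≡⟨ linear {10} {4} ((var x₀ :* var x₀) ⊡ at x₀ ⊞ (var x₁ :* var x₁) ⊡ (var x₄ ⊡ at x₀ ⊞ var x₅ ⊡ at x₁) ⊞ (var x₂ :* var x₂) ⊡ (var x₆ ⊡ at x₁ ⊞ at x₂) ⊞ (var x₃ :* var x₃) ⊡ (var x₇ ⊡ at x₀ ⊞ Y₂ ⊡ at x₁ ⊞ E ⊡ at x₂ ⊞ at x₃))
           ((var x₀ :* var x₀ :+ var x₄ :* (var x₁ :* var x₁) :+ var x₇ :* (var x₃ :* var x₃)) ⊡ at x₀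
             ⊞ (var x₅ :* (var x₁ :* var x₁) :+ var x₆ :* (var x₂ :* var x₂) :+ Y₂ :* (var x₃ :* var x₃)) ⊡ at x₁
             ⊞ (var x₂ :* var x₂ :+ E :* (var x₃ :* var x₃)) ⊡ at x₂ ⊞ (var x₃ :* var x₃) ⊡ at x₃)
           (a ∷ b ∷ c ∷ d ∷ m ∷ l ∷ τ ∷ ψ₁ ∷ ψ₂ ∷ ε ∷ []) es ⟩
      _ ≡⟨ sym (vec-≡ _ _ _ _) ⟩
      ⟪ sqᵠ χ ψ (a , b , c , d) ⟫ ∎
      where
      W : Expr 4 4
      W = var x₀ ⊡ at x₀ ⊞ var x₁ ⊡ at x₁ ⊞ var x₂ ⊡ at x₂ ⊞ var x₃ ⊡ at x₃
      open import Data.Fin.Base using (suc)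
      Y₂ E : Polynomial 10
      Y₂ = var (suc x₇)
      E = var (suc (suc x₇))

    module _ {ω : Q} (e₃e₄ : e₃ ∙ e₄ ≡ ⟪ ω ⟫) where
      mulᵠ-sound : ∀ u v → ⟪ u ⟫ ∙ ⟪ v ⟫ ≡ ⟪ mulᵠ χ ψ ω u v ⟫
      mulᵠ-sound u@(a , b , c , d) v@(a′ , b′ , c′ , d′) = begin
        vec a b c d ∙ ⟪ v ⟫ ≡⟨ cong (_∙ ⟪ v ⟫) (vec-≡ a b c d) ⟩
        (a · e₁ ⊕ b · e₂ ⊕ c · e₃ ⊕ d · e₄) ∙ ⟪ v ⟫
          ≡⟨ trans (cong (_∙ ⟪ v ⟫) (⊕-assoc _ _ _)) (⊕-∙ _ _ _) ⟩
        (a · e₁ ⊕ b · e₂) ∙ ⟪ v ⟫ ⊕ w ∙ ⟪ v ⟫ ≡⟨ cong₂ _⊕_ (mulᴸ-sound a b v) (trans (cong (w ∙_) (trans (vec-≡ a′ b′ c′ d′) (⊕-assoc _ _ _))) (∙-⊕ w _ _)) ⟩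
        ⟪ mulᴸ χ ψ (a , b) v ⟫ ⊕ (w ∙ (a′ · e₁ ⊕ b′ · e₂) ⊕ w ∙ (c′ · e₃ ⊕ d′ · e₄))
          ≡⟨ cong₂ (λ s t → ⟪ mulᴸ χ ψ (a , b) v ⟫ ⊕ (s ⊕ t)) (trans (∙-comm _ _) (trans (cong ((a′ · e₁ ⊕ b′ · e₂) ∙_) w-≡) (mulᴸ-sound a′ b′ (0# , 0# , c , d))))
               (bilinear {4} {2} ((var x₀ ⊡ at x₀ ⊞ var x₁ ⊡ at x₁) ⊠ (var x₂ ⊡ at x₀ ⊞ var x₃ ⊡ at x₁)) ((var x₀ :* var x₂) ⊡ (at x₀ ⊠ at x₀) ⊞ (var x₁ :* var x₃) ⊡ (at x₁ ⊠ at x₁) ⊞ (var x₀ :* var x₃ :+ var x₁ :* var x₂) ⊡ (at x₀ ⊠ at x₁)) (c ∷ d ∷ c′ ∷ d′ ∷ []) (e₃ ∷ e₄ ∷ [])) ⟩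
        ⟪ mulᴸ χ ψ (a , b) v ⟫ ⊕ (⟪ mulᴸ χ ψ (a′ , b′) (0# , 0# , c , d) ⟫ ⊕ ((c * c′) · (e₃ ∙ e₃) ⊕ (d * d′) · (e₄ ∙ e₄) ⊕ (c * d′ + d * c′) · (e₃ ∙ e₄)))
          ≡⟨ cong₂ (λ s t → ⟪ mulᴸ χ ψ (a , b) v ⟫ ⊕ (⟪ mulᴸ χ ψ (a′ , b′) (0# , 0# , c , d) ⟫ ⊕ (s ⊕ t))) squares (trans (cong (_ ·_) e₃e₄) (⟪⟫-· _ ω)) ⟩
        ⟪ mulᴸ χ ψ (a , b) v ⟫ ⊕ (⟪ mulᴸ χ ψ (a′ , b′) (0# , 0# , c , d) ⟫ ⊕ (⟪ sq ⟫ ⊕ ⟪ (c * d′ + d * c′) *ᵠ ω ⟫))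
          ≡⟨ trans (sym (⊕-assoc _ _ _)) (sym (⊕-assoc _ _ _)) ⟩
        ⟪ mulᴸ χ ψ (a , b) v ⟫ ⊕ ⟪ mulᴸ χ ψ (a′ , b′) (0# , 0# , c , d) ⟫ ⊕ ⟪ sq ⟫ ⊕ ⟪ (c * d′ + d * c′) *ᵠ ω ⟫
          ≡⟨ trans (cong (_⊕ ⟪ (c * d′ + d * c′) *ᵠ ω ⟫) (trans (cong (_⊕ ⟪ sq ⟫) (⟪⟫-⊕ (mulᴸ χ ψ (a , b) v) _)) (⟪⟫-⊕ _ sq))) (⟪⟫-⊕ _ _) ⟩
        ⟪ mulᵠ χ ψ ω u v ⟫ ∎
        where
        w : V
        w = c · e₃ ⊕ d · e₄
        sq : Q
        sq = ψ₁ * (d * d′) , τ * (c * c′) + ψ₂ * (d * d′) , c * c′ + ε * (d * d′) , d * d′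
        w-≡ : w ≡ ⟪ 0# , 0# , c , d ⟫
        w-≡ = sym (trans (vec-≡ 0# 0# c d) (linear {2} {4} (con false ⊡ at x₀ ⊞ con false ⊡ at x₁ ⊞ var x₀ ⊡ at x₂ ⊞ var x₁ ⊡ at x₃) (var x₀ ⊡ at x₂ ⊞ var x₁ ⊡ at x₃) (c ∷ d ∷ []) es))
        squares : (c * c′) · (e₃ ∙ e₃) ⊕ (d * d′) · (e₄ ∙ e₄) ≡ ⟪ sq ⟫
        squares = begin
          (c * c′) · (e₃ ∙ e₃) ⊕ (d * d′) · (e₄ ∙ e₄) ≡⟨ cong₂ (λ s t → (c * c′) · s ⊕ (d * d′) · t) T.e₃e₃ T.e₄e₄ ⟩
          (c * c′) · (τ · e₂ ⊕ e₃) ⊕ (d * d′) · (ψ₁ · e₁ ⊕ ψ₂ · e₂ ⊕ ε · e₃ ⊕ e₄)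
            ≡⟨ linear {6} {4} (var x₀ ⊡ (var x₂ ⊡ at x₁ ⊞ at x₂) ⊞ var x₁ ⊡ (var x₃ ⊡ at x₀ ⊞ var x₄ ⊡ at x₁ ⊞ var x₅ ⊡ at x₂ ⊞ at x₃))
                 ((var x₃ :* var x₁) ⊡ at x₀ ⊞ (var x₂ :* var x₀ :+ var x₄ :* var x₁) ⊡ at x₁ ⊞ (var x₀ :+ var x₅ :* var x₁) ⊡ at x₂ ⊞ var x₁ ⊡ at x₃)
                 (c * c′ ∷ d * d′ ∷ τ ∷ ψ₁ ∷ ψ₂ ∷ ε ∷ []) es ⟩
          _ ≡⟨ sym (vec-≡ _ _ _ _) ⟩
          ⟪ sq ⟫ ∎

    isL0-sound : ∀ {u} → isL0 u ≡ true → proj₁ u ≡ 0# × proj₂ u ≡ 0#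
    isL0-sound {a , b} e with ∧-sound (is0 a) e
    ... | p , q = is0-sound p , is0-sound q

    isQ0-sound : ∀ u → isQ0 u ≡ true → ⟪ u ⟫ ≡ 0v
    isQ0-sound (a , b , c , d) e with ∧-sound (is0 a) e
    ... | p , e′ with ∧-sound (is0 b) e′
    ...   | q , e″ with ∧-sound (is0 c) e″
    ...     | r , s = trans (cong₂ (λ x f → f x) (is0-sound {a} p) (cong₂ (λ y g x → g x y) (is0-sound {b} q) (cong₂ (λ z t x y → vec x y z t) (is0-sound {c} r) (is0-sound {d} s)))) vec-0

    isL0-zero : isL0 (0# , 0#) ≡ true
    isL0-zero = cong₂ _∧_ is0-zero is0-zero

    Ls-complete : ∀ a b → (a , b) ∈ Ls
    Ls-complete a b = ∈-cartesianProduct⁺ (complete a) (complete b)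

    Qs-complete : ∀ u → u ∈ Qs
    Qs-complete (a , b , c , d) = ∈-cartesianProduct⁺ (complete a) (∈-cartesianProduct⁺ (complete b) (Ls-complete c d))

    -- A hit provides u outside ⟨e₁,e₂⟩ and n in it with u ∙ u = n ∙ u; then u ∙ (u + n) = 0, and
    -- neither factor is zero because both have the same nonzero component outside ⟨e₁,e₂⟩.
    not-divides : divides χ ψ fixedTable ≢ true
    not-divides e with anyᵇ-sound _ fixedTable e
    ... | entry , entry∈ , e₁′ with ∈-map⁻ (λ (x , u) → (x , u) , List.map (λ t → t ∙ᴸ t +ᴸ x ∙ᴸ t) Ls) entry∈
    ...   | (((a , b) , (c , d))) , fixed , refl with anyᵇ-sound (λ i → isL0 (i +ᴸ rest χ ψ ((a , b) , (c , d)))) (List.map (λ t → t ∙ᴸ t +ᴸ (a , b) ∙ᴸ t) Ls) e₁′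
    ...     | i , i∈ , e₂′ with ∈-map⁻ (λ t → t ∙ᴸ t +ᴸ (a , b) ∙ᴸ t) i∈
    ...       | (t₁ , t₂) , _ , refl = contradiction-from (filterᵇ-⊆ fixes (List.cartesianProduct directions Ls) fixed)
      where
      contradiction-from : ((a , b) , (c , d)) ∈ List.cartesianProduct directions Ls × fixes ((a , b) , (c , d)) ≡ true → ⊥
      contradiction-from (_ , f) with ∧-sound (not (isL0 (c , d))) f
      ... | nz , f′ with ∧-sound (is0 (a * c + b * (β * d) + (c * c + ε * (d * d)))) f′ | isL0-sound {(t₁ , t₂) ∙ᴸ (t₁ , t₂) +ᴸ (a , b) ∙ᴸ (t₁ , t₂) +ᴸ rest χ ψ ((a , b) , (c , d))} e₂′
      ...   | g₃ , g₄ | z₁ , z₂ = cases (zero-product {u} {u ⊕ n} (begin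
          u ∙ (u ⊕ n) ≡⟨ trans (∙-⊕ u u n) (cong (u ∙ u ⊕_) (∙-comm u n)) ⟩
          u ∙ u ⊕ n ∙ u ≡⟨ cong₂ _⊕_ (sqᵠ-sound (t₁ , t₂ , c , d)) (mulᴸ-sound a b (t₁ , t₂ , c , d)) ⟩
          ⟪ sqᵠ χ ψ (t₁ , t₂ , c , d) ⟫ ⊕ ⟪ mulᴸ χ ψ (a , b) (t₁ , t₂ , c , d) ⟫ ≡⟨ ⟪⟫-⊕ (sqᵠ χ ψ (t₁ , t₂ , c , d)) _ ⟩
          vec _ _ _ _ ≡⟨ cong₂ (λ x f → f x) y₁ (cong₂ (λ y g x → g x y) y₂ (cong₂ (λ z t x y → vec x y z t) y₃ y₄)) ⟩
          vec 0# 0# 0# 0# ≡⟨ vec-0 ⟩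
          0v ∎))
        where
        u n : V
        u = vec t₁ t₂ c d
        n = a · e₁ ⊕ b · e₂
        nonzero : ∀ t → vec (proj₁ t) (proj₂ t) c d ≡ 0v → ⊥
        nonzero t z with vec-injective (trans z (sym vec-0))
        ... | _ , p , q = not-sound nz (trans (cong₂ (λ x y → isL0 (x , y)) p q) isL0-zero)
        sum : u ⊕ n ≡ vec (t₁ + a) (t₂ + b) c d
        sum = trans (cong (u ⊕_) (sym (vec-L a b))) (trans (vec-⊕ _ _ _ _ _ _ _ _) (cong₂ (vec (t₁ + a) (t₂ + b)) (+-identityʳ c) (+-identityʳ d)))
        cases : u ≡ 0v ⊎ u ⊕ n ≡ 0v → ⊥
        cases (inj₁ z) = nonzero (t₁ , t₂) z
        cases (inj₂ z) = nonzero (t₁ + a , t₂ + b) (trans (sym sum) z)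
        y₁ : t₁ * t₁ + m * (t₂ * t₂) + ψ₁ * (d * d) + (a * t₁ + b * (m * t₂ + χ₁ * d)) ≡ 0#
        y₁ = trans (solve 8 (λ t₁ t₂ a b d m x y → t₁ :* t₁ :+ m :* (t₂ :* t₂) :+ y :* (d :* d) :+ (a :* t₁ :+ b :* (m :* t₂ :+ x :* d))
                := (t₁ :* t₁ :+ m :* (t₂ :* t₂) :+ (a :* t₁ :+ m :* (b :* t₂))) :+ (con false :+ d :* d :* y :+ b :* d :* x)) refl t₁ t₂ a b d m χ₁ ψ₁) z₁
        y₂ : l * (t₂ * t₂) + τ * (c * c) + ψ₂ * (d * d) + (a * t₂ + b * (t₁ + l * t₂ + χ₂ * d)) ≡ 0#
        y₂ = trans (solve 10 (λ t₁ t₂ a b c d l τ x y → l :* (t₂ :* t₂) :+ τ :* (c :* c) :+ y :* (d :* d) :+ (a :* t₂ :+ b :* (t₁ :+ l :* t₂ :+ x :* d))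
                := (t₁ :* t₂ :+ t₂ :* t₁ :+ l :* (t₂ :* t₂) :+ (a :* t₂ :+ b :* t₁ :+ l :* (b :* t₂))) :+ (τ :* (c :* c) :+ d :* d :* y :+ b :* d :* x)) refl t₁ t₂ a b c d l τ χ₂ ψ₂) z₂
        y₃ : c * c + ε * (d * d) + (a * c + b * (β * d)) ≡ 0#
        y₃ = trans (+-comm _ _) (is0-sound g₃)
        y₄ : d * d + (a * d + b * (c + d)) ≡ 0#
        y₄ = trans (+-comm _ _) (is0-sound g₄)

  module Soundness′ {𝔽 : Field₂} (A : Presemifield₂ 𝔽) (l m τ β χ₁ χ₂ ψ₁ ψ₂ : Field₂.K 𝔽)
                    (T : Tables.Table A l m τ β χ₁ χ₂ ψ₁ ψ₂) where
    open Soundness A l m τ β χ₁ χ₂ ψ₁ ψ₂ T public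
    open Tables A using (_∈⟨_,_⟩)
    open Checker 𝔽 l m τ β
    private
      module T = Table T
      χ ψ : L
      χ = χ₁ , χ₂
      ψ = ψ₁ , ψ₂
      es : Vec V 4
      es = e₁ ∷ e₂ ∷ e₃ ∷ e₄ ∷ []
      open ≡-Reasoning

    ∉-line : ∀ a b → ¬ (vec a b 1# 0# ∈⟨ e₁ , T.y ⟩)
    ∉-line a b h with T.∈-e₁e₂ h
    ... | s , t , e = 1≢0 (proj₁ (proj₂ (vec-injective (trans e (sym (vec-L s t))))))

    -- The special line through a + e₃ contains a unique vector b + e₄.
    record Through (a b : L) : Set where
      field
        {q′}    : V
        special : Special ⟪ proj₁ a , proj₂ a , 1# , 0# ⟫ q′
        b∈      : ⟪ proj₁ b , proj₂ b , 0# , 1# ⟫ ∈⟨ ⟪ proj₁ a , proj₂ a , 1# , 0# ⟫ , q′ ⟩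
        closed  : ∃₂ λ s t → ⟪ proj₁ a , proj₂ a , 1# , 0# ⟫ ∙ ⟪ proj₁ b , proj₂ b , 0# , 1# ⟫ ≡
                    s · (⟪ proj₁ a , proj₂ a , 1# , 0# ⟫ ∙ ⟪ proj₁ a , proj₂ a , 1# , 0# ⟫) ⊕ t · (⟪ proj₁ b , proj₂ b , 0# , 1# ⟫ ∙ ⟪ proj₁ b , proj₂ b , 0# , 1# ⟫)

    through : ∀ a → ∃ λ b → Through a b
    through (a₁ , a₂) = from-special (exists-special A p≢0)
      where
      p : V
      p = vec a₁ a₂ 1# 0#
      p≢0 : p ≢ 0v
      p≢0 z = 1≢0 (proj₁ (proj₂ (vec-injective (trans z (sym vec-0)))))
      from-special : (∃ λ q → Special p q) → _
      from-special (q , S) with vec-surjective q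
      ... | q₁ , q₂ , q₃ , q₄ , refl with q₄ ≟ 0#
      -- With q₄ = 0 the vector q + q₃ p lies on both special lines, so disjointness makes it zero
      -- and q a multiple of p.
      ...   | yes refl = ⊥-elim (Special.q≢ S q₃ (⊕⇒≡ (special-disjoint S T.special (q₃ , 1# , sum₁) (line (∈-⊕ (∈-· (q₁ + q₃ * a₁) e₁∈) (∈-· (q₂ + q₃ * a₂) T.e₂∈))) (∉-line a₁ a₂))))
        where
        e₁∈ : e₁ ∈⟨ e₁ , T.y ⟩
        e₁∈ = 1# , 0# , linear {0} {2} (at x₀) (con true ⊡ at x₀ ⊞ con false ⊡ at x₁) [] (e₁ ∷ T.y ∷ [])
        sum₁ : q ⊕ q₃ · p ≡ q₃ · p ⊕ 1# · q
        sum₁ = linear {1} {2} (at x₁ ⊞ var x₀ ⊡ at x₀) (var x₀ ⊡ at x₀ ⊞ con true ⊡ at x₁) (q₃ ∷ []) (p ∷ q ∷ [])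
        line : (q₁ + q₃ * a₁) · e₁ ⊕ (q₂ + q₃ * a₂) · e₂ ∈⟨ e₁ , T.y ⟩ → q ⊕ q₃ · p ∈⟨ e₁ , T.y ⟩
        line = subst (_∈⟨ e₁ , T.y ⟩) (begin
          (q₁ + q₃ * a₁) · e₁ ⊕ (q₂ + q₃ * a₂) · e₂
            ≡⟨ linear {5} {4} ((var x₀ :+ var x₂ :* var x₃) ⊡ at x₀ ⊞ (var x₁ :+ var x₂ :* var x₄) ⊡ at x₁)
                 ((var x₀ ⊡ at x₀ ⊞ var x₁ ⊡ at x₁ ⊞ var x₂ ⊡ at x₂ ⊞ con false ⊡ at x₃) ⊞ var x₂ ⊡ (var x₃ ⊡ at x₀ ⊞ var x₄ ⊡ at x₁ ⊞ con true ⊡ at x₂ ⊞ con false ⊡ at x₃)) (q₁ ∷ q₂ ∷ q₃ ∷ a₁ ∷ a₂ ∷ []) es ⟩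
          _ ≡⟨ sym (cong₂ (λ s t → s ⊕ q₃ · t) (vec-≡ q₁ q₂ q₃ 0#) (vec-≡ a₁ a₂ 1# 0#)) ⟩
          q ⊕ q₃ · p ∎)
      -- b + e₄ is (q + q₃ p)/q₄. The coefficients in `closed` come from solving the relation of the
      -- special line for p ∙ q and writing q as q₃ p + q₄ (b + e₄).
      ...   | no q₄≢0 = (i * (q₁ + q₃ * a₁) , i * (q₂ + q₃ * a₂)) , record
        { special = S ; b∈ = i * q₃ , i , b≡ ; closed = i * (q₃ + ε + q₃ * q₃) , i * (q₄ * q₄) , closed }
        where
        i : K
        i = inv q₄
        b : V
        b = vec (i * (q₁ + q₃ * a₁)) (i * (q₂ + q₃ * a₂)) 0# 1#
        b≡ : b ≡ (i * q₃) · p ⊕ i · q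
        b≡ = begin
          b ≡⟨ cong (vec _ _ 0#) (trans (sym (inverse q₄ q₄≢0)) (*-comm q₄ i)) ⟩
          vec (i * (q₁ + q₃ * a₁)) (i * (q₂ + q₃ * a₂)) 0# (i * q₄) ≡⟨ vec-≡ _ _ _ _ ⟩
          _ ≡⟨ linear {7} {4} ((var x₆ :* (var x₀ :+ var x₂ :* var x₄)) ⊡ at x₀ ⊞ (var x₆ :* (var x₁ :+ var x₂ :* var x₅)) ⊡ at x₁ ⊞ con false ⊡ at x₂ ⊞ (var x₆ :* var x₃) ⊡ at x₃)
                 ((var x₆ :* var x₂) ⊡ (var x₄ ⊡ at x₀ ⊞ var x₅ ⊡ at x₁ ⊞ con true ⊡ at x₂ ⊞ con false ⊡ at x₃) ⊞ var x₆ ⊡ (var x₀ ⊡ at x₀ ⊞ var x₁ ⊡ at x₁ ⊞ var x₂ ⊡ at x₂ ⊞ var x₃ ⊡ at x₃)) (q₁ ∷ q₂ ∷ q₃ ∷ q₄ ∷ a₁ ∷ a₂ ∷ i ∷ []) es ⟩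
          _ ≡⟨ sym (cong₂ (λ s t → (i * q₃) · s ⊕ i · t) (vec-≡ a₁ a₂ 1# 0#) (vec-≡ q₁ q₂ q₃ q₄)) ⟩
          (i * q₃) · p ⊕ i · q ∎
        q≡ : q ≡ q₃ · p ⊕ q₄ · b
        q≡ = sym (begin
          q₃ · p ⊕ q₄ · b ≡⟨ cong (λ t → q₃ · p ⊕ q₄ · t) b≡ ⟩
          q₃ · p ⊕ q₄ · ((i * q₃) · p ⊕ i · q) ≡⟨ linear {3} {2} (var x₀ ⊡ at x₀ ⊞ var x₁ ⊡ ((var x₂ :* var x₀) ⊡ at x₀ ⊞ var x₂ ⊡ at x₁)) ((var x₀ :+ var x₁ :* var x₂ :* var x₀) ⊡ at x₀ ⊞ (var x₁ :* var x₂) ⊡ at x₁) (q₃ ∷ q₄ ∷ i ∷ []) (p ∷ q ∷ []) ⟩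
          (q₃ + q₄ * i * q₃) · p ⊕ (q₄ * i) · q ≡⟨ cong (λ o → (q₃ + o * q₃) · p ⊕ o · q) (inverse q₄ q₄≢0) ⟩
          (q₃ + 1# * q₃) · p ⊕ 1# · q ≡⟨ linear {1} {2} ((var x₀ :+ con true :* var x₀) ⊡ at x₀ ⊞ con true ⊡ at x₁) (at x₁) (q₃ ∷ []) (p ∷ q ∷ []) ⟩
          q ∎)
        closed : p ∙ b ≡ (i * (q₃ + ε + q₃ * q₃)) · (p ∙ p) ⊕ (i * (q₄ * q₄)) · (b ∙ b)
        closed = begin
          p ∙ b ≡⟨ cong (p ∙_) b≡ ⟩
          p ∙ ((i * q₃) · p ⊕ i · q)
            ≡⟨ bilinear {3} {2} (at x₀ ⊠ ((var x₀ :* var x₁) ⊡ at x₀ ⊞ var x₀ ⊡ at x₁))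
                 (((var x₀ :* (var x₁ :+ var x₂)) ⊡ (at x₀ ⊠ at x₀) ⊞ var x₀ ⊡ (at x₁ ⊠ at x₁)) ⊞ var x₀ ⊡ (at x₁ ⊠ at x₁ ⊞ (at x₀ ⊠ at x₁ ⊞ var x₂ ⊡ (at x₀ ⊠ at x₀)))) (i ∷ q₃ ∷ ε ∷ []) (p ∷ q ∷ []) ⟩
          _ ≡⟨ absorb i (≡⇒⊕ (Special.square S)) ⟩
          (i * (q₃ + ε)) · (p ∙ p) ⊕ i · (q ∙ q) ≡⟨ cong (λ t → (i * (q₃ + ε)) · (p ∙ p) ⊕ i · (t ∙ t)) q≡ ⟩
          (i * (q₃ + ε)) · (p ∙ p) ⊕ i · ((q₃ · p ⊕ q₄ · b) ∙ (q₃ · p ⊕ q₄ · b))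
            ≡⟨ bilinear {4} {2} ((var x₀ :* (var x₁ :+ var x₂)) ⊡ (at x₀ ⊠ at x₀) ⊞ var x₀ ⊡ ((var x₁ ⊡ at x₀ ⊞ var x₃ ⊡ at x₁) ⊠ (var x₁ ⊡ at x₀ ⊞ var x₃ ⊡ at x₁)))
                 ((var x₀ :* (var x₁ :+ var x₂ :+ var x₁ :* var x₁)) ⊡ (at x₀ ⊠ at x₀) ⊞ (var x₀ :* (var x₃ :* var x₃)) ⊡ (at x₁ ⊠ at x₁)) (i ∷ q₃ ∷ ε ∷ q₄ ∷ []) (p ∷ b ∷ []) ⟩
          (i * (q₃ + ε + q₃ * q₃)) · (p ∙ p) ⊕ (i * (q₄ * q₄)) · (b ∙ b) ∎

    reduced-zero : ∀ {w₁ w₂ w₃ w₄ s t v₁ v₂ z₁ z₂} → (w₁ ≡ s * v₁ + t * z₁ × w₂ ≡ s * v₂ + t * z₂) × (w₃ ≡ s + t * ε × w₄ ≡ t) →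
      isL0 ((w₁ , w₂) +ᴸ (w₄ *ᴸ (z₁ , z₂) +ᴸ (w₃ + ε * w₄) *ᴸ (v₁ , v₂))) ≡ true
    reduced-zero {s = s} {t} {v₁} {v₂} {z₁} {z₂} ((refl , refl) , (refl , refl)) = trans (cong₂ (λ x y → is0 x ∧ is0 y) (cancels v₁ z₁) (cancels v₂ z₂)) isL0-zero
      where
      cancels : ∀ v z → s * v + t * z + (t * z + (s + t * ε + ε * t) * v) ≡ 0#
      cancels v z = solve 5 (λ s t v z e → s :* v :+ t :* z :+ (t :* z :+ (s :+ t :* e :+ e :* t) :* v) := con false) refl s t v z ε

    module _ {a₁ a₂ b₁ b₂ : K} (M : Through (a₁ , a₂) (b₁ , b₂)) where
      private
        module M = Through M
        module S = Special M.special
        p q v₁ v₂ z₁ z₂ : _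
        p = vec a₁ a₂ 1# 0#
        q = vec b₁ b₂ 0# 1#
        v₁ = proj₁ (PPᴸ χ ψ (a₁ , a₂))
        v₂ = proj₂ (PPᴸ χ ψ (a₁ , a₂))
        z₁ = proj₁ (QQᴸ χ ψ (b₁ , b₂))
        z₂ = proj₂ (QQᴸ χ ψ (b₁ , b₂))

        pp : p ∙ p ≡ v₁ · e₁ ⊕ v₂ · e₂ ⊕ e₃
        pp = trans (sqᵠ-sound (a₁ , a₂ , 1# , 0#)) (trans (vec-≡ _ _ _ _) (linear {8} {4}
          ((A₁ :* A₁ :+ N :* (A₂ :* A₂) :+ var x₅ :* (con false :* con false)) ⊡ at x₀ ⊞ (Λ :* (A₂ :* A₂) :+ var x₄ :* (con true :* con true) :+ var x₆ :* (con false :* con false)) ⊡ at x₁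
            ⊞ (con true :* con true :+ var x₇ :* (con false :* con false)) ⊡ at x₂ ⊞ (con false :* con false) ⊡ at x₃)
          ((A₁ :* A₁ :+ N :* (A₂ :* A₂) :+ con false) ⊡ at x₀ ⊞ (A₁ :* A₂ :+ A₂ :* A₁ :+ Λ :* (A₂ :* A₂) :+ var x₄) ⊡ at x₁ ⊞ at x₂)
          (a₁ ∷ a₂ ∷ m ∷ l ∷ τ ∷ ψ₁ ∷ ψ₂ ∷ ε ∷ []) es))
          where
          A₁ A₂ N Λ : Polynomial 8
          A₁ = var x₀
          A₂ = var x₁
          N = var x₂
          Λ = var x₃

        qq : q ∙ q ≡ z₁ · e₁ ⊕ z₂ · e₂ ⊕ ε · e₃ ⊕ e₄
        qq = trans (sqᵠ-sound (b₁ , b₂ , 0# , 1#)) (trans (vec-≡ _ _ _ _) (linear {8} {4}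
          ((A₁ :* A₁ :+ N :* (A₂ :* A₂) :+ var x₅ :* (con true :* con true)) ⊡ at x₀ ⊞ (Λ :* (A₂ :* A₂) :+ var x₄ :* (con false :* con false) :+ var x₆ :* (con true :* con true)) ⊡ at x₁
            ⊞ (con false :* con false :+ var x₇ :* (con true :* con true)) ⊡ at x₂ ⊞ (con true :* con true) ⊡ at x₃)
          ((A₁ :* A₁ :+ N :* (A₂ :* A₂) :+ var x₅) ⊡ at x₀ ⊞ (A₁ :* A₂ :+ A₂ :* A₁ :+ Λ :* (A₂ :* A₂) :+ var x₆) ⊡ at x₁ ⊞ var x₇ ⊡ at x₂ ⊞ at x₃)
          (b₁ ∷ b₂ ∷ m ∷ l ∷ τ ∷ ψ₁ ∷ ψ₂ ∷ ε ∷ []) es))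
          where
          A₁ A₂ N Λ : Polynomial 8
          A₁ = var x₀
          A₂ = var x₁
          N = var x₂
          Λ = var x₃

        qq∈² : q ∙ q ∈²⟨ p , M.q′ ⟩
        qq∈² = q , M.b∈ , refl

        p∈ : p ∈⟨ p , M.q′ ⟩
        p∈ = 1# , 0# , linear {0} {2} (at x₀) (con true ⊡ at x₀ ⊞ con false ⊡ at x₁) [] (p ∷ M.q′ ∷ [])

        pq-independent : Independent p q
        pq-independent {r} {s} e with vec-injective {c = r} {s} {0#} {0#} {0#} {0#} (trans (begin
            vec (r * a₁ + s * b₁) (r * a₂ + s * b₂) r s ≡⟨ vec-≡ _ _ _ _ ⟩
            _ ≡⟨ linear {6} {4} ((var x₀ :* var x₂ :+ var x₁ :* var x₄) ⊡ at x₀ ⊞ (var x₀ :* var x₃ :+ var x₁ :* var x₅) ⊡ at x₁ ⊞ var x₀ ⊡ at x₂ ⊞ var x₁ ⊡ at x₃)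
                   (var x₀ ⊡ (var x₂ ⊡ at x₀ ⊞ var x₃ ⊡ at x₁ ⊞ con true ⊡ at x₂ ⊞ con false ⊡ at x₃) ⊞ var x₁ ⊡ (var x₄ ⊡ at x₀ ⊞ var x₅ ⊡ at x₁ ⊞ con false ⊡ at x₂ ⊞ con true ⊡ at x₃)) (r ∷ s ∷ a₁ ∷ a₂ ∷ b₁ ∷ b₂ ∷ []) es ⟩
            _ ≡⟨ sym (cong₂ (λ x y → r · x ⊕ s · y) (vec-≡ a₁ a₂ 1# 0#) (vec-≡ b₁ b₂ 0# 1#)) ⟩
            r · p ⊕ s · q ∎) (trans e (sym vec-0)))
        ... | _ , z = z

        -- The special line through p meets ⟨e₁,e₂⟩ only in 0, so independent vectors of the latter
        -- stay independent modulo the former.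
        free-line : ∀ {s t s′ t′} → wedge (s , t) (s′ , t′) ≢ 0# → Free p M.q′ (s · e₁ ⊕ t · e₂) (s′ · e₁ ⊕ t′ · e₂)
        free-line {s} {t} {s′} {t′} d r r′ h = conclude (vec-injective (trans (vec-L (r * s + r′ * s′) (r * t + r′ * t′)) (trans vanishes (sym vec-0))))
          where
          regroup : r · (s · e₁ ⊕ t · e₂) ⊕ r′ · (s′ · e₁ ⊕ t′ · e₂) ≡ (r * s + r′ * s′) · e₁ ⊕ (r * t + r′ * t′) · e₂
          regroup = linear {6} {2} (var x₀ ⊡ (var x₂ ⊡ at x₀ ⊞ var x₃ ⊡ at x₁) ⊞ var x₁ ⊡ (var x₄ ⊡ at x₀ ⊞ var x₅ ⊡ at x₁))
            ((var x₀ :* var x₂ :+ var x₁ :* var x₄) ⊡ at x₀ ⊞ (var x₀ :* var x₃ :+ var x₁ :* var x₅) ⊡ at x₁) (r ∷ r′ ∷ s ∷ t ∷ s′ ∷ t′ ∷ []) (e₁ ∷ e₂ ∷ [])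
          e₁∈ : e₁ ∈⟨ e₁ , T.y ⟩
          e₁∈ = 1# , 0# , linear {0} {2} (at x₀) (con true ⊡ at x₀ ⊞ con false ⊡ at x₁) [] (e₁ ∷ T.y ∷ [])
          vanishes : (r * s + r′ * s′) · e₁ ⊕ (r * t + r′ * t′) · e₂ ≡ 0v
          vanishes = special-disjoint M.special T.special (subst (_∈⟨ p , M.q′ ⟩) regroup h) (∈-⊕ (∈-· _ e₁∈) (∈-· _ T.e₂∈)) (∉-line a₁ a₂)
          conclude : (r * s + r′ * s′ ≡ 0# × r * t + r′ * t′ ≡ 0#) × _ → r ≡ 0# × r′ ≡ 0#
          conclude ((x , y) , _) =
            *-cancel d (trans (solve 6 (λ r r′ s t s′ t′ → (s :* t′ :+ t :* s′) :* r := (r :* s :+ r′ :* s′) :* t′ :+ (r :* t :+ r′ :* t′) :* s′) refl r r′ s t s′ t′)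
              (trans (cong₂ (λ x y → x * t′ + y * s′) x y) (trans (cong₂ _+_ (zeroˡ _) (zeroˡ _)) (+-self 0#)))) ,
            *-cancel d (trans (solve 6 (λ r r′ s t s′ t′ → (s :* t′ :+ t :* s′) :* r′ := (r :* s :+ r′ :* s′) :* t :+ (r :* t :+ r′ :* t′) :* s) refl r r′ s t s′ t′)
              (trans (cong₂ (λ x y → x * t + y * s) x y) (trans (cong₂ _+_ (zeroˡ _) (zeroˡ _)) (+-self 0#))))

        -- Adding w₄ q ∙ q eliminates e₄ and leaves w₃ + ε w₄ at e₃, which a multiple of p ∙ p
        -- eliminates.
        reduce : ∀ w {w₁ w₂ w₃ w₄ f₁ f₂} → w ≡ w₁ · e₁ ⊕ w₂ · e₂ ⊕ w₃ · e₃ ⊕ w₄ · e₄ →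
          f₁ ≡ w₁ + w₄ * z₁ + (w₃ + ε * w₄) * v₁ → f₂ ≡ w₂ + w₄ * z₂ + (w₃ + ε * w₄) * v₂ → w ⊕ (f₁ · e₁ ⊕ f₂ · e₂) ∈²⟨ p , M.q′ ⟩
        reduce _ {w₁} {w₂} {w₃} {w₄} refl refl refl = subst (_∈²⟨ p , M.q′ ⟩) (begin
          w₄ · (q ∙ q) ⊕ (w₃ + ε * w₄) · (p ∙ p) ≡⟨ cong₂ (λ s t → w₄ · s ⊕ (w₃ + ε * w₄) · t) qq pp ⟩
          w₄ · (z₁ · e₁ ⊕ z₂ · e₂ ⊕ ε · e₃ ⊕ e₄) ⊕ (w₃ + ε * w₄) · (v₁ · e₁ ⊕ v₂ · e₂ ⊕ e₃)
            ≡⟨ linear {9} {4} (var x₃ ⊡ (var x₄ ⊡ at x₀ ⊞ var x₅ ⊡ at x₁ ⊞ E ⊡ at x₂ ⊞ at x₃) ⊞ (var x₂ :+ E :* var x₃) ⊡ (var x₆ ⊡ at x₀ ⊞ var x₇ ⊡ at x₁ ⊞ at x₂))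
                 ((var x₀ ⊡ at x₀ ⊞ var x₁ ⊡ at x₁ ⊞ var x₂ ⊡ at x₂ ⊞ var x₃ ⊡ at x₃) ⊞ ((var x₀ :+ var x₃ :* var x₄ :+ (var x₂ :+ E :* var x₃) :* var x₆) ⊡ at x₀ ⊞ (var x₁ :+ var x₃ :* var x₅ :+ (var x₂ :+ E :* var x₃) :* var x₇) ⊡ at x₁))
                 (w₁ ∷ w₂ ∷ w₃ ∷ w₄ ∷ z₁ ∷ z₂ ∷ v₁ ∷ v₂ ∷ ε ∷ []) es ⟩
          _ ∎) (∈²-⊕ (∈²-· w₄ qq∈²) (∈²-· (w₃ + ε * w₄) S.pp∈²))
          where
          open import Data.Fin.Base using (suc)
          E : Polynomial 9
          E = var (suc x₇)

        f₁ fₓ g₁ gₓ : L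
        f₁ = (a₁ , a₂) +ᴸ (v₁ , v₂)
        fₓ = (0# , 1#) ∙ᴸ (a₁ , a₂) +ᴸ ((z₁ , z₂) +ᴸ ε *ᴸ (v₁ , v₂))
        g₁ = (b₁ , b₂) +ᴸ ((z₁ , z₂) +ᴸ ε *ᴸ (v₁ , v₂))
        gₓ = (0# , 1#) ∙ᴸ (b₁ , b₂) +ᴸ χ +ᴸ ((z₁ , z₂) +ᴸ (β + ε) *ᴸ (v₁ , v₂))

        images : ∀ s t → Images p M.q′ p q e₁ e₂ (s · e₁ ⊕ t · e₂)
        images s t = record
          { s₁ = proj₁ ((s , t) ∙ᴸ (s , t)) ; s₂ = proj₂ ((s , t) ∙ᴸ (s , t))
          ; f₁ = proj₁ (s *ᴸ f₁ +ᴸ t *ᴸ fₓ) ; f₂ = proj₂ (s *ᴸ f₁ +ᴸ t *ᴸ fₓ)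
          ; g₁ = proj₁ (s *ᴸ g₁ +ᴸ t *ᴸ gₓ) ; g₂ = proj₂ (s *ᴸ g₁ +ᴸ t *ᴸ gₓ)
          ; s = subst (_∈²⟨ p , M.q′ ⟩) (sym (trans (cong₂ _⊕_ (trans (cong ((s · e₁ ⊕ t · e₂) ∙_) (sym (vec-L s t))) (trans (mulᴸ-sound s t (s , t , 0# , 0#)) (vec-≡ _ _ _ _))) refl)
              (trans (linear {7} {4}
                (((var x₀ :* var x₀ :+ var x₁ :* (var x₂ :* var x₁ :+ var x₄ :* con false)) ⊡ at x₀ ⊞ (var x₀ :* var x₁ :+ var x₁ :* (var x₀ :+ var x₃ :* var x₁ :+ var x₅ :* con false)) ⊡ at x₁
                  ⊞ (var x₀ :* con false :+ var x₁ :* (var x₆ :* con false)) ⊡ at x₂ ⊞ (var x₀ :* con false :+ var x₁ :* (con false :+ con false)) ⊡ at x₃)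
                  ⊞ ((var x₀ :* var x₀ :+ var x₂ :* (var x₁ :* var x₁)) ⊡ at x₀ ⊞ (var x₀ :* var x₁ :+ var x₁ :* var x₀ :+ var x₃ :* (var x₁ :* var x₁)) ⊡ at x₁))
                (con false ⊡ at x₀) (s ∷ t ∷ m ∷ l ∷ χ₁ ∷ χ₂ ∷ β ∷ []) es) (0-· e₁)))) 0∈²
          ; f = reduce _ (trans (∙-comm p _) (trans (mulᴸ-sound s t (a₁ , a₂ , 1# , 0#)) (vec-≡ _ _ _ _)))
              (solve 10 (λ s t a₁ a₂ m x v z e b → s :* (a₁ :+ v) :+ t :* ((con false :* a₁ :+ m :* (con true :* a₂)) :+ (z :+ e :* v))
                 := (s :* a₁ :+ t :* (m :* a₂ :+ x :* con false)) :+ (s :* con false :+ t :* (con true :+ con false)) :* z :+ ((s :* con true :+ t :* (b :* con false)) :+ e :* (s :* con false :+ t :* (con true :+ con false))) :* v) refl s t a₁ a₂ m χ₁ v₁ z₁ ε β)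
              (solve 10 (λ s t a₁ a₂ l x v z e b → s :* (a₂ :+ v) :+ t :* ((con false :* a₂ :+ con true :* a₁ :+ l :* (con true :* a₂)) :+ (z :+ e :* v))
                 := (s :* a₂ :+ t :* (a₁ :+ l :* a₂ :+ x :* con false)) :+ (s :* con false :+ t :* (con true :+ con false)) :* z :+ ((s :* con true :+ t :* (b :* con false)) :+ e :* (s :* con false :+ t :* (con true :+ con false))) :* v) refl s t a₁ a₂ l χ₂ v₂ z₂ ε β)
          ; g = reduce _ (trans (∙-comm q _) (trans (mulᴸ-sound s t (b₁ , b₂ , 0# , 1#)) (vec-≡ _ _ _ _)))
              (solve 10 (λ s t a₁ a₂ m x v z e b → s :* (a₁ :+ (z :+ e :* v)) :+ t :* ((con false :* a₁ :+ m :* (con true :* a₂)) :+ x :+ (z :+ (b :+ e) :* v))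
                 := (s :* a₁ :+ t :* (m :* a₂ :+ x :* con true)) :+ (s :* con true :+ t :* (con false :+ con true)) :* z :+ ((s :* con false :+ t :* (b :* con true)) :+ e :* (s :* con true :+ t :* (con false :+ con true))) :* v) refl s t b₁ b₂ m χ₁ v₁ z₁ ε β)
              (solve 10 (λ s t a₁ a₂ l x v z e b → s :* (a₂ :+ (z :+ e :* v)) :+ t :* ((con false :* a₂ :+ con true :* a₁ :+ l :* (con true :* a₂)) :+ x :+ (z :+ (b :+ e) :* v))
                 := (s :* a₂ :+ t :* (a₁ :+ l :* a₂ :+ x :* con true)) :+ (s :* con true :+ t :* (con false :+ con true)) :* z :+ ((s :* con false :+ t :* (b :* con true)) :+ e :* (s :* con true :+ t :* (con false :+ con true))) :* v) refl s t b₁ b₂ l χ₂ v₂ z₂ ε β)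
          }

      -- Each computed entry is the pair of determinants of `images` at its direction, so a crossing
      -- would violate `no-crossing` for the special line ⟨p,q⟩.
      not-bad : badLine χ ψ (a₁ , a₂) (b₁ , b₂) ≢ true
      not-bad e = pairs (List.map (entry f₁ fₓ g₁ gₓ) directions) (∈-map⁻ (entry f₁ fₓ g₁ gₓ)) e
        where
        collide : ∀ u u′ → crosses (entry f₁ fₓ g₁ gₓ u) (entry f₁ fₓ g₁ gₓ u′) ≡ true → ⊥
        collide (s , t) (s′ , t′) c with ∧-sound (is0 _) c
        ... | z , n = no-crossing M.special p∈ M.b∈ pq-independent
                        (free-line (λ w → not-sound n (trans (cong is0 w) is0-zero))) (images s t) (images s′ t′) (+⇒≡ (is0-sound z))
        pairs : ∀ xs → (∀ {x} → x ∈ xs → ∃ λ u → u ∈ directions × x ≡ entry f₁ fₓ g₁ gₓ u) → anyPair xs ≡ true → ⊥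
        pairs (x ∷ xs) from c with anyᵇ (crosses x) xs in eq
        ... | false = pairs xs (from ∘ there) c
        ... | true with anyᵇ-sound (crosses x) xs eq
        ...   | x′ , x′∈ , c′ with from (here refl) | from (there x′∈)
        ...     | u , _ , refl | u′ , _ , refl = collide u u′ c′

      -- p ∙ q is a combination of p ∙ p and q ∙ q. Its e₃- and e₄-coordinates determine the
      -- coefficients, and the remaining two coordinates are what the check tests.
      closes-true : ∀ {ω} → e₃ ∙ e₄ ≡ ⟪ ω ⟫ → closes χ ψ ω (a₁ , a₂) (b₁ , b₂) ≡ true
      closes-true {ω} eω = conclude (mulᵠ χ ψ ω (a₁ , a₂ , 1# , 0#) (b₁ , b₂ , 0# , 1#)) M.closed (sym (mulᵠ-sound eω _ _))
        where
        conclude : ∀ w → (∃₂ λ s t → p ∙ q ≡ s · (p ∙ p) ⊕ t · (q ∙ q)) → ⟪ w ⟫ ≡ p ∙ q →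
          isL0 ((proj₁ w , proj₁ (proj₂ w)) +ᴸ (proj₂ (proj₂ (proj₂ w)) *ᴸ (z₁ , z₂) +ᴸ (proj₁ (proj₂ (proj₂ w)) + ε * proj₂ (proj₂ (proj₂ w))) *ᴸ (v₁ , v₂))) ≡ true
        conclude (w₁ , w₂ , w₃ , w₄) (s , t , e) ew = reduced-zero {s = s} {t} {v₁} {v₂} {z₁} {z₂} (vec-injective (begin
          vec w₁ w₂ w₃ w₄ ≡⟨ trans ew e ⟩
          s · (p ∙ p) ⊕ t · (q ∙ q) ≡⟨ cong₂ (λ x y → s · x ⊕ t · y) pp qq ⟩
          s · (v₁ · e₁ ⊕ v₂ · e₂ ⊕ e₃) ⊕ t · (z₁ · e₁ ⊕ z₂ · e₂ ⊕ ε · e₃ ⊕ e₄)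
            ≡⟨ linear {7} {4} (var x₀ ⊡ (var x₂ ⊡ at x₀ ⊞ var x₃ ⊡ at x₁ ⊞ at x₂) ⊞ var x₁ ⊡ (var x₄ ⊡ at x₀ ⊞ var x₅ ⊡ at x₁ ⊞ var x₆ ⊡ at x₂ ⊞ at x₃))
                 ((var x₀ :* var x₂ :+ var x₁ :* var x₄) ⊡ at x₀ ⊞ (var x₀ :* var x₃ :+ var x₁ :* var x₅) ⊡ at x₁ ⊞ (var x₀ :+ var x₁ :* var x₆) ⊡ at x₂ ⊞ var x₁ ⊡ at x₃) (s ∷ t ∷ v₁ ∷ v₂ ∷ z₁ ∷ z₂ ∷ ε ∷ []) es ⟩
          _ ≡⟨ sym (vec-≡ _ _ _ _) ⟩
          vec (s * v₁ + t * z₁) (s * v₂ + t * z₂) (s + t * ε) t ∎))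

    module _ {ω : Q} (e₃e₄ : e₃ ∙ e₄ ≡ ⟪ ω ⟫) where
      unit-⟪⟫ : ∀ {P : V → Set} → (∀ {u} → u ∈ units χ ψ → P ⟪ u ⟫) → P e₁ × P e₂ × P e₃ × P e₄
      unit-⟪⟫ {P} h = subst P (vec-unit 1# 0# 0# 0# e₁ (linear {0} {4} (con true ⊡ at x₀ ⊞ con false ⊡ at x₁ ⊞ con false ⊡ at x₂ ⊞ con false ⊡ at x₃) (at x₀) [] es)) (h (here refl))
        , subst P (vec-unit 0# 1# 0# 0# e₂ (linear {0} {4} (con false ⊡ at x₀ ⊞ con true ⊡ at x₁ ⊞ con false ⊡ at x₂ ⊞ con false ⊡ at x₃) (at x₁) [] es)) (h (there (here refl)))
        , subst P (vec-unit 0# 0# 1# 0# e₃ (linear {0} {4} (con false ⊡ at x₀ ⊞ con false ⊡ at x₁ ⊞ con true ⊡ at x₂ ⊞ con false ⊡ at x₃) (at x₂) [] es)) (h (there (there (here refl))))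
        , subst P (vec-unit 0# 0# 0# 1# e₄ (linear {0} {4} (con false ⊡ at x₀ ⊞ con false ⊡ at x₁ ⊞ con false ⊡ at x₂ ⊞ con true ⊡ at x₃) (at x₃) [] es)) (h (there (there (there (here refl)))))
        where
        vec-unit : ∀ a b c d w → a · e₁ ⊕ b · e₂ ⊕ c · e₃ ⊕ d · e₄ ≡ w → vec a b c d ≡ w
        vec-unit a b c d w e = trans (vec-≡ a b c d) e

      linear-zero : (f : V → V) → (∀ u v → f (u ⊕ v) ≡ f u ⊕ f v) → (∀ r v → f (r · v) ≡ r · f v) →
        f e₁ ≡ 0v × f e₂ ≡ 0v × f e₃ ≡ 0v × f e₄ ≡ 0v → ∀ v → f v ≡ 0v
      linear-zero f f-⊕ f-· (z₁ , z₂ , z₃ , z₄) v with vec-surjective v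
      ... | a , b , c , d , refl = begin
        f (vec a b c d) ≡⟨ cong f (vec-≡ a b c d) ⟩
        f (a · e₁ ⊕ b · e₂ ⊕ c · e₃ ⊕ d · e₄) ≡⟨ trans (f-⊕ _ _) (cong₂ _⊕_ (trans (f-⊕ _ _) (cong₂ _⊕_ (trans (f-⊕ _ _) (cong₂ _⊕_ (kill a z₁) (kill b z₂))) (kill c z₃))) (kill d z₄)) ⟩
        0v ⊕ 0v ⊕ 0v ⊕ 0v ≡⟨ trans (⊕-identityʳ _) (trans (⊕-identityʳ _) (⊕-identityʳ _)) ⟩
        0v ∎
        where
        kill : ∀ r {e} → f e ≡ 0v → f (r · e) ≡ 0v
        kill r z = trans (f-· r _) (trans (cong (r ·_) z) (·-0 r))

      private
        assoc₃ : Q → Q → Q → Q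
        assoc₃ u v w = mulᵠ χ ψ ω (mulᵠ χ ψ ω u v) w +ᵠ mulᵠ χ ψ ω u (mulᵠ χ ψ ω v w)
        assoc₂ : Q → Q → Bool
        assoc₂ u v = allᵇ (λ w → isQ0 (assoc₃ u v w)) (units χ ψ)
        assoc₁ : Q → Bool
        assoc₁ u = allᵇ (assoc₂ u) (units χ ψ)

      associator : V → V → V → V
      associator u v w = (u ∙ v) ∙ w ⊕ u ∙ (v ∙ w)

      -- The associator is trilinear, so its values on basis vectors decide; linearity is used in
      -- one argument at a time.
      associates-sound : associates χ ψ ω ≡ true → ∀ u v w → associator u v w ≡ 0v
      associates-sound e u v w =
        linear-zero (λ u → associator u v w)
          (λ a b → trans (cong₂ _⊕_ (trans (cong (_∙ w) (⊕-∙ a b v)) (⊕-∙ _ _ w)) (⊕-∙ a b _)) (⊕-medial _ _ _ _))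
          (λ r a → trans (cong₂ _⊕_ (trans (cong (_∙ w) (·-∙ r a v)) (·-∙ r _ w)) (·-∙ r a _)) (sym (·-⊕ r _ _)))
          (unit-⟪⟫ {λ u → associator u v w ≡ 0v} λ {u} u∈ → linear-zero (λ v → associator ⟪ u ⟫ v w)
            (λ a b → trans (cong₂ _⊕_ (trans (cong (_∙ w) (∙-⊕ _ a b)) (⊕-∙ _ _ w)) (trans (cong (⟪ u ⟫ ∙_) (⊕-∙ a b w)) (∙-⊕ _ _ _))) (⊕-medial _ _ _ _))
            (λ r a → trans (cong₂ _⊕_ (trans (cong (_∙ w) (∙-· r _ a)) (·-∙ r _ w)) (trans (cong (⟪ u ⟫ ∙_) (·-∙ r a w)) (∙-· r _ _))) (sym (·-⊕ r _ _)))
            (unit-⟪⟫ {λ v → associator ⟪ u ⟫ v w ≡ 0v} λ {v} v∈ → linear-zero (λ w → associator ⟪ u ⟫ ⟪ v ⟫ w)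
              (λ a b → trans (cong₂ _⊕_ (∙-⊕ _ a b) (trans (cong (⟪ u ⟫ ∙_) (∙-⊕ _ a b)) (∙-⊕ _ _ _))) (⊕-medial _ _ _ _))
              (λ r a → trans (cong₂ _⊕_ (∙-· r _ a) (trans (cong (⟪ u ⟫ ∙_) (∙-· r _ a)) (∙-· r _ _))) (sym (·-⊕ r _ _)))
              (unit-⟪⟫ {λ w → associator ⟪ u ⟫ ⟪ v ⟫ w ≡ 0v} λ {w} w∈ → begin
                (⟪ u ⟫ ∙ ⟪ v ⟫) ∙ ⟪ w ⟫ ⊕ ⟪ u ⟫ ∙ (⟪ v ⟫ ∙ ⟪ w ⟫) ≡⟨ cong₂ (λ s t → s ∙ ⟪ w ⟫ ⊕ ⟪ u ⟫ ∙ t) (mulᵠ-sound e₃e₄ u v) (mulᵠ-sound e₃e₄ v w) ⟩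
                ⟪ mulᵠ χ ψ ω u v ⟫ ∙ ⟪ w ⟫ ⊕ ⟪ u ⟫ ∙ ⟪ mulᵠ χ ψ ω v w ⟫ ≡⟨ cong₂ _⊕_ (mulᵠ-sound e₃e₄ (mulᵠ χ ψ ω u v) w) (mulᵠ-sound e₃e₄ u (mulᵠ χ ψ ω v w)) ⟩
                ⟪ mulᵠ χ ψ ω (mulᵠ χ ψ ω u v) w ⟫ ⊕ ⟪ mulᵠ χ ψ ω u (mulᵠ χ ψ ω v w) ⟫ ≡⟨ ⟪⟫-⊕ (mulᵠ χ ψ ω (mulᵠ χ ψ ω u v) w) (mulᵠ χ ψ ω u (mulᵠ χ ψ ω v w)) ⟩
                ⟪ assoc₃ u v w ⟫ ≡⟨ isQ0-sound (assoc₃ u v w) (allᵇ-sound (λ w → isQ0 (assoc₃ u v w)) (units χ ψ) (allᵇ-sound (assoc₂ u) (units χ ψ) (allᵇ-sound assoc₁ (units χ ψ) e u∈) v∈) w∈) ⟩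
                0v ∎)
              w)
            v)
          u

      -- In a commutative associative product every multiplication satisfies the nuclear relation;
      -- the factor k with e ∙ k = v moves e to v.
      nuclear : associates χ ψ ω ≡ true → Nuclear A
      nuclear as e v e≢0 with ∙-surjective e≢0 v
      ... | k , ek = (k ∙_) , trans (∙-comm k e) ek , λ a b → begin
        (k ∙ a) ∙ b ≡⟨ cong (_∙ b) (∙-comm k a) ⟩
        (a ∙ k) ∙ b ≡⟨ ⊕⇒≡ (associates-sound as a k b) ⟩
        a ∙ (k ∙ b) ∎

      isQ0-complete : ∀ u → isQ0 u ≢ true → ⟪ u ⟫ ≢ 0v
      isQ0-complete (a , b , c , d) n z = all-zero (vec-injective (trans z (sym vec-0)))
        where
        all-zero : (a ≡ 0# × b ≡ 0#) × (c ≡ 0# × d ≡ 0#) → ⊥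
        all-zero ((refl , refl) , refl , refl) = n (cong₂ _∧_ is0-zero (cong₂ _∧_ is0-zero isL0-zero))

      not-annihilates : annihilates χ ψ ω ≢ true
      not-annihilates e = product (ZeroProducts.search-sound Qs isQ0 (mulᵠ χ ψ ω) e)
        where
        product : (∃₂ λ u v → isQ0 u ≢ true × isQ0 v ≢ true × isQ0 (mulᵠ χ ψ ω u v) ≡ true) → ⊥
        product (u , v , nu , nv , z) = cases (zero-product {⟪ u ⟫} {⟪ v ⟫} (trans (mulᵠ-sound e₃e₄ u v) (isQ0-sound (mulᵠ χ ψ ω u v) z)))
          where
          cases : ⟪ u ⟫ ≡ 0v ⊎ ⟪ v ⟫ ≡ 0v → ⊥
          cases (inj₁ y) = isQ0-complete u nu y
          cases (inj₂ y) = isQ0-complete v nv y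

      accepts-sound : associates χ ψ ω ≡ true ⊎ annihilates χ ψ ω ≡ true → Nuclear A
      accepts-sound (inj₁ as) = nuclear as
      accepts-sound (inj₂ an) = ⊥-elim (not-annihilates an)

      partner : ∀ a → ∃ λ b → b ∈ Ls × badLine χ ψ a b ≢ true × closes χ ψ ω a b ≡ true
      partner a = from-line (through a)
        where
        from-line : (∃ λ b → Through a b) → ∃ λ b → b ∈ Ls × badLine χ ψ a b ≢ true × closes χ ψ ω a b ≡ true
        from-line (b , M) = b , Ls-complete (proj₁ b) (proj₂ b) , not-bad M , closes-true M {ω} e₃e₄

      settled-sound : settled χ ψ ≡ true → Nuclear A
      settled-sound e = accepts-sound (∨-sound (associates χ ψ ω)
        (Search.settled-accepts Ls Qs (badLine χ ψ) (closes χ ψ) (λ ω → associates χ ψ ω ∨ annihilates χ ψ ω) (Qs-complete ω) partner e))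

    check-sound : check ≡ true → Nuclear A
    check-sound e = cases (Sweep.sweep-sound Ls (λ χ ψ → divides χ ψ fixedTable) settled e (Ls-complete χ₁ χ₂) (Ls-complete ψ₁ ψ₂))
      where
      cases : divides χ ψ fixedTable ≡ true ⊎ settled χ ψ ≡ true → Nuclear A
      cases (inj₁ d) = ⊥-elim (not-divides d)
      cases (inj₂ s) = settled-sound (proj₂ (⟪⟫-surjective (e₃ ∙ e₄))) s

  -- Classifying the quotient actions and running the search

  module Classification (𝔽 : Field₂) where
    open Field₂-Properties 𝔽

    N₁ : K → K → K
    N₁ s t = (s * s + ε * (t * t)) * t + t * t * s

    N₂ : K → K → K → K → K
    N₂ α β s t = (s * s + ε * (t * t)) * (s + t) + t * t * (α * s + β * t)

    pairs : List ((K × K) × (K × K))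
    pairs = List.cartesianProduct (Checker.directions 𝔽 1# 1# 1# 1#) (Checker.directions 𝔽 1# 1# 1# 1#)

    crossing : K → K → (K × K) × (K × K) → Bool
    crossing α β ((s , t) , (s′ , t′)) = not (is0 (s * t′ + t * s′)) ∧ is0 (N₁ s t * N₂ α β s′ t′ + N₂ α β s t * N₁ s′ t′)

    kernel : K → K → K × K → Bool
    kernel α β (s , t) = not (is0 s ∧ is0 t) ∧ is0 (s * (s + t) + t * (α * s + β * t))

    -- The obstructions `no-crossings` and `no-kernel` of a frame, evaluated at all directions. The
    -- classification shows that α = 0 and β in a short list are all that they permit.
    impossible : K → K → Bool
    impossible α β = anyᵇ (crossing α β) pairs ∨ anyᵇ (kernel α β) (Checker.directions 𝔽 1# 1# 1# 1#)

    listed : List K → K → Bool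
    listed βs β = anyᵇ (λ β′ → is0 (β + β′)) βs

    classified : List K → Bool
    classified βs = Sweep.sweep elements impossible (λ α β → is0 α ∧ listed βs β)

    reducible : K → K → Bool
    reducible l m = anyᵇ (λ r → is0 (r * r + l * r + m)) elements

    rebases : K → K → K × K × K → Bool
    rebases l m (a , b , m′) = not (is0 (a * a + a * b + ε * (b * b)))
      ∧ is0 ((a + b) * (a + b) * l + (a * (a + b) + b * (ε * b) + b * (a + b) * l + m′ * (b * b * l)))
      ∧ is0 (ε * b * (ε * b) + (a + b) * (a + b) * m + (a * (ε * b) + b * (a + b) * m + m′ * (a * a + b * b * m)))

    -- Every pair (l , m) without a root can be moved to (1 , m′) with m′ in the list, by a change
    -- of base point a p + b x satisfying the conditions of `rebase-frame`.
    rebasable : List K → Bool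
    rebasable ms = Sweep.sweep elements reducible (λ l m → anyᵇ (rebases l m) (List.cartesianProduct elements (List.cartesianProduct elements ms)))

    -- The second route needs β = ε: together with α = 0 this makes x act on the quotient like a
    -- root of y² + y + ε, the field whose multiplications change the base point.
    data Settled (l m β : K) : Set where
      directly : Checked 𝔽 l m β → Settled l m β
      rebased  : ∀ m′ x → rebases l m (proj₁ x , proj₂ x , m′) ≡ true → β ≡ ε → Checked 𝔽 1# m′ ε → Settled l m β

    settled-directly : ∀ {l m β} → Sweep.sweep elements reducible (λ l m → Checker.check 𝔽 l m (ε * inv l) β) ≡ true →
                       reducible l m ≢ true → Settled l m β
    settled-directly {l} {m} {β} s n = cases (Sweep.sweep-sound elements reducible (λ l m → Checker.check 𝔽 l m (ε * inv l) β) s (complete l) (complete m))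
      where
      cases : reducible l m ≡ true ⊎ Checker.check 𝔽 l m (ε * inv l) β ≡ true → Settled l m β
      cases (inj₁ r) = ⊥-elim (n r)
      cases (inj₂ c) = directly (checked c)

    settled-rebased : ∀ {ms l m} → rebasable ms ≡ true → (∀ {m′} → m′ ∈ ms → Checked 𝔽 1# m′ ε) →
                      reducible l m ≢ true → Settled l m ε
    settled-rebased {ms} {l} {m} s all-checked n = cases (Sweep.sweep-sound elements reducible (λ l m → anyᵇ (rebases l m) triples) s (complete l) (complete m))
      where
      triples : List (K × K × K)
      triples = List.cartesianProduct elements (List.cartesianProduct elements ms)
      third-∈ : ∀ {a b m′} → (a , b , m′) ∈ triples → m′ ∈ ms
      third-∈ x∈ = proj₂ (∈-cartesianProduct⁻ elements ms (proj₂ (∈-cartesianProduct⁻ elements (List.cartesianProduct elements ms) x∈)))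
      found : (∃ λ x → x ∈ triples × rebases l m x ≡ true) → Settled l m ε
      found ((a , b , m′) , x∈ , r) = rebased m′ (a , b) r refl (all-checked (third-∈ x∈))
      cases : reducible l m ≡ true ⊎ anyᵇ (rebases l m) triples ≡ true → Settled l m ε
      cases (inj₁ r) = ⊥-elim (n r)
      cases (inj₂ r) = found (anyᵇ-sound (rebases l m) triples r)

    module _ (A : Presemifield₂ 𝔽) {βs : List K} (classification : classified βs ≡ true)
             (settle : ∀ {l m β} → β ∈ βs → reducible l m ≢ true → Settled l m β) where
      open NormalForms A using (Frame; module Frame; rebase-frame; normal-basis; exists-frame; NormalBasis; module NormalBasis; norm)

      private
        from-basis : ∀ {p x v z l m β χ₁ χ₂ ψ₁ ψ₂} → Checker.check 𝔽 l m (ε * inv l) β ≡ true →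
          NormalBasis p x v z l m (ε * inv l) β χ₁ χ₂ ψ₁ ψ₂ → Nuclear A
        from-basis {l = l} {m} {β} {χ₁} {χ₂} {ψ₁} {ψ₂} c N = nuclear-isotopic (isotopic A (NormalBasis.basis N))
          (Soundness′.check-sound (isotope A (NormalBasis.basis N)) l m (ε * inv l) β χ₁ χ₂ ψ₁ ψ₂ (table A N) c)

        from-checked : ∀ {p x v c l m β} → Checker.check 𝔽 l m (ε * inv l) β ≡ true → Frame p x v c l m 0# β → Nuclear A
        from-checked ch F = go (normal-basis F)
          where
          go : (∃₂ λ v′ z → ∃₂ λ χ₁ χ₂ → ∃₂ λ ψ₁ ψ₂ → NormalBasis _ _ v′ z _ _ _ _ χ₁ χ₂ ψ₁ ψ₂) → Nuclear A
          go (_ , _ , _ , _ , _ , _ , N) = from-basis ch N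

        from-settled : ∀ {p x v c l m β} → Settled l m β → Frame p x v c l m 0# β → Nuclear A
        from-settled (directly (checked ch)) F = from-checked ch F
        from-settled {l = l} {m} (rebased m′ (a , b) r refl (checked ch)) F = from-checked ch
          (rebase-frame a b m′ (λ z → not-sound (proj₁ s) (trans (cong is0 z) is0-zero)) (+⇒≡ (is0-sound (proj₁ s′))) (+⇒≡ (is0-sound (proj₂ s′))) F)
          where
          s  = ∧-sound (not (is0 (a * a + a * b + ε * (b * b)))) r
          s′ = ∧-sound (is0 ((a + b) * (a + b) * l + (a * (a + b) + b * (ε * b) + b * (a + b) * l + m′ * (b * b * l)))) (proj₂ s)

        irreducible : ∀ {p x v c l m α β} → Frame p x v c l m α β → reducible l m ≢ true
        irreducible {l = l} {m} F e with anyᵇ-sound (λ r → is0 (r * r + l * r + m)) elements e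
        ... | r , _ , z = Frame.irreducible F r (is0-sound z)

        no-crossing : ∀ {p x v c l m α β} → Frame p x v c l m α β → anyᵇ (crossing α β) pairs ≢ true
        no-crossing {α = α} {β} F e with anyᵇ-sound (crossing α β) pairs e
        ... | ((s , t) , (s′ , t′)) , _ , c with ∧-sound (not (is0 (s * t′ + t * s′))) c
        ...   | n , z = Frame.no-crossings F {s} {t} {s′} {t′} (λ w → not-sound n (trans (cong is0 w) is0-zero)) (+⇒≡ (is0-sound z))

        no-kernel : ∀ {p x v c l m α β} → Frame p x v c l m α β → anyᵇ (kernel α β) (Checker.directions 𝔽 1# 1# 1# 1#) ≢ true
        no-kernel {α = α} {β} F e with anyᵇ-sound (kernel α β) (Checker.directions 𝔽 1# 1# 1# 1#) e
        ... | (s , t) , _ , c with ∧-sound (not (is0 s ∧ is0 t)) c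
        ...   | n , z = Frame.no-kernel F {s} {t} (λ (w , w′) → not-sound n (cong₂ _∧_ (trans (cong is0 w) is0-zero) (trans (cong is0 w′) is0-zero))) (is0-sound z)

        from-frame : ∀ {p x v c l m α β} → Frame p x v c l m α β → Nuclear A
        from-frame {α = α} {β} F = cases (Sweep.sweep-sound elements impossible (λ α β → is0 α ∧ listed βs β) classification (complete α) (complete β))
          where
          listed-∈ : (∃ λ β′ → β′ ∈ βs × is0 (β + β′) ≡ true) → β ∈ βs
          listed-∈ (β′ , β′∈ , z) = subst (_∈ βs) (sym (+⇒≡ (is0-sound z))) β′∈
          excluded : anyᵇ (crossing α β) pairs ≡ true ⊎ anyᵇ (kernel α β) (Checker.directions 𝔽 1# 1# 1# 1#) ≡ true → ⊥
          excluded (inj₁ x) = no-crossing F x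
          excluded (inj₂ x) = no-kernel F x
          cases : impossible α β ≡ true ⊎ is0 α ∧ listed βs β ≡ true → Nuclear A
          cases (inj₁ x) = ⊥-elim (excluded (∨-sound (anyᵇ (crossing α β) pairs) x))
          cases (inj₂ y) = standard (is0-sound (proj₁ (∧-sound (is0 α) y))) (listed-∈ (anyᵇ-sound (λ β′ → is0 (β + β′)) βs (proj₂ (∧-sound (is0 α) y))))
            where
            standard : α ≡ 0# → β ∈ βs → Nuclear A
            standard refl β∈ = from-settled (settle β∈ (irreducible F)) F

      always-nuclear : Nuclear A
      always-nuclear = go (exists-frame e₁≢0)
        where
        e₁≢0 : e₁ ≢ 0v
        e₁≢0 z = 1≢0 (first z)
          where
          opaque
            unfolding _⊕_ e₁
            first : e₁ ≡ 0v → 1# ≡ 0#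
            first = cong proj₁
        go : (∃ λ x → ∃₂ λ v c → ∃₂ λ l m → ∃₂ λ α β → Frame e₁ x v c l m α β) → Nuclear A
        go (_ , _ , _ , _ , _ , _ , _ , F) = from-frame F

  module Verified where
    open Classification

    nuclear₂ : (A : Presemifield₂ GF2.field₂) → Nuclear A
    nuclear₂ A = always-nuclear GF2.field₂ A {𝟏₂ ∷ []} refl settle
      where
      settle : ∀ {l m β} → β ∈ 𝟏₂ ∷ [] → reducible GF2.field₂ l m ≢ true → Settled GF2.field₂ l m β
      settle (here refl) = settled-directly GF2.field₂ refl

    -- Two quotient actions survive here, β = ε and β = ε + 1; for each of them all irreducible
    -- pairs (l , m) are searched directly.
    nuclear₄ : (A : Presemifield₂ GF4.field₂) → Nuclear A
    nuclear₄ A = always-nuclear GF4.field₂ A {ω₄ ∷ ω₄² ∷ []} refl settle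
      where
      settle : ∀ {l m β} → β ∈ ω₄ ∷ ω₄² ∷ [] → reducible GF4.field₂ l m ≢ true → Settled GF4.field₂ l m β
      settle (here refl)         = settled-directly GF4.field₂ refl
      settle (there (here refl)) = settled-directly GF4.field₂ refl

    -- Only β = ε = 1 survives, so l can be moved to 1 and four searches replace one for each of the
    -- 28 irreducible pairs (l , m).
    nuclear₈ : (A : Presemifield₂ GF8.field₂) → Nuclear A
    nuclear₈ A = always-nuclear GF8.field₂ A {𝟏₈ ∷ []} refl settle
      where
      settle : ∀ {l m β} → β ∈ 𝟏₈ ∷ [] → reducible GF8.field₂ l m ≢ true → Settled GF8.field₂ l m β
      settle (here refl) = settled-rebased GF8.field₂ {𝟏₈ ∷ γ₃ ∷ γ₅ ∷ γ₇ ∷ []} refl checked₈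

open import Defs
import Algebra.Properties.CommutativeMonoid.Sum as Sum
import Algebra.Solver.Ring
open import Algebra.Bundles using (RawRing)
open import Algebra.Solver.Ring.AlmostCommutativeRing using (fromCommutativeRing; _-Raw-AlmostCommutative⟶_)
open import Data.Bool.Base using (Bool; true; false; _xor_; _∧_)
open import Data.Empty using (⊥; ⊥-elim)
import Data.Fin.Base as Fin
open import Data.Fin.Base using (Fin; zero; suc; punchIn; splitAt; _↑ˡ_; _↑ʳ_)
open import Data.Fin.Permutation using (permutation)
open import Data.Maybe.Base using (Maybe; just; nothing)
import Data.Fin.Properties as Fin
open import Data.Nat.Base as ℕ using (ℕ; zero; suc; s≤s; z≤n)
open import Data.Product using (∃; ∃₂; _×_; _,_; proj₁; proj₂)
open import Data.Sum using (_⊎_; inj₁; inj₂; reduce; map₂)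
import Data.Vec.Functional as VF
import Data.Vec.Functional.Properties as VF
open import Function.Base using (id)
open import Level using (0ℓ)
open import Relation.Nullary using (¬_; yes; no; Dec)
import Relation.Binary.Reasoning.Setoid
open import Relation.Binary.PropositionalEquality as ≡ using (_≡_; _≢_)
open Commutative using (Finite; Fin-surjective; injective⇒surjective; Field₂; module Field₂-Properties; Presemifield₂; Nuclear; allᵇ; allᵇ-sound;
  F₂; 𝟎₂; 𝟏₂; F₄; 𝟎₄; 𝟏₄; ω₄; ω₄²; F₈; 𝟎₈; 𝟏₈; γ₂; γ₃; γ₄; γ₅; γ₆; γ₇; module GF2; module GF4; module GF8; module Verified)

-- Identifying an abstract field of order 2, 4 or 8 with its concrete model

module FieldProperties {q : ℕ} (F : FiniteField q) where
  open FiniteField F hiding (zero)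
  open Relation.Binary.Reasoning.Setoid setoid

  index : Carrier → Fin q
  index x = proj₁ (enum-surjective x)

  enum-index : ∀ x → enum (index x) ≈ x
  enum-index x = proj₂ (enum-surjective x)

  index-cong : ∀ {x y} → x ≈ y → index x ≡ index y
  index-cong {x} {y} e = enum-injective _ _ (trans (enum-index x) (trans e (sym (enum-index y))))

  index-enum : ∀ i → index (enum i) ≡ i
  index-enum i = enum-injective _ _ (enum-index (enum i))

  *-cancelˡ : ∀ {a x y} → ¬ (a ≈ 0#) → a * x ≈ a * y → x ≈ y
  *-cancelˡ {a} {x} {y} a≉0 e = begin
    x           ≈⟨ *-identityˡ x ⟨
    1# * x      ≈⟨ *-congʳ (trans (*-comm b a) ab) ⟨
    b * a * x   ≈⟨ *-assoc b a x ⟩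
    b * (a * x) ≈⟨ *-congˡ e ⟩
    b * (a * y) ≈⟨ *-assoc b a y ⟨
    b * a * y   ≈⟨ *-congʳ (trans (*-comm b a) ab) ⟩
    1# * y      ≈⟨ *-identityˡ y ⟩
    y           ∎
    where
    b = proj₁ (inverse a a≉0)
    ab = proj₂ (inverse a a≉0)

  *-zero : ∀ {x y} → x * y ≈ 0# → x ≈ 0# ⊎ y ≈ 0#
  *-zero {x} {y} e with x ≟ 0#
  ... | yes z = inj₁ z
  ... | no n  = inj₂ (*-cancelˡ n (trans e (sym (zeroʳ x))))

  module +Sum = Sum +-commutativeMonoid
  module *Sum = Sum *-commutativeMonoid

  _×1 : ℕ → Carrier
  zero ×1  = 0#
  suc n ×1 = 1# + n ×1

  +-cancelˡ : ∀ a {x y} → a + x ≈ a + y → x ≈ y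
  +-cancelˡ a {x} {y} e = begin
    x             ≈⟨ +-identityˡ x ⟨
    0# + x        ≈⟨ +-congʳ (-‿inverseˡ a) ⟨
    - a + a + x   ≈⟨ +-assoc _ _ _ ⟩
    - a + (a + x) ≈⟨ +-congˡ e ⟩
    - a + (a + y) ≈⟨ +-assoc _ _ _ ⟨
    - a + a + y   ≈⟨ +-congʳ (-‿inverseˡ a) ⟩
    0# + y        ≈⟨ +-identityˡ y ⟩
    y             ∎

  sum-const-1 : ∀ n → +Sum.sum {n} (λ _ → 1#) ≈ n ×1
  sum-const-1 zero    = refl
  sum-const-1 (suc n) = +-congˡ (sum-const-1 n)

  -- Summing over all z and over all z + 1 gives q · 1 = 0.
  size-zero : q ×1 ≈ 0#
  size-zero = +-cancelˡ (+Sum.sum enum) (begin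
    +Sum.sum enum + q ×1 ≈⟨ +-congˡ (sum-const-1 q) ⟨
    +Sum.sum enum + +Sum.sum {q} (λ _ → 1#) ≈⟨ +Sum.∑-distrib-+ enum (λ _ → 1#) ⟨
    +Sum.sum (λ i → enum i + 1#) ≈⟨ +Sum.sum-cong-≋ (λ i → sym (enum-index (enum i + 1#))) ⟩
    +Sum.sum (λ i → enum (index (enum i + 1#))) ≈⟨ +Sum.sum-permute enum shift ⟨
    +Sum.sum enum ≈⟨ +-identityʳ _ ⟨
    +Sum.sum enum + 0# ∎)
    where
    shift = permutation (λ i → index (enum i + 1#)) (λ i → index (enum i + - 1#))
      (λ i → ≡.trans (index-cong (trans (+-congʳ (enum-index _)) (trans (+-assoc _ _ _) (trans (+-congˡ (-‿inverseˡ 1#)) (+-identityʳ _))))) (index-enum i))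
      (λ i → ≡.trans (index-cong (trans (+-congʳ (enum-index _)) (trans (+-assoc _ _ _) (trans (+-congˡ (-‿inverseʳ 1#)) (+-identityʳ _))))) (index-enum i))

  infixr 8 _^_
  _^_ : Carrier → ℕ → Carrier
  x ^ zero  = 1#
  x ^ suc n = x * x ^ n

  product-const : ∀ a n → *Sum.sum {n} (λ _ → a) ≈ a ^ n
  product-const a zero    = refl
  product-const a (suc n) = *-congˡ (product-const a n)

  -- Multiplication by a permutes the field; comparing the products of the nonzero elements gives a^(q-1) = 1.
  module _ {n : ℕ} (size : q ≡ suc n) where
    private
      nonzero : Carrier → Carrier
      nonzero x with x ≟ 0#
      ... | yes _ = 1#
      ... | no _  = x

      nonzero-zero : ∀ {x} → x ≈ 0# → nonzero x ≈ 1#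
      nonzero-zero {x} z with x ≟ 0#
      ... | yes _ = refl
      ... | no n  = ⊥-elim (n z)

      nonzero-nonzero : ∀ {x} → ¬ (x ≈ 0#) → nonzero x ≈ x
      nonzero-nonzero {x} n with x ≟ 0#
      ... | yes z = ⊥-elim (n z)
      ... | no _  = refl

      nonzero-≉0 : ∀ x → ¬ (nonzero x ≈ 0#)
      nonzero-≉0 x z with x ≟ 0#
      ... | yes _ = 0≉1 (sym z)
      ... | no n  = n z

      nonzero-cong : ∀ {x y} → x ≈ y → nonzero x ≈ nonzero y
      nonzero-cong {x} {y} e with x ≟ 0# | y ≟ 0#
      ... | yes _ | yes _ = refl
      ... | no _  | no _  = e
      ... | yes z | no n  = ⊥-elim (n (trans (sym e) z))
      ... | no n  | yes z = ⊥-elim (n (trans e z))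

      factor : Carrier → Carrier → Carrier
      factor a x with x ≟ 0#
      ... | yes _ = 1#
      ... | no _  = a

      nonzero-* : ∀ {a} → ¬ (a ≈ 0#) → ∀ x → nonzero (a * x) ≈ factor a x * nonzero x
      nonzero-* {a} a≉0 x with x ≟ 0#
      ... | yes z = trans (nonzero-zero (trans (*-congˡ z) (zeroʳ a))) (sym (*-identityˡ 1#))
      ... | no n  = nonzero-nonzero (λ z → n (*-cancelˡ a≉0 (trans z (sym (zeroʳ a)))))

      product-≉0 : ∀ {k} (f : Fin k → Carrier) → (∀ i → ¬ (f i ≈ 0#)) → ¬ (*Sum.sum f ≈ 0#)
      product-≉0 {zero}  f nz z = 0≉1 (sym z)
      product-≉0 {suc k} f nz z with *-zero z
      ... | inj₁ y = nz zero y
      ... | inj₂ y = product-≉0 (λ i → f (suc i)) (λ i → nz (suc i)) y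

    fermat : ∀ {a} → ¬ (a ≈ 0#) → a ^ n ≈ 1#
    fermat {a} a≉0 = sym (*-cancelˡ (product-≉0 (λ i → nonzero (enum i)) (λ i → nonzero-≉0 _)) (begin
      Π * 1# ≈⟨ *-identityʳ Π ⟩
      Π ≈⟨ *Sum.sum-permute (λ i → nonzero (enum i)) scale ⟩
      *Sum.sum (λ i → nonzero (enum (index (a * enum i)))) ≈⟨ *Sum.sum-cong-≋ (λ i → trans (nonzero-cong (enum-index _)) (nonzero-* a≉0 (enum i))) ⟩
      *Sum.sum (λ i → factor a (enum i) * nonzero (enum i)) ≈⟨ *Sum.∑-distrib-+ (λ i → factor a (enum i)) (λ i → nonzero (enum i)) ⟩
      *Sum.sum (λ i → factor a (enum i)) * Π ≈⟨ *-congʳ (factors size (λ i → factor a (enum i)) (index 0#) (factor-zero (enum-index 0#)) (λ i i≢ → factor-nonzero (λ z → i≢ (≡.trans (≡.sym (index-enum i)) (index-cong z))))) ⟩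
      a ^ n * Π ≈⟨ *-comm _ _ ⟩
      Π * a ^ n ∎))
      where
      Π = *Sum.sum (λ i → nonzero (enum i))
      b = proj₁ (inverse a a≉0)
      ab = proj₂ (inverse a a≉0)
      undo : ∀ {c d} → c * d ≈ 1# → ∀ i → index (c * enum (index (d * enum i))) ≡ i
      undo {c} {d} cd i = ≡.trans (index-cong (trans (*-congˡ (enum-index _)) (trans (sym (*-assoc c d _)) (trans (*-congʳ cd) (*-identityˡ _))))) (index-enum i)
      scale = permutation (λ i → index (a * enum i)) (λ i → index (b * enum i)) (undo ab) (undo (trans (*-comm b a) ab))
      factor-zero : ∀ {x} → x ≈ 0# → factor a x ≈ 1#
      factor-zero {x} z with x ≟ 0#
      ... | yes _ = refl
      ... | no n  = ⊥-elim (n z)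
      factor-nonzero : ∀ {x} → ¬ (x ≈ 0#) → factor a x ≈ a
      factor-nonzero {x} n with x ≟ 0#
      ... | yes z = ⊥-elim (n z)
      ... | no _  = refl
      factors : ∀ {k} → k ≡ suc n → (f : Fin k → Carrier) (i₀ : Fin k) → f i₀ ≈ 1# → (∀ i → i ≢ i₀ → f i ≈ a) → *Sum.sum f ≈ a ^ n
      factors ≡.refl f i₀ f₀ f₁ = begin
        *Sum.sum f ≈⟨ *Sum.sum-remove {i = i₀} f ⟩
        f i₀ * *Sum.sum (λ i → f (punchIn i₀ i)) ≈⟨ *-cong f₀ (*Sum.sum-cong-≋ (λ i → f₁ (punchIn i₀ i) (λ e → Fin.punchInᵢ≢i i₀ i e))) ⟩
        1# * *Sum.sum {n} (λ _ → a) ≈⟨ trans (*-identityˡ _) (product-const a n) ⟩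
        a ^ n ∎

  outside-01 : 2 ℕ.< q → ∃ λ g → ¬ (g ≈ 0#) × ¬ (g ≈ 1#)
  outside-01 2<q with Fin.any? (λ i → ¬? (enum i ≟ 0#) ×-dec ¬? (enum i ≟ 1#))
    where open import Relation.Nullary.Decidable using (¬?; _×-dec_)
  ... | yes (i , p) = enum i , p
  ... | no none = ⊥-elim (collision (Fin.pigeonhole 2<q side))
    where
    side′ : ∀ i → Dec (enum i ≈ 0#) → Fin 2
    side′ i (yes _) = zero
    side′ i (no _)  = suc zero
    side : Fin q → Fin 2
    side i = side′ i (enum i ≟ 0#)
    same : ∀ i j (d : Dec (enum i ≈ 0#)) (d′ : Dec (enum j ≈ 0#)) → side′ i d ≡ side′ j d′ → enum i ≈ enum j
    same i j (yes z) (yes z′) _ = trans z (sym z′)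
    same i j (no n)  (no n′)  _ with enum i ≟ 1# | enum j ≟ 1#
    ... | yes o | yes o′ = trans o (sym o′)
    ... | no o  | _      = ⊥-elim (none (i , n , o))
    ... | _     | no o   = ⊥-elim (none (j , n′ , o))
    collision : (∃₂ λ i j → i Fin.< j × side i ≡ side j) → ⊥
    collision (i , j , i<j , e) = Fin.<⇒≢ i<j (enum-injective i j (same i j (enum i ≟ 0#) (enum j ≟ 0#) e))

Characteristic-2 : ∀ {q} → FiniteField q → Set
Characteristic-2 F = 1# + 1# ≈ 0#
  where open FiniteField F

record Model {q : ℕ} (F : FiniteField q) (𝔽 : Field₂) : Set where
  open FiniteField F
  private module K = Field₂-Properties 𝔽
  field
    char-2 : 1# + 1# ≈ 0#
    φ      : K.K → Carrier
    φ-+    : ∀ a b → φ (a K.+ b) ≈ φ a + φ b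
    φ-*    : ∀ a b → φ (a K.* b) ≈ φ a * φ b
    φ-0    : φ K.0# ≈ 0#
    φ-1    : φ K.1# ≈ 1#
    size≡  : Finite.size K.finite ≡ q

  φ-injective : ∀ {a b} → φ a ≈ φ b → a ≡ b
  φ-injective {a} {b} e with (a K.+ b) K.≟ K.0#
  ... | yes z = K.+⇒≡ z
  ... | no n = ⊥-elim (0≉1 (begin
    0#                                 ≈⟨ zeroˡ _ ⟨
    0# * φ (K.inv (a K.+ b))           ≈⟨ *-congʳ (trans (φ-+ a b) (trans (+-congʳ e) (trans (sym (φ-+ b b)) (trans (reflexive (≡.cong φ (K.+-self b))) φ-0)))) ⟨
    φ (a K.+ b) * φ (K.inv (a K.+ b))  ≈⟨ φ-* _ _ ⟨
    φ ((a K.+ b) K.* K.inv (a K.+ b))  ≈⟨ reflexive (≡.cong φ (K.inverse _ n)) ⟩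
    φ K.1#                             ≈⟨ φ-1 ⟩
    1#                                 ∎))
    where open Relation.Binary.Reasoning.Setoid setoid

  φ-surjective : ∀ x → ∃ λ a → φ a ≈ x
  φ-surjective x = pull size≡
    where
    open FieldProperties F using (index; enum-index)
    module Fi = Finite K.finite
    pull : Fi.size ≡ q → ∃ λ a → φ a ≈ x
    pull ≡.refl with Fin-surjective (λ i → index (φ (Fi.from i))) (λ e → Fi.from-injective (φ-injective (trans (sym (enum-index _)) (trans (reflexive (≡.cong enum e)) (enum-index _))))) (index x)
    ... | i , e = Fi.from i , trans (sym (enum-index _)) (trans (reflexive (≡.cong enum e)) (enum-index x))

  φ⁻¹ : Carrier → K.K
  φ⁻¹ x = proj₁ (φ-surjective x)

  φ-φ⁻¹ : ∀ x → φ (φ⁻¹ x) ≈ x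
  φ-φ⁻¹ x = proj₂ (φ-surjective x)

module Char2 {q : ℕ} (F : FiniteField q) (char-2 : Characteristic-2 F) where
  open FiniteField F hiding (zero)
  open FieldProperties F
  open Relation.Binary.Reasoning.Setoid setoid

  +-self : ∀ x → x + x ≈ 0#
  +-self x = begin
    x + x           ≈⟨ +-cong (*-identityʳ x) (*-identityʳ x) ⟨
    x * 1# + x * 1# ≈⟨ distribˡ x 1# 1# ⟨
    x * (1# + 1#)   ≈⟨ *-congˡ char-2 ⟩
    x * 0#          ≈⟨ zeroʳ x ⟩
    0#              ∎

  -‿id : ∀ x → - x ≈ x
  -‿id x = +-cancelˡ x (trans (-‿inverseʳ x) (sym (+-self x)))

  +⇒≈ : ∀ {x y} → x + y ≈ 0# → x ≈ y
  +⇒≈ {x} {y} e = +-cancelˡ y (trans (+-comm y x) (trans e (sym (+-self y))))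

  bit : Bool → Carrier
  bit false = 0#
  bit true  = 1#

  bit-xor : ∀ a b → bit (a xor b) ≈ bit a + bit b
  bit-xor false b     = sym (+-identityˡ _)
  bit-xor true  false = sym (+-identityʳ _)
  bit-xor true  true  = sym char-2

  bit-∧ : ∀ a b → bit (a ∧ b) ≈ bit a * bit b
  bit-∧ false b = sym (zeroˡ _)
  bit-∧ true  b = sym (*-identityˡ _)

  private
    Coeff : RawRing 0ℓ 0ℓ
    Coeff = record { _≈_ = _≡_ ; _+_ = _xor_ ; _*_ = _∧_ ; -_ = id ; 0# = false ; 1# = true }

    morphism : Coeff -Raw-AlmostCommutative⟶ fromCommutativeRing commRing
    morphism = record
      { ⟦_⟧ = bit ; +-homo = bit-xor ; *-homo = bit-∧ ; -‿homo = λ a → sym (-‿id (bit a)) ; 0-homo = refl ; 1-homo = refl }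

    coeff≟ : ∀ x y → Maybe (bit x ≈ bit y)
    coeff≟ false false = just refl
    coeff≟ true  true  = just refl
    coeff≟ _     _     = nothing

  open Algebra.Solver.Ring Coeff (fromCommutativeRing commRing) morphism coeff≟ public
    using (con; _:+_; _:*_; _:=_; solve)

module _ (F : FiniteField 2) where
  open FiniteField F hiding (zero)
  open FieldProperties F using (size-zero)

  model₂ : Model F GF2.field₂
  model₂ = record
    { char-2 = char-2 ; φ = bit₂ ; φ-0 = refl ; φ-1 = refl ; size≡ = ≡.refl
    ; φ-+ = λ { 𝟎₂ b → sym (+-identityˡ _) ; 𝟏₂ 𝟎₂ → sym (+-identityʳ _) ; 𝟏₂ 𝟏₂ → sym char-2 }
    ; φ-* = λ { 𝟎₂ b → sym (zeroˡ _) ; 𝟏₂ b → sym (*-identityˡ _) }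
    }
    where
    char-2 : 1# + 1# ≈ 0#
    char-2 = trans (+-congˡ (sym (+-identityʳ 1#))) size-zero
    bit₂ : F₂ → Carrier
    bit₂ 𝟎₂ = 0#
    bit₂ 𝟏₂ = 1#

module _ (F : FiniteField 4) where
  open FiniteField F hiding (zero)
  open FieldProperties F using (size-zero; fermat; outside-01; *-zero)

  private
    opaque
      -- The vanishing sum of four ones is the square of 1 + 1.
      char-2 : 1# + 1# ≈ 0#
      char-2 = reduce (*-zero {1# + 1#} {1# + 1#} (begin
        (1# + 1#) * (1# + 1#)           ≈⟨ trans (distribʳ (1# + 1#) 1# 1#) (+-cong (*-identityˡ (1# + 1#)) (*-identityˡ (1# + 1#))) ⟩
        (1# + 1#) + (1# + 1#)           ≈⟨ +-assoc 1# 1# (1# + 1#) ⟩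
        1# + (1# + (1# + 1#))           ≈⟨ +-congˡ (+-congˡ (+-congˡ (+-identityʳ 1#))) ⟨
        1# + (1# + (1# + (1# + 0#)))    ≈⟨ size-zero ⟩
        0#                              ∎))
        where open Relation.Binary.Reasoning.Setoid setoid

  open Char2 F char-2

  private
    opaque
      -- An element other than 0 and 1 satisfies w³ + 1 = 0, and the factor w + 1 can be cancelled.
      generator : ∃ λ w → w * w + w + 1# ≈ 0#
      generator = pick (outside-01 (s≤s (s≤s (s≤s z≤n))))
        where
        open Relation.Binary.Reasoning.Setoid setoid
        factors : ∀ w → ¬ (w ≈ 0#) → (w + 1#) * (w * w + w + 1#) ≈ 0#
        factors w w≉0 = begin
          (w + 1#) * (w * w + w + 1#) ≈⟨ solve 1 (λ w → (w :+ con true) :* (w :* w :+ w :+ con true) := w :* (w :* (w :* con true)) :+ con true) refl w ⟩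
          w * (w * (w * 1#)) + 1#     ≈⟨ +-congʳ (fermat ≡.refl w≉0) ⟩
          1# + 1#                     ≈⟨ char-2 ⟩
          0#                          ∎
        pick : (∃ λ w → ¬ (w ≈ 0#) × ¬ (w ≈ 1#)) → ∃ λ w → w * w + w + 1# ≈ 0#
        pick (w , w≉0 , w≉1) = w , other (*-zero (factors w w≉0))
          where
          other : w + 1# ≈ 0# ⊎ w * w + w + 1# ≈ 0# → w * w + w + 1# ≈ 0#
          other (inj₁ z) = ⊥-elim (w≉1 (+⇒≈ z))
          other (inj₂ z) = z

    w = proj₁ generator

    bits : F₄ → Bool × Bool
    bits 𝟎₄  = false , false
    bits 𝟏₄  = true  , false
    bits ω₄  = false , true
    bits ω₄² = true  , true

    value : Bool × Bool → Carrier
    value (a , b) = bit a + bit b * w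

    _⊞_ _⊠_ : Bool × Bool → Bool × Bool → Bool × Bool
    (a , b) ⊞ (c , d) = a xor c , b xor d
    (a , b) ⊠ (c , d) = (a ∧ c) xor (b ∧ d) , ((a ∧ d) xor (b ∧ c)) xor (b ∧ d)

    bits-+ : ∀ x y → bits (x GF4.+ y) ≡ bits x ⊞ bits y
    bits-+ 𝟎₄ _ = ≡.refl
    bits-+ 𝟏₄ 𝟎₄ = ≡.refl ; bits-+ 𝟏₄ 𝟏₄ = ≡.refl ; bits-+ 𝟏₄ ω₄ = ≡.refl ; bits-+ 𝟏₄ ω₄² = ≡.refl
    bits-+ ω₄ 𝟎₄ = ≡.refl ; bits-+ ω₄ 𝟏₄ = ≡.refl ; bits-+ ω₄ ω₄ = ≡.refl ; bits-+ ω₄ ω₄² = ≡.refl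
    bits-+ ω₄² 𝟎₄ = ≡.refl ; bits-+ ω₄² 𝟏₄ = ≡.refl ; bits-+ ω₄² ω₄ = ≡.refl ; bits-+ ω₄² ω₄² = ≡.refl

    bits-* : ∀ x y → bits (x GF4.* y) ≡ bits x ⊠ bits y
    bits-* 𝟎₄ 𝟎₄ = ≡.refl ; bits-* 𝟎₄ 𝟏₄ = ≡.refl ; bits-* 𝟎₄ ω₄ = ≡.refl ; bits-* 𝟎₄ ω₄² = ≡.refl
    bits-* 𝟏₄ 𝟎₄ = ≡.refl ; bits-* 𝟏₄ 𝟏₄ = ≡.refl ; bits-* 𝟏₄ ω₄ = ≡.refl ; bits-* 𝟏₄ ω₄² = ≡.refl
    bits-* ω₄ 𝟎₄ = ≡.refl ; bits-* ω₄ 𝟏₄ = ≡.refl ; bits-* ω₄ ω₄ = ≡.refl ; bits-* ω₄ ω₄² = ≡.refl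
    bits-* ω₄² 𝟎₄ = ≡.refl ; bits-* ω₄² 𝟏₄ = ≡.refl ; bits-* ω₄² ω₄ = ≡.refl ; bits-* ω₄² ω₄² = ≡.refl

    open Relation.Binary.Reasoning.Setoid setoid

    value-⊞ : ∀ x y → value (x ⊞ y) ≈ value x + value y
    value-⊞ (a , b) (c , d) = begin
      bit (a xor c) + bit (b xor d) * w ≈⟨ +-cong (bit-xor a c) (*-congʳ (bit-xor b d)) ⟩
      bit a + bit c + (bit b + bit d) * w ≈⟨ solve 5 (λ a b c d w → a :+ c :+ (b :+ d) :* w := (a :+ b :* w) :+ (c :+ d :* w)) refl (bit a) (bit b) (bit c) (bit d) w ⟩
      value (a , b) + value (c , d) ∎

    value-⊠ : ∀ x y → value (x ⊠ y) ≈ value x * value y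
    value-⊠ (a , b) (c , d) = begin
      bit ((a ∧ c) xor (b ∧ d)) + bit (((a ∧ d) xor (b ∧ c)) xor (b ∧ d)) * w
        ≈⟨ +-cong (trans (bit-xor (a ∧ c) (b ∧ d)) (+-cong (bit-∧ a c) (bit-∧ b d)))
             (*-congʳ (trans (bit-xor ((a ∧ d) xor (b ∧ c)) (b ∧ d)) (+-cong (trans (bit-xor (a ∧ d) (b ∧ c)) (+-cong (bit-∧ a d) (bit-∧ b c))) (bit-∧ b d)))) ⟩
      (bit a * bit c + bit b * bit d) + (bit a * bit d + bit b * bit c + bit b * bit d) * w
        ≈⟨ solve 5 (λ a b c d w → (a :* c :+ b :* d) :+ (a :* d :+ b :* c :+ b :* d) :* w := (a :+ b :* w) :* (c :+ d :* w) :+ b :* d :* (w :* w :+ w :+ con true)) refl (bit a) (bit b) (bit c) (bit d) w ⟩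
      value (a , b) * value (c , d) + bit b * bit d * (w * w + w + 1#) ≈⟨ +-congˡ (trans (*-congˡ (proj₂ generator)) (zeroʳ _)) ⟩
      value (a , b) * value (c , d) + 0# ≈⟨ +-identityʳ _ ⟩
      value (a , b) * value (c , d) ∎

  model₄ : Model F GF4.field₂
  model₄ = record
    { char-2 = char-2 ; φ = λ x → value (bits x) ; size≡ = ≡.refl
    ; φ-+ = λ x y → trans (reflexive (≡.cong value (bits-+ x y))) (value-⊞ (bits x) (bits y))
    ; φ-* = λ x y → trans (reflexive (≡.cong value (bits-* x y))) (value-⊠ (bits x) (bits y))
    ; φ-0 = trans (+-congˡ (zeroˡ w)) (+-identityʳ _)
    ; φ-1 = trans (+-congˡ (zeroˡ w)) (+-identityʳ _)
    }

module _ (F : FiniteField 8) where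
  open FiniteField F hiding (zero)
  open FieldProperties F using (size-zero; fermat; outside-01; *-zero)

  private
    open Relation.Binary.Reasoning.Setoid setoid

    opaque
      -- The vanishing sum of eight ones is the cube of 1 + 1.
      char-2 : 1# + 1# ≈ 0#
      char-2 = reduce (map₂ (λ z → reduce (*-zero z)) (*-zero (begin
        (1# + 1#) * ((1# + 1#) * (1# + 1#)) ≈⟨ double _ ⟩
        (1# + 1#) * (1# + 1#) + (1# + 1#) * (1# + 1#) ≈⟨ +-cong (double _) (double _) ⟩
        (1# + 1# + (1# + 1#)) + (1# + 1# + (1# + 1#)) ≈⟨ +-cong (+-assoc _ _ _) (+-assoc _ _ _) ⟩
        (1# + (1# + (1# + 1#))) + (1# + (1# + (1# + 1#))) ≈⟨ trans (+-assoc _ _ _) (+-congˡ (trans (+-assoc _ _ _) (+-congˡ (trans (+-assoc _ _ _) (+-congˡ (+-congˡ (+-congˡ (+-congˡ (+-congˡ (sym (+-identityʳ 1#))))))))))) ⟩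
        1# + (1# + (1# + (1# + (1# + (1# + (1# + (1# + 0#))))))) ≈⟨ size-zero ⟩
        0# ∎)))
        where
        double : ∀ x → (1# + 1#) * x ≈ x + x
        double x = trans (distribʳ x 1# 1#) (+-cong (*-identityˡ x) (*-identityˡ x))

  open Char2 F char-2

  private
    opaque
      -- In characteristic 2, g⁷ + 1 factors as (g + 1)(g³ + g + 1)(g³ + g² + 1). The first factor
      -- is excluded by the choice of g, and adding 1 turns a root of the last factor into a root of
      -- the middle one.
      generator : ∃ λ g → g * g * g + g + 1# ≈ 0#
      generator = pick (outside-01 (s≤s (s≤s (s≤s z≤n))))
        where
        factors : ∀ g → ¬ (g ≈ 0#) → (g + 1#) * ((g * g * g + g + 1#) * (g * g * g + g * g + 1#)) ≈ 0#
        factors g g≉0 = begin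
          (g + 1#) * ((g * g * g + g + 1#) * (g * g * g + g * g + 1#))
            ≈⟨ solve 1 (λ g → (g :+ con true) :* ((g :* g :* g :+ g :+ con true) :* (g :* g :* g :+ g :* g :+ con true)) := g :* (g :* (g :* (g :* (g :* (g :* (g :* con true)))))) :+ con true) refl g ⟩
          g * (g * (g * (g * (g * (g * (g * 1#)))))) + 1# ≈⟨ +-congʳ (fermat ≡.refl g≉0) ⟩
          1# + 1# ≈⟨ char-2 ⟩
          0# ∎
        pick : (∃ λ g → ¬ (g ≈ 0#) × ¬ (g ≈ 1#)) → ∃ λ g → g * g * g + g + 1# ≈ 0#
        pick (g , g≉0 , g≉1) = choose (*-zero (factors g g≉0))
          where
          choose′ : g * g * g + g + 1# ≈ 0# ⊎ g * g * g + g * g + 1# ≈ 0# → ∃ λ g → g * g * g + g + 1# ≈ 0#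
          choose′ (inj₁ y) = g , y
          choose′ (inj₂ y) = g + 1# , trans (solve 1 (λ g → (g :+ con true) :* (g :+ con true) :* (g :+ con true) :+ (g :+ con true) :+ con true := g :* g :* g :+ g :* g :+ con true) refl g) y
          choose : g + 1# ≈ 0# ⊎ (g * g * g + g + 1#) * (g * g * g + g * g + 1#) ≈ 0# → ∃ λ g → g * g * g + g + 1# ≈ 0#
          choose (inj₁ z) = ⊥-elim (g≉1 (+⇒≈ z))
          choose (inj₂ z) = choose′ (*-zero z)

    g = proj₁ generator

    Bits : Set
    Bits = Bool × Bool × Bool

    bits : F₈ → Bits
    bits 𝟎₈ = false , false , false
    bits 𝟏₈ = true  , false , false
    bits γ₂ = false , true  , false
    bits γ₃ = true  , true  , false
    bits γ₄ = false , false , true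
    bits γ₅ = true  , false , true
    bits γ₆ = false , true  , true
    bits γ₇ = true  , true  , true

    scale : Bool → Bits → Bits
    scale false _ = false , false , false
    scale true  x = x

    -- Multiplication by g on coefficient triples, with g³ = g + 1.
    shift : Bits → Bits
    shift (a , b , c) = c , a xor c , b

    value : Bits → Carrier
    value (a , b , c) = bit a + bit b * g + bit c * (g * g)

    _⊞_ _⊠_ : Bits → Bits → Bits
    (a , b , c) ⊞ (d , e , f) = a xor d , b xor e , c xor f
    x ⊠ (d , e , f) = (scale d x ⊞ scale e (shift x)) ⊞ scale f (shift (shift x))

    _==_ : Bits → Bits → Bool
    (a , b , c) == (d , e , f) = (same a d) ∧ ((same b e) ∧ (same c f))
      where
      same : Bool → Bool → Bool
      same false false = true
      same true true = true
      same _ _ = false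

    ==-sound : ∀ x y → (x == y) ≡ true → x ≡ y
    ==-sound (false , false , false) (false , false , false) _ = ≡.refl
    ==-sound (false , false , true)  (false , false , true)  _ = ≡.refl
    ==-sound (false , true , false)  (false , true , false)  _ = ≡.refl
    ==-sound (false , true , true)   (false , true , true)   _ = ≡.refl
    ==-sound (true , false , false)  (true , false , false)  _ = ≡.refl
    ==-sound (true , false , true)   (true , false , true)   _ = ≡.refl
    ==-sound (true , true , false)   (true , true , false)   _ = ≡.refl
    ==-sound (true , true , true)    (true , true , true)    _ = ≡.refl

    exhaust : (f h : F₈ → F₈ → Bits) → allᵇ (λ x → allᵇ (λ y → f x y == h x y) GF8.elements) GF8.elements ≡ true → ∀ x y → f x y ≡ h x y
    exhaust f h e x y = ==-sound (f x y) (h x y) (allᵇ-sound (λ y → f x y == h x y) GF8.elements (allᵇ-sound (λ x → allᵇ (λ y → f x y == h x y) GF8.elements) GF8.elements e (GF8.complete x)) (GF8.complete y))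

    medial : ∀ a b c d → (a + b) + (c + d) ≈ (a + c) + (b + d)
    medial = solve 4 (λ a b c d → (a :+ b) :+ (c :+ d) := (a :+ c) :+ (b :+ d)) refl

    value-⊞ : ∀ x y → value (x ⊞ y) ≈ value x + value y
    value-⊞ (a , b , c) (d , e , f) = begin
      bit (a xor d) + bit (b xor e) * g + bit (c xor f) * (g * g)
        ≈⟨ +-cong (+-cong (bit-xor a d) (term b e g)) (term c f (g * g)) ⟩
      (bit a + bit d) + (bit b * g + bit e * g) + (bit c * (g * g) + bit f * (g * g)) ≈⟨ +-congʳ (medial _ _ _ _) ⟩
      (bit a + bit b * g) + (bit d + bit e * g) + (bit c * (g * g) + bit f * (g * g)) ≈⟨ medial _ _ _ _ ⟩
      value (a , b , c) + value (d , e , f) ∎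
      where
      term : ∀ a b x → bit (a xor b) * x ≈ bit a * x + bit b * x
      term a b x = trans (*-congʳ (bit-xor a b)) (distribʳ x _ _)

    constant : ∀ a → value (a , false , false) ≈ bit a
    constant a = trans (+-cong (trans (+-congˡ (zeroˡ g)) (+-identityʳ _)) (zeroˡ _)) (+-identityʳ _)

    value-scale : ∀ d x → value (scale d x) ≈ bit d * value x
    value-scale false x = trans (constant false) (sym (zeroˡ _))
    value-scale true  x = sym (*-identityˡ _)

    value-shift : ∀ x → value (shift x) ≈ g * value x
    value-shift (a , b , c) = begin
      bit c + bit (a xor c) * g + bit b * (g * g) ≈⟨ +-congʳ (+-congˡ (*-congʳ (bit-xor a c))) ⟩
      bit c + (bit a + bit c) * g + bit b * (g * g)
        ≈⟨ solve 4 (λ a b c g → c :+ (a :+ c) :* g :+ b :* (g :* g) := g :* (a :+ b :* g :+ c :* (g :* g)) :+ c :* (g :* g :* g :+ g :+ con true)) refl (bit a) (bit b) (bit c) g ⟩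
      g * value (a , b , c) + bit c * (g * g * g + g + 1#) ≈⟨ +-congˡ (trans (*-congˡ (proj₂ generator)) (zeroʳ _)) ⟩
      g * value (a , b , c) + 0# ≈⟨ +-identityʳ _ ⟩
      g * value (a , b , c) ∎

    value-⊠ : ∀ x y → value (x ⊠ y) ≈ value x * value y
    value-⊠ x (d , e , f) = begin
      value (x ⊠ (d , e , f))
        ≈⟨ trans (value-⊞ (scale d x ⊞ scale e (shift x)) (scale f (shift (shift x)))) (+-cong (trans (value-⊞ (scale d x) (scale e (shift x)))
             (+-cong (value-scale d x) (trans (value-scale e (shift x)) (*-congˡ (value-shift x)))))
             (trans (value-scale f (shift (shift x))) (*-congˡ (trans (value-shift (shift x)) (*-congˡ (value-shift x)))))) ⟩
      bit d * value x + bit e * (g * value x) + bit f * (g * (g * value x))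
        ≈⟨ solve 5 (λ d e f g x → d :* x :+ e :* (g :* x) :+ f :* (g :* (g :* x)) := x :* (d :+ e :* g :+ f :* (g :* g))) refl (bit d) (bit e) (bit f) g (value x) ⟩
      value x * value (d , e , f) ∎

  model₈ : Model F GF8.field₂
  model₈ = record
    { char-2 = char-2 ; φ = λ x → value (bits x) ; size≡ = ≡.refl
    ; φ-+ = λ x y → trans (reflexive (≡.cong value (exhaust (λ x y → bits (x GF8.+ y)) (λ x y → bits x ⊞ bits y) ≡.refl x y))) (value-⊞ (bits x) (bits y))
    ; φ-* = λ x y → trans (reflexive (≡.cong value (exhaust (λ x y → bits (x GF8.* y)) (λ x y → bits x ⊠ bits y) ≡.refl x y))) (value-⊠ (bits x) (bits y))
    ; φ-0 = constant false
    ; φ-1 = constant true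
    }

-- Linear and bilinear maps on coordinate vectors over a setoid field

module LinearAlgebra {q : ℕ} (F : FiniteField q) where
  open FiniteField F hiding (zero)
  open import Algebra.Properties.CommutativeSemigroup +-commutativeSemigroup using (interchange)
  open Relation.Binary.Reasoning.Setoid setoid

  𝕍 : ℕ → Set
  𝕍 = Defs.Vec F

  infix 4 _≋_
  _≋_ : ∀ {n} → 𝕍 n → 𝕍 n → Set
  _≋_ = Defs._≈v_ F

  𝟎 : ∀ {n} → 𝕍 n
  𝟎 = Defs.0v F

  ∑ : ∀ {n} → (Fin n → Carrier) → Carrier
  ∑ = Defs.Σ F

  infixl 6 _⊹_
  infixr 7 _⋆_

  _⊹_ : ∀ {n} → 𝕍 n → 𝕍 n → 𝕍 n
  (x ⊹ y) i = x i + y i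

  _⋆_ : ∀ {n} → Carrier → 𝕍 n → 𝕍 n
  (r ⋆ x) i = r * x i

  δ : ∀ {n} → Fin n → 𝕍 n
  δ zero    zero    = 1#
  δ zero    (suc _) = 0#
  δ (suc _) zero    = 0#
  δ (suc i) (suc j) = δ i j

  ∑-cong : ∀ {n} {f g : Fin n → Carrier} → (∀ i → f i ≈ g i) → ∑ f ≈ ∑ g
  ∑-cong {zero}  e = refl
  ∑-cong {suc n} e = +-cong (e zero) (∑-cong (λ i → e (suc i)))

  ∑-+ : ∀ {n} (f g : Fin n → Carrier) → ∑ (λ i → f i + g i) ≈ ∑ f + ∑ g
  ∑-+ {zero}  f g = sym (+-identityʳ 0#)
  ∑-+ {suc n} f g = trans (+-congˡ (∑-+ (λ i → f (suc i)) (λ i → g (suc i)))) (interchange _ _ _ _)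

  ∑-* : ∀ {n} r (f : Fin n → Carrier) → ∑ (λ i → r * f i) ≈ r * ∑ f
  ∑-* {zero}  r f = sym (zeroʳ r)
  ∑-* {suc n} r f = trans (+-congˡ (∑-* r (λ i → f (suc i)))) (sym (distribˡ r _ _))

  ∑∑-cong : ∀ {m n} (f g : Fin m → Fin n → Carrier) → (∀ i j → f i j ≈ g i j) → ∑ (λ i → ∑ (f i)) ≈ ∑ (λ i → ∑ (g i))
  ∑∑-cong f g e = ∑-cong (λ i → ∑-cong (e i))

  ∑∑-+ : ∀ {m n} (f g : Fin m → Fin n → Carrier) → ∑ (λ i → ∑ (λ j → f i j + g i j)) ≈ ∑ (λ i → ∑ (f i)) + ∑ (λ i → ∑ (g i))
  ∑∑-+ f g = trans (∑-cong (λ i → ∑-+ (f i) (g i))) (∑-+ (λ i → ∑ (f i)) (λ i → ∑ (g i)))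

  ∑∑-* : ∀ {m n} r (f : Fin m → Fin n → Carrier) → ∑ (λ i → ∑ (λ j → r * f i j)) ≈ r * ∑ (λ i → ∑ (f i))
  ∑∑-* r f = trans (∑-cong (λ i → ∑-* r (f i))) (∑-* r (λ i → ∑ (f i)))

  record Linear {n : ℕ} (f : 𝕍 n → Carrier) : Set where
    field
      cong  : ∀ {x y} → x ≋ y → f x ≈ f y
      ⊹-hom : ∀ x y → f (x ⊹ y) ≈ f x + f y
      ⋆-hom : ∀ r x → f (r ⋆ x) ≈ r * f x

    𝟎-hom : f 𝟎 ≈ 0#
    𝟎-hom = trans (cong (λ _ → sym (zeroˡ 0#))) (trans (⋆-hom 0# 𝟎) (zeroˡ _))

  open Linear

  linear-+ : ∀ {n} {f g : 𝕍 n → Carrier} → Linear f → Linear g → Linear (λ x → f x + g x)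
  linear-+ L M = record
    { cong  = λ e → +-cong (cong L e) (cong M e)
    ; ⊹-hom = λ x y → trans (+-cong (⊹-hom L x y) (⊹-hom M x y)) (interchange _ _ _ _)
    ; ⋆-hom = λ r x → trans (+-cong (⋆-hom L r x) (⋆-hom M r x)) (sym (distribˡ r _ _))
    }

  linear-∘ : ∀ {m n} {f : 𝕍 n → Carrier} {h : 𝕍 m → 𝕍 n} → Linear f → (∀ k → Linear (λ x → h x k)) → Linear (λ x → f (h x))
  linear-∘ L M = record
    { cong  = λ e → cong L (λ k → cong (M k) e)
    ; ⊹-hom = λ x y → trans (cong L (λ k → ⊹-hom (M k) x y)) (⊹-hom L _ _)
    ; ⋆-hom = λ r x → trans (cong L (λ k → ⋆-hom (M k) r x)) (⋆-hom L r _)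
    }

  vanishing : ∀ {n} {f : 𝕍 n → Carrier} → Linear f → (∀ k → f (δ k) ≈ 0#) → ∀ x → f x ≈ 0#
  vanishing {zero}      L z x = trans (cong L (λ ())) (𝟎-hom L)
  vanishing {suc n} {f} L z x = begin
    f x                                         ≈⟨ cong L split ⟩
    f (x zero ⋆ δ zero ⊹ shift (λ i → x (suc i))) ≈⟨ ⊹-hom L _ _ ⟩
    f (x zero ⋆ δ zero) + f (shift (λ i → x (suc i))) ≈⟨ +-cong (trans (⋆-hom L (x zero) (δ zero)) (trans (*-congˡ (z zero)) (zeroʳ _))) tail ⟩
    0# + 0#                                     ≈⟨ +-identityʳ 0# ⟩
    0#                                          ∎
    where
    shift : 𝕍 n → 𝕍 (suc n)
    shift y zero    = 0#
    shift y (suc i) = y i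
    split : x ≋ x zero ⋆ δ zero ⊹ shift (λ i → x (suc i))
    split zero    = sym (trans (+-identityʳ _) (*-identityʳ _))
    split (suc i) = sym (trans (+-congʳ (zeroʳ _)) (+-identityˡ _))
    shift-linear : ∀ k → Linear (λ y → shift y k)
    shift-linear zero    = record { cong = λ _ → refl ; ⊹-hom = λ _ _ → sym (+-identityʳ 0#) ; ⋆-hom = λ r _ → sym (zeroʳ r) }
    shift-linear (suc i) = record { cong = λ e → e i ; ⊹-hom = λ _ _ → refl ; ⋆-hom = λ _ _ → refl }
    shift-δ : ∀ k → δ (suc k) ≋ shift (δ k)
    shift-δ k zero    = refl
    shift-δ k (suc i) = refl
    tail : f (shift (λ i → x (suc i))) ≈ 0#
    tail = vanishing (linear-∘ L shift-linear) (λ k → trans (cong L (λ i → sym (shift-δ k i))) (z (suc k))) _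

  record Bilinear {m n : ℕ} (f : 𝕍 m → 𝕍 n → Carrier) : Set where
    field
      ˡ-linear : ∀ y → Linear (λ x → f x y)
      ʳ-linear : ∀ x → Linear (f x)

    cong₂ : ∀ {x x′ y y′} → x ≋ x′ → y ≋ y′ → f x y ≈ f x′ y′
    cong₂ e e′ = trans (cong (ˡ-linear _) e) (cong (ʳ-linear _) e′)

  bilinear : ∀ {m n} (g : Fin m → Fin n → Carrier) → Bilinear (λ u v → ∑ λ i → ∑ λ j → (u i * g i j) * v j)
  bilinear g = record
    { ˡ-linear = λ y → record
      { cong  = λ {u} {v} e → ∑∑-cong (λ i j → (u i * g i j) * y j) (λ i j → (v i * g i j) * y j) λ i j → *-congʳ (*-congʳ (e i))
      ; ⊹-hom = λ u v → trans (∑-cong λ i → ∑-cong λ j → trans (*-congʳ (distribʳ (g i j) (u i) (v i))) (distribʳ (y j) (u i * g i j) (v i * g i j)))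
          (∑∑-+ (λ i j → (u i * g i j) * y j) (λ i j → (v i * g i j) * y j))
      ; ⋆-hom = λ r u → trans (∑-cong λ i → ∑-cong λ j → trans (*-congʳ (*-assoc r (u i) (g i j))) (*-assoc r (u i * g i j) (y j)))
          (∑∑-* r (λ i j → (u i * g i j) * y j))
      }
    ; ʳ-linear = λ x → record
      { cong  = λ {u} {v} e → ∑∑-cong (λ i j → (x i * g i j) * u j) (λ i j → (x i * g i j) * v j) λ i j → *-congˡ (e j)
      ; ⊹-hom = λ u v → trans (∑-cong λ i → ∑-cong λ j → distribˡ (x i * g i j) (u j) (v j))
          (∑∑-+ (λ i j → (x i * g i j) * u j) (λ i j → (x i * g i j) * v j))
      ; ⋆-hom = λ r u → trans (∑-cong λ i → ∑-cong λ j → x∙yz≈y∙xz (x i * g i j) r (u j))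
          (∑∑-* r (λ i j → (x i * g i j) * u j))
      }
    }
    where open import Algebra.Properties.CommutativeSemigroup *-commutativeSemigroup using (x∙yz≈y∙xz)

  bilinear-≈ : ∀ {m n} {f g : 𝕍 m → 𝕍 n → Carrier} → (∀ x y → f x y ≈ g x y) → Bilinear f → Bilinear g
  bilinear-≈ e B = record
    { ˡ-linear = λ y → record
      { cong  = λ p → trans (sym (e _ y)) (trans (cong (ˡ-linear y) p) (e _ y))
      ; ⊹-hom = λ u v → trans (sym (e _ y)) (trans (⊹-hom (ˡ-linear y) u v) (+-cong (e u y) (e v y)))
      ; ⋆-hom = λ r u → trans (sym (e _ y)) (trans (⋆-hom (ˡ-linear y) r u) (*-congˡ (e u y)))
      }
    ; ʳ-linear = λ x → record
      { cong  = λ p → trans (sym (e x _)) (trans (cong (ʳ-linear x) p) (e x _))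
      ; ⊹-hom = λ u v → trans (sym (e x _)) (trans (⊹-hom (ʳ-linear x) u v) (+-cong (e x u) (e x v)))
      ; ⋆-hom = λ r u → trans (sym (e x _)) (trans (⋆-hom (ʳ-linear x) r u) (*-congˡ (e x u)))
      }
    }
    where open Bilinear B

  product-bilinear : ∀ {n} (S : Presemifield F n) → let open Presemifield S in ∀ k → Bilinear (λ x y → (x ∙ y) k)
  product-bilinear S k = bilinear-≈ (λ x y → ∑-cong λ i → ∑-cong λ j → xy∙z≈xz∙y (x i) (Presemifield.c S i j k) (y j)) (bilinear (λ i j → Presemifield.c S i j k))
    where open import Algebra.Properties.CommutativeSemigroup *-commutativeSemigroup using (xy∙z≈xz∙y)

-- The pairing of the two summands induced by the symplectic form

module Symplectic {q : ℕ} (F : FiniteField q) (char-2 : Characteristic-2 F)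
                  {n : ℕ} (S : Presemifield F n) (symplectic : IsSymplectic F S) where
  open FiniteField F hiding (zero)
  open LinearAlgebra F
  open Linear
  open Char2 F char-2 using (+⇒≈; +-self)
  open Presemifield S
  open import Algebra.Properties.CommutativeSemigroup +-commutativeSemigroup using (interchange)
  open Relation.Binary.Reasoning.Setoid setoid

  private
    G           = proj₁ symplectic
    alternating = proj₁ (proj₂ symplectic)
    nondegen    = proj₁ (proj₂ (proj₂ symplectic))
    isotropic   = proj₁ (proj₂ (proj₂ (proj₂ symplectic)))
    isotropic-∞ = proj₂ (proj₂ (proj₂ (proj₂ symplectic)))

    ω : 𝕍 (n ℕ.+ n) → 𝕍 (n ℕ.+ n) → Carrier
    ω = form F S G

    ω-bilinear : Bilinear ω
    ω-bilinear = bilinear G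

    open Bilinear ω-bilinear renaming (cong₂ to ω-cong; ˡ-linear to ω-linearˡ; ʳ-linear to ω-linearʳ)

    ι₁ ι₂ : 𝕍 n → 𝕍 (n ℕ.+ n)
    ι₁ x = x VF.++ 𝟎
    ι₂ x = 𝟎 VF.++ x

    ++-split : ∀ x y → (x VF.++ y) ≋ ι₁ x ⊹ ι₂ y
    ++-split x y i with splitAt n i
    ... | inj₁ _ = sym (+-identityʳ _)
    ... | inj₂ _ = sym (+-identityˡ _)

    ++-cong : ∀ {x x′ y y′ : 𝕍 n} → x ≋ x′ → y ≋ y′ → (x VF.++ y) ≋ (x′ VF.++ y′)
    ++-cong e e′ i with splitAt n i
    ... | inj₁ j = e j
    ... | inj₂ j = e′ j

    ++-halves : ∀ (v : 𝕍 (n ℕ.+ n)) → v ≋ ((λ i → v (i ↑ˡ n)) VF.++ (λ i → v (n ↑ʳ i)))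
    ++-halves v i with splitAt n i in eq
    ... | inj₁ j = reflexive (≡.cong v (≡.sym (Fin.splitAt⁻¹-↑ˡ eq)))
    ... | inj₂ j = reflexive (≡.cong v (≡.sym (Fin.splitAt⁻¹-↑ʳ eq)))

    ι-linear : ∀ (ι : 𝕍 n → 𝕍 (n ℕ.+ n)) → (∀ i → (∃ λ j → ∀ x → ι x i ≡ x j) ⊎ (∀ x → ι x i ≡ 0#)) → ∀ k → Linear (λ x → ι x k)
    ι-linear ι cases k with cases k
    ... | inj₁ (j , p) = record
      { cong  = λ {x} {y} e → trans (reflexive (p x)) (trans (e j) (reflexive (≡.sym (p y))))
      ; ⊹-hom = λ x y → trans (reflexive (p _)) (reflexive (≡.sym (≡.cong₂ _+_ (p x) (p y))))
      ; ⋆-hom = λ r x → trans (reflexive (p _)) (reflexive (≡.sym (≡.cong (r *_) (p x))))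
      }
    ... | inj₂ p = record
      { cong  = λ {x} {y} _ → reflexive (≡.trans (p x) (≡.sym (p y)))
      ; ⊹-hom = λ x y → trans (reflexive (p _)) (trans (sym (+-identityʳ 0#)) (reflexive (≡.sym (≡.cong₂ _+_ (p x) (p y)))))
      ; ⋆-hom = λ r x → trans (reflexive (p _)) (trans (sym (zeroʳ r)) (reflexive (≡.sym (≡.cong (r *_) (p x)))))
      }

    ι₁-linear : ∀ k → Linear (λ x → ι₁ x k)
    ι₁-linear = ι-linear ι₁ cases
      where
      cases : ∀ i → (∃ λ j → ∀ x → ι₁ x i ≡ x j) ⊎ (∀ x → ι₁ x i ≡ 0#)
      cases i with splitAt n i
      ... | inj₁ j = inj₁ (j , λ _ → ≡.refl)
      ... | inj₂ _ = inj₂ λ _ → ≡.refl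

    ι₂-linear : ∀ k → Linear (λ x → ι₂ x k)
    ι₂-linear = ι-linear ι₂ cases
      where
      cases : ∀ i → (∃ λ j → ∀ x → ι₂ x i ≡ x j) ⊎ (∀ x → ι₂ x i ≡ 0#)
      cases i with splitAt n i
      ... | inj₁ _ = inj₂ λ _ → ≡.refl
      ... | inj₂ j = inj₁ (j , λ _ → ≡.refl)

    ω-expand : ∀ u v x y → ω (u ⊹ v) (x ⊹ y) ≈ (ω u x + ω u y) + (ω v x + ω v y)
    ω-expand u v x y = trans (⊹-hom (ω-linearˡ _) u v) (+-cong (⊹-hom (ω-linearʳ u) x y) (⊹-hom (ω-linearʳ v) x y))

    ω-sym : ∀ u v → ω u v ≈ ω v u
    ω-sym u v = +⇒≈ (begin
      ω u v + ω v u                     ≈⟨ +-cong (+-identityˡ _) (+-identityʳ _) ⟨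
      (0# + ω u v) + (ω v u + 0#)       ≈⟨ +-cong (+-congʳ (alternating u)) (+-congˡ (alternating v)) ⟨
      (ω u u + ω u v) + (ω v u + ω v v) ≈⟨ ω-expand u v u v ⟨
      ω (u ⊹ v) (u ⊹ v)                 ≈⟨ alternating (u ⊹ v) ⟩
      0#                                ∎)

  ∙-linearˡ : ∀ y k → Linear (λ x → (x ∙ y) k)
  ∙-linearˡ y k = Bilinear.ˡ-linear (product-bilinear S k) y

  ∙-linearʳ : ∀ x k → Linear (λ y → (x ∙ y) k)
  ∙-linearʳ x k = Bilinear.ʳ-linear (product-bilinear S k) x

  b : 𝕍 n → 𝕍 n → Carrier
  b x z = ω (ι₁ x) (ι₂ z)

  b-linearˡ : ∀ z → Linear (λ x → b x z)
  b-linearˡ z = linear-∘ (ω-linearˡ (ι₂ z)) ι₁-linear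

  b-linearʳ : ∀ x → Linear (b x)
  b-linearʳ x = linear-∘ (ω-linearʳ (ι₁ x)) ι₂-linear

  private
    -- S ⊕ 0 is the spread element belonging to y = 0.
    isotropic-0 : ∀ x x′ → ω (ι₁ x) (ι₁ x′) ≈ 0#
    isotropic-0 x x′ = trans (ω-cong (++-cong (λ _ → refl) (λ k → sym (𝟎-hom (∙-linearʳ x k)))) (++-cong (λ _ → refl) (λ k → sym (𝟎-hom (∙-linearʳ x′ k))))) (isotropic 𝟎 x x′)

  -- Both summands of V are spread elements, so evaluating the form on (x , x ∙ y) and (x′ , x′ ∙ y)
  -- leaves only the two mixed terms, and these must cancel.
  b-symmetric : ∀ x x′ y → b x (x′ ∙ y) ≈ b x′ (x ∙ y)
  b-symmetric x x′ y = +⇒≈ (begin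
    b x (x′ ∙ y) + b x′ (x ∙ y) ≈⟨ +-cong (+-identityˡ _) (trans (+-identityʳ _) (ω-sym _ _)) ⟨
    (0# + b x (x′ ∙ y)) + (ω (ι₂ (x ∙ y)) (ι₁ x′) + 0#) ≈⟨ +-cong (+-congʳ (isotropic-0 x x′)) (+-congˡ (isotropic-∞ (x ∙ y) (x′ ∙ y))) ⟨
    (ω (ι₁ x) (ι₁ x′) + b x (x′ ∙ y)) + (ω (ι₂ (x ∙ y)) (ι₁ x′) + ω (ι₂ (x ∙ y)) (ι₂ (x′ ∙ y))) ≈⟨ ω-expand _ _ _ _ ⟨
    ω (ι₁ x ⊹ ι₂ (x ∙ y)) (ι₁ x′ ⊹ ι₂ (x′ ∙ y)) ≈⟨ ω-cong (++-split x (x ∙ y)) (++-split x′ (x′ ∙ y)) ⟨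
    ω (x VF.++ (x ∙ y)) (x′ VF.++ (x′ ∙ y)) ≈⟨ isotropic y x x′ ⟩
    0# ∎)

  private
    orthogonal : ∀ u → (∀ x → ω u (ι₁ x) ≈ 0#) → (∀ z → ω u (ι₂ z) ≈ 0#) → u ≋ 𝟎
    orthogonal u o₁ o₂ = nondegen u λ v → trans (ω-cong (λ _ → refl) (λ i → trans (++-halves v i) (++-split _ _ i)))
      (trans (⊹-hom (ω-linearʳ u) _ _) (trans (+-cong (o₁ _) (o₂ _)) (+-identityʳ 0#)))

  -- A vector of S ⊕ 0 is orthogonal to that summand anyway, so orthogonality to the other one puts
  -- it in the radical of the form.
  b-nondegenerateˡ : ∀ x → (∀ z → b x z ≈ 0#) → x ≋ 𝟎
  b-nondegenerateˡ x o i = trans (reflexive (≡.sym (VF.lookup-++ˡ x 𝟎 i))) (orthogonal (ι₁ x) (isotropic-0 x) o (i ↑ˡ n))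

  b-nondegenerateʳ : ∀ z → (∀ x → b x z ≈ 0#) → z ≋ 𝟎
  b-nondegenerateʳ z o i = trans (reflexive (≡.sym (VF.lookup-++ʳ (𝟎 {n}) z i)))
    (orthogonal (ι₂ z) (λ x → trans (ω-sym _ _) (o x)) (isotropic-∞ z) (n ↑ʳ i))

  b-cancelʳ : ∀ {z z′} → (∀ x → b x z ≈ b x z′) → z ≋ z′
  b-cancelʳ {z} {z′} e i = +⇒≈ (b-nondegenerateʳ (z ⊹ z′) (λ x → trans (⊹-hom (b-linearʳ x) z z′) (trans (+-congʳ (e x)) (+-self _))) i)

-- Transposition to a commutative presemifield, and the return to associativity

module Transfer {q : ℕ} (F : FiniteField q) {𝔽 : Field₂} (M : Model F 𝔽) (S : Semifield F 4)
                (symplectic : IsSymplectic F (Semifield.presemifield S)) where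
  open FiniteField F hiding (zero)
  open LinearAlgebra F
  open Linear
  open Model M
  open Char2 F char-2 using (+⇒≈; +-self)
  open Semifield S
  open Symplectic F char-2 presemifield symplectic
  private module K = Field₂-Properties 𝔽
  open Relation.Binary.Reasoning.Setoid setoid

  Φ : K.V → 𝕍 4
  Φ (a , _ , _ , _) zero                   = φ a
  Φ (_ , a , _ , _) (suc zero)             = φ a
  Φ (_ , _ , a , _) (suc (suc zero))       = φ a
  Φ (_ , _ , _ , a) (suc (suc (suc zero))) = φ a

  Ψ : 𝕍 4 → K.V
  Ψ x = φ⁻¹ (x zero) , φ⁻¹ (x (suc zero)) , φ⁻¹ (x (suc (suc zero))) , φ⁻¹ (x (suc (suc (suc zero))))

  Φ-injective : ∀ {u v} → Φ u ≋ Φ v → u ≡ v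
  Φ-injective e = tuple (φ-injective (e zero)) (φ-injective (e (suc zero))) (φ-injective (e (suc (suc zero)))) (φ-injective (e (suc (suc (suc zero)))))
    where
    tuple : ∀ {a b c d a′ b′ c′ d′ : K.K} → a ≡ a′ → b ≡ b′ → c ≡ c′ → d ≡ d′ → (a , b , c , d) ≡ (a′ , b′ , c′ , d′)
    tuple ≡.refl ≡.refl ≡.refl ≡.refl = ≡.refl

  Φ-Ψ : ∀ x → Φ (Ψ x) ≋ x
  Φ-Ψ x zero                   = φ-φ⁻¹ _
  Φ-Ψ x (suc zero)             = φ-φ⁻¹ _
  Φ-Ψ x (suc (suc zero))       = φ-φ⁻¹ _
  Φ-Ψ x (suc (suc (suc zero))) = φ-φ⁻¹ _

  Ψ-cong : ∀ {x y} → x ≋ y → Ψ x ≡ Ψ y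
  Ψ-cong {x} {y} e = Φ-injective {Ψ x} {Ψ y} (λ i → trans (Φ-Ψ x i) (trans (e i) (sym (Φ-Ψ y i))))

  Ψ-injective : ∀ {x y} → Ψ x ≡ Ψ y → x ≋ y
  Ψ-injective {x} {y} e i = trans (sym (Φ-Ψ x i)) (trans (reflexive (≡.cong (λ v → Φ v i) e)) (Φ-Ψ y i))

  opaque
    unfolding K._⊕_

    Φ-⊕ : ∀ u v → Φ (u K.⊕ v) ≋ Φ u ⊹ Φ v
    Φ-⊕ u v zero                   = φ-+ _ _
    Φ-⊕ u v (suc zero)             = φ-+ _ _
    Φ-⊕ u v (suc (suc zero))       = φ-+ _ _
    Φ-⊕ u v (suc (suc (suc zero))) = φ-+ _ _

    Φ-· : ∀ r u → Φ (r K.· u) ≋ φ r ⋆ Φ u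
    Φ-· r u zero                   = φ-* _ _
    Φ-· r u (suc zero)             = φ-* _ _
    Φ-· r u (suc (suc zero))       = φ-* _ _
    Φ-· r u (suc (suc (suc zero))) = φ-* _ _

  Φ-0 : Φ K.0v ≋ 𝟎
  Φ-0 i = trans (reflexive (≡.cong (λ v → Φ v i) (≡.sym (K.⊕-self K.0v)))) (trans (Φ-⊕ K.0v K.0v i) (+-self _))

  t : 𝕍 4 → 𝕍 4 → 𝕍 4 → Carrier
  t x x′ y = b x (x′ ∙ y)

  t-linearʳ : ∀ x x′ → Linear (t x x′)
  t-linearʳ x x′ = linear-∘ (b-linearʳ x) (∙-linearʳ x′)

  t-linearᵐ : ∀ x y → Linear (λ x′ → t x x′ y)
  t-linearᵐ x y = linear-∘ (b-linearʳ x) (∙-linearˡ y)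

  infixl 7 _⊛_
  -- The trilinear form t is turned into a product by taking the functional y ↦ t u v y in
  -- coordinates. This permutes the indices of the structure tensor, twisted by `b`, so that the
  -- symmetry of t becomes commutativity.
  _⊛_ : K.V → K.V → K.V
  u ⊛ v = Ψ (λ k → t (Φ u) (Φ v) (δ k))

  Φ-⊛ : ∀ u v k → Φ (u ⊛ v) k ≈ t (Φ u) (Φ v) (δ k)
  Φ-⊛ u v = Φ-Ψ (λ k → t (Φ u) (Φ v) (δ k))

  associate : Presemifield₂ 𝔽
  associate = record
    { _∙_          = _⊛_
    ; ∙-comm       = λ u v → Ψ-cong {λ k → t (Φ u) (Φ v) (δ k)} {λ k → t (Φ v) (Φ u) (δ k)} (λ k → b-symmetric (Φ u) (Φ v) (δ k))
    ; ∙-⊕          = λ u v w → Φ-injective {u ⊛ (v K.⊕ w)} {u ⊛ v K.⊕ u ⊛ w} λ k → begin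
        Φ (u ⊛ (v K.⊕ w)) k ≈⟨ Φ-⊛ u (v K.⊕ w) k ⟩
        t (Φ u) (Φ (v K.⊕ w)) (δ k) ≈⟨ cong (t-linearᵐ (Φ u) (δ k)) {Φ (v K.⊕ w)} {Φ v ⊹ Φ w} (Φ-⊕ v w) ⟩
        t (Φ u) (Φ v ⊹ Φ w) (δ k) ≈⟨ ⊹-hom (t-linearᵐ (Φ u) (δ k)) (Φ v) (Φ w) ⟩
        t (Φ u) (Φ v) (δ k) + t (Φ u) (Φ w) (δ k) ≈⟨ +-cong (Φ-⊛ u v k) (Φ-⊛ u w k) ⟨
        Φ (u ⊛ v) k + Φ (u ⊛ w) k ≈⟨ Φ-⊕ (u ⊛ v) (u ⊛ w) k ⟨
        Φ (u ⊛ v K.⊕ u ⊛ w) k ∎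
    ; ∙-·          = λ r u v → Φ-injective {u ⊛ (r K.· v)} {r K.· (u ⊛ v)} λ k → begin
        Φ (u ⊛ (r K.· v)) k ≈⟨ Φ-⊛ u (r K.· v) k ⟩
        t (Φ u) (Φ (r K.· v)) (δ k) ≈⟨ cong (t-linearᵐ (Φ u) (δ k)) {Φ (r K.· v)} {φ r ⋆ Φ v} (Φ-· r v) ⟩
        t (Φ u) (φ r ⋆ Φ v) (δ k) ≈⟨ ⋆-hom (t-linearᵐ (Φ u) (δ k)) (φ r) (Φ v) ⟩
        φ r * t (Φ u) (Φ v) (δ k) ≈⟨ *-congˡ (Φ-⊛ u v k) ⟨
        φ r * Φ (u ⊛ v) k ≈⟨ Φ-· r (u ⊛ v) k ⟨
        Φ (r K.· (u ⊛ v)) k ∎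
    ; zero-product = λ {u} {v} e → zero-product u v e (v K.≟ᵛ K.0v)
    }
    where
    -- For v nonzero, y ↦ v ∙ y is bijective by counting, so a vanishing functional t u v makes u
    -- orthogonal to everything under `b`.
    zero-product : ∀ u v → u ⊛ v ≡ K.0v → Dec (v ≡ K.0v) → u ≡ K.0v ⊎ v ≡ K.0v
    zero-product u v e (yes z) = inj₂ z
    zero-product u v e (no n)  = inj₁ (Φ-injective {u} {K.0v} (λ i → trans (b-nondegenerateˡ (Φ u) orthogonal i) (sym (Φ-0 i))))
      where
      vanishes : ∀ y → t (Φ u) (Φ v) y ≈ 0#
      vanishes = vanishing (t-linearʳ (Φ u) (Φ v)) (λ k → trans (sym (Φ-⊛ u v k)) (trans (reflexive (≡.cong (λ w → Φ w k) e)) (Φ-0 k)))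
      difference : ∀ {r s} → Φ v ≋ 𝟎 ⊎ (Φ r ⊹ Φ s) ≋ 𝟎 → r ≡ s
      difference (inj₁ z) = ⊥-elim (n (Φ-injective {v} {K.0v} (λ i → trans (z i) (sym (Φ-0 i)))))
      difference {r} {s} (inj₂ z) = Φ-injective {r} {s} (λ i → +⇒≈ (z i))
      injective : ∀ {r s} → Ψ (Φ v ∙ Φ r) ≡ Ψ (Φ v ∙ Φ s) → r ≡ s
      injective {r} {s} p = difference (no-zero-divisors (Φ v) (Φ r ⊹ Φ s)
        (λ k → trans (⊹-hom (∙-linearʳ (Φ v) k) (Φ r) (Φ s)) (trans (+-congʳ (Ψ-injective {Φ v ∙ Φ r} {Φ v ∙ Φ s} p k)) (+-self _))))
      orthogonal : ∀ z → b (Φ u) z ≈ 0#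
      orthogonal z = hit (injective⇒surjective K.V-finite (λ r → Ψ (Φ v ∙ Φ r)) injective (Ψ z))
        where
        hit : (∃ λ r → Ψ (Φ v ∙ Φ r) ≡ Ψ z) → b (Φ u) z ≈ 0#
        hit (r , p) = trans (cong (b-linearʳ (Φ u)) {z} {Φ v ∙ Φ r} (λ k → sym (Ψ-injective {Φ v ∙ Φ r} {z} p k))) (vanishes (Φ r))

  module _ (nuclear : (A : Presemifield₂ 𝔽) → Nuclear A) where
    private
      e′≢0 : Ψ e ≢ K.0v
      e′≢0 z = 0≉1 (trans (sym (vanish (δ zero))) refl)
        where
        e≋0 : e ≋ 𝟎
        e≋0 i = trans (sym (Φ-Ψ e i)) (trans (reflexive (≡.cong (λ v → Φ v i) z)) (Φ-0 i))
        vanish : ∀ (x : 𝕍 4) → x zero ≈ 0#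
        vanish x = trans (sym (proj₁ (identity x) zero)) (trans (cong (∙-linearˡ x zero) {e} {𝟎} e≋0) (𝟎-hom (∙-linearˡ x zero)))

      module _ (x : 𝕍 4) where
        μ : K.V → K.V
        μ = proj₁ (nuclear associate (Ψ e) (Ψ x) e′≢0)

        N : 𝕍 4 → 𝕍 4
        N w = Φ (μ (Ψ w))

        N-cong : ∀ {v w} → v ≋ w → N v ≋ N w
        N-cong {v} {w} p i = reflexive (≡.cong (λ u → Φ (μ u) i) (Ψ-cong {v} {w} p))

        N-e : N e ≋ x
        N-e i = trans (reflexive (≡.cong (λ u → Φ u i) (proj₁ (proj₂ (nuclear associate (Ψ e) (Ψ x) e′≢0))))) (Φ-Ψ x i)

        -- This is the nuclear relation of the transposed product, read off on basis vectors and
        -- extended linearly in y.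
        adjoint : ∀ a a′ y → b (N a) (a′ ∙ y) ≈ b a (N a′ ∙ y)
        adjoint a a′ y = trans (cong (b-linearʳ (N a)) {a′ ∙ y} {Φ (Ψ a′) ∙ y} (λ k → cong (∙-linearˡ y k) {a′} {Φ (Ψ a′)} (λ i → sym (Φ-Ψ a′ i))))
          (trans (+⇒≈ (vanishing (linear-+ (t-linearʳ (N a) (Φ (Ψ a′))) (t-linearʳ (Φ (Ψ a)) (N a′))) agree y))
            (cong (b-linearˡ (N a′ ∙ y)) {Φ (Ψ a)} {a} (Φ-Ψ a)))
          where
          agree : ∀ k → t (N a) (Φ (Ψ a′)) (δ k) + t (Φ (Ψ a)) (N a′) (δ k) ≈ 0#
          agree k = trans (+-congʳ (trans (sym (Φ-⊛ (μ (Ψ a)) (Ψ a′) k)) (trans (reflexive (≡.cong (λ w → Φ w k) (proj₂ (proj₂ (nuclear associate (Ψ e) (Ψ x) e′≢0)) (Ψ a) (Ψ a′)))) (Φ-⊛ (Ψ a) (μ (Ψ a′)) k)))) (+-self _)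

        -- Here the unit of S enters: the previous relation is specialised to y = e.
        self-adjoint : ∀ a w → b (N a) w ≈ b a (N w)
        self-adjoint a w = trans (cong (b-linearʳ (N a)) {w} {w ∙ e} (λ k → sym (proj₂ (identity w) k)))
          (trans (adjoint a w e) (cong (b-linearʳ a) {N w ∙ e} {N w} (proj₂ (identity (N w)))))

        -- Pairing both sides with any c, N is moved onto c by `adjoint` and back onto a ∙ y by
        -- `self-adjoint`; `b` is nondegenerate.
        N-∙ : ∀ a y → (N a ∙ y) ≋ N (a ∙ y)
        N-∙ a y = b-cancelʳ {N a ∙ y} {N (a ∙ y)} (λ c → trans (sym (adjoint c a y)) (self-adjoint c (a ∙ y)))

        N-left : ∀ y → (x ∙ y) ≋ N y
        N-left y k = trans (cong (∙-linearˡ y k) {x} {N e} (λ i → sym (N-e i))) (trans (N-∙ e y k) (N-cong {e ∙ y} {y} (proj₁ (identity y)) k))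

    -- Left multiplication by x is the nuclear map `N x` chosen with e ↦ x, and such maps commute
    -- with right multiplications.
    associative : IsAssociative F presemifield
    associative x y z k = begin
      (x ∙ y ∙ z) k     ≈⟨ cong (∙-linearˡ z k) {x ∙ y} {N x y} (N-left x y) ⟩
      (N x y ∙ z) k     ≈⟨ N-∙ x y z k ⟩
      N x (y ∙ z) k     ≈⟨ N-left x (y ∙ z) k ⟨
      (x ∙ (y ∙ z)) k   ∎

theorem1 : (q : ℕ) → q ≡ 2 ⊎ q ≡ 4 ⊎ q ≡ 8 → (F : FiniteField q) →
    (S : Semifield F 4) →
    IsSymplectic F (Semifield.presemifield S) →
    IsAssociative F (Semifield.presemifield S)
theorem1 _ (inj₁ ≡.refl)        F S ω = Transfer.associative F (model₂ F) S ω Verified.nuclear₂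
theorem1 _ (inj₂ (inj₁ ≡.refl)) F S ω = Transfer.associative F (model₄ F) S ω Verified.nuclear₄
theorem1 _ (inj₂ (inj₂ ≡.refl)) F S ω = Transfer.associative F (model₈ F) S ω Verified.nuclear₈
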